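{- For every integer $\Delta\ge 1$, there are constants $\varepsilon,\nu,\alpha>0$ such that the following holds for all sufficiently large $n$ and $m$. Let $H$ be an $n$-vertex graph with $m$ edges and maximum degree $\Delta$, let $G$ be an $n$-vertex graph with minimum degree at least $(1-\varepsilon)n$, and let $\mathbf c:E(G)\to\{ -1,1\}$ be a $\nu$-balanced $2$-edge-colouring of $G$. If the triplet $(H,G,\mathbf c)$ is inert, let $a=4$; otherwise, let $a=2$. Then, there is an integer $b\in\{0,1,2,3\}$ such that, for every integer $k\in[-\alpha m,\alpha m]$, there is a copy $H'\subseteq G$ of $H$ with $\mathbf c(H')=k$ if and only if $k\equiv b\pmod a$.
   Context: For $\mathbf c:E(G)\to\{ -1,1\}$ and a subgraph $G'\subseteq G$, write $\mathbf c(G')=\sum_{e\in E(G')}\mathbf c(e)$. The $2$-edge-colouring $\mathbf c$ is $\nu$-balanced if, for each of the two colours, the proportion of edges of $G$ having that colour lies in $[1/2-\nu,1/2+\nu]$. A colouring $\mathbf c:E(G)\to\{ -1,1\}$ is called bipartite if there is a partition $(V_1,V_2)$ of $V(G)$ such that either $\mathbf c^{ -1}(1)$ or $\mathbf c^{ -1}(-1)$ is equal to the edge set of $G[V_1]\cup G[V_2]$. For $n$-vertex graphs $H$ and $G$, the triplet $(H,G,\mathbf c)$ is inert if all degrees in $H$ have the same parity and the colouring $\mathbf c$ is bipartite. A copy of $H$ in $G$ is a subgraph of $G$ isomorphic to $H$. -}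

module Defs where

open import Data.Bool.Base using (Bool; true; false; T; _∧_; _∨_)
open import Data.Bool.Properties using (T?; T-≡; T-∧; T-∨; ∧-comm)
open import Data.Fin.Base using (Fin) renaming (_<_ to _<ᶠ_)
open import Data.Fin.Properties using (_<?_)
open import Data.Fin.Subset using (Subset; _∈_; ∣_∣; ∁) renaming (_∪_ to _∪ˢ_)
open import Data.Fin.Subset.Properties using (p⊆p∪q; q⊆p∪q)
open import Data.Integer.Base as ℤ using (ℤ; +_; _◃_)
open import Data.Integer.Divisibility using () renaming (_∣_ to _∣ℤ_)
open import Data.List.Base
  using (List; allFin; cartesianProduct; filter; foldr; length; map; mapMaybe)
open import Data.List.Extrema.Nat using (max; min)
open import Data.Maybe.Base using (Maybe; just; nothing)
open import Data.Nat.Base using (ℕ; parity)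
open import Data.Product.Base using (_×_; _,_; ∃-syntax; proj₁; proj₂)
open import Data.Rational.Base as ℚ using (ℚ; ½)
open import Data.Rational.Literals using (fromℤ)
open import Data.Sign.Base using (Sign)
open import Data.Sign.Properties using (_≟_)
open import Data.Sum.Base using (inj₁; inj₂)
open import Data.Vec.Base using (lookup; tabulate)
open import Data.Vec.Properties using (lookup⇒[]=)
open import Function.Bundles using (_↔_; _⇔_; Inverse; Equivalence)
open import Relation.Binary.PropositionalEquality using (_≡_; cong₂)
open import Relation.Nullary.Decidable.Core using (yes; no)

-- Adjacency is Bool-valued so that proofs of adjacency are unique; otherwise a
-- colouring could depend on the proof.
record Graph (n : ℕ) : Set where
  field
    adj    : Fin n → Fin n → Bool
    sym    : ∀ u v → adj u v ≡ adj v u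
    irrefl : ∀ v → adj v v ≡ false

-- The edge {src , tgt}, represented once, by its increasing ordering.
record Edge {n : ℕ} (adj : Fin n → Fin n → Bool) : Set where
  constructor edge
  field
    src tgt  : Fin n
    src<tgt  : src <ᶠ tgt
    adjacent : T (adj src tgt)

edges : ∀ {n} (adj : Fin n → Fin n → Bool) → List (Edge adj)
edges {n} adj = mapMaybe edge? (cartesianProduct (allFin n) (allFin n))
  where
  edge? : Fin n × Fin n → Maybe (Edge adj)
  edge? (u , v) with u <? v | T? (adj u v)
  ... | yes u<v | yes uv = just (edge u v u<v uv)
  ... | _       | _      = nothing

module _ {n : ℕ} (G : Graph n) where
  open Graph G

  E : Set
  E = Edge adj

  size : ℕ
  size = length (edges adj)

  degree : Fin n → ℕ
  degree v = ∣ tabulate (adj v) ∣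

  degrees : List ℕ
  degrees = map degree (allFin n)

  maxDegree : ℕ
  maxDegree = max 0 degrees

  -- The default value n exceeds every degree, so it matters only when n = 0.
  minDegree : ℕ
  minDegree = min n degrees

  Colouring : Set
  Colouring = E → Sign

-- Not necessarily spanning, not necessarily induced.
record Subgraph {n : ℕ} (G : Graph n) : Set where
  field
    vertices : Subset n
    adj      : Fin n → Fin n → Bool
    sym      : ∀ u v → adj u v ≡ adj v u
    ends     : ∀ u v → T (adj u v) → u ∈ vertices
    adj⊆     : ∀ u v → T (adj u v) → T (Graph.adj G u v)

module _ {n : ℕ} {G : Graph n} where

  inclusion : (G′ : Subgraph G) → Edge (Subgraph.adj G′) → E G
  inclusion G′ (edge u v u<v uv) = edge u v u<v (Subgraph.adj⊆ G′ u v uv)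

  infix 4 _∈E_
  _∈E_ : E G → Subgraph G → Set
  e ∈E G′ = T (Subgraph.adj G′ (Edge.src e) (Edge.tgt e))

  infixr 6 _∪_
  _∪_ : Subgraph G → Subgraph G → Subgraph G
  A ∪ B = record
    { vertices = A.vertices ∪ˢ B.vertices
    ; adj      = λ u v → A.adj u v ∨ B.adj u v
    ; sym      = λ u v → cong₂ _∨_ (A.sym u v) (B.sym u v)
    ; ends     = ends
    ; adj⊆     = adj⊆
    }
    where
    module A = Subgraph A
    module B = Subgraph B

    ends : ∀ u v → T (A.adj u v ∨ B.adj u v) → u ∈ (A.vertices ∪ˢ B.vertices)
    ends u v uv with Equivalence.to T-∨ uv
    ... | inj₁ a = p⊆p∪q B.vertices (A.ends u v a)
    ... | inj₂ b = q⊆p∪q A.vertices B.vertices (B.ends u v b)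

    adj⊆ : ∀ u v → T (A.adj u v ∨ B.adj u v) → T (Graph.adj G u v)
    adj⊆ u v uv with Equivalence.to T-∨ uv
    ... | inj₁ a = A.adj⊆ u v a
    ... | inj₂ b = B.adj⊆ u v b

induced : ∀ {n} (G : Graph n) → Subset n → Subgraph G
induced {n} G S = record
  { vertices = S
  ; adj      = adjS
  ; sym      = λ u v → cong₂ _∧_ (G.sym u v) (∧-comm (lookup S u) (lookup S v))
  ; ends     = λ u v uv → lookup⇒[]= u S
                 (Equivalence.to T-≡ (proj₁ (Equivalence.to T-∧ (proj₂ (split u v uv)))))
  ; adj⊆     = λ u v uv → proj₁ (split u v uv)
  }
  where
  module G = Graph G

  adjS : Fin n → Fin n → Bool
  adjS u v = G.adj u v ∧ (lookup S u ∧ lookup S v)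

  split : ∀ u v → T (adjS u v) → T (G.adj u v) × T (lookup S u ∧ lookup S v)
  split u v = Equivalence.to T-∧

record IsCopyOf {n : ℕ} (H : Graph n) {G : Graph n} (H′ : Subgraph G) : Set where
  field
    bijection : Fin n ↔ (∃[ v ] v ∈ Subgraph.vertices H′)

  image : Fin n → Fin n
  image v = proj₁ (Inverse.to bijection v)

  field
    adj-iso : ∀ u v → Graph.adj H u v ≡ Subgraph.adj H′ (image u) (image v)

module _ {n : ℕ} (G : Graph n) (c : Colouring G) where

  -- The sign s stands for the colour s ◃ 1, that is, 1 or -1.
  total : Subgraph G → ℤ
  total G′ = foldr ℤ._+_ (+ 0)
    (map (λ e → c (inclusion G′ e) ◃ 1) (edges (Subgraph.adj G′)))

  colourCount : Sign → ℕ
  colourCount s = length (filter (λ e → c e ≟ s) (edges (Graph.adj G)))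

  -- The bounds on the proportion colourCount s / size G, multiplied by size G.
  Balanced : ℚ → Set
  Balanced ν = ∀ s →
    (½ ℚ.- ν) ℚ.* fromℤ (+ size G) ℚ.≤ fromℤ (+ colourCount s) ×
    fromℤ (+ colourCount s) ℚ.≤ (½ ℚ.+ ν) ℚ.* fromℤ (+ size G)

  -- The partition is (V₁ , ∁ V₁); a part may be empty.
  Bipartite : Set
  Bipartite = ∃[ V₁ ] ∃[ s ] ∀ (e : E G) → c e ≡ s ⇔ e ∈E induced G V₁ ∪ induced G (∁ V₁)

Inert : ∀ {n} (H G : Graph n) → Colouring G → Set
Inert H G c = (∀ u v → parity (degree H u) ≡ parity (degree H v)) × Bipartite G c

infix 4 _≡_[mod_]
_≡_[mod_] : ℤ → ℤ → ℕ → Set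
k ≡ b [mod a ] = (+ a) ∣ℤ (k ℤ.- b)

module Submission where

module EmbeddingSpectrum where

  import Algebra.Properties.Semiring.Sum
  open import Data.Bool.Base using (Bool; true; false; T; not; _∧_; _∨_)
  open import Data.Bool.Properties using (T?; T-irrelevant)
  open import Data.Empty using (⊥; ⊥-elim)
  open import Data.Fin.Base using (Fin; zero; suc; toℕ; fromℕ<; punchOut) renaming (_<_ to _<ᶠ_)
  open import Data.Fin.Permutation as Perm using (Permutation′; _⟨$⟩ʳ_; _⟨$⟩ˡ_; _∘ₚ_)
  open import Data.Fin.Properties using (any?; toℕ-fromℕ<; injective⇒≤; punchOut-injective) renaming (_≟_ to _≟ᶠ_; _<?_ to _<ᶠ?_; <-cmp to <ᶠ-cmp; <-asym to <ᶠ-asym; <-irrelevant to <ᶠ-irrelevant)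
  open import Data.Fin.Subset using (Subset; ⊤; ∁) renaming (∣_∣ to ∣_∣ˢ)
  open import Data.Fin.Subset.Properties using (∈⊤)
  open import Data.Integer.Base hiding (suc; _⊔_; _⊓_; NonZero; NonNegative)
  open import Data.Integer.DivMod using (_%ℕ_; _/ℕ_; n%ℕd<d; a≡a%ℕn+[a/ℕn]*n)
  import Data.Integer.Divisibility.Signed as Signed
  open import Data.Integer.Properties
  open import Data.Integer.Tactic.RingSolver using (solve-∀)
  open import Data.List.Base using (List; []; _∷_; length; map; filter; tabulate; allFin; _++_; foldr; cartesianProduct; mapMaybe)
  open import Data.List.Extrema.Nat using (xs≤max; min≤xs)
  open import Data.List.Membership.Propositional using (_∈_; _∉_)
  open import Data.List.Membership.Propositional.Properties using (∈-map⁺; ∈-filter⁺; ∈-filter⁻; ∈-allFin; ∈-++⁺ˡ; ∈-++⁺ʳ)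
  open import Data.List.Properties using (length-map; length-++; map-++; map-∘)
  open import Data.List.Relation.Unary.All as All using (All; []; _∷_)
  import Data.List.Relation.Unary.All.Properties as Allₚ
  open import Data.List.Relation.Unary.AllPairs using (AllPairs; []; _∷_)
  open import Data.List.Relation.Unary.Any using (here; there)
  open import Data.Maybe.Base using (Maybe; just; nothing)
  open import Data.Nat.Base as ℕ using (ℕ)
  import Data.Nat.Properties as ℕₚ
  open import Data.Parity.Base using (Parity; 0ℙ; 1ℙ)
  open import Data.Parity.Properties using () renaming (_≟_ to _≟ₚ_)
  open import Data.Product.Base using (Σ; _×_; _,_; ∃-syntax; proj₁; proj₂; Σ-syntax)
  open import Data.Rational.Base as ℚ using (ℚ; 0ℚ; 1ℚ; ½)
  open import Data.Rational.Literals using (fromℤ)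
  import Data.Rational.Properties as ℚₚ
  import Data.Rational.Unnormalised.Base as ℚᵘ
  import Data.Rational.Unnormalised.Properties as ℚᵘₚ
  open import Data.Sign.Base as Sign using (Sign)
  open import Data.Sign.Properties using () renaming (_≟_ to _≟ˢ_)
  open import Data.Sum.Base using (_⊎_; inj₁; inj₂)
  open import Data.Unit.Base using (tt)
  import Data.Vec.Base as Vec
  open import Data.Vec.Properties using (lookup-map; lookup∘tabulate)
  open import Data.Vec.Properties.WithK using ([]=-irrelevant)
  open import Function.Base using (_∘_)
  open import Function.Bundles using (mk↔ₛ′; _⇔_; mk⇔; Inverse; Equivalence)
  open import Relation.Binary.Definitions using (tri<; tri≈; tri>)
  open import Relation.Binary.PropositionalEquality
  open import Relation.Nullary using (¬_; Dec; yes; no)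
  open import Relation.Nullary.Decidable using (_×-dec_; ¬?; True; toWitness; decidable-stable)

  open Algebra.Properties.Semiring.Sum +-*-semiring
    using (sum; sum-cong-≗; ∑-distrib-+; sum-permute; *-distribˡ-sum; *-distribʳ-sum)
    renaming (∑-comm to sum-comm)

  infixl 6 _⊕_
  infixl 7 _⊗_

  _⊕_ : ∀ {a b} → 0ℤ ≤ a → 0ℤ ≤ b → 0ℤ ≤ a + b
  _⊕_ = +-mono-≤

  _⊗_ : ∀ {a b} → 0ℤ ≤ a → 0ℤ ≤ b → 0ℤ ≤ a * b
  _⊗_ {a} {b} p q = subst (_≤ a * b) (*-zeroʳ a) (*-monoˡ-≤-nonNeg a {{nonNegative p}} q)

  diff : ∀ {a b} → a ≤ b → 0ℤ ≤ b - a
  diff = i≤j⇒0≤j-i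

  ≤by : ∀ {a b e} → 0ℤ ≤ e → e ≡ b - a → a ≤ b
  ≤by p eq = 0≤i-j⇒j≤i (subst (0ℤ ≤_) eq p)

  num : ∀ k → 0ℤ ≤ + k
  num k = +≤+ ℕ.z≤n

  ≤-absurd : ∀ {a b} {X : Set} → a ≤ b → b < a → X
  ≤-absurd p q = ⊥-elim (<-irrefl refl (<-≤-trans q p))

  <⇒1+≤ : ∀ {a b} → a < b → 1ℤ + a ≤ b
  <⇒1+≤ = i<j⇒suc[i]≤j

  1+≤⇒< : ∀ {a b} → 1ℤ + a ≤ b → a < b
  1+≤⇒< = suc[i]≤j⇒i<j

  square≥0 : ∀ a → 0ℤ ≤ a * a
  square≥0 (+ n)    = num n ⊗ num n
  square≥0 -[1+ n ] = +≤+ ℕ.z≤n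

  ≤-cancel : ∀ {a b c} → 0ℤ < c → c * a ≤ c * b → a ≤ b
  ≤-cancel {a} {b} {c} p = *-cancelˡ-≤-pos a b c {{positive p}}

  private variable
    n : ℕ

  opaque
    ∑ : (Fin n → ℤ) → ℤ
    ∑ = sum

    ∑-cong : {f g : Fin n → ℤ} → (∀ i → f i ≡ g i) → ∑ f ≡ ∑ g
    ∑-cong = sum-cong-≗

    ∑-+ : (f g : Fin n → ℤ) → ∑ (λ i → f i + g i) ≡ ∑ f + ∑ g
    ∑-+ = ∑-distrib-+

    ∑-*ˡ : ∀ c (f : Fin n → ℤ) → ∑ (λ i → c * f i) ≡ c * ∑ f
    ∑-*ˡ c f = sym (*-distribˡ-sum c f)

    ∑-*ʳ : ∀ c (f : Fin n → ℤ) → ∑ (λ i → f i * c) ≡ ∑ f * c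
    ∑-*ʳ c f = sym (*-distribʳ-sum c f)

    ∑-comm : ∀ {m n} (f : Fin m → Fin n → ℤ) → ∑ (λ i → ∑ (f i)) ≡ ∑ (λ j → ∑ (λ i → f i j))
    ∑-comm = sum-comm

    ∑-neg : (f : Fin n → ℤ) → ∑ (λ i → - f i) ≡ - ∑ f
    ∑-neg {n = ℕ.zero}  f = refl
    ∑-neg {n = ℕ.suc n} f = trans (cong (λ z → - f zero + z) (∑-neg (f ∘ suc))) (sym (neg-distrib-+ (f zero) _))

    ∑-- : (f g : Fin n → ℤ) → ∑ (λ i → f i - g i) ≡ ∑ f - ∑ g
    ∑-- f g = trans (∑-+ f (λ i → - g i)) (cong (λ z → ∑ f + z) (∑-neg g))

    ∑-const : ∀ n c → ∑ {n} (λ _ → c) ≡ + n * c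
    ∑-const ℕ.zero    c = refl
    ∑-const (ℕ.suc n) c = trans (cong (λ z → c + z) (∑-const n c)) (sym (suc-* (+ n) c))

    ∑-zero : ∀ n → ∑ {n} (λ _ → 0ℤ) ≡ 0ℤ
    ∑-zero n = trans (∑-const n 0ℤ) (*-zeroʳ (+ n))

    ∑-mono : {f g : Fin n → ℤ} → (∀ i → f i ≤ g i) → ∑ f ≤ ∑ g
    ∑-mono {n = ℕ.zero}  p = ≤-refl
    ∑-mono {n = ℕ.suc n} p = +-mono-≤ (p zero) (∑-mono (p ∘ suc))

    ∑-nonneg : {f : Fin n → ℤ} → (∀ i → 0ℤ ≤ f i) → 0ℤ ≤ ∑ f
    ∑-nonneg {n = n} {f} p = subst (_≤ ∑ f) (∑-zero n) (∑-mono p)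

    term≤∑ : {f : Fin n → ℤ} → (∀ i → 0ℤ ≤ f i) → ∀ i → f i ≤ ∑ f
    term≤∑ {n = ℕ.suc n} {f} p zero    = subst (_≤ ∑ f) (+-identityʳ _) (+-monoʳ-≤ (f zero) (∑-nonneg (p ∘ suc)))
    term≤∑ {n = ℕ.suc n} {f} p (suc i) = ≤-trans (term≤∑ (p ∘ suc) i)
      (subst (_≤ ∑ f) (+-identityˡ _) (+-monoˡ-≤ (∑ (f ∘ suc)) (p zero)))

    ∑-permute : ∀ (f : Fin n → ℤ) (π : Permutation′ n) → ∑ (λ i → f (π ⟨$⟩ʳ i)) ≡ ∑ f
    ∑-permute f π = sym (sum-permute f π)

  ∑<⇒∃< : (f g : Fin n → ℤ) → ∑ f < ∑ g → ∃[ i ] f i < g i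
  ∑<⇒∃< f g p with any? (λ i → f i <? g i)
  ... | yes q = q
  ... | no ¬q = ≤-absurd (∑-mono (λ i → ≮⇒≥ (λ r → ¬q (i , r)))) p

  ∑∑<⇒∃< : ∀ {k} (f g : Fin n → Fin k → ℤ) → ∑ (λ i → ∑ (f i)) < ∑ (λ i → ∑ (g i)) → ∃[ i ] ∃[ j ] f i j < g i j
  ∑∑<⇒∃< f g p = let i , q = ∑<⇒∃< _ _ p; j , r = ∑<⇒∃< _ _ q in i , j , r

  δ : Fin n → Fin n → ℤ
  δ i j with i ≟ᶠ j
  ... | yes _ = 1ℤ
  ... | no  _ = 0ℤ

  δ-refl : (i : Fin n) → δ i i ≡ 1ℤ
  δ-refl i with i ≟ᶠ i
  ... | yes _ = refl
  ... | no ¬p = ⊥-elim (¬p refl)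

  δ-≢ : {i j : Fin n} → i ≢ j → δ i j ≡ 0ℤ
  δ-≢ {i = i} {j} p with i ≟ᶠ j
  ... | yes q = ⊥-elim (p q)
  ... | no  _ = refl

  δ≥0 : (i j : Fin n) → 0ℤ ≤ δ i j
  δ≥0 i j with i ≟ᶠ j
  ... | yes _ = num 1
  ... | no  _ = num 0

  δ-suc : (i j : Fin n) → δ (suc i) (suc j) ≡ δ i j
  δ-suc i j with i ≟ᶠ j
  ... | yes _ = refl
  ... | no  _ = refl

  opaque
    unfolding ∑

    ∑-δ : (i : Fin n) (f : Fin n → ℤ) → ∑ (λ j → δ i j * f j) ≡ f i
    ∑-δ {n = ℕ.suc n} zero    f = trans (cong₂ _+_ (*-identityˡ (f zero)) (∑-zero n)) (+-identityʳ (f zero))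
    ∑-δ {n = ℕ.suc n} (suc i) f = trans (+-identityˡ _)
      (trans (∑-cong (λ j → cong (_* f (suc j)) (δ-suc i j))) (∑-δ i (f ∘ suc)))

  δ-sym : (i j : Fin n) → δ i j ≡ δ j i
  δ-sym i j with i ≟ᶠ j | j ≟ᶠ i
  ... | yes _ | yes _ = refl
  ... | no  _ | no  _ = refl
  ... | yes p | no q  = ⊥-elim (q (sym p))
  ... | no p  | yes q = ⊥-elim (p (sym q))

  ∑-δ₁ : (i : Fin n) → ∑ (δ i) ≡ 1ℤ
  ∑-δ₁ i = trans (∑-cong (λ j → sym (*-identityʳ (δ i j)))) (∑-δ i (λ _ → 1ℤ))

  cong+ : ∀ c {a b} → a ≡ b → c + a ≡ c + b
  cong+ c = cong (λ z → c + z)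

  ∑² : ∀ {m n} → (Fin m → Fin n → ℤ) → ℤ
  ∑² f = ∑ (λ i → ∑ (f i))

  ∑²-cong : ∀ {m n} {f g : Fin m → Fin n → ℤ} → (∀ i j → f i j ≡ g i j) → ∑² f ≡ ∑² g
  ∑²-cong p = ∑-cong (λ i → ∑-cong (p i))

  ∑²-+ : ∀ {m n} (f g : Fin m → Fin n → ℤ) → ∑² (λ i j → f i j + g i j) ≡ ∑² f + ∑² g
  ∑²-+ f g = trans (∑-cong (λ i → ∑-+ (f i) (g i))) (∑-+ _ _)

  ∑²-- : ∀ {m n} (f g : Fin m → Fin n → ℤ) → ∑² (λ i j → f i j - g i j) ≡ ∑² f - ∑² g
  ∑²-- f g = trans (∑-cong (λ i → ∑-- (f i) (g i))) (∑-- _ _)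

  ∑²-*ˡ : ∀ {m n} c (f : Fin m → Fin n → ℤ) → ∑² (λ i j → c * f i j) ≡ c * ∑² f
  ∑²-*ˡ c f = trans (∑-cong (λ i → ∑-*ˡ c (f i))) (∑-*ˡ c _)

  ∑²-comm : ∀ {m n} (f : Fin m → Fin n → ℤ) → ∑² f ≡ ∑² (λ j i → f i j)
  ∑²-comm f = ∑-comm f

  ∑²-mono : ∀ {m n} {f g : Fin m → Fin n → ℤ} → (∀ i j → f i j ≤ g i j) → ∑² f ≤ ∑² g
  ∑²-mono p = ∑-mono (λ i → ∑-mono (p i))

  ∑²-nonneg : ∀ {m n} {f : Fin m → Fin n → ℤ} → (∀ i j → 0ℤ ≤ f i j) → 0ℤ ≤ ∑² f
  ∑²-nonneg p = ∑-nonneg (λ i → ∑-nonneg (p i))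

  ∑²-outer : ∀ {m n} (f : Fin m → ℤ) (g : Fin n → ℤ) → ∑² (λ i j → f i * g j) ≡ ∑ f * ∑ g
  ∑²-outer f g = trans (∑-cong (λ i → ∑-*ˡ (f i) g)) (∑-*ʳ (∑ g) f)

  ∑²-fst : ∀ {m n} (f : Fin m → ℤ) → ∑² (λ i (_ : Fin n) → f i) ≡ + n * ∑ f
  ∑²-fst {n = n} f = trans (∑-cong (λ i → ∑-const n (f i))) (∑-*ˡ (+ n) f)

  ∑²-snd : ∀ {m n} (f : Fin n → ℤ) → ∑² (λ (_ : Fin m) j → f j) ≡ + m * ∑ f
  ∑²-snd {m} f = ∑-const m (∑ f)

  term≤∑² : ∀ {m n} {f : Fin m → Fin n → ℤ} → (∀ i j → 0ℤ ≤ f i j) → ∀ i j → f i j ≤ ∑² f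
  term≤∑² p i j = ≤-trans (term≤∑ (p i) j) (term≤∑ (λ i → ∑-nonneg (p i)) i)

  Mat : ℕ → Set
  Mat n = Fin n → Fin n → ℤ

  ∑²-permute : (w : Mat n) (π : Permutation′ n) → ∑² (λ a b → w (π ⟨$⟩ʳ a) (π ⟨$⟩ʳ b)) ≡ ∑² w
  ∑²-permute w π = trans (∑-cong (λ a → ∑-permute (w (π ⟨$⟩ʳ a)) π)) (∑-permute (λ x → ∑ (w x)) π)

  tr : Fin n → Fin n → Fin n → Fin n
  tr u y = Perm.transpose u y ⟨$⟩ʳ_

  tr-left : (u y : Fin n) → tr u y u ≡ y
  tr-left u y with u ≟ᶠ u
  ... | yes _ = refl
  ... | no ¬p = ⊥-elim (¬p refl)

  tr-other : {u y a : Fin n} → a ≢ u → a ≢ y → tr u y a ≡ a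
  tr-other {u = u} {y} {a} p q with a ≟ᶠ u
  ... | yes r = ⊥-elim (p r)
  ... | no  _ with a ≟ᶠ y
  ...   | yes r = ⊥-elim (q r)
  ...   | no  _ = refl

  tr-shift-identity : ∀ x → x + (1ℤ - 1ℤ) * (x - x) ≡ x
  tr-shift-identity = solve-∀

  tr-shift-identity₂ : ∀ x z → x + (1ℤ - 0ℤ) * (z - x) ≡ z
  tr-shift-identity₂ = solve-∀

  tr-shift-identity₃ : ∀ x z → x + (0ℤ - 1ℤ) * (x - z) ≡ z
  tr-shift-identity₃ = solve-∀

  tr-shift-identity₄ : ∀ x z → x + (0ℤ - 0ℤ) * z ≡ x
  tr-shift-identity₄ = solve-∀

  tr-shift : (u y a : Fin n) (g : Fin n → ℤ) → g (tr u y a) ≡ g a + (δ u a - δ y a) * (g y - g u)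
  tr-shift u y a g with a ≟ᶠ u
  ... | yes refl with a ≟ᶠ y
  ...   | yes refl rewrite δ-refl a = sym (tr-shift-identity (g a))
  ...   | no a≢y rewrite δ-refl a | δ-≢ (λ p → a≢y (sym p)) = sym (tr-shift-identity₂ (g a) (g y))
  tr-shift u y a g | no a≢u with a ≟ᶠ y
  ...   | yes refl rewrite δ-refl a | δ-≢ (λ p → a≢u (sym p)) = sym (tr-shift-identity₃ (g a) (g u))
  ...   | no a≢y rewrite δ-≢ (λ p → a≢u (sym p)) | δ-≢ (λ p → a≢y (sym p)) = sym (tr-shift-identity₄ (g a) (g y - g u))

  ∑-δδ-identity : ∀ p q x → (p - q) * x ≡ p * x - q * x
  ∑-δδ-identity = solve-∀

  ∑-δδ : (u y : Fin n) (f : Fin n → ℤ) → ∑ (λ a → (δ u a - δ y a) * f a) ≡ f u - f y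
  ∑-δδ u y f = trans (∑-cong (λ a → ∑-δδ-identity (δ u a) (δ y a) (f a)))
    (trans (∑-- _ _) (cong₂ _-_ (∑-δ u f) (∑-δ y f)))

  infixl 9 _⟪_⇄_⟫
  _⟪_⇄_⟫ : Mat n → Fin n → Fin n → Mat n
  (w ⟪ u ⇄ y ⟫) a b = w (tr u y a) (tr u y b)

  quad : Mat n → Fin n → Fin n → Fin n → Fin n → ℤ
  quad w u y z t = w y t - w y z - w u t + w u z

  ⇄-expand-identity : ∀ e f wab wyb wub way wau wyy wyu wuy wuu →
    wab + f * (way - wau) + e * (wyb + f * (wyy - wyu) - (wub + f * (wuy - wuu)))
    ≡ wab + e * (wyb - wub) + f * (way - wau) + e * (f * (wyy - wyu - wuy + wuu))
  ⇄-expand-identity = solve-∀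

  ⇄-expand : (w : Mat n) (u y a b : Fin n) → (w ⟪ u ⇄ y ⟫) a b ≡
    w a b + (δ u a - δ y a) * (w y b - w u b) + (δ u b - δ y b) * (w a y - w a u)
    + (δ u a - δ y a) * ((δ u b - δ y b) * quad w u y u y)
  ⇄-expand w u y a b
    rewrite tr-shift u y a (λ x → w x (tr u y b))
          | tr-shift u y b (w a) | tr-shift u y b (w y) | tr-shift u y b (w u)
    = ⇄-expand-identity (δ u a - δ y a) (δ u b - δ y b) (w a b) (w y b) (w u b) (w a y) (w a u) (w y y) (w y u) (w u y) (w u u)

  𝔼-swap-identity : ∀ A w ea p eb q r → A * (w + ea * p + eb * q + ea * (eb * r))
    ≡ A * w + ea * (A * p) + eb * (A * q) + ea * (eb * A * r)
  𝔼-swap-identity = solve-∀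

  𝔼-swap-identity₂ : ∀ 𝔼 L A q → 𝔼 + L + L + ((0ℤ - A) - (A - 0ℤ)) * q ≡ 𝔼 + (+ 2 * L - + 2 * (A * q))
  𝔼-swap-identity₂ = solve-∀

  𝔼-swap-identity₃ : ∀ p q r → p * r - q * r ≡ (p - q) * r
  𝔼-swap-identity₃ = solve-∀

  S-swap-identity : ∀ p q r s → p * (q + r * s) ≡ p * q + r * (p * s)
  S-swap-identity = solve-∀

  L-swap₂-identity : ∀ Az At wtb wzb e wty wtu wzy wzu →
    (Az - At) * (wtb + e * (wty - wtu) - (wzb + e * (wzy - wzu)))
    ≡ (Az - At) * (wtb - wzb) + e * ((Az - At) * (wty - wtu - wzy + wzu))
  L-swap₂-identity = solve-∀

  L-swap₂-identity₂ : ∀ l p q r s x → l + ((p - q) * x - (r - s) * x) ≡ l + (p - q - r + s) * x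
  L-swap₂-identity₂ = solve-∀

  x+y-x≡y : ∀ x y → x + y - x ≡ y
  x+y-x≡y = solve-∀

  𝔼-swap₂-identity : ∀ a b c d → a - b - c + d ≡ a - c - b + d
  𝔼-swap₂-identity = solve-∀

  𝔼-swap₂-identity₂ : ∀ 𝔼' l x q 𝔼 → 𝔼' + (+ 2 * (l + x) - + 2 * q) - 𝔼' ≡ 𝔼 + (+ 2 * l - + 2 * q) - 𝔼 + + 2 * x
  𝔼-swap₂-identity₂ = solve-∀

  bd-*-identity : ∀ x y → - (- x * y) ≡ x * y
  bd-*-identity = solve-∀

  ne0-+-identity : ∀ x → x - 1ℤ ≡ + 2 * x - (1ℤ + x)
  ne0-+-identity = solve-∀

  module Energy {n : ℕ} (A : Mat n) (A-sym : ∀ a b → A a b ≡ A b a) (A-irr : ∀ a → A a a ≡ 0ℤ) where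

    𝔼 : Mat n → ℤ
    𝔼 w = ∑² (λ a b → A a b * w a b)

    deg : Fin n → ℤ
    deg u = ∑ (A u)

    L : Mat n → Fin n → Fin n → ℤ
    L w u y = ∑ (λ b → (A u b - A y b) * (w y b - w u b))

    𝔼-swap : (w : Mat n) → (∀ a b → w a b ≡ w b a) → ∀ u y →
      𝔼 (w ⟪ u ⇄ y ⟫) ≡ 𝔼 w + (+ 2 * L w u y - + 2 * (A u y * quad w u y u y))
    𝔼-swap w w-sym u y = begin
      𝔼 (w ⟪ u ⇄ y ⟫)
        ≡⟨ ∑²-cong (λ a b → trans (cong (A a b *_) (⇄-expand w u y a b))
             (𝔼-swap-identity (A a b) (w a b) (e a) (w y b - w u b) (e b) (w a y - w a u) (quad w u y u y))) ⟩
      ∑² (λ a b → A a b * w a b + e a * (A a b * (w y b - w u b)) + e b * (A a b * (w a y - w a u))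
                  + e a * (e b * A a b * quad w u y u y))
        ≡⟨ trans (∑²-+ _ _) (cong₂ _+_ (trans (∑²-+ _ _) (cong₂ _+_ (∑²-+ _ _) refl)) refl) ⟩
      𝔼 w + ∑² (λ a b → e a * (A a b * (w y b - w u b))) + ∑² (λ a b → e b * (A a b * (w a y - w a u)))
          + ∑² (λ a b → e a * (e b * A a b * quad w u y u y))
        ≡⟨ cong₂ _+_ (cong₂ _+_ (cong+ (𝔼 w) first) second) third ⟩
      𝔼 w + L w u y + L w u y + ((A u u - A u y) - (A y u - A y y)) * quad w u y u y
        ≡⟨ cong (λ z → 𝔼 w + L w u y + L w u y + z * quad w u y u y)
             (cong₂ _-_ (cong (_- A u y) (A-irr u)) (cong₂ _-_ (A-sym y u) (A-irr y))) ⟩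
      𝔼 w + L w u y + L w u y + ((0ℤ - A u y) - (A u y - 0ℤ)) * quad w u y u y
        ≡⟨ 𝔼-swap-identity₂ (𝔼 w) (L w u y) (A u y) (quad w u y u y) ⟩
      𝔼 w + (+ 2 * L w u y - + 2 * (A u y * quad w u y u y)) ∎
      where
      open ≡-Reasoning
      e : Fin n → ℤ
      e a = δ u a - δ y a
      first : ∑² (λ a b → e a * (A a b * (w y b - w u b))) ≡ L w u y
      first = begin
        ∑² (λ a b → e a * (A a b * (w y b - w u b)))
          ≡⟨ ∑-cong (λ a → ∑-*ˡ (e a) _) ⟩
        ∑ (λ a → e a * ∑ (λ b → A a b * (w y b - w u b)))
          ≡⟨ ∑-δδ u y _ ⟩
        ∑ (λ b → A u b * (w y b - w u b)) - ∑ (λ b → A y b * (w y b - w u b))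
          ≡⟨ trans (sym (∑-- _ _)) (∑-cong (λ b → 𝔼-swap-identity₃ (A u b) (A y b) _)) ⟩
        L w u y ∎
      second : ∑² (λ a b → e b * (A a b * (w a y - w a u))) ≡ L w u y
      second = trans (∑²-comm (λ a b → e b * (A a b * (w a y - w a u))))
        (trans (∑²-cong (λ b a → cong₂ (λ p q → e b * (p * q)) (A-sym a b) (cong₂ _-_ (w-sym a y) (w-sym a u)))) first)
      third : ∑² (λ a b → e a * (e b * A a b * quad w u y u y)) ≡ ((A u u - A u y) - (A y u - A y y)) * quad w u y u y
      third = begin
        ∑² (λ a b → e a * (e b * A a b * quad w u y u y))
          ≡⟨ ∑-cong (λ a → trans (∑-*ˡ (e a) _) (cong (e a *_) (trans (∑-*ʳ (quad w u y u y) _)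
               (cong (_* quad w u y u y) (∑-δδ u y (A a)))))) ⟩
        ∑ (λ a → e a * ((A a u - A a y) * quad w u y u y))
          ≡⟨ ∑-δδ u y _ ⟩
        (A u u - A u y) * quad w u y u y - (A y u - A y y) * quad w u y u y
          ≡⟨ 𝔼-swap-identity₃ (A u u - A u y) (A y u - A y y) (quad w u y u y) ⟩
        ((A u u - A u y) - (A y u - A y y)) * quad w u y u y ∎

    row : Mat n → Fin n → ℤ
    row w u = ∑ (w u)

    S : Mat n → ℤ
    S w = ∑ (λ u → deg u * row w u)

    row-swap : (w : Mat n) → ∀ u y a → row (w ⟪ u ⇄ y ⟫) a ≡ row w (tr u y a)
    row-swap w u y a = ∑-permute (w (tr u y a)) (Perm.transpose u y)

    S-swap : (w : Mat n) → ∀ u y → S (w ⟪ u ⇄ y ⟫) ≡ S w + (deg u - deg y) * (row w y - row w u)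
    S-swap w u y = begin
      S (w ⟪ u ⇄ y ⟫)
        ≡⟨ ∑-cong (λ a → trans (cong (deg a *_) (trans (row-swap w u y a) (tr-shift u y a (row w))))
                        (S-swap-identity (deg a) (row w a) (δ u a - δ y a) (row w y - row w u))) ⟩
      ∑ (λ a → deg a * row w a + (δ u a - δ y a) * (deg a * (row w y - row w u)))
        ≡⟨ trans (∑-+ _ _) (cong+ (S w) (trans (∑-δδ u y _) (𝔼-swap-identity₃ (deg u) (deg y) (row w y - row w u)))) ⟩
      S w + (deg u - deg y) * (row w y - row w u) ∎
      where
      open ≡-Reasoning

    quadA : Fin n → Fin n → Fin n → Fin n → ℤ
    quadA u y z t = A u z - A u t - A y z + A y t

    module _ (w : Mat n) {u y z t : Fin n} (z≢u : z ≢ u) (z≢y : z ≢ y) (t≢u : t ≢ u) (t≢y : t ≢ y) where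

      L-swap₂ : L (w ⟪ u ⇄ y ⟫) z t ≡ L w z t + quadA u y z t * quad w z t u y
      L-swap₂ = begin
        L (w ⟪ u ⇄ y ⟫) z t
          ≡⟨ ∑-cong (λ b → cong ((A z b - A t b) *_) (cong₂ _-_
               (trans (cong (λ x → w x (tr u y b)) (tr-other t≢u t≢y)) (tr-shift u y b (w t)))
               (trans (cong (λ x → w x (tr u y b)) (tr-other z≢u z≢y)) (tr-shift u y b (w z))))) ⟩
        ∑ (λ b → (A z b - A t b) * (w t b + (δ u b - δ y b) * (w t y - w t u) - (w z b + (δ u b - δ y b) * (w z y - w z u))))
          ≡⟨ ∑-cong (λ b → L-swap₂-identity (A z b) (A t b) (w t b) (w z b) (δ u b - δ y b) (w t y) (w t u) (w z y) (w z u)) ⟩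
        ∑ (λ b → (A z b - A t b) * (w t b - w z b) + (δ u b - δ y b) * ((A z b - A t b) * quad w z t u y))
          ≡⟨ trans (∑-+ _ _) (cong+ (L w z t) (∑-δδ u y (λ b → (A z b - A t b) * quad w z t u y))) ⟩
        L w z t + ((A z u - A t u) * quad w z t u y - (A z y - A t y) * quad w z t u y)
          ≡⟨ cong₂ (λ p q → L w z t + (p * quad w z t u y - q * quad w z t u y))
               (cong₂ _-_ (A-sym z u) (A-sym t u)) (cong₂ _-_ (A-sym z y) (A-sym t y)) ⟩
        L w z t + ((A u z - A u t) * quad w z t u y - (A y z - A y t) * quad w z t u y)
          ≡⟨ L-swap₂-identity₂ (L w z t) (A u z) (A u t) (A y z) (A y t) (quad w z t u y) ⟩
        L w z t + quadA u y z t * quad w z t u y ∎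
        where
        open ≡-Reasoning

      quad-swap₂ : quad (w ⟪ u ⇄ y ⟫) z t z t ≡ quad w z t z t
      quad-swap₂ rewrite tr-other {u = u} {y} {z} z≢u z≢y | tr-other {u = u} {y} {t} t≢u t≢y = refl

      row-swap₂ : (row (w ⟪ u ⇄ y ⟫) t - row (w ⟪ u ⇄ y ⟫) z) ≡ row w t - row w z
      row-swap₂ = cong₂ _-_ (trans (row-swap w u y t) (cong (row w) (tr-other t≢u t≢y)))
                            (trans (row-swap w u y z) (cong (row w) (tr-other z≢u z≢y)))

      S-swap₂ : S ((w ⟪ u ⇄ y ⟫) ⟪ z ⇄ t ⟫) - S (w ⟪ u ⇄ y ⟫) ≡ S (w ⟪ z ⇄ t ⟫) - S w
      S-swap₂ = begin
        S ((w ⟪ u ⇄ y ⟫) ⟪ z ⇄ t ⟫) - S (w ⟪ u ⇄ y ⟫)   ≡⟨ cong (_- S (w ⟪ u ⇄ y ⟫)) (S-swap (w ⟪ u ⇄ y ⟫) z t) ⟩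
        S (w ⟪ u ⇄ y ⟫) + dz * (row (w ⟪ u ⇄ y ⟫) t - row (w ⟪ u ⇄ y ⟫) z) - S (w ⟪ u ⇄ y ⟫)
          ≡⟨ x+y-x≡y (S (w ⟪ u ⇄ y ⟫)) _ ⟩
        dz * (row (w ⟪ u ⇄ y ⟫) t - row (w ⟪ u ⇄ y ⟫) z) ≡⟨ cong (dz *_) row-swap₂ ⟩
        dz * (row w t - row w z)                  ≡⟨ sym (x+y-x≡y (S w) _) ⟩
        S w + dz * (row w t - row w z) - S w      ≡⟨ cong (_- S w) (sym (S-swap w z t)) ⟩
        S (w ⟪ z ⇄ t ⟫) - S w ∎
        where
        open ≡-Reasoning
        dz : ℤ
        dz = deg z - deg t

      𝔼-swap₂ : (∀ a b → w a b ≡ w b a) →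
        𝔼 ((w ⟪ u ⇄ y ⟫) ⟪ z ⇄ t ⟫) - 𝔼 (w ⟪ u ⇄ y ⟫) ≡ 𝔼 (w ⟪ z ⇄ t ⟫) - 𝔼 w + + 2 * (quadA u y z t * quad w u y z t)
      𝔼-swap₂ w-sym = begin
        𝔼 ((w ⟪ u ⇄ y ⟫) ⟪ z ⇄ t ⟫) - 𝔼 (w ⟪ u ⇄ y ⟫)
          ≡⟨ cong (_- 𝔼 (w ⟪ u ⇄ y ⟫)) (𝔼-swap (w ⟪ u ⇄ y ⟫) (λ a b → w-sym _ _) z t) ⟩
        𝔼 (w ⟪ u ⇄ y ⟫) + (+ 2 * L (w ⟪ u ⇄ y ⟫) z t - + 2 * (A z t * quad (w ⟪ u ⇄ y ⟫) z t z t)) - 𝔼 (w ⟪ u ⇄ y ⟫)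
          ≡⟨ cong₂ (λ p q → 𝔼 (w ⟪ u ⇄ y ⟫) + (+ 2 * p - + 2 * (A z t * q)) - 𝔼 (w ⟪ u ⇄ y ⟫)) L-swap₂ quad-swap₂ ⟩
        𝔼 (w ⟪ u ⇄ y ⟫) + (+ 2 * (L w z t + Q * quad w z t u y) - + 2 * (A z t * quad w z t z t)) - 𝔼 (w ⟪ u ⇄ y ⟫)
          ≡⟨ cong (λ p → 𝔼 (w ⟪ u ⇄ y ⟫) + (+ 2 * (L w z t + Q * p) - + 2 * (A z t * quad w z t z t)) - 𝔼 (w ⟪ u ⇄ y ⟫)) qsym ⟩
        𝔼 (w ⟪ u ⇄ y ⟫) + (+ 2 * (L w z t + Q * quad w u y z t) - + 2 * (A z t * quad w z t z t)) - 𝔼 (w ⟪ u ⇄ y ⟫)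
          ≡⟨ 𝔼-swap₂-identity₂ (𝔼 (w ⟪ u ⇄ y ⟫)) (L w z t) (Q * quad w u y z t) (A z t * quad w z t z t) (𝔼 w) ⟩
        𝔼 w + (+ 2 * L w z t - + 2 * (A z t * quad w z t z t)) - 𝔼 w + + 2 * (Q * quad w u y z t)
          ≡⟨ cong (λ p → p - 𝔼 w + + 2 * (Q * quad w u y z t)) (sym (𝔼-swap w w-sym z t)) ⟩
        𝔼 (w ⟪ z ⇄ t ⟫) - 𝔼 w + + 2 * (Q * quad w u y z t) ∎
        where
        open ≡-Reasoning
        Q : ℤ
        Q = quadA u y z t
        qsym : quad w z t u y ≡ quad w u y z t
        qsym = trans (𝔼-swap₂-identity (w t y) (w t u) (w z y) (w z u))
          (cong₂ _+_ (cong₂ _-_ (cong₂ _-_ (w-sym t y) (w-sym z y)) (w-sym t u)) (w-sym z u))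

  ∣_∣≤_ : ℤ → ℤ → Set
  ∣ x ∣≤ b = (- b ≤ x) × (x ≤ b)

  bd-+ : ∀ {x y a b} → ∣ x ∣≤ a → ∣ y ∣≤ b → ∣ x + y ∣≤ (a + b)
  bd-+ {x} {y} {a} {b} (p , q) (r , s) = subst (_≤ x + y) (sym (neg-distrib-+ a b)) (+-mono-≤ p r) , +-mono-≤ q s

  bd-neg : ∀ {x a} → ∣ x ∣≤ a → ∣ - x ∣≤ a
  bd-neg {x} {a} (p , q) = neg-mono-≤ q , subst (- x ≤_) (neg-involutive a) (neg-mono-≤ p)

  bd-- : ∀ {x y a b} → ∣ x ∣≤ a → ∣ y ∣≤ b → ∣ x - y ∣≤ (a + b)
  bd-- p q = bd-+ p (bd-neg q)

  bd-∑ : {f g : Fin n → ℤ} → (∀ i → ∣ f i ∣≤ g i) → ∣ ∑ f ∣≤ ∑ g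
  bd-∑ {f = f} {g} p = subst (_≤ ∑ f) (∑-neg g) (∑-mono (λ i → proj₁ (p i))) , ∑-mono (λ i → proj₂ (p i))

  bd-weaken : ∀ {x a b} → ∣ x ∣≤ a → a ≤ b → ∣ x ∣≤ b
  bd-weaken (p , q) r = ≤-trans (neg-mono-≤ r) p , ≤-trans q r

  prod≤-identity : ∀ x y a b → (a - x) * (y - - b) + (b - y) * (x - - a) ≡ + 2 * (a * b) - + 2 * (x * y)
  prod≤-identity = solve-∀

  prod≤ : ∀ {x y a b} → ∣ x ∣≤ a → ∣ y ∣≤ b → x * y ≤ a * b
  prod≤ {x} {y} {a} {b} (p , q) (r , s) = ≤-cancel {c = + 2} (+<+ (ℕ.s≤s ℕ.z≤n))
    (≤by (diff q ⊗ diff r ⊕ diff s ⊗ diff p) (prod≤-identity x y a b))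

  bd-* : ∀ {x y a b} → ∣ x ∣≤ a → ∣ y ∣≤ b → ∣ x * y ∣≤ (a * b)
  bd-* {x} {y} {a} {b} p q = subst (- (a * b) ≤_) (bd-*-identity x y) (neg-mono-≤ (prod≤ (bd-neg p) q)) , prod≤ p q

  bd-*ˡ : ∀ {c x a} → 0ℤ ≤ c → ∣ x ∣≤ a → ∣ c * x ∣≤ (c * a)
  bd-*ˡ {c} c≥0 p = bd-* (≤-trans (neg-mono-≤ c≥0) c≥0 , ≤-refl) p

  nonneg-bd : ∀ {x a} → 0ℤ ≤ x → x ≤ a → ∣ x ∣≤ a
  nonneg-bd p q = ≤-trans (neg-mono-≤ (≤-trans p q)) p , q

  *-monoˡ : ∀ {c x y} → 0ℤ ≤ c → x ≤ y → c * x ≤ c * y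
  *-monoˡ {c} p q = *-monoˡ-≤-nonNeg c {{nonNegative p}} q

  0≤1 : 0ℤ ≤ 1ℤ
  0≤1 = num 1

  zero-or-pos : ∀ {x} → 0ℤ ≤ x → x ≡ 0ℤ ⊎ 1ℤ ≤ x
  zero-or-pos {+ ℕ.zero}    _ = inj₁ refl
  zero-or-pos {+ (ℕ.suc k)} _ = inj₂ (+≤+ (ℕ.s≤s ℕ.z≤n))

  y≡x+y-x : ∀ x y → y ≡ x + y - x
  y≡x+y-x = solve-∀

  sum≡0ˡ : ∀ {x y} → 0ℤ ≤ x → 0ℤ ≤ y → x + y ≡ 0ℤ → x ≡ 0ℤ
  sum≡0ˡ {x} {y} p q eq = ≤-antisym (subst (x ≤_) eq (≤by q (y≡x+y-x x y))) p

  sum≡0ʳ : ∀ {x y} → 0ℤ ≤ x → 0ℤ ≤ y → x + y ≡ 0ℤ → y ≡ 0ℤ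
  sum≡0ʳ {x} {y} p q eq = sum≡0ˡ q p (trans (+-comm y x) eq)

  ne0 : ℤ → ℤ
  ne0 (+ ℕ.zero)  = 0ℤ
  ne0 +[1+ _ ]    = 1ℤ
  ne0 -[1+ _ ]    = 1ℤ

  ne0≥0 : ∀ x → 0ℤ ≤ ne0 x
  ne0≥0 (+ ℕ.zero) = num 0
  ne0≥0 +[1+ _ ]   = num 1
  ne0≥0 -[1+ _ ]   = num 1

  ne0≤1 : ∀ x → ne0 x ≤ 1ℤ
  ne0≤1 (+ ℕ.zero) = num 1
  ne0≤1 +[1+ _ ]   = ≤-refl
  ne0≤1 -[1+ _ ]   = ≤-refl

  ne0-+ : ∀ x → ne0 x + x ≤ 0ℤ ⊎ (1ℤ ≤ x × ne0 x + x ≤ + 2 * x)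
  ne0-+ (+ ℕ.zero) = inj₁ ≤-refl
  ne0-+ -[1+ ℕ.zero ] = inj₁ ≤-refl
  ne0-+ -[1+ ℕ.suc k ] = inj₁ -≤+
  ne0-+ +[1+ k ] = inj₂ (p , ≤by (diff p) (ne0-+-identity +[1+ k ]))
    where p : 1ℤ ≤ +[1+ k ]
          p = +≤+ (ℕ.s≤s ℕ.z≤n)

  record Weight {n : ℕ} (w : Mat n) : Set where
    field
      symm : ∀ a b → w a b ≡ w b a
      irr  : ∀ a → w a a ≡ 0ℤ
      val  : ∀ a b → w a b ≡ 0ℤ ⊎ w a b ≡ 1ℤ ⊎ w a b ≡ -1ℤ

    bd : ∀ a b → ∣ w a b ∣≤ 1ℤ
    bd a b with w a b | val a b
    ... | _ | inj₁ refl = -≤+ , num 1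
    ... | _ | inj₂ (inj₁ refl) = -≤+ , ≤-refl
    ... | _ | inj₂ (inj₂ refl) = ≤-refl , -≤+

  N : Mat n → Mat n
  N w a b = 1ℤ - w a b * w a b

  module _ {w : Mat n} (W : Weight w) where
    open Weight W

    N-bd : ∀ a b → 0ℤ ≤ N w a b × N w a b ≤ 1ℤ
    N-bd a b with w a b | val a b
    ... | _ | inj₁ refl = num 1 , ≤-refl
    ... | _ | inj₂ (inj₁ refl) = num 0 , num 1
    ... | _ | inj₂ (inj₂ refl) = num 0 , num 1

    N-sym : ∀ a b → N w a b ≡ N w b a
    N-sym a b rewrite symm a b = refl

    N-irr : ∀ a → N w a a ≡ 1ℤ
    N-irr a rewrite irr a = refl

    weight-permute : (π : Permutation′ n) → Weight (λ a b → w (π ⟨$⟩ʳ a) (π ⟨$⟩ʳ b))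
    weight-permute π = record { symm = λ _ _ → symm _ _ ; irr = λ _ → irr _ ; val = λ _ _ → val _ _ }

    weight-neg : Weight (λ a b → - w a b)
    weight-neg = record { symm = λ a b → cong -_ (symm a b) ; irr = λ a → cong -_ (irr a) ; val = λ a b → v a b }
      where
      v : ∀ a b → - w a b ≡ 0ℤ ⊎ - w a b ≡ 1ℤ ⊎ - w a b ≡ -1ℤ
      v a b with w a b | val a b
      ... | _ | inj₁ refl = inj₁ refl
      ... | _ | inj₂ (inj₁ refl) = inj₂ (inj₂ refl)
      ... | _ | inj₂ (inj₂ refl) = inj₂ (inj₁ refl)

  record Adjacency {n : ℕ} (A : Mat n) (Δ : ℤ) : Set where
    field
      symm : ∀ a b → A a b ≡ A b a
      irr  : ∀ a → A a a ≡ 0ℤ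
      val  : ∀ a b → A a b ≡ 0ℤ ⊎ A a b ≡ 1ℤ
      deg≤ : ∀ a → ∑ (A a) ≤ Δ

  δ≡0⇒≢ : {i j : Fin n} → δ i j ≡ 0ℤ → i ≢ j
  δ≡0⇒≢ {i = i} p refl with trans (sym p) (δ-refl i)
  ... | ()

  record Sizes (n M Δ e d f K G : ℤ) : Set where
    field
      1≤Δ  : 1ℤ ≤ Δ
      1≤G  : 1ℤ ≤ G
      1≤K  : 1ℤ ≤ K
      K≤n  : K ≤ n
      K≤M  : K ≤ M
      M≤Δn : M ≤ Δ * n
      e≥0  : 0ℤ ≤ e
      f≥0  : 0ℤ ≤ f
      Ke≤n : K * e ≤ n
      Kd≤  : K * d ≤ n * n
      Kf≤n : K * f ≤ n
      Kf≤M : K * f ≤ M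
      K≥   : + 40 * ((+ 8 * G) * (+ 8 * G) * (Δ * Δ)) ≤ K

    K≥0 : 0ℤ ≤ K
    K≥0 = ≤-trans 0≤1 1≤K

    n≥0 : 0ℤ ≤ n
    n≥0 = ≤-trans K≥0 K≤n

    M≥0 : 0ℤ ≤ M
    M≥0 = ≤-trans K≥0 K≤M

    Δ≥0 : 0ℤ ≤ Δ
    Δ≥0 = ≤-trans 0≤1 1≤Δ

    G≥0 : 0ℤ ≤ G
    G≥0 = ≤-trans 0≤1 1≤G

  bound₁-identity : ∀ M n Q SS 𝔼 S D d q y →
    + 16 * (M * (n * n)) * (q - Q) + (y - SS) + + 4 * (M * (n * n)) * (𝔼 - - M)
    + + 4 * (M * M * n) * (D - - d) + + 4 * M * (M * n * d - S * D)
    ≡ + 4 * (M * (n * n * n) * 𝔼) + (+ 16 * (M * (n * n)) * q + + 4 * (M * M * (n * n)) + + 8 * (M * M * n * d) + y)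
    - (+ 16 * (M * (n * n)) * Q - (M * (n * n) * (+ 4 * S - + 4 * (n * 𝔼) + + 4 * 𝔼)
    + (+ 2 * (M * n) - + 2 * S) * (+ 2 * (M * D) - + 2 * (n * S)) - SS) + + 4 * (n * (S * S)))
  bound₁-identity = solve-∀

  bound₂-identity : ∀ K M n Δ e d f →
    + 64 * (Δ * M * M * (n * n)) * (n - K * e)
    + + 32 * (Δ * M * (n * n * n)) * (M - K * f)
    + + 32 * (M * M * (n * n)) * (n - K * f)
    + + 4 * (M * M * (n * n)) * (n - K)
    + + 8 * (M * M * n) * (n * n - K * d)
    + + 16 * (Δ * M * (n * n * n)) * (M - K)
    + + 44 * (M * M * (n * n * n)) * (Δ - 1ℤ)
    ≡ + 156 * (Δ * (M * M * (n * n * n))) - K * (+ 16 * (M * (n * n)) * (+ 4 * (Δ * (M * e)) + + 2 * (n * (Δ * f)) + + 2 * (M * f))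
    + + 4 * (M * M * (n * n)) + + 8 * (M * M * n * d) + + 16 * (Δ * (n * n * n * M)))
  bound₂-identity = solve-∀

  bound₂-identity₂ : ∀ K r n s m 𝔼 u x → K * (+ 4 * (m * 𝔼) + x - (r + + 4 * (n * s))) + (+ 156 * u - K * x)
    ≡ + 4 * (m * (K * 𝔼)) + + 156 * u - (K * r + + 4 * (n * (K * s)))
  bound₂-identity₂ = solve-∀

  bound₂-identity₃ : ∀ M n Δ k → + 4 * (M * (n * n * n)) * (M - k) + + 4 * (M * M * (n * n * n)) * (Δ - 1ℤ)
    ≡ + 160 * (Δ * (M * M * (n * n * n))) - (+ 4 * (M * (n * n * n) * k) + + 156 * (Δ * (M * M * (n * n * n))))
  bound₂-identity₃ = solve-∀

  Δn>0-identity : ∀ D n → + 160 * ((D - 1ℤ) * n) + + 160 * (n - 1ℤ) + + 159 ≡ + 160 * (D * n) - 1ℤ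
  Δn>0-identity = solve-∀

  8GS≤-identity : ∀ K r n S D M g →
    (+ 160 * (D * (M * M * (n * n * n))) - (K * r + + 4 * (n * (K * (S * S))))) + K * r
    + + 4 * (n * ((K - + 40 * (g * g * (D * D))) * (S * S))) + + 160 * (n * (g * g * (D * (D - 1ℤ)) * (S * S)))
    ≡ + 160 * (D * n) * (M * n * (M * n)) - + 160 * (D * n) * (g * S * (g * S))
  8GS≤-identity = solve-∀

  8GS≤-identity₂ : ∀ x y → (x + x + (y - (1ℤ + x))) * (y - (1ℤ + x)) + (x + x) + + 2 * (y - (1ℤ + x)) ≡ y * y - (1ℤ + x * x)
  8GS≤-identity₂ = solve-∀

  1≤*-identity : ∀ a b → (a - 1ℤ) * b + (b - 1ℤ) ≡ a * b - 1ℤ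
  1≤*-identity = solve-∀

  module FlatArithmetic {n M Δ e d f K G : ℤ} (s : Sizes n M Δ e d f K G) where
    open Sizes s

    U : ℤ
    U = M * M * (n * n * n)

    U≥0 : 0ℤ ≤ U
    U≥0 = M≥0 ⊗ M≥0 ⊗ (n≥0 ⊗ n≥0 ⊗ n≥0)

    bound₁ : ∀ Q SS 𝔼 S D → Q ≤ + 4 * (Δ * (M * e)) + + 2 * (n * (Δ * f)) + + 2 * (M * f) →
      SS ≤ + 16 * (Δ * (n * n * n * M)) → - M ≤ 𝔼 → ∣ S ∣≤ (M * n) → ∣ D ∣≤ d →
      + 16 * (M * (n * n)) * Q - (M * (n * n) * (+ 4 * S - + 4 * (n * 𝔼) + + 4 * 𝔼)
        + (+ 2 * (M * n) - + 2 * S) * (+ 2 * (M * D) - + 2 * (n * S)) - SS) + + 4 * (n * (S * S))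
      ≤ + 4 * (M * (n * n * n) * 𝔼) + (+ 16 * (M * (n * n)) * (+ 4 * (Δ * (M * e)) + + 2 * (n * (Δ * f)) + + 2 * (M * f))
        + + 4 * (M * M * (n * n)) + + 8 * (M * M * n * d) + + 16 * (Δ * (n * n * n * M)))
    bound₁ Q SS 𝔼 S D hQ hS hE bS bD = ≤by
      (num 16 ⊗ (M≥0 ⊗ (n≥0 ⊗ n≥0)) ⊗ diff hQ ⊕ diff hS ⊕ num 4 ⊗ (M≥0 ⊗ (n≥0 ⊗ n≥0)) ⊗ diff hE
       ⊕ num 4 ⊗ (M≥0 ⊗ M≥0 ⊗ n≥0) ⊗ diff (proj₁ bD) ⊕ num 4 ⊗ M≥0 ⊗ diff (prod≤ bS bD))
      (bound₁-identity M n Q SS 𝔼 S D d _ _)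

    bound₂ : K * (+ 16 * (M * (n * n)) * (+ 4 * (Δ * (M * e)) + + 2 * (n * (Δ * f)) + + 2 * (M * f))
        + + 4 * (M * M * (n * n)) + + 8 * (M * M * n * d) + + 16 * (Δ * (n * n * n * M)))
      ≤ + 156 * (Δ * U)
    bound₂ = ≤by
      (num 64 ⊗ (Δ≥0 ⊗ M≥0 ⊗ M≥0 ⊗ (n≥0 ⊗ n≥0)) ⊗ diff Ke≤n
       ⊕ num 32 ⊗ (Δ≥0 ⊗ M≥0 ⊗ (n≥0 ⊗ n≥0 ⊗ n≥0)) ⊗ diff Kf≤M
       ⊕ num 32 ⊗ (M≥0 ⊗ M≥0 ⊗ (n≥0 ⊗ n≥0)) ⊗ diff Kf≤n
       ⊕ num 4 ⊗ (M≥0 ⊗ M≥0 ⊗ (n≥0 ⊗ n≥0)) ⊗ diff K≤n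
       ⊕ num 8 ⊗ (M≥0 ⊗ M≥0 ⊗ n≥0) ⊗ diff Kd≤
       ⊕ num 16 ⊗ (Δ≥0 ⊗ M≥0 ⊗ (n≥0 ⊗ n≥0 ⊗ n≥0)) ⊗ diff K≤M
       ⊕ num 44 ⊗ U≥0 ⊗ diff 1≤Δ)
      (bound₂-identity K M n Δ e d f)

    module _ {RR 𝔼 S : ℤ} (RR≥0 : 0ℤ ≤ RR) (KE≤M : K * 𝔼 ≤ M)
      (h : RR + + 4 * (n * (S * S)) ≤ + 4 * (M * (n * n * n) * 𝔼)
           + (+ 16 * (M * (n * n)) * (+ 4 * (Δ * (M * e)) + + 2 * (n * (Δ * f)) + + 2 * (M * f))
           + + 4 * (M * M * (n * n)) + + 8 * (M * M * n * d) + + 16 * (Δ * (n * n * n * M)))) where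

      KZ : K * RR + + 4 * (n * (K * (S * S))) ≤ + 4 * (M * (n * n * n) * (K * 𝔼)) + + 156 * (Δ * U)
      KZ = ≤by (K≥0 ⊗ diff h ⊕ diff bound₂) (bound₂-identity₂ K RR n (S * S) (M * (n * n * n)) 𝔼 (Δ * U) _)

      Z≤ : K * RR + + 4 * (n * (K * (S * S))) ≤ + 160 * (Δ * U)
      Z≤ = ≤-trans KZ (≤by (num 4 ⊗ (M≥0 ⊗ (n≥0 ⊗ n≥0 ⊗ n≥0)) ⊗ diff KE≤M ⊕ num 4 ⊗ U≥0 ⊗ diff 1≤Δ) (bound₂-identity₃ M n Δ (K * 𝔼)))

      S²≥0 : 0ℤ ≤ n * (K * (S * S))
      S²≥0 = n≥0 ⊗ (K≥0 ⊗ square≥0 S)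

      KRR≤ : K * RR ≤ + 160 * (Δ * U)
      KRR≤ = ≤-trans (≤by (num 4 ⊗ S²≥0) (y≡x+y-x (K * RR) _)) Z≤

      𝔼≥ : 0ℤ ≤ + 4 * (M * (n * n * n) * (K * 𝔼)) + + 156 * (Δ * U)
      𝔼≥ = ≤-trans (K≥0 ⊗ RR≥0 ⊕ num 4 ⊗ S²≥0) KZ

      n>0 : 0ℤ < n
      n>0 = <-≤-trans (+<+ (ℕ.s≤s ℕ.z≤n)) (≤-trans 1≤K K≤n)

      8GS≤ : + 8 * G * S ≤ M * n
      8GS≤ with + 8 * G * S ≤? M * n
      ... | yes p = p
      ... | no ¬p = ≤-absurd sq (1+≤⇒< strict)
        where
        Mn≥0 = M≥0 ⊗ n≥0
        Δn>0 : 0ℤ < + 160 * (Δ * n)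
        Δn>0 = <-≤-trans (+<+ (ℕ.s≤s ℕ.z≤n)) (≤by (num 160 ⊗ (diff 1≤Δ ⊗ n≥0) ⊕ num 160 ⊗ diff (≤-trans 1≤K K≤n) ⊕ num 159) (Δn>0-identity Δ n))
        sq : + 8 * G * S * (+ 8 * G * S) ≤ M * n * (M * n)
        sq = ≤-cancel Δn>0 (≤by (diff Z≤ ⊕ K≥0 ⊗ RR≥0 ⊕ num 4 ⊗ (n≥0 ⊗ (diff K≥ ⊗ square≥0 S))
               ⊕ num 160 ⊗ (n≥0 ⊗ ((num 8 ⊗ G≥0 ⊗ (num 8 ⊗ G≥0) ⊗ (Δ≥0 ⊗ diff 1≤Δ)) ⊗ square≥0 S))) (8GS≤-identity K RR n S Δ M (+ 8 * G)))
        strict : 1ℤ + M * n * (M * n) ≤ + 8 * G * S * (+ 8 * G * S)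
        strict = ≤by ((Mn≥0 ⊕ Mn≥0 ⊕ gap) ⊗ gap ⊕ (Mn≥0 ⊕ Mn≥0) ⊕ num 2 ⊗ gap) (8GS≤-identity₂ (M * n) (+ 8 * G * S))
          where gap = diff (<⇒1+≤ (≰⇒> ¬p))

  1≤* : ∀ {a b} → 1ℤ ≤ a → 1ℤ ≤ b → 1ℤ ≤ a * b
  1≤* {a} {b} p q = ≤by (diff p ⊗ ≤-trans 0≤1 q ⊕ diff q) (1≤*-identity a b)

  errA-identity : ∀ K n M f e F 𝕋 → n * M * (n - K) + n * n * (K * (f - F) + (M - K * f)) + n * (K * (+ 2 * (M * e) - 𝕋))
    + + 2 * (n * M) * (n - K * e) ≡ + 4 * (n * n * M) - K * (n * M + n * n * F + n * 𝕋)
  errA-identity = solve-∀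

  errB-identity : ∀ K n M Δ f e F N → + 3 * n * (n - K) + K * (Δ * n - M) + Δ * n * (n - K) + + 2 * n * (K * (f - F) + (n - K * f))
    + K * (n * e - N) + n * (n - K * e) ≡ (+ 6 + Δ) * (n * n) - K * (+ 3 * n + M + + 2 * (n * F) + N)
  errB-identity = solve-∀

  1≤*-identity₂ : ∀ K n M Δ R a b →
    + 2 * (Δ * n) * (+ 160 * (Δ * (M * M * (n * n * n))) - K * R)
    + + 16 * (Δ * (M * (n * n))) * (+ 4 * (n * n * M) - K * a)
    + + 32 * (Δ * Δ * (M * (n * n * n * n))) * (M - K)
    + + 8 * (M * M * (n * n)) * ((+ 6 + Δ) * (n * n) - K * b)
    ≡ (+ 352 * (Δ * Δ) + + 72 * Δ + + 48) * (n * (M * M * (n * n * n)))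
    - K * (+ 2 * (Δ * (n * R + + 8 * (M * (n * n)) * a)) + M * (n * (n * (+ 32 * (Δ * Δ * (n * n)))) + + 8 * (M * (n * n)) * b))
  1≤*-identity₂ = solve-∀

  final-identity : ∀ K n M Δ NE D S 𝔼 d r r₂ →
    + 4 * (K * (r - M * (n * n) * (NE + (M * D - + 2 * (n * S) + n * n * 𝔼)))) + + 4 * (r₂ - K * r)
    + n * (+ 4 * (M * (n * n * n) * (K * 𝔼)) + + 156 * (Δ * (M * M * (n * n * n))))
    + + 4 * (M * M * (n * n)) * (K * (D - - d) + (n * n - K * d))
    ≡ + 4 * r₂ + + 156 * (Δ * (n * (M * M * (n * n * n)))) + + 4 * (n * (M * M * (n * n * n)))
    + + 8 * (K * (M * (n * n * n) * S)) - + 4 * (K * (M * (n * n) * NE))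
  final-identity = solve-∀

  final-identity₂ : ∀ Δ V → (+ 640 * Δ + + 196) * (Δ - 1ℤ) * V
    ≡ + 8 * (+ 256 * (Δ * Δ * V)) - (+ 4 * ((+ 352 * (Δ * Δ) + + 72 * Δ + + 48) * V) + + 156 * (Δ * V) + + 4 * V)
  final-identity₂ = solve-∀

  3KV-identity : ∀ K M n G NE S c r → + 4 * (K * (M * (n * n))) * (G * NE - M * (n * n))
    + G * (r + + 8 * (K * (M * (n * n * n) * S)) - + 4 * (K * (M * (n * n) * NE)))
    + G * (+ 8 * c - r)
    + K * (M * (n * n * n)) * (M * n - + 8 * G * S)
    ≡ + 8 * G * c - + 3 * (K * (n * (M * M * (n * n * n))))
  3KV-identity = solve-∀

  final-identity₃ : ∀ K V g Δ → + 3 * ((K - + 40 * (g * g * (Δ * Δ))) * V) + + 120 * (g * (Δ * Δ * V) * (g - + 8))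
    + + 703 * (g * (Δ * Δ * V)) + (g * (Δ * Δ * V) - 1ℤ) ≡ + 3 * (K * V) - (1ℤ + g * (+ 256 * (Δ * Δ * V)))
  final-identity₃ = solve-∀

  8≤g-identity : ∀ G → + 8 * (G - 1ℤ) ≡ + 8 * G - + 8
  8≤g-identity = solve-∀

  row-gap-identity : ∀ ar bt bs ax → ar + bt ≡ ar + bs + ((ax + bt) - (ax + bs))
  row-gap-identity = solve-∀

  col-gap-identity : ∀ br ax ay bs → ax + br ≡ ay + br + ((ax + bs) - (ay + bs))
  col-gap-identity = solve-∀

  x≡x+y-y : ∀ x y → x ≡ x + y - y
  x≡x+y-y = solve-∀

  module FinalArithmetic {n M Δ e d f K G : ℤ} (s : Sizes n M Δ e d f K G) where
    open Sizes s
    open FlatArithmetic s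

    errA : ∀ F TT → F ≤ f → TT ≤ + 2 * (M * e) → K * (n * M + n * n * F + n * TT) ≤ + 4 * (n * n * M)
    errA F TT hF hT = ≤by
      (n≥0 ⊗ M≥0 ⊗ diff K≤n ⊕ n≥0 ⊗ n≥0 ⊗ (K≥0 ⊗ diff hF ⊕ diff Kf≤M) ⊕ n≥0 ⊗ (K≥0 ⊗ diff hT)
       ⊕ num 2 ⊗ (n≥0 ⊗ M≥0) ⊗ diff Ke≤n) (errA-identity K n M f e F TT)

    errB : ∀ F NN → F ≤ f → NN ≤ n * e → K * (+ 3 * n + M + + 2 * (n * F) + NN) ≤ (+ 6 + Δ) * (n * n)
    errB F NN hF hN = ≤by
      (num 3 ⊗ n≥0 ⊗ diff K≤n ⊕ K≥0 ⊗ diff M≤Δn ⊕ Δ≥0 ⊗ n≥0 ⊗ diff K≤n ⊕ num 2 ⊗ n≥0 ⊗ (K≥0 ⊗ diff hF ⊕ diff Kf≤n)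
       ⊕ K≥0 ⊗ diff hN ⊕ n≥0 ⊗ diff Ke≤n) (errB-identity K n M Δ f e F NN)

    V : ℤ
    V = n * U

    V≥0 : 0ℤ ≤ V
    V≥0 = n≥0 ⊗ U≥0

    1≤V : 1ℤ ≤ V
    1≤V = 1≤* 1≤n (1≤* (1≤* 1≤M 1≤M) (1≤* (1≤* 1≤n 1≤n) 1≤n))
      where 1≤n = ≤-trans 1≤K K≤n
            1≤M = ≤-trans 1≤K K≤M

    rhs : ∀ RR a b → K * RR ≤ + 160 * (Δ * U) → K * a ≤ + 4 * (n * n * M) → K * b ≤ (+ 6 + Δ) * (n * n) →
      K * (+ 2 * (Δ * (n * RR + + 8 * (M * (n * n)) * a)) + M * (n * (n * (+ 32 * (Δ * Δ * (n * n)))) + + 8 * (M * (n * n)) * b))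
      ≤ (+ 352 * (Δ * Δ) + + 72 * Δ + + 48) * V
    rhs RR a b hR ha hb = ≤by
      (num 2 ⊗ (Δ≥0 ⊗ n≥0) ⊗ diff hR ⊕ num 16 ⊗ (Δ≥0 ⊗ (M≥0 ⊗ (n≥0 ⊗ n≥0))) ⊗ diff ha
       ⊕ num 32 ⊗ (Δ≥0 ⊗ Δ≥0 ⊗ (M≥0 ⊗ (n≥0 ⊗ n≥0 ⊗ n≥0 ⊗ n≥0))) ⊗ diff K≤M
       ⊕ num 8 ⊗ (M≥0 ⊗ M≥0 ⊗ (n≥0 ⊗ n≥0)) ⊗ diff hb) (1≤*-identity₂ K n M Δ RR a b)

    final : ∀ RR a b NE D S 𝔼 → K * RR ≤ + 160 * (Δ * U) → K * a ≤ + 4 * (n * n * M) → K * b ≤ (+ 6 + Δ) * (n * n) →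
      - d ≤ D → + 8 * G * S ≤ M * n → 0ℤ ≤ + 4 * (M * (n * n * n) * (K * 𝔼)) + + 156 * (Δ * U) →
      M * (n * n) ≤ G * NE →
      M * (n * n) * (NE + (M * D - + 2 * (n * S) + n * n * 𝔼))
        ≤ + 2 * (Δ * (n * RR + + 8 * (M * (n * n)) * a)) + M * (n * (n * (+ 32 * (Δ * Δ * (n * n)))) + + 8 * (M * (n * n)) * b) → ⊥
    final RR a b NE D S 𝔼 hR ha hb hD hS hE hG h = ≤-absurd 3KV (1+≤⇒< big)
      where
      g = + 8 * G
      g≥0 : 0ℤ ≤ g
      g≥0 = num 8 ⊗ G≥0
      r₁ r₂ c₁ : ℤ
      r₁ = + 2 * (Δ * (n * RR + + 8 * (M * (n * n)) * a)) + M * (n * (n * (+ 32 * (Δ * Δ * (n * n)))) + + 8 * (M * (n * n)) * b)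
      r₂ = (+ 352 * (Δ * Δ) + + 72 * Δ + + 48) * V
      c₁ = + 256 * (Δ * Δ * V)
      step : + 4 * (K * (M * (n * n) * NE)) ≤ + 4 * r₂ + + 156 * (Δ * V) + + 4 * V + + 8 * (K * (M * (n * n * n) * S))
      step = ≤by (num 4 ⊗ (K≥0 ⊗ diff h) ⊕ num 4 ⊗ diff (rhs RR a b hR ha hb) ⊕ n≥0 ⊗ hE
          ⊕ num 4 ⊗ (M≥0 ⊗ M≥0 ⊗ (n≥0 ⊗ n≥0)) ⊗ (K≥0 ⊗ diff hD ⊕ diff Kd≤))
        (final-identity K n M Δ NE D S 𝔼 d r₁ r₂)
      collect : + 4 * r₂ + + 156 * (Δ * V) + + 4 * V ≤ + 8 * c₁
      collect = ≤by ((num 640 ⊗ Δ≥0 ⊕ num 196) ⊗ diff 1≤Δ ⊗ V≥0) (final-identity₂ Δ V)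
      3KV : + 3 * (K * V) ≤ + 8 * G * c₁
      3KV = ≤by (num 4 ⊗ (K≥0 ⊗ (M≥0 ⊗ (n≥0 ⊗ n≥0))) ⊗ diff hG ⊕ G≥0 ⊗ diff step ⊕ G≥0 ⊗ diff collect
                 ⊕ K≥0 ⊗ (M≥0 ⊗ (n≥0 ⊗ n≥0 ⊗ n≥0)) ⊗ diff hS)
        (3KV-identity K M n G NE S c₁ (+ 4 * r₂ + + 156 * (Δ * V) + + 4 * V))
      big : 1ℤ + g * c₁ ≤ + 3 * (K * V)
      big = ≤by (num 3 ⊗ (diff K≥ ⊗ V≥0) ⊕ num 120 ⊗ (g≥0 ⊗ (Δ≥0 ⊗ Δ≥0 ⊗ V≥0) ⊗ diff 8≤g) ⊕ num 703 ⊗ (g≥0 ⊗ (Δ≥0 ⊗ Δ≥0 ⊗ V≥0))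
             ⊕ diff (1≤* (≤-trans (+≤+ (ℕ.s≤s ℕ.z≤n)) 8≤g) (1≤* (1≤* 1≤Δ 1≤Δ) 1≤V))) (final-identity₃ K V g Δ)
        where 8≤g : + 8 ≤ g
              8≤g = ≤by (num 8 ⊗ diff 1≤G) (8≤g-identity G)

  sumL : List ℤ → ℤ
  sumL []       = 0ℤ
  sumL (x ∷ xs) = x + sumL xs

  sumL≥0 : ∀ {xs} → All (0ℤ ≤_) xs → 0ℤ ≤ sumL xs
  sumL≥0 []       = ≤-refl
  sumL≥0 (p ∷ ps) = p ⊕ sumL≥0 ps

  sumL≡0 : ∀ {xs} → All (0ℤ ≤_) xs → sumL xs ≡ 0ℤ → All (_≡ 0ℤ) xs
  sumL≡0 []       _ = []
  sumL≡0 (p ∷ ps) e = sum≡0ˡ p (sumL≥0 ps) e ∷ sumL≡0 ps (sum≡0ʳ p (sumL≥0 ps) e)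

  isPos isNeg : ℤ → ℤ
  isPos +[1+ _ ] = 1ℤ
  isPos _        = 0ℤ
  isNeg -[1+ _ ] = 1ℤ
  isNeg _        = 0ℤ

  PM : ℤ → Set
  PM x = x ≡ 1ℤ ⊎ x ≡ -1ℤ

  row-gap : ∀ ar bt bs ax {p q i j} → p ≡ ar + bt → q ≡ ar + bs → i ≡ ax + bt → j ≡ ax + bs → p ≡ q + (i - j)
  row-gap ar bt bs ax refl refl refl refl = row-gap-identity ar bt bs ax

  col-gap : ∀ br ax ay bs {p q i j} → p ≡ ax + br → q ≡ ay + br → i ≡ ax + bs → j ≡ ay + bs → p ≡ q + (i - j)
  col-gap br ax ay bs refl refl refl refl = col-gap-identity br ax ay bs

  +-cancelʳ : ∀ {x y z} → x + z ≡ y + z → x ≡ y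
  +-cancelʳ {x} {y} {z} h = trans (x≡x+y-y x z) (trans (cong (_- z) h) (sym (x≡x+y-y y z)))

  +-cancelˡ : ∀ {x y z} → z + x ≡ z + y → x ≡ y
  +-cancelˡ {x} {y} {z} h = +-cancelʳ (trans (+-comm x z) (trans h (+-comm z y)))

  pairs-sum-identity : ∀ z → z + (z + (z + (z + (z + (z + (z + (z + (z + (z + 0ℤ))))))))) ≡ + 10 * z
  pairs-sum-identity = solve-∀

  module PairSums {n : ℕ} where

    nn : ℤ
    nn = + n

    ∑⁴ : (Fin n → Fin n → Fin n → Fin n → ℤ) → ℤ
    ∑⁴ F = ∑² (λ x t → ∑² (F x t))

    ∑²-const : ∀ c → ∑² {n} {n} (λ _ _ → c) ≡ nn * nn * c
    ∑²-const c = trans (∑²-fst (λ _ → c)) (trans (cong (nn *_) (∑-const n c)) (sym (*-assoc nn nn c)))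

    module _ (F : Mat n) where
      s12 : ∑⁴ (λ x t z v → F x t) ≡ nn * nn * ∑² F
      s12 = trans (∑²-cong (λ x t → ∑²-const (F x t))) (∑²-*ˡ (nn * nn) F)

      s34 : ∑⁴ (λ x t z v → F z v) ≡ nn * nn * ∑² F
      s34 = ∑²-const (∑² F)

      s13 : ∑⁴ (λ x t z v → F x z) ≡ nn * nn * ∑² F
      s13 = trans (∑²-cong (λ x t → ∑²-fst (F x))) (trans (∑²-fst (λ x → nn * ∑ (F x)))
        (trans (cong (nn *_) (∑-*ˡ nn (λ x → ∑ (F x)))) (sym (*-assoc nn nn _))))

      s14 : ∑⁴ (λ x t z v → F x v) ≡ nn * nn * ∑² F
      s14 = trans (∑²-cong (λ x t → ∑²-snd (F x))) (trans (∑²-fst (λ x → nn * ∑ (F x)))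
        (trans (cong (nn *_) (∑-*ˡ nn (λ x → ∑ (F x)))) (sym (*-assoc nn nn _))))

      s23 : ∑⁴ (λ x t z v → F t z) ≡ nn * nn * ∑² F
      s23 = trans (∑²-cong (λ x t → ∑²-fst (F t))) (trans (∑²-snd (λ x → nn * ∑ (F x)))
        (trans (cong (nn *_) (∑-*ˡ nn (λ x → ∑ (F x)))) (sym (*-assoc nn nn _))))

      s24 : ∑⁴ (λ x t z v → F t v) ≡ nn * nn * ∑² F
      s24 = trans (∑²-cong (λ x t → ∑²-snd (F t))) (trans (∑²-snd (λ x → nn * ∑ (F x)))
        (trans (cong (nn *_) (∑-*ˡ nn (λ x → ∑ (F x)))) (sym (*-assoc nn nn _))))

    ∑⁴-+ : ∀ F F′ → ∑⁴ (λ x t z v → F x t z v + F′ x t z v) ≡ ∑⁴ F + ∑⁴ F′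
    ∑⁴-+ F F′ = trans (∑²-cong (λ x t → ∑²-+ (F x t) (F′ x t))) (∑²-+ _ _)

    pairs : Mat n → Fin n → Fin n → Fin n → Fin n → List ℤ
    pairs Z x t z v = Z x t ∷ Z z v ∷ Z x z ∷ Z z x ∷ Z x v ∷ Z v x ∷ Z t z ∷ Z z t ∷ Z t v ∷ Z v t ∷ []

    pairs-sum : (Z : Mat n) → ∑⁴ (λ x t z v → sumL (pairs Z x t z v)) ≡ + 10 * (nn * nn * ∑² Z)
    pairs-sum Z = trans (peel (λ x t z v → Z x t) (s12 Z) (peel (λ x t z v → Z z v) (s34 Z)
      (peel (λ x t z v → Z x z) (s13 Z) (peel (λ x t z v → Z z x) (tr′ (s13 Zᵀ))
      (peel (λ x t z v → Z x v) (s14 Z) (peel (λ x t z v → Z v x) (tr′ (s14 Zᵀ))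
      (peel (λ x t z v → Z t z) (s23 Z) (peel (λ x t z v → Z z t) (tr′ (s23 Zᵀ))
      (peel (λ x t z v → Z t v) (s24 Z) (peel (λ x t z v → Z v t) (tr′ (s24 Zᵀ)) nil))))))))))
      (pairs-sum-identity ζ)
      where
      ζ : ℤ
      ζ = nn * nn * ∑² Z
      Zᵀ : Mat n
      Zᵀ a b = Z b a
      tr′ : ∀ {x} → x ≡ nn * nn * ∑² Zᵀ → x ≡ ζ
      tr′ e = trans e (cong (nn * nn *_) (sym (∑²-comm Z)))
      peel : ∀ F {F′ y} → ∑⁴ F ≡ ζ → ∑⁴ F′ ≡ y → ∑⁴ (λ x t z v → F x t z v + F′ x t z v) ≡ ζ + y
      peel F {F′} p q = trans (∑⁴-+ F F′) (cong₂ _+_ p q)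
      nil : ∑⁴ (λ _ _ _ _ → 0ℤ) ≡ 0ℤ
      nil = trans (∑²-cong {g = λ _ _ → 0ℤ} (λ x t → trans (∑²-const 0ℤ) (*-zeroʳ (nn * nn)))) (trans (∑²-const 0ℤ) (*-zeroʳ (nn * nn)))

  PQPQ≤-identity : ∀ k → k + (k + k + (k + k + k)) ≡ + 6 * k
  PQPQ≤-identity = solve-∀

  rich-identity : ∀ m P Q → m * (+ 4 * Q - m) + + 4 * ((+ 4 * P - m) * Q) ≡ + 16 * (P * Q) - m * m
  rich-identity = solve-∀

  chain-at-identity : ∀ m P Q k h z → (m * m + k * (P * Q)) * (k * (P * Q) - m * m) + k * k * (+ 6 * (m * m * (+ 10 * (m * z))) - P * (Q * (P * Q)))
    + (h - k) * (h + k) * (+ 60 * (m * (m * m) * z)) ≡ m * (m * m) * (+ 60 * (h * h) * z) - m * (m * m) * m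
  chain-at-identity = solve-∀

  rich-identity₂ : ∀ n e X z h → + 2 * (+ 60 * (h * h) * z - n * n) + + 120 * (h * h) * (n * e + X - z) + n * (n - + 120 * (h * h) * e) ≡ + 120 * (h * h) * X - n * n
  rich-identity₂ = solve-∀

  N-neg-identity : ∀ x → 1ℤ - - x * - x ≡ 1ℤ - x * x
  N-neg-identity = solve-∀

  least-of-three-identity : ∀ a b c s → + 3 * (s - (a + b + c)) + (+ 3 * a - s) + (+ 3 * b - s) ≡ s - + 3 * c
  least-of-three-identity = solve-∀

  indicator⇒≡-identity : ∀ y → y - 1ℤ ≡ 0ℤ - (1ℤ - y)
  indicator⇒≡-identity = solve-∀

  even-or-odd-ℕ-identity : ∀ j → 1ℤ + (1ℤ + + 2 * j) ≡ + 2 * (1ℤ + j)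
  even-or-odd-ℕ-identity = solve-∀

  even-or-odd-identity : ∀ j → - (1ℤ + + 2 * j) ≡ 1ℤ + + 2 * (- j - 1ℤ)
  even-or-odd-identity = solve-∀

  even-or-odd-identity₂ : ∀ j → - (1ℤ + (1ℤ + + 2 * j)) ≡ + 2 * (- j - 1ℤ)
  even-or-odd-identity₂ = solve-∀

  x+x≡2x : ∀ x → x + x ≡ + 2 * x
  x+x≡2x = solve-∀

  module Rich {n : ℕ} {w : Mat n} (W : Weight w) (a b : Fin n → ℤ) where
    open Weight W
    open PairSums {n}

    Z : Mat n
    Z y t = N w y t + ne0 (w y t - (a y + b t))

    Z≥0 : ∀ y t → 0ℤ ≤ Z y t
    Z≥0 y t = proj₁ (N-bd W y t) ⊕ ne0≥0 _

    ne0≡0 : ∀ {x} → ne0 x ≡ 0ℤ → x ≡ 0ℤ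
    ne0≡0 {+ ℕ.zero} _ = refl
    ne0≡0 {+[1+ _ ]} ()
    ne0≡0 { -[1+ _ ]} ()

    Z≡0 : ∀ {y t} → Z y t ≡ 0ℤ → w y t ≡ a y + b t × PM (w y t)
    Z≡0 {y} {t} e = i-j≡0⇒i≡j _ _ (ne0≡0 (sum≡0ʳ (proj₁ (N-bd W y t)) (ne0≥0 _) e)) , pm (val y t) (sum≡0ˡ (proj₁ (N-bd W y t)) (ne0≥0 (w y t - (a y + b t))) e)
      where
      pm : ∀ {x} → x ≡ 0ℤ ⊎ x ≡ 1ℤ ⊎ x ≡ -1ℤ → 1ℤ - x * x ≡ 0ℤ → PM x
      pm (inj₁ refl) ()
      pm (inj₂ p) _ = p

    pairs≥0 : ∀ x t z v → All (0ℤ ≤_) (pairs Z x t z v)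
    pairs≥0 x t z v = Z≥0 _ _ ∷ Z≥0 _ _ ∷ Z≥0 _ _ ∷ Z≥0 _ _ ∷ Z≥0 _ _ ∷ Z≥0 _ _ ∷ Z≥0 _ _ ∷ Z≥0 _ _ ∷ Z≥0 _ _ ∷ Z≥0 _ _ ∷ []

    K : Fin n → Fin n → Fin n → Fin n → ℤ
    K x t z v = sumL (pairs Z x t z v)

    K≥0 : ∀ x t z v → 0ℤ ≤ K x t z v
    K≥0 x t z v = sumL≥0 (pairs≥0 x t z v)

    Zs : Fin n → Fin n → Fin n → Fin n → Set
    Zs x t z v = All (_≡ 0ℤ) (pairs Z x t z v)

    K≡0 : ∀ x t z v → K x t z v ≡ 0ℤ → Zs x t z v
    K≡0 x t z v = sumL≡0 (pairs≥0 x t z v)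

    -- Two plus edges and two minus edges cannot all be of the form a + b.
    clash : ∀ x t y s z v z′ v′ → w x t ≡ 1ℤ → w y s ≡ -1ℤ → w z v ≡ 1ℤ → w z′ v′ ≡ -1ℤ →
      Zs x t y s → Zs x t z v → Zs x t z′ v′ → Zs y s z v → Zs y s z′ v′ → Zs z v z′ v′ → ⊥
    clash x t y s z v z′ v′ xt ys zv z′v′
      (Zxt ∷ Zys ∷ _ ∷ _ ∷ Zxs ∷ _ ∷ _ ∷ Zyt ∷ _)
      (_ ∷ Zzv ∷ Zxz ∷ _ ∷ Zxv ∷ _ ∷ _ ∷ Zzt ∷ _ ∷ Zvt ∷ _)
      (_ ∷ Zz′v′ ∷ Zxz′ ∷ _ ∷ Zxv′ ∷ _ ∷ _ ∷ Zz′t ∷ _ ∷ Zv′t ∷ _)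
      (_ ∷ _ ∷ Zyz ∷ _ ∷ Zyv ∷ _ ∷ _ ∷ Zzs ∷ _ ∷ Zvs ∷ _)
      (_ ∷ _ ∷ Zyz′ ∷ _ ∷ Zyv′ ∷ _ ∷ _ ∷ Zz′s ∷ _ ∷ Zv′s ∷ _)
      (_ ∷ _ ∷ Zzz′ ∷ Zz′z ∷ _ ∷ _ ∷ _ ∷ _ ∷ Zvv′ ∷ Zv′v ∷ _)
      = by-sign (proj₂ (Z≡0 Zxs))
      where
      two : ∀ {u v} → PM u → PM v → u ≡ v + + 2 → u ≡ 1ℤ
      two (inj₁ p) _ _ = p
      two (inj₂ refl) (inj₁ refl) ()
      two (inj₂ refl) (inj₂ refl) ()
      e : ∀ {r c} → Z r c ≡ 0ℤ → w r c ≡ a r + b c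
      e z = proj₁ (Z≡0 z)
      by-sign : PM (w x s) → ⊥
      by-sign (inj₂ xs) = absurd (trans (sym (plus zv Zzv (rowα Zzt Zzs) (rowα Zv′t Zv′s) Zv′v)) (trans (symm v′ v) (plus z′v′ Zz′v′ (rowα Zz′t Zz′s) (rowα Zvt Zvs) Zvv′)))
        where
        absurd : 1ℤ ≡ -1ℤ → ⊥
        absurd ()
        -- Columns t and s differ by 2, so every row is plus at t.
        rowα : ∀ {r} → Z r t ≡ 0ℤ → Z r s ≡ 0ℤ → a r ≡ a x
        rowα {r} p q = +-cancelʳ {a r} {a x} {b t} (trans (sym (e p)) (trans (two (proj₂ (Z≡0 p)) (proj₂ (Z≡0 q)) d) (trans (sym xt) (e Zxt))))
          where
          d : w r t ≡ w r s + + 2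
          d = row-gap (a r) (b t) (b s) (a x) (e p) (e q) (trans (sym xt) (e Zxt)) (trans (sym xs) (e Zxs))
        plus : ∀ {r c r′ k} → w r c ≡ k → Z r c ≡ 0ℤ → a r ≡ a x → a r′ ≡ a x → Z r′ c ≡ 0ℤ → w r′ c ≡ k
        plus {r} {c} h p ar ar′ q = trans (e q) (trans (cong (_+ b c) (trans ar′ (sym ar))) (trans (sym (e p)) h))
      by-sign (inj₁ xs) = absurd (trans (sym (plus zv Zzv (colβ Zxv Zyv) (colβ Zxz′ Zyz′) Zzz′)) (trans (symm z z′) (plus z′v′ Zz′v′ (colβ Zxv′ Zyv′) (colβ Zxz Zyz) Zz′z)))
        where
        absurd : 1ℤ ≡ -1ℤ → ⊥
        absurd ()
        colβ : ∀ {r} → Z x r ≡ 0ℤ → Z y r ≡ 0ℤ → b r ≡ b t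
        colβ {r} p q = +-cancelˡ {b r} {b t} {a x} (trans (sym (e p)) (trans (two (proj₂ (Z≡0 p)) (proj₂ (Z≡0 q)) d) (trans (sym xt) (e Zxt))))
          where
          d : w x r ≡ w y r + + 2
          d = col-gap (b r) (a x) (a y) (b s) (e p) (e q) (trans (sym xs) (e Zxs)) (trans (sym ys) (e Zys))
        plus : ∀ {r c c′ k} → w r c ≡ k → Z r c ≡ 0ℤ → b c ≡ b t → b c′ ≡ b t → Z r c′ ≡ 0ℤ → w r c′ ≡ k
        plus {r} {c} h p bc bc′ q = trans (e q) (trans (cong (λ z → a r + z) (trans bc′ (sym bc))) (trans (sym (e p)) h))

    Ks : Fin n → Fin n → Fin n → Fin n → Fin n → Fin n → Fin n → Fin n → ℤ
    Ks x t y s z v z′ v′ = K x t y s + (K x t z v + K x t z′ v′ + (K y s z v + K y s z′ v′ + K z v z′ v′))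

    pointwise : ∀ x t y s z v z′ v′ →
      isPos (w x t) * (isNeg (w y s) * (isPos (w z v) * isNeg (w z′ v′))) ≤ Ks x t y s z v z′ v′
    pointwise x t y s z v z′ v′ = go (val x t) (val y s) (val z v) (val z′ v′)
      where
      k1 = K≥0 x t y s
      k2 = K≥0 x t z v ⊕ K≥0 x t z′ v′
      k3 = K≥0 y s z v ⊕ K≥0 y s z′ v′
      k4 = K≥0 z v z′ v′
      Ks≥0 : 0ℤ ≤ Ks x t y s z v z′ v′
      Ks≥0 = k1 ⊕ (k2 ⊕ (k3 ⊕ k4))
      Tri : ℤ → Set
      Tri x = x ≡ 0ℤ ⊎ x ≡ 1ℤ ⊎ x ≡ -1ℤ
      zero≤ : ∀ {p} → p ≡ 0ℤ → p ≤ Ks x t y s z v z′ v′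
      zero≤ refl = Ks≥0
      posz : ∀ {x} → Tri x → x ≡ 1ℤ ⊎ isPos x ≡ 0ℤ
      posz (inj₁ refl) = inj₂ refl
      posz (inj₂ (inj₁ p)) = inj₁ p
      posz (inj₂ (inj₂ refl)) = inj₂ refl
      negz : ∀ {x} → Tri x → x ≡ -1ℤ ⊎ isNeg x ≡ 0ℤ
      negz (inj₁ refl) = inj₂ refl
      negz (inj₂ (inj₁ refl)) = inj₂ refl
      negz (inj₂ (inj₂ p)) = inj₁ p
      go : Tri (w x t) → Tri (w y s) → Tri (w z v) → Tri (w z′ v′) → _
      go p1 p2 p3 p4 with posz p1 | negz p2 | posz p3 | negz p4
      ... | inj₂ q | _ | _ | _ = zero≤ (cong (_* (isNeg (w y s) * (isPos (w z v) * isNeg (w z′ v′)))) q)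
      ... | inj₁ _ | inj₂ q | _ | _ = zero≤ (trans (cong (λ h → isPos (w x t) * (h * (isPos (w z v) * isNeg (w z′ v′)))) q) (*-zeroʳ (isPos (w x t))))
      ... | inj₁ _ | inj₁ _ | inj₂ q | _ = zero≤ (trans (cong (λ h → isPos (w x t) * (isNeg (w y s) * (h * isNeg (w z′ v′)))) q)
              (trans (cong (isPos (w x t) *_) (*-zeroʳ (isNeg (w y s)))) (*-zeroʳ (isPos (w x t)))))
      ... | inj₁ _ | inj₁ _ | inj₁ _ | inj₂ q = zero≤ (trans (cong (λ h → isPos (w x t) * (isNeg (w y s) * (isPos (w z v) * h))) q)
              (trans (cong (λ h → isPos (w x t) * (isNeg (w y s) * h)) (*-zeroʳ (isPos (w z v)))) (trans (cong (isPos (w x t) *_) (*-zeroʳ (isNeg (w y s)))) (*-zeroʳ (isPos (w x t))))))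
      ... | inj₁ e1 | inj₁ e2 | inj₁ e3 | inj₁ e4 with zero-or-pos Ks≥0
      ...   | inj₂ q = subst (_≤ Ks x t y s z v z′ v′) (sym one) q
        where one : isPos (w x t) * (isNeg (w y s) * (isPos (w z v) * isNeg (w z′ v′))) ≡ 1ℤ
              one rewrite e1 | e2 | e3 | e4 = refl
      ...   | inj₁ q = ⊥-elim (clash x t y s z v z′ v′ e1 e2 e3 e4 (K≡0 x t y s (sum≡0ˡ k1 (k2 ⊕ (k3 ⊕ k4)) q))
          (K≡0 x t z v (sum≡0ˡ (K≥0 x t z v) (K≥0 x t z′ v′) q2)) (K≡0 x t z′ v′ (sum≡0ʳ (K≥0 x t z v) (K≥0 x t z′ v′) q2))
          (K≡0 y s z v (sum≡0ˡ (K≥0 y s z v) (K≥0 y s z′ v′) q3)) (K≡0 y s z′ v′ (sum≡0ʳ (K≥0 y s z v) (K≥0 y s z′ v′) q3))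
          (K≡0 z v z′ v′ (sum≡0ʳ k3 k4 q34)))
        where q234 = sum≡0ʳ k1 (k2 ⊕ (k3 ⊕ k4)) q
              q2 = sum≡0ˡ k2 (k3 ⊕ k4) q234
              q34 = sum≡0ʳ k2 (k3 ⊕ k4) q234
              q3 = sum≡0ˡ k3 k4 q34

    P Q κ n² : ℤ
    P = ∑² (λ x t → isPos (w x t))
    Q = ∑² (λ x t → isNeg (w x t))
    κ = ∑⁴ K
    n² = nn * nn

    ∑⁸ : (Fin n → Fin n → Fin n → Fin n → Fin n → Fin n → Fin n → Fin n → ℤ) → ℤ
    ∑⁸ F = ∑² (λ x t → ∑² (λ y s → ∑⁴ (F x t y s)))

    PQPQ≤ : P * (Q * (P * Q)) ≤ + 6 * (n² * n² * κ)
    PQPQ≤ = subst₂ _≤_ left right (∑²-mono (λ x t → ∑²-mono (λ y s → ∑²-mono (λ z v → ∑²-mono (λ z′ v′ → pointwise x t y s z v z′ v′)))))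
      where
      ∑²-*ʳ : ∀ c (f : Mat n) → ∑² (λ i j → f i j * c) ≡ ∑² f * c
      ∑²-*ʳ c f = trans (∑-cong (λ i → ∑-*ʳ c (f i))) (∑-*ʳ c (λ i → ∑ (f i)))
      left : ∑⁸ (λ x t y s z v z′ v′ → isPos (w x t) * (isNeg (w y s) * (isPos (w z v) * isNeg (w z′ v′)))) ≡ P * (Q * (P * Q))
      left = trans (∑²-cong (λ x t → trans (∑²-cong (λ y s → trans (∑²-cong (λ z v →
          trans (∑²-*ˡ (isPos (w x t)) _) (cong (isPos (w x t) *_) (trans (∑²-*ˡ (isNeg (w y s)) _) (cong (isNeg (w y s) *_) (∑²-*ˡ (isPos (w z v)) (λ z′ v′ → isNeg (w z′ v′))))))))
          (trans (∑²-*ˡ (isPos (w x t)) _) (cong (isPos (w x t) *_) (trans (∑²-*ˡ (isNeg (w y s)) _) (cong (isNeg (w y s) *_) (∑²-*ʳ Q (λ z v → isPos (w z v)))))))))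
        (trans (∑²-*ˡ (isPos (w x t)) _) (cong (isPos (w x t) *_) (∑²-*ʳ (P * Q) (λ y s → isNeg (w y s)))))))
        (∑²-*ʳ (Q * (P * Q)) (λ x t → isPos (w x t)))
      ∑⁸-+ : ∀ F F′ {p q} → ∑⁸ F ≡ p → ∑⁸ F′ ≡ q → ∑⁸ (λ x t y s z v z′ v′ → F x t y s z v z′ v′ + F′ x t y s z v z′ v′) ≡ p + q
      ∑⁸-+ F F′ h k = trans (trans (∑²-cong (λ x t → trans (∑²-cong (λ y s → ∑⁴-+ (F x t y s) (F′ x t y s))) (∑²-+ _ _))) (∑²-+ _ _)) (cong₂ _+_ h k)
      c4 : ∀ c → ∑⁴ (λ _ _ _ _ → c) ≡ n² * n² * c
      c4 c = trans (∑²-cong (λ _ _ → ∑²-const c)) (trans (∑²-const (n² * c)) (sym (*-assoc n² n² c)))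
      κ₀ = n² * n² * κ
      d12 : ∑⁸ (λ x t y s z v z′ v′ → K x t y s) ≡ κ₀
      d12 = trans (∑²-cong (λ x t → trans (∑²-cong (λ y s → c4 (K x t y s))) (∑²-*ˡ (n² * n²) (K x t)))) (∑²-*ˡ (n² * n²) _)
      d34 : ∑⁸ (λ x t y s z v z′ v′ → K z v z′ v′) ≡ κ₀
      d34 = c4 κ
      d13 : ∑⁸ (λ x t y s z v z′ v′ → K x t z v) ≡ κ₀
      d13 = trans (∑²-cong (λ x t → trans (∑²-cong (λ y s → trans (∑²-cong (λ z v → ∑²-const (K x t z v))) (∑²-*ˡ n² (K x t))))
        (trans (∑²-const (n² * ∑² (K x t))) (sym (*-assoc n² n² _))))) (∑²-*ˡ (n² * n²) _)
      d14 : ∑⁸ (λ x t y s z v z′ v′ → K x t z′ v′) ≡ κ₀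
      d14 = trans (∑²-cong (λ x t → trans (∑²-cong (λ y s → ∑²-const (∑² (K x t))))
        (trans (∑²-const (n² * ∑² (K x t))) (sym (*-assoc n² n² _))))) (∑²-*ˡ (n² * n²) _)
      d23 : ∑⁸ (λ x t y s z v z′ v′ → K y s z v) ≡ κ₀
      d23 = trans (∑²-cong {g = λ _ _ → n² * κ} (λ x t → trans (∑²-cong (λ y s → trans (∑²-cong (λ z v → ∑²-const (K y s z v))) (∑²-*ˡ n² (K y s)))) (∑²-*ˡ n² _)))
        (trans (∑²-const (n² * κ)) (sym (*-assoc n² n² κ)))
      d24 : ∑⁸ (λ x t y s z v z′ v′ → K y s z′ v′) ≡ κ₀
      d24 = trans (∑²-cong {g = λ _ _ → n² * κ} (λ x t → trans (∑²-cong (λ y s → ∑²-const (∑² (K y s)))) (∑²-*ˡ n² _)))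
        (trans (∑²-const (n² * κ)) (sym (*-assoc n² n² κ)))
      right : ∑⁸ Ks ≡ + 6 * κ₀
      right = trans (∑⁸-+ (λ x t y s z v z′ v′ → K x t y s) _ d12 (∑⁸-+ _ _
          (∑⁸-+ (λ x t y s z v z′ v′ → K x t z v) (λ x t y s z v z′ v′ → K x t z′ v′) d13 d14)
          (∑⁸-+ _ (λ x t y s z v z′ v′ → K z v z′ v′) (∑⁸-+ (λ x t y s z v z′ v′ → K y s z v) (λ x t y s z v z′ v′ → K y s z′ v′) d23 d24) d34)))
        (PQPQ≤-identity κ₀)

    rich : ∀ {e h} → + 16 ≤ h → n² ≤ + 4 * P → n² ≤ + 4 * Q → (∀ y → ∑ (N w y) ≤ e) → + 120 * (h * h) * e ≤ nn → 0ℤ < nn →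
      n² ≤ + 120 * (h * h) * ∑² (λ y t → ne0 (w y t - (a y + b t)))
    rich {e} {h} 16≤h hP hQ hN he n>0 = fin (≤-cancel n⁶>0 chain)
      where
      c₀ : ℤ
      c₀ = + 60 * (h * h)
      h≥0 : 0ℤ ≤ h
      h≥0 = ≤-trans (num 16) 16≤h
      X ζ : ℤ
      X = ∑² (λ y t → ne0 (w y t - (a y + b t)))
      ζ = ∑² Z
      n0 = num n
      P≥0 : 0ℤ ≤ P
      P≥0 = ∑²-nonneg (λ x t → isPos≥0 (w x t))
        where isPos≥0 : ∀ x → 0ℤ ≤ isPos x
              isPos≥0 (+ ℕ.zero) = num 0
              isPos≥0 +[1+ _ ] = num 1
              isPos≥0 -[1+ _ ] = num 0
      Q≥0 : 0ℤ ≤ Q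
      Q≥0 = ∑²-nonneg (λ x t → isNeg≥0 (w x t))
        where isNeg≥0 : ∀ x → 0ℤ ≤ isNeg x
              isNeg≥0 (+ _) = num 0
              isNeg≥0 -[1+ _ ] = num 1
      n²>0 : 0ℤ < n²
      n²>0 = 1+≤⇒< (1≤* (<⇒1+≤ n>0) (<⇒1+≤ n>0))
      n⁶>0 : 0ℤ < n² * (n² * n²)
      n⁶>0 = 1+≤⇒< (1≤* (<⇒1+≤ n²>0) (1≤* (<⇒1+≤ n²>0) (<⇒1+≤ n²>0)))
      m0 : 0ℤ ≤ n²
      m0 = n0 ⊗ n0
      PQ : n² * n² ≤ + 16 * (P * Q)
      PQ = ≤by (m0 ⊗ diff hQ ⊕ num 4 ⊗ (diff hP ⊗ Q≥0)) (rich-identity n² P Q)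
      ζ≥0 : 0ℤ ≤ ζ
      ζ≥0 = ∑²-nonneg Z≥0
      chain-at : ∀ k → 0ℤ ≤ k → k ≤ h → n² * n² ≤ k * (P * Q) → n² * (n² * n²) * n² ≤ n² * (n² * n²) * (c₀ * ζ)
      chain-at k k≥0 k≤h PQ = ≤by ((m0 ⊗ m0 ⊕ k≥0 ⊗ (P≥0 ⊗ Q≥0)) ⊗ diff PQ ⊕ (k≥0 ⊗ k≥0) ⊗ diff PQPQ≤
           ⊕ (diff k≤h ⊗ (h≥0 ⊕ k≥0)) ⊗ (num 60 ⊗ (m0 ⊗ (m0 ⊗ m0) ⊗ ζ≥0)))
        (trans (cong (λ x → (n² * n² + k * (P * Q)) * (k * (P * Q) - n² * n²) + k * k * (+ 6 * (n² * n² * x) - P * (Q * (P * Q)))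
                       + (h - k) * (h + k) * (+ 60 * (n² * (n² * n²) * ζ))) (pairs-sum Z)) (chain-at-identity n² P Q k h ζ))
      chain : n² * (n² * n²) * n² ≤ n² * (n² * n²) * (c₀ * ζ)
      chain = chain-at (+ 16) (num 16) 16≤h PQ
      ζ≤ : ζ ≤ nn * e + X
      ζ≤ = subst (_≤ nn * e + X) (sym (∑²-+ (N w) (λ y t → ne0 (w y t - (a y + b t))))) (+-monoˡ-≤ X (subst (∑² (N w) ≤_) (∑-const n e) (∑-mono hN)))
      fin : n² ≤ c₀ * ζ → n² ≤ + 120 * (h * h) * X
      fin p = ≤by (num 2 ⊗ diff p ⊕ num 120 ⊗ (h≥0 ⊗ h≥0) ⊗ diff ζ≤ ⊕ n0 ⊗ diff he) (rich-identity₂ nn e X ζ h)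

  cnt : ∀ {n} → List (Fin n) → Fin n → ℤ
  cnt []       u = 0ℤ
  cnt (x ∷ xs) u = δ x u + cnt xs u

  cnt≥0 : ∀ {n} (F : List (Fin n)) u → 0ℤ ≤ cnt F u
  cnt≥0 []       u = ≤-refl
  cnt≥0 (x ∷ xs) u = δ≥0 x u ⊕ cnt≥0 xs u

  ∑cnt : ∀ {n} (F : List (Fin n)) → ∑ (cnt F) ≡ + length F
  ∑cnt {n} []       = ∑-zero n
  ∑cnt {n} (x ∷ xs) = trans (∑-+ (δ x) (cnt xs)) (cong₂ _+_ (∑-δ₁ x) (∑cnt xs))

  cnt≡0⇒∉ : ∀ {n} {F : List (Fin n)} {u} → cnt F u ≡ 0ℤ → u ∉ F
  cnt≡0⇒∉ {F = x ∷ xs} {u} e (here refl)  = δ≡0⇒≢ (sum≡0ˡ (δ≥0 x u) (cnt≥0 xs u) e) refl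
  cnt≡0⇒∉ {F = x ∷ xs} {u} e (there u∈xs) = cnt≡0⇒∉ (sum≡0ʳ (δ≥0 x u) (cnt≥0 xs u) e) u∈xs

  1≤cnt⇒∈ : ∀ {n} {F : List (Fin n)} {u} → 1ℤ ≤ cnt F u → u ∈ F
  1≤cnt⇒∈ {F = []} (+≤+ ())
  1≤cnt⇒∈ {F = x ∷ xs} {u} p with x ≟ᶠ u
  ... | yes refl = here refl
  ... | no  _    = there (1≤cnt⇒∈ (subst (1ℤ ≤_) (+-identityˡ (cnt xs u)) p))

  ne0-neg : ∀ x → ne0 (- x) ≡ ne0 x
  ne0-neg (+ ℕ.zero) = refl
  ne0-neg +[1+ _ ]   = refl
  ne0-neg -[1+ _ ]   = refl

  N-neg : ∀ {n} (w : Mat n) a b → N (λ a b → - w a b) a b ≡ N w a b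
  N-neg w a b = N-neg-identity (w a b)

  pull : ∀ {n} → Mat n → Permutation′ n → Mat n
  pull v φ a b = v (φ ⟨$⟩ʳ a) (φ ⟨$⟩ʳ b)

  swap : ∀ {n} → Fin n → Fin n → Permutation′ n → Permutation′ n
  swap u y φ = Perm.transpose u y ∘ₚ φ

  AgreeOn : ∀ {n} → List (Fin n) → Permutation′ n → Permutation′ n → Set
  AgreeOn F φ ψ = ∀ {x} → x ∈ F → φ ⟨$⟩ʳ x ≡ ψ ⟨$⟩ʳ x

  agree-trans : ∀ {n} {F : List (Fin n)} {φ ψ θ : Permutation′ n} → AgreeOn F φ ψ → AgreeOn F ψ θ → AgreeOn F φ θ
  agree-trans p q x∈F = trans (p x∈F) (q x∈F)

  swap-agree : ∀ {n} {F : List (Fin n)} {u y} (φ : Permutation′ n) → cnt F u ≡ 0ℤ → cnt F y ≡ 0ℤ → AgreeOn F (swap u y φ) φ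
  swap-agree {F = F} φ u0 y0 x∈F = cong (φ ⟨$⟩ʳ_) (tr-other (λ { refl → cnt≡0⇒∉ {F = F} u0 x∈F }) (λ { refl → cnt≡0⇒∉ {F = F} y0 x∈F }))

  opaque
    unfolding ∑

    length-filter≤ : ∀ {m n} (f : Fin n → ℤ) → (∀ i → 0ℤ ≤ f i) → (g : Fin m → Fin n) →
      + length (filter (λ i → 1ℤ ≤? f i) (tabulate g)) ≤ ∑ (λ j → f (g j))
    length-filter≤ {ℕ.zero}  f p g = ≤-refl
    length-filter≤ {ℕ.suc m} f p g with 1ℤ ≤? f (g zero)
    ... | yes q = +-mono-≤ q (length-filter≤ f p (g ∘ suc))
    ... | no  _ = ≤-trans (length-filter≤ f p (g ∘ suc)) (subst (_≤ f (g zero) + ∑ (λ j → f (g (suc j)))) (+-identityˡ _) (+-monoˡ-≤ _ (p (g zero))))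

  support : ∀ {n} → (Fin n → ℤ) → List (Fin n)
  support {n} f = filter (λ i → 1ℤ ≤? f i) (allFin n)

  ∈-support⁺ : ∀ {n} (f : Fin n → ℤ) {i} → 1ℤ ≤ f i → i ∈ support f
  ∈-support⁺ f p = ∈-filter⁺ (λ i → 1ℤ ≤? f i) (∈-allFin _) p

  ∈-support⁻ : ∀ {n} (f : Fin n → ℤ) {i} → i ∈ support f → 1ℤ ≤ f i
  ∈-support⁻ f p = proj₂ (∈-filter⁻ (λ i → 1ℤ ≤? f i) {xs = allFin _} p)

  length-support≤ : ∀ {n} (f : Fin n → ℤ) → (∀ i → 0ℤ ≤ f i) → + length (support f) ≤ ∑ f
  length-support≤ f p = length-filter≤ f p (λ i → i)

  ∑<n⇒∃0 : ∀ {n} (f : Fin n → ℤ) → (∀ i → 0ℤ ≤ f i) → ∑ f < + n → ∃[ i ] f i ≡ 0ℤ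
  ∑<n⇒∃0 {n} f p q with ∑<⇒∃< f (λ _ → 1ℤ) (subst (∑ f <_) (sym (trans (∑-const n 1ℤ) (*-identityʳ (+ n)))) q)
  ... | i , r with zero-or-pos (p i)
  ...   | inj₁ e = i , e
  ...   | inj₂ s = ≤-absurd s r

  by-evaluation : ∀ {a b} {t : True (a ≤? b)} → a ≤ b
  by-evaluation {t = t} = toWitness t

  three-classes : ∀ {x y} → x ≡ 0ℤ ⊎ x ≡ 1ℤ ⊎ x ≡ -1ℤ → y ≡ 0ℤ ⊎ y ≡ 1ℤ ⊎ y ≡ -1ℤ →
    ne0 (y - x - -[1+ 1 ]) + ne0 (y - x - 0ℤ) + ne0 (y - x - + 2) ≤ + 2 + (1ℤ - x * x) + (1ℤ - y * y)
  three-classes (inj₁ refl) (inj₁ refl) = by-evaluation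
  three-classes (inj₁ refl) (inj₂ (inj₁ refl)) = by-evaluation
  three-classes (inj₁ refl) (inj₂ (inj₂ refl)) = by-evaluation
  three-classes (inj₂ (inj₁ refl)) (inj₁ refl) = by-evaluation
  three-classes (inj₂ (inj₁ refl)) (inj₂ (inj₁ refl)) = by-evaluation
  three-classes (inj₂ (inj₁ refl)) (inj₂ (inj₂ refl)) = by-evaluation
  three-classes (inj₂ (inj₂ refl)) (inj₁ refl) = by-evaluation
  three-classes (inj₂ (inj₂ refl)) (inj₂ (inj₁ refl)) = by-evaluation
  three-classes (inj₂ (inj₂ refl)) (inj₂ (inj₂ refl)) = by-evaluation

  least-of-three : ∀ {a b c s} → a + b + c ≤ s → + 3 * a ≤ s ⊎ + 3 * b ≤ s ⊎ + 3 * c ≤ s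
  least-of-three {a} {b} {c} {s} h with + 3 * a ≤? s | + 3 * b ≤? s
  ... | yes p | _     = inj₁ p
  ... | no  _ | yes q = inj₂ (inj₁ q)
  ... | no  p | no  q = inj₂ (inj₂ (≤by (num 3 ⊗ diff h ⊕ diff (<⇒≤ (≰⇒> p)) ⊕ diff (<⇒≤ (≰⇒> q))) (least-of-three-identity a b c s)))

  ne0≡0 : ∀ {x} → ne0 x ≡ 0ℤ → x ≡ 0ℤ
  ne0≡0 {+ ℕ.zero}  _ = refl
  ne0≡0 {+[1+ _ ]}  ()
  ne0≡0 { -[1+ _ ]} ()

  N≡0⇒PM : ∀ {x} → x ≡ 0ℤ ⊎ x ≡ 1ℤ ⊎ x ≡ -1ℤ → 1ℤ - x * x ≡ 0ℤ → PM x
  N≡0⇒PM (inj₁ refl) ()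
  N≡0⇒PM (inj₂ p)    _ = p

  small-gap : ∀ {a b c d} → PM a → PM b → PM c → PM d → 1ℤ ≤ (a - b) - (c - d) → (a - b) - (c - d) ≡ + 2 ⊎ (a - b) - (c - d) ≡ + 4
  small-gap (inj₁ refl) (inj₁ refl) (inj₁ refl) (inj₁ refl) (+≤+ ())
  small-gap (inj₁ refl) (inj₁ refl) (inj₁ refl) (inj₂ refl) ()
  small-gap (inj₁ refl) (inj₁ refl) (inj₂ refl) (inj₁ refl) _ = inj₁ refl
  small-gap (inj₁ refl) (inj₁ refl) (inj₂ refl) (inj₂ refl) (+≤+ ())
  small-gap (inj₁ refl) (inj₂ refl) (inj₁ refl) (inj₁ refl) _ = inj₁ refl
  small-gap (inj₁ refl) (inj₂ refl) (inj₁ refl) (inj₂ refl) (+≤+ ())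
  small-gap (inj₁ refl) (inj₂ refl) (inj₂ refl) (inj₁ refl) _ = inj₂ refl
  small-gap (inj₁ refl) (inj₂ refl) (inj₂ refl) (inj₂ refl) _ = inj₁ refl
  small-gap (inj₂ refl) (inj₁ refl) (inj₁ refl) (inj₁ refl) ()
  small-gap (inj₂ refl) (inj₁ refl) (inj₁ refl) (inj₂ refl) ()
  small-gap (inj₂ refl) (inj₁ refl) (inj₂ refl) (inj₁ refl) (+≤+ ())
  small-gap (inj₂ refl) (inj₁ refl) (inj₂ refl) (inj₂ refl) ()
  small-gap (inj₂ refl) (inj₂ refl) (inj₁ refl) (inj₁ refl) (+≤+ ())
  small-gap (inj₂ refl) (inj₂ refl) (inj₁ refl) (inj₂ refl) ()
  small-gap (inj₂ refl) (inj₂ refl) (inj₂ refl) (inj₁ refl) _ = inj₁ refl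
  small-gap (inj₂ refl) (inj₂ refl) (inj₂ refl) (inj₂ refl) (+≤+ ())

  parity-gap : ∀ {a b c d} → PM a → PM b → PM c → PM d → a * b ≡ c * d ⊎ (a - b) - (c - d) ≡ + 2 ⊎ (b - a) - (d - c) ≡ + 2
  parity-gap (inj₁ refl) (inj₁ refl) (inj₁ refl) (inj₁ refl) = inj₁ refl
  parity-gap (inj₁ refl) (inj₁ refl) (inj₁ refl) (inj₂ refl) = inj₂ (inj₂ refl)
  parity-gap (inj₁ refl) (inj₁ refl) (inj₂ refl) (inj₁ refl) = inj₂ (inj₁ refl)
  parity-gap (inj₁ refl) (inj₁ refl) (inj₂ refl) (inj₂ refl) = inj₁ refl
  parity-gap (inj₁ refl) (inj₂ refl) (inj₁ refl) (inj₁ refl) = inj₂ (inj₁ refl)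
  parity-gap (inj₁ refl) (inj₂ refl) (inj₁ refl) (inj₂ refl) = inj₁ refl
  parity-gap (inj₁ refl) (inj₂ refl) (inj₂ refl) (inj₁ refl) = inj₁ refl
  parity-gap (inj₁ refl) (inj₂ refl) (inj₂ refl) (inj₂ refl) = inj₂ (inj₁ refl)
  parity-gap (inj₂ refl) (inj₁ refl) (inj₁ refl) (inj₁ refl) = inj₂ (inj₂ refl)
  parity-gap (inj₂ refl) (inj₁ refl) (inj₁ refl) (inj₂ refl) = inj₁ refl
  parity-gap (inj₂ refl) (inj₁ refl) (inj₂ refl) (inj₁ refl) = inj₁ refl
  parity-gap (inj₂ refl) (inj₁ refl) (inj₂ refl) (inj₂ refl) = inj₂ (inj₂ refl)
  parity-gap (inj₂ refl) (inj₂ refl) (inj₁ refl) (inj₁ refl) = inj₁ refl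
  parity-gap (inj₂ refl) (inj₂ refl) (inj₁ refl) (inj₂ refl) = inj₂ (inj₂ refl)
  parity-gap (inj₂ refl) (inj₂ refl) (inj₂ refl) (inj₁ refl) = inj₂ (inj₁ refl)
  parity-gap (inj₂ refl) (inj₂ refl) (inj₂ refl) (inj₂ refl) = inj₁ refl

  opposite-gap : ∀ {a b} → PM a → PM b → a * b ≡ -1ℤ → a - b ≡ + 2 ⊎ a - b ≡ - + 2
  opposite-gap (inj₁ refl) (inj₁ refl) ()
  opposite-gap (inj₁ refl) (inj₂ refl) _ = inj₁ refl
  opposite-gap (inj₂ refl) (inj₁ refl) _ = inj₂ refl
  opposite-gap (inj₂ refl) (inj₂ refl) ()

  equal-or-opposite : ∀ {a b} → PM a → PM b → a - b ≡ 0ℤ ⊎ a * b ≡ -1ℤ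
  equal-or-opposite (inj₁ refl) (inj₁ refl) = inj₁ refl
  equal-or-opposite (inj₁ refl) (inj₂ refl) = inj₂ refl
  equal-or-opposite (inj₂ refl) (inj₁ refl) = inj₂ refl
  equal-or-opposite (inj₂ refl) (inj₂ refl) = inj₁ refl

  indicator : ℤ → ℤ → ℤ
  indicator d x = 1ℤ - ne0 (x - d)

  indicator≥0 : ∀ d x → 0ℤ ≤ indicator d x
  indicator≥0 d x = diff (ne0≤1 (x - d))

  indicator⇒≡ : ∀ {d x} → 0ℤ < indicator d x → x ≡ d
  indicator⇒≡ {d} {x} p with zero-or-pos (ne0≥0 (x - d))
  ... | inj₁ e = i-j≡0⇒i≡j x d (ne0≡0 e)
  ... | inj₂ q = ≤-absurd (≤by (diff q) (indicator⇒≡-identity (ne0 (x - d)))) p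

  indicator-refl : ∀ d → indicator d d ≡ 1ℤ
  indicator-refl d = trans (cong (λ z → 1ℤ - ne0 z) (+-inverseʳ d)) refl

  below-1 : ∀ {x} → 0ℤ ≤ x → x < 1ℤ → x ≡ 0ℤ
  below-1 p q with zero-or-pos p
  ... | inj₁ e = e
  ... | inj₂ r = ≤-absurd r q

  record Room (n M Δ e G R : ℤ) : Set where
    field
      0≤Δ    : 0ℤ ≤ Δ
      0≤e    : 0ℤ ≤ e
      0≤R    : 0ℤ ≤ R
      1≤G    : 1ℤ ≤ G
      cycles : G * (+ 3 * e + + 2 * R) < n
      build  : (+ 8 + + 3 * Δ) * e + + 3 * R + + 5 < n
      many   : Δ * (Δ * ((1ℤ + Δ + Δ * Δ) * R)) < M
      fix    : + 2 * (Δ * e) + R < n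

  even-or-odd-ℕ : ∀ m → (∃[ j ] + m ≡ + 2 * j) ⊎ (∃[ j ] + m ≡ 1ℤ + + 2 * j)
  even-or-odd-ℕ ℕ.zero = inj₁ (0ℤ , refl)
  even-or-odd-ℕ (ℕ.suc m) with even-or-odd-ℕ m
  ... | inj₁ (j , e) = inj₂ (j , cong (λ z → 1ℤ + z) e)
  ... | inj₂ (j , e) = inj₁ (1ℤ + j , trans (cong (λ z → 1ℤ + z) e) (even-or-odd-ℕ-identity j))

  even-or-odd : ∀ x → (∃[ j ] x ≡ + 2 * j) ⊎ (∃[ j ] x ≡ 1ℤ + + 2 * j)
  even-or-odd (+ m) = even-or-odd-ℕ m
  even-or-odd -[1+ m ] with even-or-odd-ℕ m
  ... | inj₁ (j , e) = inj₂ (- j - 1ℤ , trans (cong (λ z → - (1ℤ + z)) e) (even-or-odd-identity j))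
  ... | inj₂ (j , e) = inj₁ (- j - 1ℤ , trans (cong (λ z → - (1ℤ + z)) e) (even-or-odd-identity₂ j))

  multiple-small : ∀ {j} r m → 0ℤ ≤ + 8 * j → + 8 * j ≤ + 8 * + m → 2 ℕ.* m ℕ.≤ r → ∃[ i ] j ≡ + i × 2 ℕ.* i ℕ.≤ r
  multiple-small {j} r m lo hi h with ≤-cancel {0ℤ} {j} {+ 8} (+<+ (ℕ.s≤s ℕ.z≤n)) (subst (_≤ + 8 * j) (sym (*-zeroʳ (+ 8))) lo)
    | ≤-cancel {j} {+ m} {+ 8} (+<+ (ℕ.s≤s ℕ.z≤n)) hi
  multiple-small {+ i} r m lo hi h | _ | +≤+ i≤m = i , refl , ℕₚ.≤-trans (ℕₚ.*-monoʳ-≤ 2 i≤m) h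

  up : ∀ {n} → Mat n → Mat n
  up f a b with a <ᶠ? b
  ... | yes _ = f a b
  ... | no  _ = 0ℤ

  symmetric-sum : ∀ {n} (f : Mat n) → (∀ a b → f a b ≡ f b a) → (∀ a → f a a ≡ 0ℤ) → ∑² f ≡ + 2 * ∑² (up f)
  symmetric-sum f f-sym f-irr = trans (∑²-cong split) (trans (∑²-+ (up f) (λ a b → up f b a))
      (trans (cong (λ z → ∑² (up f) + z) (sym (∑²-comm (up f)))) (x+x≡2x (∑² (up f)))))
    where
    split : ∀ a b → f a b ≡ up f a b + up f b a
    split a b with a <ᶠ? b | b <ᶠ? a
    ... | yes p | yes q = ⊥-elim (<ᶠ-asym p q)
    ... | yes p | no  _ = sym (+-identityʳ (f a b))
    ... | no  _ | yes q = trans (f-sym a b) (sym (+-identityˡ (f b a)))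
    ... | no ¬p | no ¬q with <ᶠ-cmp a b
    ...   | tri< p _ _    = ⊥-elim (¬p p)
    ...   | tri≈ _ refl _ = f-irr a
    ...   | tri> _ _ q    = ⊥-elim (¬q q)

  PM-sq : ∀ {a} → PM a → a * a ≡ 1ℤ
  PM-sq (inj₁ refl) = refl
  PM-sq (inj₂ refl) = refl

  PM-* : ∀ {a b} → PM a → PM b → PM (a * b)
  PM-* (inj₁ refl) (inj₁ refl) = inj₁ refl
  PM-* (inj₁ refl) (inj₂ refl) = inj₂ refl
  PM-* (inj₂ refl) (inj₁ refl) = inj₂ refl
  PM-* (inj₂ refl) (inj₂ refl) = inj₁ refl

  PM-isNeg : ∀ {a} → PM a → a ≡ 1ℤ - + 2 * isNeg a
  PM-isNeg (inj₁ refl) = refl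
  PM-isNeg (inj₂ refl) = refl

  record TwoSided {n : ℕ} (v : Mat n) : Set where
    field
      s    : ℤ
      σ    : Fin n → ℤ
      s-pm : PM s
      σ-pm : ∀ u → PM (σ u)
      form : ∀ {u w} → N v u w ≡ 0ℤ → v u w ≡ s * (σ u * σ w)

  ∑L-identity : ∀ p q r s → (p - q) * (r - s) ≡ (p * r + q * s) - (p * s + q * r)
  ∑L-identity = solve-∀

  ∑L-identity₂ : ∀ s x → (s + s) - (x + x) ≡ + 2 * s - + 2 * x
  ∑L-identity₂ = solve-∀

  EN-swap-identity : ∀ p q r s → q * r ≡ (p * r + q * s) - p * s - (p - q) * (r - s)
  EN-swap-identity = solve-∀

  q≥0-identity : ∀ x → (1ℤ - x) + (1ℤ - x) ≡ 1ℤ - x - x + 1ℤ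
  q≥0-identity = solve-∀

  EN-swap-identity₂ : ∀ e l t g a q → + 2 * (t - g - l) + + 2 * (a * q) ≡ e + (+ 2 * t - + 2 * g) - (e + (+ 2 * l - + 2 * (a * q)))
  EN-swap-identity₂ = solve-∀

  ΔE-bd-identity : ∀ p q a → + 4 * (p - a) + + 4 * (q - a) ≡ + 8 * (p + q) - (+ 2 * ((p + q) * + 2) + + 2 * (a * + 4))
  ΔE-bd-identity = solve-∀

  ∑ΔE-identity : ∀ s x e → + 2 * (+ 2 * s - + 2 * x) - + 2 * (- (+ 2) * e) ≡ + 4 * s - + 4 * x + + 4 * e
  ∑ΔE-identity = solve-∀

  ∑ΔE-identity₂ : ∀ a x → a * (0ℤ - x - x + 0ℤ) ≡ - (+ 2) * (a * x)
  ∑ΔE-identity₂ = solve-∀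

  ∑ΔS-identity : ∀ p q r s → (p - q) * (r - s) ≡ (p * r + s * q) - (p * s + q * r)
  ∑ΔS-identity = solve-∀

  ∑ΔS-identity₂ : ∀ m d x → (m * d + d * m) - (x + x) ≡ + 2 * (m * d) - + 2 * x
  ∑ΔS-identity₂ = solve-∀

  ∑ΔS²-identity : ∀ D n m → + 8 * (D * (n * n)) * (n * m + n * m) ≡ + 16 * (D * (n * n * n * m))
  ∑ΔS²-identity = solve-∀

  ∑ΔS²-identity₂ : ∀ p q D n → + 4 * (n * n) * (p + q) * (D - p + (D - q)) ≡ + 8 * (D * (n * n)) * (p + q) - (p + q) * (n + n) * ((p + q) * (n + n))
  ∑ΔS²-identity₂ = solve-∀

  P-swap-identity : ∀ a b e s x y → a * (e + x) + + 2 * b * (s + y) - (s + y) * (s + y)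
    ≡ a * e + + 2 * b * s - s * s + (a * x + y * (+ 2 * b - + 2 * s - y))
  P-swap-identity = solve-∀

  P-bd-identity : ∀ m n e s → m * (n * n) * (m - e) + + 2 * (m * n) * (m * n - s) + s * s ≡ + 3 * (m * m * (n * n)) - (m * (n * n) * e + + 2 * (m * n) * s - s * s)
  P-bd-identity = solve-∀

  C-bd-identity : ∀ b s x → + 2 * b - s - (s + x) ≡ + 2 * b - + 2 * s - x
  C-bd-identity = solve-∀

  C-bd-identity₂ : ∀ b → + 2 * b + b + b ≡ + 4 * b
  C-bd-identity₂ = solve-∀

  ΔP-bd-identity : ∀ m n d x y → m * (n * n) * (+ 8 * d - x) + (d * (n + n) * (+ 4 * (m * n)) - y) ≡ + 16 * (m * (n * n)) * d - (m * (n * n) * x + y)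
  ΔP-bd-identity = solve-∀

  ∑ΔP-identity : ∀ a x y c → a * x + y * (c - y) ≡ a * x + c * y - y * y
  ∑ΔP-identity = solve-∀

  stays-good-identity : ∀ g → + 2 * g ≡ 0ℤ - (0ℤ + (+ 2 * 0ℤ - + 2 * g))
  stays-good-identity = solve-∀

  ΔP≤0-identity : ∀ p q → p - (p + q) ≡ 0ℤ - q
  ΔP≤0-identity = solve-∀

  R≥0-identity : ∀ c d k → c * d * (k - 1ℤ) ≡ c * (d * k) - c * d
  R≥0-identity = solve-∀

  B₀≥-identity : ∀ D n x → + 2 * ((D + D) * (n + n) * ((D + D) * (n + n)) - x) ≡ + 32 * (D * D * (n * n)) - + 2 * x
  B₀≥-identity = solve-∀

  x-y+y≡x : ∀ x y → x - y + y ≡ x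
  x-y+y≡x = solve-∀

  EN₁₂-identity : ∀ e1 e2 yz ut uz → 0ℤ - e1 + (0ℤ - e2) + + 2 * (yz + ut + (0ℤ - uz)) ≡ 0ℤ - (e2 - 0ℤ + + 2 * (1ℤ * (0ℤ - yz - ut + uz)) + e1)
  EN₁₂-identity = solve-∀

  E₁₂-identity : ∀ e x d1 d2 → e + d2 - e + + 2 * (1ℤ * x) + (e + d1) ≡ e + (d1 + d2 + + 2 * x)
  E₁₂-identity = solve-∀

  S₁₂-identity : ∀ e d1 d2 → e + d2 - e + (e + d1) ≡ e + (d1 + d2)
  S₁₂-identity = solve-∀

  double-good-identity : ∀ a b e s x d1 d2 s1 s2 l1 l2 B → 
    (a * e + + 2 * b * s - s * s - (a * (e + (d1 + d2 + x)) + + 2 * b * (s + (s1 + s2)) - (s + (s1 + s2)) * (s + (s1 + s2))))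
    + l1 + l2 + (B - + 2 * (s1 * s2)) ≡
    (l1 - (a * d1 + s1 * (+ 2 * b - + 2 * s - s1))) + (l2 - (a * d2 + s2 * (+ 2 * b - + 2 * s - s2))) + B - a * x
  double-good-identity = solve-∀

  double-identity : ∀ r s b m e q → r + s + b + + 8 * m * (e - 1ℤ) + + 2 * m * (+ 4 - q) ≡ r + s + b + + 8 * m * e - m * (+ 2 * q)
  double-identity = solve-∀

  ∑deg≤-identity : ∀ D x y t a b → (D - x + (D - y)) * t ≡ + 2 * D * t + ((x * a + x * b) + (a * y + y * b)) - (x + y) * (t + (a + b))
  ∑deg≤-identity = solve-∀

  ∑deg≤-identity₂ : ∀ Δ 𝕋 n s M F f e → + 2 * Δ * (+ 2 * (M * e) - 𝕋) + + 2 * n * (Δ * F - s + Δ * (f - F)) + + 2 * M * (f - F)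
    ≡ + 4 * (Δ * (M * e)) + + 2 * (n * (Δ * f)) + + 2 * (M * f) - (+ 2 * Δ * 𝕋 + ((n * s + M * F) + (F * M + n * s)))
  ∑deg≤-identity₂ = solve-∀

  NE≥-identity : ∀ p q r s → p - (q - s + r) ≡ p - q - r + s
  NE≥-identity = solve-∀

  at-edge-identity : ∀ r s b m n du dz M fu fz F tu tz N → r + s + b + m * ((n + n + n) + (n * du + n * dz + M) + n * (n * (fu + fz)) + (F + F) + (tu + tz) + N)
    ≡ (r + m * (n * du + n * n * fu + tu)) + (s + m * (n * dz + n * n * fz + tz)) + (b + m * (+ 3 * n + M + + 2 * F + N))
  at-edge-identity = solve-∀

  G*NE-identity : ∀ a g x → a * (g * x) ≡ g * (a * x)
  G*NE-identity = solve-∀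

  ∑Ax-identity : ∀ a d n p q x → a * (d - n * p - n * q + n * (n * x)) ≡ a * d - n * (a * p) - n * (a * q) + n * n * (a * x)
  ∑Ax-identity = solve-∀

  ∑Ax-identity₂ : ∀ a s x → a - s - s + x ≡ a - + 2 * s + x
  ∑Ax-identity₂ = solve-∀

  summed-identity : ∀ x y z → + 2 * (y - x) ≡ + 2 * y + z - (+ 2 * x + z)
  summed-identity = solve-∀

  edgewise-identity : ∀ m p q r s t → m * (0ℤ * p + 0ℤ * q) ≡ 0ℤ * r + 0ℤ * s + 0ℤ * t
  edgewise-identity = solve-∀

  edgewise-identity₂ : ∀ m p q → m * (p + q) ≡ m * (1ℤ * p + 1ℤ * q)
  edgewise-identity₂ = solve-∀

  edgewise-identity₃ : ∀ p q r → p + q + r ≡ 1ℤ * p + 1ℤ * q + 1ℤ * r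
  edgewise-identity₃ = solve-∀

  𝔼-neg-identity : ∀ p q → p * - q ≡ - (p * q)
  𝔼-neg-identity = solve-∀

  neg-spread-identity : ∀ x a b → - (x - (- a + - b)) ≡ - x - (a + b)
  neg-spread-identity = solve-∀

  step≤-identity : ∀ p q D → + 8 * (D - p) + + 8 * (D - q) ≡ + 16 * D - + 8 * (p + q)
  step≤-identity = solve-∀

  ascend-identity : ∀ D → + 16 * D ≡ + 32 * D - + 16 * D
  ascend-identity = solve-∀

  ascend-identity₂ : ∀ e D → e + + 16 * D + + 16 * D ≡ e + + 32 * D
  ascend-identity₂ = solve-∀

  next-identity : ∀ b p q f → p + (1ℤ + f) - b + (q - (1ℤ + p)) ≡ q + f - b
  next-identity = solve-∀

  next-identity₂ : ∀ k C e → k - C - e ≡ k - (e + C)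
  next-identity₂ = solve-∀

  ascend-to-identity : ∀ x y → x + (y - x) ≡ y
  ascend-to-identity = solve-∀

  reach-identity : ∀ k x C → C + (x - k) ≡ C - k - - x
  reach-identity = solve-∀

  reach-identity₂ : ∀ k x C → - x - (C - k - C) ≡ k - x
  reach-identity₂ = solve-∀

  repair-step-identity : ∀ e g → + 2 * (g - 1ℤ) + 1ℤ ≡ e - (1ℤ + (e + (+ 2 * 0ℤ - + 2 * g)))
  repair-step-identity = solve-∀

  pred-≤-identity : ∀ x k → 1ℤ + k - (1ℤ + x) ≡ k - x
  pred-≤-identity = solve-∀

  ∑far-identity : ∀ D l p q → D * l - p + (D * p - q) + D * (D * l - p) ≡ (1ℤ + D + D * D) * l - (l + p + q)
  ∑far-identity = solve-∀

  flip-𝔼-identity : ∀ e g q → e + (+ 2 * g - + 2 * (0ℤ * q)) ≡ e + + 2 * g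
  flip-𝔼-identity = solve-∀

  continue-identity : ∀ e r → e + + 8 + + 8 * r ≡ e + + 8 * (1ℤ + r)
  continue-identity = solve-∀

  weighted-sum-identity : ∀ d r → 0ℤ * d ≡ 0ℤ * r + 0ℤ * (d - r)
  weighted-sum-identity = solve-∀

  weighted-sum-identity₂ : ∀ d r → 1ℤ * d ≡ 1ℤ * r + 1ℤ * (d - r)
  weighted-sum-identity₂ = solve-∀

  weighted-sum-identity₃ : ∀ a r x → a * r + x * (r - r) ≡ a * r
  weighted-sum-identity₃ = solve-∀

  x≢x′-identity : ∀ a b → (a - a) - (b - b) ≡ 0ℤ
  x≢x′-identity = solve-∀

  x-x≡0 : ∀ x → x - x ≡ 0ℤ
  x-x≡0 = solve-∀

  total-identity : ∀ n e p q → e - p + (e - q) ≡ + 2 * n + + 2 * e - (n * + 2 + p + q)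
  total-identity = solve-∀

  regular-identity : ∀ l D → l + (D + + 2) + (D + + 2) ≡ l + (+ 2 * D + + 4)
  regular-identity = solve-∀

  F≤R-identity : ∀ l D → + 2 * D + + 4 ≡ l + (+ 2 * D + + 4) - l
  F≤R-identity = solve-∀

  ∑bad-identity : ∀ n e c p q → + 2 * n + + 2 * e - + 3 * c + + 3 * (e - p) + + 3 * (e - q) ≡ + 2 * n + + 8 * e + + 3 - + 3 * (c + p + q + 1ℤ)
  ∑bad-identity = solve-∀

  enough-identity : ∀ n e D R l s → + 2 * n + + 8 * e + + 3 - + 3 * s + (n - (1ℤ + ((+ 8 + + 3 * D) * e + + 3 * R + + 5))) + + 3 * (R - l) ≡ + 3 * n - + 3 * (1ℤ + (s + D * e + l))
  enough-identity = solve-∀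

  size₁-identity : ∀ D k l → D - k ≡ l + (D + + 2) - (k + (+ 2 + l))
  size₁-identity = solve-∀

  half₁-identity : ∀ l D → D + + 2 ≡ l + (+ 2 * D + + 4) - (l + (D + + 2))
  half₁-identity = solve-∀

  sup′-identity : ∀ l D → D + + 2 ≡ l + (D + + 2) - l
  sup′-identity = solve-∀

  regular-identity₂ : ∀ d r a b → d * r + (a - r) - (d * r + (b - r)) ≡ a - b
  regular-identity₂ = solve-∀

  module Embeddings {n : ℕ} {A : Mat n} {Δ : ℤ} (H : Adjacency A Δ) where

    open Adjacency H public using () renaming (symm to A-sym; irr to A-diag₀; val to A-val; deg≤ to deg≤Δ)
    open Energy A A-sym A-diag₀ public

    M nn : ℤ
    M  = ∑ deg
    nn = + n

    A≥0 : ∀ a b → 0ℤ ≤ A a b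
    A≥0 a b with A a b | A-val a b
    ... | _ | inj₁ refl = num 0
    ... | _ | inj₂ refl = num 1

    deg≥0 : ∀ a → 0ℤ ≤ deg a
    deg≥0 a = ∑-nonneg (A≥0 a)

    M≥0 : 0ℤ ≤ M
    M≥0 = ∑-nonneg deg≥0

    A≤deg : ∀ a b → A a b ≤ deg a
    A≤deg a b = term≤∑ (A≥0 a) b

    A≤degʳ : ∀ a b → A a b ≤ deg b
    A≤degʳ a b = subst (_≤ deg b) (A-sym b a) (A≤deg b a)

    deg-col : ∀ b → ∑ (λ a → A a b) ≡ deg b
    deg-col b = ∑-cong (λ a → A-sym a b)

    -- The sum over u and y of the first term of L, for w or for N w.
    cross : (w : Mat n) → (∀ a b → w a b ≡ w b a) →
      ∑² (λ u y → ∑ (λ b → A u b * w y b)) ≡ S w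
    cross w w-sym = begin
      ∑² (λ u y → ∑ (λ b → A u b * w y b))
        ≡⟨ ∑-cong (λ u → trans (∑-comm (λ y b → A u b * w y b)) (∑-cong (λ b → trans (∑-*ˡ (A u b) _) (cong (A u b *_) (∑-cong (λ y → w-sym y b)))))) ⟩
      ∑ (λ u → ∑ (λ b → A u b * row w b))
        ≡⟨ trans (∑-comm (λ u b → A u b * row w b)) (∑-cong (λ b → trans (∑-*ʳ (row w b) _) (cong (_* row w b) (deg-col b)))) ⟩
      S w ∎
      where open ≡-Reasoning

    ∑L : (w : Mat n) → (∀ a b → w a b ≡ w b a) → ∑² (L w) ≡ + 2 * S w - + 2 * (nn * 𝔼 w)
    ∑L w w-sym = begin
      ∑² (L w)
        ≡⟨ ∑²-cong (λ u y → trans (∑-cong (λ b → ∑L-identity (A u b) (A y b) (w y b) (w u b)))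
             (trans (∑-- _ _) (cong₂ _-_ (∑-+ _ _) (∑-+ _ _)))) ⟩
      ∑² (λ u y → (f u y + f y u) - (g u + g y))
        ≡⟨ trans (∑²-- _ _) (cong₂ _-_ (∑²-+ _ _) (∑²-+ _ _)) ⟩
      (∑² f + ∑² (λ u y → f y u)) - (∑² (λ u y → g u) + ∑² (λ u y → g y))
        ≡⟨ cong₂ _-_ (cong₂ _+_ (cross w w-sym) (trans (sym (∑²-comm f)) (cross w w-sym)))
                     (cong₂ _+_ (∑²-fst g) (∑²-snd g)) ⟩
      (S w + S w) - (nn * 𝔼 w + nn * 𝔼 w)
        ≡⟨ ∑L-identity₂ (S w) (nn * 𝔼 w) ⟩
      + 2 * S w - + 2 * (nn * 𝔼 w) ∎
      where
      open ≡-Reasoning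
      f : Mat n
      f u y = ∑ (λ b → A u b * w y b)
      g : Fin n → ℤ
      g u = ∑ (λ b → A u b * w u b)

    𝕋 : Mat n → Fin n → Fin n → ℤ
    𝕋 w u y = ∑ (λ b → A u b * N w y b + A y b * N w u b)

    module _ {w : Mat n} (W : Weight w) where
      open Weight W using (bd) renaming (symm to w-sym; irr to w-irr)

      𝕋≥0 : ∀ u y → 0ℤ ≤ 𝕋 w u y
      𝕋≥0 u y = ∑-nonneg (λ b → A≥0 u b ⊗ proj₁ (N-bd W y b) ⊕ A≥0 y b ⊗ proj₁ (N-bd W u b))

      ∑𝕋 : ∑² (𝕋 w) ≡ + 2 * S (N w)
      ∑𝕋 = begin
        ∑² (𝕋 w) ≡⟨ ∑²-cong (λ u y → ∑-+ _ _) ⟩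
        ∑² (λ u y → f u y + f y u) ≡⟨ ∑²-+ _ _ ⟩
        ∑² f + ∑² (λ u y → f y u) ≡⟨ cong₂ _+_ (cross (N w) (N-sym W)) (trans (sym (∑²-comm f)) (cross (N w) (N-sym W))) ⟩
        S (N w) + S (N w) ≡⟨ x+x≡2x (S (N w)) ⟩
        + 2 * S (N w) ∎
        where
        open ≡-Reasoning
        f : Mat n
        f u y = ∑ (λ b → A u b * N w y b)

      EN≥0 : 0ℤ ≤ 𝔼 (N w)
      EN≥0 = ∑²-nonneg (λ a b → A≥0 a b ⊗ proj₁ (N-bd W a b))

      EN-swap : ∀ u y → 𝔼 (N (w ⟪ u ⇄ y ⟫)) ≤ 𝔼 (N w) + (+ 2 * 𝕋 w u y - + 2 * ∑ (λ b → A u b * N w u b))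
      EN-swap u y = subst (_≤ 𝔼 (N w) + (+ 2 * 𝕋 w u y - + 2 * G)) (sym (𝔼-swap (N w) (N-sym W) u y))
        (arith {𝔼 (N w)} {L (N w) u y} {𝕋 w u y} {G} {A u y} {quad (N w) u y u y} L≤ (A≥0 u y) q≥0)
        where
        G : ℤ
        G = ∑ (λ b → A u b * N w u b)
        L≤ : L (N w) u y ≤ 𝕋 w u y - G
        L≤ = subst (L (N w) u y ≤_) (∑-- _ _) (∑-mono (λ b → ≤by (A≥0 y b ⊗ proj₁ (N-bd W y b))
               (EN-swap-identity (A u b) (A y b) (N w y b) (N w u b))))
        q≥0 : 0ℤ ≤ quad (N w) u y u y
        q≥0 rewrite N-irr W y | N-irr W u | N-sym W y u = subst (0ℤ ≤_) (q≥0-identity (N w u y)) (d ⊕ d)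
          where d : 0ℤ ≤ 1ℤ - N w u y
                d = diff (proj₂ (N-bd W u y))
        arith : ∀ {e l t g a q} → l ≤ t - g → 0ℤ ≤ a → 0ℤ ≤ q →
          e + (+ 2 * l - + 2 * (a * q)) ≤ e + (+ 2 * t - + 2 * g)
        arith {e} {l} {t} {g} {a} {q} p r s = ≤by (num 2 ⊗ diff p ⊕ num 2 ⊗ (r ⊗ s)) (EN-swap-identity₂ e l t g a q)

      quad-bd : ∀ u y z t → ∣ quad w u y z t ∣≤ (+ 4)
      quad-bd u y z t = bd-+ (bd-- (bd-- (bd y t) (bd y z)) (bd u t)) (bd u z)

      row-bd : ∀ u → ∣ row w u ∣≤ nn
      row-bd u = subst (∣ row w u ∣≤_) (trans (∑-const n 1ℤ) (*-identityʳ nn)) (bd-∑ (bd u))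

      S-bd : ∣ S w ∣≤ (M * nn)
      S-bd = subst (∣ S w ∣≤_) (∑-*ʳ nn deg) (bd-∑ (λ u → bd-*ˡ (deg≥0 u) (row-bd u)))

      𝔼-bd : ∣ 𝔼 w ∣≤ M
      𝔼-bd = bd-∑ (λ u → bd-∑ (λ b → subst (∣ A u b * w u b ∣≤_) (*-identityʳ (A u b)) (bd-*ˡ (A≥0 u b) (bd u b))))

      ΔE ΔS : Fin n → Fin n → ℤ
      ΔE u y = + 2 * L w u y - + 2 * (A u y * quad w u y u y)
      ΔS u y = (deg u - deg y) * (row w y - row w u)

      ΔE-bd : ∀ u y → ∣ ΔE u y ∣≤ (+ 8 * (deg u + deg y))
      ΔE-bd u y = bd-weaken (bd-- (bd-*ˡ (num 2) L-bd) (bd-*ˡ (num 2) (bd-*ˡ (A≥0 u y) (quad-bd u y u y))))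
        (arith {deg u} {deg y} (A≤deg u y) (A≤degʳ u y))
        where
        L-bd : ∣ L w u y ∣≤ ((deg u + deg y) * + 2)
        L-bd = subst (∣ L w u y ∣≤_) (trans (∑-*ʳ (+ 2) _) (cong (_* + 2) (∑-+ (A u) (A y))))
          (bd-∑ (λ b → bd-* (bd-- (nonneg-bd (A≥0 u b) ≤-refl) (nonneg-bd (A≥0 y b) ≤-refl)) (bd-- (bd y b) (bd u b))))
        arith : ∀ {du dy a} → a ≤ du → a ≤ dy → + 2 * ((du + dy) * + 2) + + 2 * (a * + 4) ≤ + 8 * (du + dy)
        arith {du} {dy} {a} p q = ≤by (num 4 ⊗ diff p ⊕ num 4 ⊗ diff q) (ΔE-bd-identity du dy a)

      ΔS-bd : ∀ u y → ∣ ΔS u y ∣≤ ((deg u + deg y) * (nn + nn))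
      ΔS-bd u y = bd-* (bd-- (nonneg-bd (deg≥0 u) ≤-refl) (nonneg-bd (deg≥0 y) ≤-refl)) (bd-- (row-bd y) (row-bd u))

      ∑ΔE : ∑² ΔE ≡ + 4 * S w - + 4 * (nn * 𝔼 w) + + 4 * 𝔼 w
      ∑ΔE = begin
        ∑² ΔE ≡⟨ trans (∑²-- _ _) (cong₂ _-_ (∑²-*ˡ (+ 2) _) (trans (∑²-*ˡ (+ 2) _)
                   (cong (+ 2 *_) (trans (∑²-cong q≡) (∑²-*ˡ (- (+ 2)) _))))) ⟩
        + 2 * ∑² (L w) - + 2 * (- (+ 2) * 𝔼 w) ≡⟨ cong (λ z → + 2 * z - + 2 * (- (+ 2) * 𝔼 w)) (∑L w w-sym) ⟩
        + 2 * (+ 2 * S w - + 2 * (nn * 𝔼 w)) - + 2 * (- (+ 2) * 𝔼 w) ≡⟨ ∑ΔE-identity (S w) (nn * 𝔼 w) (𝔼 w) ⟩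
        + 4 * S w - + 4 * (nn * 𝔼 w) + + 4 * 𝔼 w ∎
        where
        open ≡-Reasoning
        q≡ : ∀ u y → A u y * quad w u y u y ≡ - (+ 2) * (A u y * w u y)
        q≡ u y rewrite w-irr u | w-irr y | w-sym y u = ∑ΔE-identity₂ (A u y) (w u y)

      ∑ΔS : ∑² ΔS ≡ + 2 * (M * ∑² w) - + 2 * (nn * S w)
      ∑ΔS = begin
        ∑² ΔS ≡⟨ ∑²-cong (λ u y → ∑ΔS-identity (deg u) (deg y) (row w y) (row w u)) ⟩
        ∑² (λ u y → (deg u * row w y + row w u * deg y) - (deg u * row w u + deg y * row w y))
          ≡⟨ trans (∑²-- _ _) (cong₂ _-_ (trans (∑²-+ _ _) (cong₂ _+_ (∑²-outer deg (row w)) (∑²-outer (row w) deg)))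
               (trans (∑²-+ _ _) (cong₂ _+_ (∑²-fst (λ u → deg u * row w u)) (∑²-snd (λ u → deg u * row w u))))) ⟩
        (M * ∑² w + ∑² w * M) - (nn * S w + nn * S w) ≡⟨ ∑ΔS-identity₂ M (∑² w) (nn * S w) ⟩
        + 2 * (M * ∑² w) - + 2 * (nn * S w) ∎
        where
        open ≡-Reasoning

      ∑ΔS² : ∑² (λ u y → ΔS u y * ΔS u y) ≤ + 16 * (Δ * (nn * nn * nn * M))
      ∑ΔS² = ≤-trans (∑²-mono bound) (≤-reflexive total)
        where
        open ≡-Reasoning
        arith : ∀ {du dy D n s} → 0ℤ ≤ n → 0ℤ ≤ du → 0ℤ ≤ dy → du ≤ D → dy ≤ D → s ≤ (du + dy) * (n + n) * ((du + dy) * (n + n)) →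
          s ≤ + 8 * (D * (n * n)) * (du + dy)
        arith {du} {dy} {D} {n} {s} n0 p p' q r h = ≤-trans h
          (≤by (num 4 ⊗ (n0 ⊗ n0) ⊗ (p ⊕ p') ⊗ (diff q ⊕ diff r)) (∑ΔS²-identity₂ du dy D n))
        bound : ∀ u y → ΔS u y * ΔS u y ≤ + 8 * (Δ * (nn * nn)) * (deg u + deg y)
        bound u y = arith (num n) (deg≥0 u) (deg≥0 y) (deg≤Δ u) (deg≤Δ y) (prod≤ (ΔS-bd u y) (ΔS-bd u y))
        total : ∑² (λ u y → + 8 * (Δ * (nn * nn)) * (deg u + deg y)) ≡ + 16 * (Δ * (nn * nn * nn * M))
        total = begin
          ∑² (λ u y → + 8 * (Δ * (nn * nn)) * (deg u + deg y)) ≡⟨ ∑²-*ˡ (+ 8 * (Δ * (nn * nn))) (λ u y → deg u + deg y) ⟩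
          + 8 * (Δ * (nn * nn)) * ∑² (λ u y → deg u + deg y)
            ≡⟨ cong (+ 8 * (Δ * (nn * nn)) *_) (trans (∑²-+ _ _) (cong₂ _+_ (∑²-fst deg) (∑²-snd deg))) ⟩
          + 8 * (Δ * (nn * nn)) * (nn * M + nn * M) ≡⟨ ∑ΔS²-identity Δ nn M ⟩
          + 16 * (Δ * (nn * nn * nn * M)) ∎

    P : Mat n → ℤ
    P w = M * (nn * nn) * 𝔼 w + + 2 * (M * nn) * S w - S w * S w

    -- fz counts how often a vertex is frozen; moves exchange unfrozen vertices.
    record LocalMax (fz : Fin n → ℤ) (w : Mat n) : Set where
      field
        max₁ : ∀ u y → fz u ≡ 0ℤ → fz y ≡ 0ℤ → 𝔼 (N (w ⟪ u ⇄ y ⟫)) ≤ 0ℤ → P (w ⟪ u ⇄ y ⟫) ≤ P w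
        max₂ : ∀ u y z t → fz u ≡ 0ℤ → fz y ≡ 0ℤ → fz z ≡ 0ℤ → fz t ≡ 0ℤ →
               𝔼 (N (w ⟪ u ⇄ y ⟫ ⟪ z ⇄ t ⟫)) ≤ 0ℤ → P (w ⟪ u ⇄ y ⟫ ⟪ z ⇄ t ⟫) ≤ P w

    module _ {w : Mat n} (W : Weight w) where
      open Weight W using () renaming (symm to w-sym; irr to w-irr)

      ΔP : Fin n → Fin n → ℤ
      ΔP u y = M * (nn * nn) * ΔE W u y + ΔS W u y * (+ 2 * (M * nn) - + 2 * S w - ΔS W u y)

      P-swap : ∀ u y → P (w ⟪ u ⇄ y ⟫) ≡ P w + ΔP u y
      P-swap u y = trans (cong₂ (λ e s → M * (nn * nn) * e + + 2 * (M * nn) * s - s * s) (𝔼-swap w w-sym u y) (S-swap w u y))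
                         (P-swap-identity (M * (nn * nn)) (M * nn) (𝔼 w) (S w) (ΔE W u y) (ΔS W u y))

      P-bd : P w ≤ + 3 * (M * M * (nn * nn))
      P-bd = arith {M} {nn} {𝔼 w} {S w} M≥0 (num n) (proj₂ (𝔼-bd W)) (proj₂ (S-bd W)) (square≥0 (S w))
        where
        arith : ∀ {m n e s} → 0ℤ ≤ m → 0ℤ ≤ n → e ≤ m → s ≤ m * n → 0ℤ ≤ s * s →
          m * (n * n) * e + + 2 * (m * n) * s - s * s ≤ + 3 * (m * m * (n * n))
        arith {m} {n} {e} {s} m0 n0 p q r = ≤by (m0 ⊗ (n0 ⊗ n0) ⊗ diff p ⊕ num 2 ⊗ (m0 ⊗ n0) ⊗ diff q ⊕ r)
          (P-bd-identity m n e s)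

      ΔP-bd : ∀ u y → ΔP u y ≤ + 16 * (M * (nn * nn)) * (deg u + deg y)
      ΔP-bd u y = arith {M} {nn} {deg u + deg y} M≥0 (num n) (proj₂ (ΔE-bd W u y)) (prod≤ (ΔS-bd W u y) C-bd)
        where
        S₁-bd : ∣ S w + ΔS W u y ∣≤ (M * nn)
        S₁-bd = subst (∣_∣≤ (M * nn)) (S-swap w u y) (S-bd (weight-permute W (Perm.transpose u y)))
        C-bd : ∣ + 2 * (M * nn) - + 2 * S w - ΔS W u y ∣≤ (+ 4 * (M * nn))
        C-bd = subst₂ ∣_∣≤_ (C-bd-identity (M * nn) (S w) (ΔS W u y)) (C-bd-identity₂ (M * nn))
          (bd-- {a = + 2 * (M * nn) + M * nn} (bd-- {+ 2 * (M * nn)} {S w} {+ 2 * (M * nn)} {M * nn}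
            (nonneg-bd (num 2 ⊗ (M≥0 ⊗ num n)) ≤-refl) (S-bd W)) S₁-bd)
        arith : ∀ {m n d x y} → 0ℤ ≤ m → 0ℤ ≤ n → x ≤ + 8 * d → y ≤ d * (n + n) * (+ 4 * (m * n)) →
          m * (n * n) * x + y ≤ + 16 * (m * (n * n)) * d
        arith {m} {n} {d} {x} {y} m0 n0 p q = ≤by (m0 ⊗ (n0 ⊗ n0) ⊗ diff p ⊕ diff q) (ΔP-bd-identity m n d x y)

      ∑ΔP : ∑² ΔP ≡ M * (nn * nn) * (+ 4 * S w - + 4 * (nn * 𝔼 w) + + 4 * 𝔼 w)
                    + (+ 2 * (M * nn) - + 2 * S w) * (+ 2 * (M * ∑² w) - + 2 * (nn * S w))
                    - ∑² (λ u y → ΔS W u y * ΔS W u y)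
      ∑ΔP = begin
        ∑² ΔP ≡⟨ ∑²-cong (λ u y → ∑ΔP-identity (M * (nn * nn)) (ΔE W u y) (ΔS W u y) c) ⟩
        ∑² (λ u y → M * (nn * nn) * ΔE W u y + c * ΔS W u y - ΔS W u y * ΔS W u y)
          ≡⟨ trans (∑²-- _ _) (cong (_- ∑² (λ u y → ΔS W u y * ΔS W u y)) (trans (∑²-+ _ _)
               (cong₂ _+_ (∑²-*ˡ (M * (nn * nn)) (ΔE W)) (∑²-*ˡ c (ΔS W))))) ⟩
        M * (nn * nn) * ∑² (ΔE W) + c * ∑² (ΔS W) - ∑² (λ u y → ΔS W u y * ΔS W u y)
          ≡⟨ cong₂ (λ p q → M * (nn * nn) * p + c * q - ∑² (λ u y → ΔS W u y * ΔS W u y)) (∑ΔE W) (∑ΔS W) ⟩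
        _ ∎
        where
        open ≡-Reasoning
        c : ℤ
        c = + 2 * (M * nn) - + 2 * S w

      module Flat (fz : Fin n → ℤ) (fz≥0 : ∀ u → 0ℤ ≤ fz u) (good : 𝔼 (N w) ≡ 0ℤ) (lm : LocalMax fz w) where
        open LocalMax lm

        slack R : Fin n → Fin n → ℤ
        slack u y = + 16 * (M * (nn * nn)) * ((deg u + deg y) * (𝕋 w u y + (fz u + fz y)))
        R u y = slack u y - ΔP u y

        Mn²≥0 : 0ℤ ≤ M * (nn * nn)
        Mn²≥0 = M≥0 ⊗ (num n ⊗ num n)

        slack≥0 : ∀ u y → 0ℤ ≤ slack u y
        slack≥0 u y = num 16 ⊗ Mn²≥0 ⊗ ((deg≥0 u ⊕ deg≥0 y) ⊗ (𝕋≥0 W u y ⊕ (fz≥0 u ⊕ fz≥0 y)))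

        stays-good : ∀ u y → 𝕋 w u y ≡ 0ℤ → 𝔼 (N (w ⟪ u ⇄ y ⟫)) ≤ 0ℤ
        stays-good u y T0 = ≤-trans (EN-swap W u y) (arith good T0
          (∑-nonneg (λ b → A≥0 u b ⊗ proj₁ (N-bd W u b))))
          where arith : ∀ {e t g} → e ≡ 0ℤ → t ≡ 0ℤ → 0ℤ ≤ g → e + (+ 2 * t - + 2 * g) ≤ 0ℤ
                arith {g = g} refl refl p = ≤by (num 2 ⊗ p) (stays-good-identity g)

        R≥0 : ∀ u y → 0ℤ ≤ R u y
        R≥0 u y with zero-or-pos (𝕋≥0 W u y ⊕ (fz≥0 u ⊕ fz≥0 y))
        ... | inj₁ k≡0 = diff (≤-trans ΔP≤0 (slack≥0 u y))
          where
          f≡0 = sum≡0ʳ (𝕋≥0 W u y) (fz≥0 u ⊕ fz≥0 y) k≡0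
          P≤ : P w + ΔP u y ≤ P w
          P≤ = subst (_≤ P w) (P-swap u y) (max₁ u y (sum≡0ˡ (fz≥0 u) (fz≥0 y) f≡0) (sum≡0ʳ (fz≥0 u) (fz≥0 y) f≡0)
                 (stays-good u y (sum≡0ˡ (𝕋≥0 W u y) (fz≥0 u ⊕ fz≥0 y) k≡0)))
          ΔP≤0 : ΔP u y ≤ 0ℤ
          ΔP≤0 = ≤by (diff P≤) (ΔP≤0-identity (P w) (ΔP u y))
        ... | inj₂ 1≤k = diff (≤-trans (ΔP-bd u y) (arith (deg≥0 u ⊕ deg≥0 y) (num 16 ⊗ Mn²≥0) 1≤k))
          where
          arith : ∀ {c d k} → 0ℤ ≤ d → 0ℤ ≤ c → 1ℤ ≤ k → c * d ≤ c * (d * k)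
          arith {c} {d} {k} p q r = ≤by (q ⊗ p ⊗ diff r) (R≥0-identity c d k)

        err : Fin n → Fin n → Fin n → Fin n → ℤ
        err u z y t = (δ z y + δ t u + δ t y) + (A u t + A y z + A y t) + (fz u + fz z) + (fz y + fz t)
                      + (𝕋 w u y + 𝕋 w z t) + N w y t

        B₀ : ℤ
        B₀ = + 32 * (Δ * Δ * (nn * nn))

        B₀≥ : ∀ u y z t → + 2 * (ΔS W u y * ΔS W z t) ≤ B₀
        B₀≥ u y z t = arith {Δ} {nn} (prod≤ (b u y) (b z t))
          where
          b : ∀ u y → ∣ ΔS W u y ∣≤ ((Δ + Δ) * (nn + nn))
          b u y = bd-weaken (ΔS-bd W u y) (*-monoʳ-≤-nonNeg (nn + nn) (+-mono-≤ (deg≤Δ u) (deg≤Δ y)))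
          arith : ∀ {D n x} → x ≤ (D + D) * (n + n) * ((D + D) * (n + n)) → + 2 * x ≤ + 32 * (D * D * (n * n))
          arith {D} {n} {x} p = ≤by (num 2 ⊗ diff p) (B₀≥-identity D n x)

        B₀≥0 : 0ℤ ≤ B₀
        B₀≥0 = subst (0ℤ ≤_) refl (num 32 ⊗ (square≥0 Δ ⊗ (num n ⊗ num n)))

        double-good : ∀ u z y t → A u z ≡ 1ℤ → err u z y t ≡ 0ℤ →
          M * (nn * nn) * (+ 2 * quad w u y z t) ≤ R u y + R z t + B₀
        double-good u z y t Auz err≡0 = arith (M * (nn * nn)) (M * nn) (𝔼 w) (S w) (+ 2 * quad w u y z t) (ΔE W u y) (ΔE W z t) (ΔS W u y) (ΔS W z t)
            (slack u y) (slack z t) B₀ P≤ (slack≥0 u y) (slack≥0 z t) (B₀≥ u y z t)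
          where
          i1 = δ≥0 z y ⊕ δ≥0 t u ⊕ δ≥0 t y
          i2 = A≥0 u t ⊕ A≥0 y z ⊕ A≥0 y t
          i3 = fz≥0 u ⊕ fz≥0 z
          i4 = fz≥0 y ⊕ fz≥0 t
          i5 = 𝕋≥0 W u y ⊕ 𝕋≥0 W z t
          i6 = proj₁ (N-bd W y t)
          s5 = sum≡0ˡ (i1 ⊕ i2 ⊕ i3 ⊕ i4 ⊕ i5) i6 err≡0
          s4 = sum≡0ˡ (i1 ⊕ i2 ⊕ i3 ⊕ i4) i5 s5
          s3 = sum≡0ˡ (i1 ⊕ i2 ⊕ i3) i4 s4
          s2 = sum≡0ˡ (i1 ⊕ i2) i3 s3
          e1 = sum≡0ˡ i1 i2 s2
          e2 = sum≡0ʳ i1 i2 s2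
          e3 = sum≡0ʳ (i1 ⊕ i2) i3 s3
          e4 = sum≡0ʳ (i1 ⊕ i2 ⊕ i3) i4 s4
          e5 = sum≡0ʳ (i1 ⊕ i2 ⊕ i3 ⊕ i4) i5 s5
          e6 : N w y t ≡ 0ℤ
          e6 = sum≡0ʳ (i1 ⊕ i2 ⊕ i3 ⊕ i4 ⊕ i5) i6 err≡0
          e1′ = sum≡0ˡ (δ≥0 z y ⊕ δ≥0 t u) (δ≥0 t y) e1
          z≢y = δ≡0⇒≢ (sum≡0ˡ (δ≥0 z y) (δ≥0 t u) e1′)
          t≢u = δ≡0⇒≢ (sum≡0ʳ (δ≥0 z y) (δ≥0 t u) e1′)
          t≢y = δ≡0⇒≢ (sum≡0ʳ (δ≥0 z y ⊕ δ≥0 t u) (δ≥0 t y) e1)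
          e2′ = sum≡0ˡ (A≥0 u t ⊕ A≥0 y z) (A≥0 y t) e2
          Aut : A u t ≡ 0ℤ
          Aut = sum≡0ˡ (A≥0 u t) (A≥0 y z) e2′
          Ayz : A y z ≡ 0ℤ
          Ayz = sum≡0ʳ (A≥0 u t) (A≥0 y z) e2′
          Ayt : A y t ≡ 0ℤ
          Ayt = sum≡0ʳ (A≥0 u t ⊕ A≥0 y z) (A≥0 y t) e2
          Tuy = sum≡0ˡ (𝕋≥0 W u y) (𝕋≥0 W z t) e5
          Tzt = sum≡0ʳ (𝕋≥0 W u y) (𝕋≥0 W z t) e5
          z≢u : z ≢ u
          z≢u refl with trans (sym Auz) (A-diag₀ u)
          ... | ()
          qA : quadA u y z t ≡ 1ℤ
          qA = cong₂ (λ p q → p + q) (cong₂ _-_ (cong₂ _-_ Auz Aut) Ayz) Ayt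
          Nuz : N w u z ≤ 0ℤ
          Nuz = ≤-trans (subst (λ a → N w u z ≤ a * N w u z) (sym Auz) (≤-reflexive (sym (*-identityˡ (N w u z)))))
                (subst (A u z * N w u z ≤_) good (term≤∑² (λ a b → A≥0 a b ⊗ proj₁ (N-bd W a b)) u z))
          EN₁₂ : 𝔼 (N (w ⟪ u ⇄ y ⟫ ⟪ z ⇄ t ⟫)) ≤ 0ℤ
          EN₁₂ = ar (𝔼-swap₂ (N w) z≢u z≢y t≢u t≢y (N-sym W)) qA (stays-good u y Tuy) (stays-good z t Tzt) good e6
                   (proj₁ (N-bd W y z)) (proj₁ (N-bd W u t)) Nuz
            where
            ar : ∀ {e12 e1 e2 e q yt yz ut uz} → e12 - e1 ≡ e2 - e + + 2 * (q * (yt - yz - ut + uz)) → q ≡ 1ℤ →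
                 e1 ≤ 0ℤ → e2 ≤ 0ℤ → e ≡ 0ℤ → yt ≡ 0ℤ → 0ℤ ≤ yz → 0ℤ ≤ ut → uz ≤ 0ℤ → e12 ≤ 0ℤ
            ar {e12} {e1} {e2} {yz = yz} {ut} {uz} h refl a b refl refl c d f =
              subst (_≤ 0ℤ) (trans (cong (_+ e1) (sym h)) (x-y+y≡x e12 e1))
                (≤by (diff a ⊕ diff b ⊕ num 2 ⊗ (c ⊕ d ⊕ diff f)) (EN₁₂-identity e1 e2 yz ut uz))
          w₁ = w ⟪ u ⇄ y ⟫
          w₁₂ = w ⟪ u ⇄ y ⟫ ⟪ z ⇄ t ⟫
          E₁₂ : 𝔼 w₁₂ ≡ 𝔼 w + (ΔE W u y + ΔE W z t + + 2 * quad w u y z t)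
          E₁₂ = ar (𝔼-swap₂ w z≢u z≢y t≢u t≢y w-sym) qA (𝔼-swap w w-sym u y) (𝔼-swap w w-sym z t)
            where
            ar : ∀ {e12 e1 e2 e q x d1 d2} → e12 - e1 ≡ e2 - e + + 2 * (q * x) → q ≡ 1ℤ → e1 ≡ e + d1 → e2 ≡ e + d2 →
                 e12 ≡ e + (d1 + d2 + + 2 * x)
            ar {e12} {e = e} {x = x} {d1} {d2} h refl refl refl = trans (trans (sym (x-y+y≡x e12 (e + d1))) (cong (_+ (e + d1)) h)) (E₁₂-identity e x d1 d2)
          S₁₂ : S w₁₂ ≡ S w + (ΔS W u y + ΔS W z t)
          S₁₂ = ar (S-swap₂ w z≢u z≢y t≢u t≢y) (S-swap w u y) (S-swap w z t)
            where
            ar : ∀ {e12 e1 e2 e d1 d2} → e12 - e1 ≡ e2 - e → e1 ≡ e + d1 → e2 ≡ e + d2 → e12 ≡ e + (d1 + d2)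
            ar {e12} {e = e} {d1} {d2} h refl refl = trans (trans (sym (x-y+y≡x e12 (e + d1))) (cong (_+ (e + d1)) h)) (S₁₂-identity e d1 d2)
          P≤ : M * (nn * nn) * (𝔼 w + (ΔE W u y + ΔE W z t + + 2 * quad w u y z t))
               + + 2 * (M * nn) * (S w + (ΔS W u y + ΔS W z t))
               - (S w + (ΔS W u y + ΔS W z t)) * (S w + (ΔS W u y + ΔS W z t)) ≤ P w
          P≤ = subst₂ (λ e s → M * (nn * nn) * e + + 2 * (M * nn) * s - s * s ≤ P w) E₁₂ S₁₂
            (max₂ u y z t (sum≡0ˡ (fz≥0 u) (fz≥0 z) e3) (sum≡0ˡ (fz≥0 y) (fz≥0 t) e4)
                          (sum≡0ʳ (fz≥0 u) (fz≥0 z) e3) (sum≡0ʳ (fz≥0 y) (fz≥0 t) e4) EN₁₂)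
          arith : ∀ a b e s x d1 d2 s1 s2 l1 l2 B →
            a * (e + (d1 + d2 + x)) + + 2 * b * (s + (s1 + s2)) - (s + (s1 + s2)) * (s + (s1 + s2)) ≤ a * e + + 2 * b * s - s * s →
            0ℤ ≤ l1 → 0ℤ ≤ l2 → + 2 * (s1 * s2) ≤ B →
            a * x ≤ (l1 - (a * d1 + s1 * (+ 2 * b - + 2 * s - s1))) + (l2 - (a * d2 + s2 * (+ 2 * b - + 2 * s - s2))) + B
          arith a b e s x d1 d2 s1 s2 l1 l2 B h p q r =
            ≤by (diff h ⊕ p ⊕ q ⊕ diff r) (double-good-identity a b e s x d1 d2 s1 s2 l1 l2 B)

        err≥0 : ∀ u z y t → 0ℤ ≤ err u z y t
        err≥0 u z y t = (δ≥0 z y ⊕ δ≥0 t u ⊕ δ≥0 t y) ⊕ (A≥0 u t ⊕ A≥0 y z ⊕ A≥0 y t) ⊕ (fz≥0 u ⊕ fz≥0 z)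
          ⊕ (fz≥0 y ⊕ fz≥0 t) ⊕ (𝕋≥0 W u y ⊕ 𝕋≥0 W z t) ⊕ proj₁ (N-bd W y t)

        double : ∀ u z y t → A u z ≡ 1ℤ →
          M * (nn * nn) * (ne0 (quad w u y z t) + quad w u y z t) ≤ R u y + R z t + B₀ + + 8 * (M * (nn * nn)) * err u z y t
        double u z y t Auz with ne0-+ (quad w u y z t)
        ... | inj₁ p = ≤-trans (subst (M * (nn * nn) * (ne0 (quad w u y z t) + quad w u y z t) ≤_) (*-zeroʳ (M * (nn * nn)))
                                 (*-monoˡ Mn²≥0 p))
                         (R≥0 u y ⊕ R≥0 z t ⊕ B₀≥0 ⊕ num 8 ⊗ Mn²≥0 ⊗ err≥0 u z y t)
        ... | inj₂ (_ , p) with zero-or-pos (err≥0 u z y t)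
        ...   | inj₁ e0 = ≤-trans (*-monoˡ Mn²≥0 p) (≤-trans (double-good u z y t Auz e0)
                  (≤by (num 8 ⊗ Mn²≥0 ⊗ err≥0 u z y t) (y≡x+y-x (R u y + R z t + B₀) _)))
        ...   | inj₂ 1≤e = ≤-trans (*-monoˡ Mn²≥0 p)
                  (≤by (R≥0 u y ⊕ R≥0 z t ⊕ B₀≥0 ⊕ num 8 ⊗ Mn²≥0 ⊗ diff 1≤e ⊕ num 2 ⊗ Mn²≥0 ⊗ diff (proj₂ (quad-bd W u y z t)))
                    (double-identity (R u y) (R z t) B₀ (M * (nn * nn)) (err u z y t) (quad w u y z t)))

    ∑A-fst : (g : Fin n → ℤ) → ∑² (λ u z → A u z * g u) ≡ ∑ (λ u → deg u * g u)
    ∑A-fst g = ∑-cong (λ u → ∑-*ʳ (g u) (A u))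

    ∑A-snd : (g : Fin n → ℤ) → ∑² (λ u z → A u z * g z) ≡ ∑ (λ u → deg u * g u)
    ∑A-snd g = trans (∑²-comm (λ u z → A u z * g z)) (trans (∑²-cong (λ z u → cong (_* g z) (A-sym u z))) (∑A-fst g))

    ∑deg≤ : (g : Fin n → ℤ) → (∀ u → 0ℤ ≤ g u) → ∑ (λ u → deg u * g u) ≤ Δ * ∑ g
    ∑deg≤ g p = subst (∑ (λ u → deg u * g u) ≤_) (∑-*ˡ Δ g)
      (∑-mono (λ u → *-monoʳ-≤-nonNeg (g u) {{nonNegative (p u)}} (deg≤Δ u)))

    record Spread (w : Mat n) (e d G : ℤ) : Set where
      field
        row-N : ∀ b → row (N w) b ≤ e
        tot   : ∣ ∑² w ∣≤ d
        rich  : ∀ (a b : Fin n → ℤ) → nn * nn ≤ G * ∑² (λ y t → ne0 (w y t - (a y + b t)))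

    module AtLocalMax {w : Mat n} (W : Weight w) (fz : Fin n → ℤ) (fz≥0 : ∀ u → 0ℤ ≤ fz u) (good : 𝔼 (N w) ≡ 0ℤ) (lm : LocalMax fz w)
      {e d f K G : ℤ} (sz : Sizes nn M Δ e d f K G) (sp : Spread w e d G) (∑fz≤ : ∑ fz ≤ f) where
      open Weight W using () renaming (symm to w-sym; irr to w-irr)
      open Sizes sz using (Δ≥0)
      open Spread sp
      module F = Flat W fz fz≥0 good lm
      open F

      SN≤ : S (N w) ≤ M * e
      SN≤ = subst (S (N w) ≤_) (∑-*ʳ e deg) (∑-mono (λ u → *-monoˡ (deg≥0 u) (row-N u)))

      TT RR D Fz Q : ℤ
      TT = ∑² (𝕋 w)
      RR = ∑² R
      D  = ∑² w
      Fz = ∑ fz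
      Q  = ∑² (λ u y → (deg u + deg y) * (𝕋 w u y + (fz u + fz y)))

      TT≤ : TT ≤ + 2 * (M * e)
      TT≤ = subst (_≤ + 2 * (M * e)) (sym (∑𝕋 W)) (*-monoˡ (num 2) SN≤)

      Q≤ : Q ≤ + 4 * (Δ * (M * e)) + + 2 * (nn * (Δ * f)) + + 2 * (M * f)
      Q≤ = ≤-trans (∑²-mono pt) (≤-trans (≤-reflexive eq) fin)
        where
        open ≡-Reasoning
        df : Fin n → ℤ
        df u = deg u * fz u
        pt : ∀ u y → (deg u + deg y) * (𝕋 w u y + (fz u + fz y)) ≤
             + 2 * Δ * 𝕋 w u y + ((df u + deg u * fz y) + (fz u * deg y + df y))
        pt u y = ≤by ((diff (deg≤Δ u) ⊕ diff (deg≤Δ y)) ⊗ 𝕋≥0 W u y) (∑deg≤-identity Δ (deg u) (deg y) (𝕋 w u y) (fz u) (fz y))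
        eq : ∑² (λ u y → + 2 * Δ * 𝕋 w u y + ((df u + deg u * fz y) + (fz u * deg y + df y)))
             ≡ + 2 * Δ * TT + ((nn * ∑ df + M * Fz) + (Fz * M + nn * ∑ df))
        eq = trans (∑²-+ _ _) (cong₂ _+_ (∑²-*ˡ (+ 2 * Δ) (𝕋 w)) (trans (∑²-+ _ _) (cong₂ _+_
               (trans (∑²-+ _ _) (cong₂ _+_ (∑²-fst df) (∑²-outer deg fz)))
               (trans (∑²-+ _ _) (cong₂ _+_ (∑²-outer fz deg) (∑²-snd df))))))
        fin : + 2 * Δ * TT + ((nn * ∑ df + M * Fz) + (Fz * M + nn * ∑ df)) ≤ + 4 * (Δ * (M * e)) + + 2 * (nn * (Δ * f)) + + 2 * (M * f)
        fin = ≤by (num 2 ⊗ Δ≥0 ⊗ diff TT≤ ⊕ num 2 ⊗ num n ⊗ (diff (∑deg≤ fz fz≥0) ⊕ Δ≥0 ⊗ diff ∑fz≤) ⊕ num 2 ⊗ M≥0 ⊗ diff ∑fz≤)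
                (∑deg≤-identity₂ Δ TT nn (∑ df) M Fz f e)

      open FlatArithmetic sz
      open FinalArithmetic sz

      RR≡ : RR ≡ + 16 * (M * (nn * nn)) * Q - (M * (nn * nn) * (+ 4 * S w - + 4 * (nn * 𝔼 w) + + 4 * 𝔼 w)
                    + (+ 2 * (M * nn) - + 2 * S w) * (+ 2 * (M * ∑² w) - + 2 * (nn * S w))
                    - ∑² (λ u y → ΔS W u y * ΔS W u y))
      RR≡ = trans (∑²-- _ _) (cong₂ _-_ (∑²-*ˡ (+ 16 * (M * (nn * nn))) (λ u y → (deg u + deg y) * (𝕋 w u y + (fz u + fz y)))) (∑ΔP W))

      RR≥0 : 0ℤ ≤ RR
      RR≥0 = ∑²-nonneg R≥0

      RR-bound : RR + + 4 * (nn * (S w * S w)) ≤ + 4 * (M * (nn * nn * nn) * 𝔼 w)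
        + (+ 16 * (M * (nn * nn)) * (+ 4 * (Δ * (M * e)) + + 2 * (nn * (Δ * f)) + + 2 * (M * f))
        + + 4 * (M * M * (nn * nn)) + + 8 * (M * M * nn * d) + + 16 * (Δ * (nn * nn * nn * M)))
      RR-bound = subst (λ r → r + + 4 * (nn * (S w * S w)) ≤ _) (sym RR≡)
        (bound₁ Q _ (𝔼 w) (S w) D Q≤ (∑ΔS² W) (proj₁ (𝔼-bd W)) (S-bd W) tot)

      NE-at x-at : Fin n → Fin n → ℤ
      NE-at u z = ∑² (λ y t → ne0 (quad w u y z t))
      x-at u z = ∑² (λ y t → quad w u y z t)

      NE≥ : ∀ u z → nn * nn ≤ G * NE-at u z
      NE≥ u z = subst (λ x → nn * nn ≤ G * x) (∑²-cong (λ y t → cong ne0 (NE≥-identity (w y t) (w y z) (w u t) (w u z))))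
        (rich (λ y → w y z - w u z) (w u))

      x≡ : ∀ u z → x-at u z ≡ D - nn * row w z - nn * row w u + nn * (nn * w u z)
      x≡ u z = trans (∑²-+ (λ y t → w y t - w y z - w u t) (λ _ _ → w u z)) (cong₂ (λ p q → p + q)
          (trans (∑²-- (λ y t → w y t - w y z) (λ _ t → w u t)) (cong₂ (λ p q → p - q)
            (trans (∑²-- w (λ y _ → w y z)) (cong (λ p → D - p) col)) (∑²-snd (w u)))) cst)
        where
        col : ∑² {n} {n} (λ y _ → w y z) ≡ nn * row w z
        col = trans (∑²-fst (λ y → w y z)) (cong (λ p → nn * p) (∑-cong (λ y → w-sym y z)))
        cst : ∑² {n} {n} (λ _ _ → w u z) ≡ nn * (nn * w u z)
        cst = trans (∑²-fst (λ _ → w u z)) (cong (λ p → nn * p) (∑-const n (w u z)))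

      err-sum : ∀ u z → ∑² (λ y t → err u z y t) ≡
        (nn + nn + nn) + (nn * deg u + nn * deg z + M) + nn * (nn * (fz u + fz z)) + (nn * Fz + nn * Fz)
        + (nn * ∑ (𝕋 w u) + nn * ∑ (𝕋 w z)) + ∑² (N w)
      err-sum u z = trans (∑²-+ _ _) (cong₂ _+_ (trans (∑²-+ _ _) (cong₂ _+_ (trans (∑²-+ _ _) (cong₂ _+_ (trans (∑²-+ _ _) (cong₂ _+_ (trans (∑²-+ _ _) (cong₂ _+_
        (trans (∑²-+ _ _) (cong₂ _+_ (trans (∑²-+ _ _) (cong₂ _+_
          (trans (∑²-fst (δ z)) (trans (cong (nn *_) (∑-δ₁ z)) (*-identityʳ nn)))
          (trans (∑²-snd (λ t → δ t u)) (trans (cong (nn *_) (δcol u)) (*-identityʳ nn)))))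
          (trans (∑-cong δcol) (trans (∑-const n 1ℤ) (*-identityʳ nn)))))
        (trans (∑²-+ _ _) (cong₂ _+_ (trans (∑²-+ _ _) (cong₂ _+_ (∑²-snd (A u)) (trans (∑²-fst (λ y → A y z)) (cong (nn *_) (deg-col z))))) refl))))
        (trans (∑²-fst (λ _ → fz u + fz z)) (cong (nn *_) (∑-const n (fz u + fz z))))))
        (trans (∑²-+ _ _) (cong₂ _+_ (∑²-fst fz) (∑²-snd fz)))))
        (trans (∑²-+ _ _) (cong₂ _+_ (∑²-fst (𝕋 w u)) (∑²-snd (𝕋 w z)))))) refl)
        where δcol : ∀ u → ∑ (λ t → δ t u) ≡ 1ℤ
              δcol u = trans (∑-cong (λ t → δ-sym t u)) (∑-δ₁ u)

      g : Fin n → ℤ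
      g u = nn * ∑ (R u) + + 8 * (M * (nn * nn)) * (nn * deg u + nn * nn * fz u + nn * ∑ (𝕋 w u))

      c : ℤ
      c = nn * (nn * B₀) + + 8 * (M * (nn * nn)) * (+ 3 * nn + M + + 2 * (nn * Fz) + ∑² (N w))

      at-edge : ∀ u z → A u z ≡ 1ℤ → M * (nn * nn) * (NE-at u z + x-at u z) ≤ g u + g z + c
      at-edge u z Auz = subst₂ _≤_ left right (∑²-mono (λ y t → double u z y t Auz))
        where
        left : ∑² (λ y t → M * (nn * nn) * (ne0 (quad w u y z t) + quad w u y z t)) ≡ M * (nn * nn) * (NE-at u z + x-at u z)
        left = trans (∑²-*ˡ (M * (nn * nn)) (λ y t → ne0 (quad w u y z t) + quad w u y z t)) (cong (M * (nn * nn) *_) (∑²-+ _ _))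
        right : ∑² (λ y t → R u y + R z t + B₀ + + 8 * (M * (nn * nn)) * err u z y t) ≡ g u + g z + c
        right = trans (trans (∑²-+ _ _) (cong₂ _+_ (trans (∑²-+ _ _) (cong₂ _+_ (trans (∑²-+ _ _) (cong₂ _+_
                  (∑²-fst (R u)) (∑²-snd (R z)))) (trans (∑²-fst (λ _ → B₀)) (cong (nn *_) (∑-const n B₀)))))
                  (trans (∑²-*ˡ (+ 8 * (M * (nn * nn))) (err u z)) (cong (+ 8 * (M * (nn * nn)) *_) (err-sum u z)))))
                (at-edge-identity (nn * ∑ (R u)) (nn * ∑ (R z)) (nn * (nn * B₀)) (+ 8 * (M * (nn * nn))) nn (deg u) (deg z) M (fz u) (fz z) (nn * Fz) (nn * ∑ (𝕋 w u)) (nn * ∑ (𝕋 w z)) (∑² (N w)))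

      NE : ℤ
      NE = ∑² (λ u z → A u z * NE-at u z)

      G*NE : M * (nn * nn) ≤ G * NE
      G*NE = subst₂ _≤_ (∑A-const (nn * nn)) (trans (∑²-cong (λ u z → G*NE-identity (A u z) G (NE-at u z))) (∑²-*ˡ G (λ u z → A u z * NE-at u z)))
        (∑²-mono (λ u z → *-monoˡ (A≥0 u z) (NE≥ u z)))
        where
        ∑A-const : ∀ k → ∑² (λ u z → A u z * k) ≡ M * k
        ∑A-const k = trans (∑-cong (λ u → ∑-*ʳ k (A u))) (∑-*ʳ k deg)

      ∑Ax : ∑² (λ u z → A u z * x-at u z) ≡ M * D - + 2 * (nn * S w) + nn * nn * 𝔼 w
      ∑Ax = begin
        ∑² (λ u z → A u z * x-at u z)
          ≡⟨ ∑²-cong (λ u z → trans (cong (A u z *_) (x≡ u z)) (∑Ax-identity (A u z) D nn (row w z) (row w u) (w u z))) ⟩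
        ∑² (λ u z → A u z * D - nn * (A u z * row w z) - nn * (A u z * row w u) + nn * nn * (A u z * w u z))
          ≡⟨ trans (∑²-+ _ _) (cong₂ _+_ (trans (∑²-- _ _) (cong₂ _-_ (trans (∑²-- _ _) (cong₂ _-_
               (trans (∑-cong (λ u → ∑-*ʳ D (A u))) (∑-*ʳ D deg))
               (trans (∑²-*ˡ nn _) (cong (nn *_) (∑A-snd (row w))))))
               (trans (∑²-*ˡ nn _) (cong (nn *_) (∑A-fst (row w))))))
               (∑²-*ˡ (nn * nn) _)) ⟩
        M * D - nn * S w - nn * S w + nn * nn * 𝔼 w ≡⟨ ∑Ax-identity₂ (M * D) (nn * S w) (nn * nn * 𝔼 w) ⟩
        M * D - + 2 * (nn * S w) + nn * nn * 𝔼 w ∎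
        where
        open ≡-Reasoning

      a b : ℤ
      a = nn * M + nn * nn * Fz + nn * TT
      b = + 3 * nn + M + + 2 * (nn * Fz) + ∑² (N w)

      g≥0 : ∀ u → 0ℤ ≤ g u
      g≥0 u = num n ⊗ ∑-nonneg (R≥0 u) ⊕ num 8 ⊗ Mn²≥0 ⊗ (num n ⊗ deg≥0 u ⊕ num n ⊗ num n ⊗ fz≥0 u ⊕ num n ⊗ ∑-nonneg (𝕋≥0 W u))

      ∑g : ∑ g ≡ nn * RR + + 8 * (M * (nn * nn)) * a
      ∑g = trans (∑-+ _ _) (cong₂ _+_ (∑-*ˡ nn _) (trans (∑-*ˡ (+ 8 * (M * (nn * nn))) (λ u → nn * deg u + nn * nn * fz u + nn * ∑ (𝕋 w u)))
        (cong (+ 8 * (M * (nn * nn)) *_) (trans (∑-+ _ _) (cong₂ _+_ (trans (∑-+ _ _) (cong₂ _+_ (∑-*ˡ nn deg) (∑-*ˡ (nn * nn) fz))) (∑-*ˡ nn _))))))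

      summed : M * (nn * nn) * (NE + (M * D - + 2 * (nn * S w) + nn * nn * 𝔼 w))
               ≤ + 2 * (Δ * (nn * RR + + 8 * (M * (nn * nn)) * a)) + M * (nn * (nn * (+ 32 * (Δ * Δ * (nn * nn)))) + + 8 * (M * (nn * nn)) * b)
      summed = ≤-trans (subst₂ _≤_ left right (∑²-mono edgewise)) (≤by (num 2 ⊗ diff (∑deg≤ g g≥0)) (trans (summed-identity (∑ (λ u → deg u * g u)) (Δ * ∑ g) (M * c))
          (cong (λ s → + 2 * (Δ * s) + M * c - (+ 2 * ∑ (λ u → deg u * g u) + M * c)) ∑g)))
        where
        m² = M * (nn * nn)
        edgewise : ∀ u z → m² * (A u z * NE-at u z + A u z * x-at u z) ≤ A u z * g u + A u z * g z + A u z * c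
        edgewise u z = by-cases m² (NE-at u z) (x-at u z) (g u) (g z) c (A-val u z) (at-edge u z)
          where
          by-cases : ∀ {α} m p q r s t → α ≡ 0ℤ ⊎ α ≡ 1ℤ → (α ≡ 1ℤ → m * (p + q) ≤ r + s + t) →
            m * (α * p + α * q) ≤ α * r + α * s + α * t
          by-cases m p q r s t (inj₁ refl) _ = ≤-reflexive (edgewise-identity m p q r s t)
          by-cases m p q r s t (inj₂ refl) h = subst₂ _≤_ (edgewise-identity₂ m p q) (edgewise-identity₃ r s t) (h refl)
        left : ∑² (λ u z → m² * (A u z * NE-at u z + A u z * x-at u z)) ≡ m² * (NE + (M * D - + 2 * (nn * S w) + nn * nn * 𝔼 w))
        left = trans (∑²-*ˡ m² (λ u z → A u z * NE-at u z + A u z * x-at u z)) (cong (m² *_) (trans (∑²-+ _ _) (cong (λ z → NE + z) ∑Ax)))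
        right : ∑² (λ u z → A u z * g u + A u z * g z + A u z * c) ≡ + 2 * ∑ (λ u → deg u * g u) + M * c
        right = trans (∑²-+ _ _) (cong₂ _+_ (trans (∑²-+ _ _) (trans (cong₂ _+_ (∑A-fst g) (∑A-snd g)) (x+x≡2x (∑ (λ u → deg u * g u)))))
          (trans (∑-cong (λ u → ∑-*ʳ c (A u))) (∑-*ʳ c deg)))

      climb : M < K * 𝔼 w
      climb with M <? K * 𝔼 w
      ... | yes p = p
      ... | no ¬p = ⊥-elim (final RR a b NE D (S w) (𝔼 w) (KRR≤ {RR} {𝔼 w} {S w} RR≥0 KE≤M RR-bound) (errA Fz TT ∑fz≤ TT≤)
          (errB Fz (∑² (N w)) ∑fz≤ NN≤) (proj₁ tot) (8GS≤ {RR} {𝔼 w} {S w} RR≥0 KE≤M RR-bound) (𝔼≥ {RR} {𝔼 w} {S w} RR≥0 KE≤M RR-bound) G*NE summed)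
        where
        KE≤M = ≮⇒≥ ¬p
        NN≤ : ∑² (N w) ≤ nn * e
        NN≤ = subst (∑² (N w) ≤_) (∑-const n e) (∑-mono row-N)

    Good : Mat n → Permutation′ n → Set
    Good v φ = 𝔼 (N (pull v φ)) ≡ 0ℤ

    pull-spread : ∀ {v e d G} → Spread v e d G → ∀ φ → Spread (pull v φ) e d G
    pull-spread {v} {e} {d} {G} sp φ = record
      { row-N = λ b → subst (_≤ e) (sym (∑-permute (N v (φ ⟨$⟩ʳ b)) φ)) (Spread.row-N sp (φ ⟨$⟩ʳ b))
      ; tot   = subst (∣_∣≤ d) (sym (∑²-permute v φ)) (Spread.tot sp)
      ; rich  = λ a b → subst (λ x → nn * nn ≤ G * x)
          (trans (sym (∑²-permute (λ y t → ne0 (v y t - (a (φ ⟨$⟩ˡ y) + b (φ ⟨$⟩ˡ t)))) φ))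
            (∑²-cong (λ y t → cong₂ (λ p q → ne0 (pull v φ y t - (a p + b q))) (Perm.inverseˡ φ) (Perm.inverseˡ φ))))
          (Spread.rich sp (λ y → a (φ ⟨$⟩ˡ y)) (λ t → b (φ ⟨$⟩ˡ t)))
      }

    𝔼-cong : ∀ {w w′ : Mat n} → (∀ a b → w a b ≡ w′ a b) → 𝔼 w ≡ 𝔼 w′
    𝔼-cong p = ∑²-cong (λ a b → cong (A a b *_) (p a b))

    𝔼-neg : ∀ (w : Mat n) → 𝔼 (λ a b → - w a b) ≡ - 𝔼 w
    𝔼-neg w = trans (∑²-cong (λ a b → 𝔼-neg-identity (A a b) (w a b))) (trans (∑-cong (λ a → ∑-neg (λ b → A a b * w a b))) (∑-neg _))

    neg-spread : ∀ {v e d G} → Spread v e d G → Spread (λ a b → - v a b) e d G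
    neg-spread {v} {e} {d} {G} sp = record
      { row-N = λ b → subst (_≤ e) (sym (∑-cong (N-neg v b))) (Spread.row-N sp b)
      ; tot   = subst (∣_∣≤ d) (sym (trans (∑-cong (λ a → ∑-neg (v a))) (∑-neg _))) (bd-neg (Spread.tot sp))
      ; rich  = λ a b → subst (λ x → nn * nn ≤ G * x)
          (∑²-cong (λ y t → trans (sym (ne0-neg _)) (cong ne0 (neg-spread-identity (v y t) (a y) (b t)))))
          (Spread.rich sp (λ y → - a y) (λ t → - b t))
      }

    good-neg : ∀ {v φ} → Good v φ → Good (λ a b → - v a b) φ
    good-neg {v} {φ} g = trans (𝔼-cong (N-neg (pull v φ))) g

    good-neg⁻ : ∀ {v φ} → Good (λ a b → - v a b) φ → Good v φ
    good-neg⁻ {v} {φ} g = trans (sym (𝔼-cong (N-neg (pull v φ)))) g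

    step≤ : ∀ {w} (W : Weight w) u y → 𝔼 (w ⟪ u ⇄ y ⟫) ≤ 𝔼 w + + 16 * Δ
    step≤ {w} W u y = ≤-trans (≤-reflexive (𝔼-swap w (Weight.symm W) u y))
      (+-monoʳ-≤ (𝔼 w) (≤-trans (proj₂ (ΔE-bd W u y)) (arith (deg u) (deg y) Δ (Adjacency.deg≤ H u) (Adjacency.deg≤ H y))))
      where arith : ∀ p q D → p ≤ D → q ≤ D → + 8 * (p + q) ≤ + 16 * D
            arith p q D h k = ≤by (num 8 ⊗ diff h ⊕ num 8 ⊗ diff k) (step≤-identity p q D)

    module _ (F : List (Fin n)) (w : Mat n) where
      Free : Fin n → Set
      Free u = cnt F u ≡ 0ℤ

      Better : Mat n → Set
      Better w′ = 𝔼 (N w′) ≤ 0ℤ × P w < P w′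

      Improve₁ Improve₂ : Set
      Improve₁ = ∃[ u ] ∃[ y ] (Free u × Free y) × Better (w ⟪ u ⇄ y ⟫)
      Improve₂ = ∃[ u ] ∃[ y ] ∃[ z ] ∃[ t ] ((Free u × Free y) × (Free z × Free t)) × Better (w ⟪ u ⇄ y ⟫ ⟪ z ⇄ t ⟫)

      better? : ∀ w′ → Dec (Better w′)
      better? w′ = (𝔼 (N w′) ≤? 0ℤ) ×-dec (P w <? P w′)

      free? : ∀ u → Dec (Free u)
      free? u = cnt F u ≟ 0ℤ

      improve₁? : Dec Improve₁
      improve₁? = any? (λ u → any? (λ y → (free? u ×-dec free? y) ×-dec better? _))

      improve₂? : Dec Improve₂
      improve₂? = any? (λ u → any? (λ y → any? (λ z → any? (λ t →
        ((free? u ×-dec free? y) ×-dec (free? z ×-dec free? t)) ×-dec better? _))))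

      stuck⇒max : ¬ Improve₁ → ¬ Improve₂ → LocalMax (cnt F) w
      stuck⇒max p q = record
        { max₁ = λ u y fu fy g → ≮⇒≥ (λ h → p (u , y , (fu , fy) , g , h))
        ; max₂ = λ u y z t fu fy fz ft g → ≮⇒≥ (λ h → q (u , y , z , t , ((fu , fy) , (fz , ft)) , g , h))
        }

    module _ {e d f K G : ℤ} (sz : Sizes nn M Δ e d f K G) (F : List (Fin n)) (F≤f : + length F ≤ f) where
      open Sizes sz using (Δ≥0; K≥0)

      C : ℤ
      C = + 32 * Δ

      ∑cnt≤f : ∑ (cnt F) ≤ f
      ∑cnt≤f = subst (_≤ f) (sym (∑cnt F)) F≤f

      module _ {v : Mat n} (W : Weight v) (sp : Spread v e d G) where

        Target : Permutation′ n → ℤ → Set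
        Target φ k = ∃[ θ ] Good v θ × AgreeOn F θ φ × (k - C ≤ 𝔼 (pull v θ)) × (𝔼 (pull v θ) ≤ k)

        good≡ : ∀ {φ} → 𝔼 (N (pull v φ)) ≤ 0ℤ → Good v φ
        good≡ {φ} p = ≤-antisym p (EN≥0 (weight-permute W φ))

        ascend : ∀ fuel k φ → K * k ≤ M → + 3 * (M * M * (nn * nn)) ≤ P (pull v φ) + + fuel →
          Good v φ → 𝔼 (pull v φ) ≤ k → Target φ k
        next : ∀ fuel k φ ψ → K * k ≤ M → + 3 * (M * M * (nn * nn)) ≤ P (pull v φ) + + fuel →
          AgreeOn F ψ φ → Good v ψ → P (pull v φ) < P (pull v ψ) → 𝔼 (pull v ψ) ≤ 𝔼 (pull v φ) + C →
          𝔼 (pull v φ) ≤ k - C → Target φ k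

        ascend fuel k φ Kk≤M enough g 𝔼≤k with k - C ≤? 𝔼 (pull v φ)
        ... | yes p = φ , g , (λ _ → refl) , p , 𝔼≤k
        ... | no ¬p with improve₁? F (pull v φ)
        ...   | yes (u , y , (fu , fy) , g′ , P<) = next fuel k φ (swap u y φ) Kk≤M enough (swap-agree φ fu fy) (good≡ {swap u y φ} g′) P<
                  (≤-trans (step≤ (weight-permute W φ) u y) (+-monoʳ-≤ (𝔼 (pull v φ)) (≤by (num 16 ⊗ Δ≥0) (ascend-identity Δ)))) (<⇒≤ (≰⇒> ¬p))
        ...   | no ¬1 with improve₂? F (pull v φ)
        ...     | yes (u , y , z , t , ((fu , fy) , (fz , ft)) , g′ , P<) =
                  next fuel k φ (swap z t (swap u y φ)) Kk≤M enough
                    (agree-trans {F = F} {swap z t (swap u y φ)} {swap u y φ} {φ} (swap-agree (swap u y φ) fz ft) (swap-agree φ fu fy))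
                    (good≡ {swap z t (swap u y φ)} g′) P<
                    (≤-trans (step≤ (weight-permute W (swap u y φ)) z t)
                      (≤-trans (+-monoˡ-≤ (+ 16 * Δ) (step≤ (weight-permute W φ) u y)) (≤-reflexive (ascend-identity₂ (𝔼 (pull v φ)) Δ)))) (<⇒≤ (≰⇒> ¬p))
        ...     | no ¬2 = ≤-absurd (≤-trans (*-monoˡ K≥0 𝔼≤k) Kk≤M)
                  (AtLocalMax.climb (weight-permute W φ) (cnt F) (cnt≥0 F) g (stuck⇒max F (pull v φ) ¬1 ¬2) sz (pull-spread sp φ) ∑cnt≤f)

        next ℕ.zero k φ ψ _ enough _ _ P< _ _ = ≤-absurd (P-bd (weight-permute W ψ))
          (≤-<-trans (subst (_ ≤_) (+-identityʳ _) enough) P<)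
        next (ℕ.suc fuel) k φ ψ Kk≤M enough ag g P< 𝔼≤ 𝔼≤k-C =
          let θ , gθ , agθ , lo , hi = ascend fuel k ψ Kk≤M (arith (+ 3 * (M * M * (nn * nn))) (P (pull v φ)) (P (pull v ψ)) enough (<⇒1+≤ P<)) g (≤-trans 𝔼≤ (arith₂ (𝔼 (pull v φ)) 𝔼≤k-C))
          in θ , gθ , agree-trans {F = F} {θ} {ψ} {φ} agθ ag , lo , hi
          where
          arith : ∀ b p q → b ≤ p + +[1+ fuel ] → 1ℤ + p ≤ q → b ≤ q + + fuel
          arith b p q h k = ≤by (diff h ⊕ diff k) (next-identity b p q (+ fuel))
          arith₂ : ∀ e → e ≤ k - C → e + C ≤ k
          arith₂ e h = ≤by (diff h) (next-identity₂ k C e)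

        ascend-to : ∀ k φ → K * k ≤ M → Good v φ → 𝔼 (pull v φ) ≤ k → Target φ k
        ascend-to k φ Kk≤M = ascend ∣ gap ∣ k φ Kk≤M (≤-reflexive (sym (trans (cong (λ x → P (pull v φ) + x) (0≤i⇒+∣i∣≡i gap≥0)) (ascend-to-identity (P (pull v φ)) (+ 3 * (M * M * (nn * nn)))))))
          where
          gap = + 3 * (M * M * (nn * nn)) - P (pull v φ)
          gap≥0 : 0ℤ ≤ gap
          gap≥0 = diff (P-bd (weight-permute W φ))

      module _ {v : Mat n} (W : Weight v) (sp : Spread v e d G) where

        reach : ∀ k φ → K * k ≤ M → K * (C - k) ≤ M → Good v φ → Target W sp φ k
        reach k φ hi lo g with 𝔼 (pull v φ) ≤? k
        ... | yes 𝔼≤k = ascend-to W sp k φ hi g 𝔼≤k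
        ... | no 𝔼≰k =
          let ψ , gψ , agψ , p , _ = ascend-to (weight-neg W) (neg-spread sp) (C - k) φ lo (good-neg {v} {φ} g)
                                       (≤-trans (≤-reflexive (𝔼-neg (pull v φ))) (arith₁ (≰⇒> 𝔼≰k)))
              θ , gθ , agθ , p′ , q′ = ascend-to W sp k ψ hi (good-neg⁻ {v} {ψ} gψ) (arith₂ (subst (C - k - C ≤_) (𝔼-neg (pull v ψ)) p))
          in θ , gθ , agree-trans {F = F} {θ} {ψ} {φ} agθ agψ , p′ , q′
          where
          arith₁ : ∀ {x} → k < x → - x ≤ C - k
          arith₁ {x} h = ≤by (num 32 ⊗ Δ≥0 ⊕ diff (<⇒≤ h)) (reach-identity k x C)
          arith₂ : ∀ {x} → C - k - C ≤ - x → x ≤ k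
          arith₂ {x} h = ≤by (diff h) (reach-identity₂ k x C)

    ∑𝕋-row : ∀ {v} (W : Weight v) {e} → (∀ b → row (N v) b ≤ e) → 0ℤ ≤ Δ → ∀ u → ∑ (𝕋 v u) ≤ + 2 * (Δ * e)
    ∑𝕋-row {v} W {e} hN Δ≥0 u = ≤-trans (≤-reflexive (trans (∑²-+ _ _) (cong₂ _+_
        (trans (∑-comm (λ y b → A u b * N v y b)) (∑-cong (λ b → trans (∑-*ˡ (A u b) _) (cong (A u b *_) (∑-cong (λ y → N-sym W y b))))))
        (trans (∑-comm (λ y b → A y b * N v u b)) (∑-cong (λ b → trans (∑-*ʳ (N v u b) _) (cong (_* N v u b) (deg-col b))))))))
      (≤-trans (+-mono-≤ p q) (≤-reflexive (x+x≡2x (Δ * e))))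
      where
      e≥0 : 0ℤ ≤ e
      e≥0 = ≤-trans (∑-nonneg (λ b → proj₁ (N-bd W u b))) (hN u)
      p : ∑ (λ b → A u b * row (N v) b) ≤ Δ * e
      p = ≤-trans (∑-mono (λ b → *-monoˡ (A≥0 u b) (hN b))) (≤-trans (≤-reflexive (∑-*ʳ e (A u))) (*-monoʳ-≤-nonNeg e {{nonNegative e≥0}} (Adjacency.deg≤ H u)))
      q : ∑ (λ b → deg b * N v u b) ≤ Δ * e
      q = ≤-trans (∑deg≤ (N v u) (λ b → proj₁ (N-bd W u b))) (*-monoˡ Δ≥0 (hN u))

    module _ {v : Mat n} (W : Weight v) {e : ℤ} (hN : ∀ b → row (N v) b ≤ e) (F : List (Fin n))
      (Δ≥0 : 0ℤ ≤ Δ) (room : + 2 * (Δ * e) + + length F < nn) where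

      FrozenGood : Permutation′ n → Set
      FrozenGood φ = ∀ {a b} → a ∈ F → b ∈ F → A a b * N (pull v φ) a b ≤ 0ℤ

      spot : ∀ φ u → ∃[ y ] 𝕋 (pull v φ) u y ≡ 0ℤ × cnt F y ≡ 0ℤ
      spot φ u = let y , p = ∑<⇒∃< (λ y → 𝕋 (pull v φ) u y + cnt F y) (λ _ → 1ℤ) small
                     z = small⇒0 (cnt≥0-𝕋 y) p
                 in y , sum≡0ˡ (𝕋≥0 (weight-permute W φ) u y) (cnt≥0 F y) z , sum≡0ʳ (𝕋≥0 (weight-permute W φ) u y) (cnt≥0 F y) z
        where
        cnt≥0-𝕋 : ∀ y → 0ℤ ≤ 𝕋 (pull v φ) u y + cnt F y
        cnt≥0-𝕋 y = 𝕋≥0 (weight-permute W φ) u y ⊕ cnt≥0 F y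
        small⇒0 : ∀ {x} → 0ℤ ≤ x → x < 1ℤ → x ≡ 0ℤ
        small⇒0 p q with zero-or-pos p
        ... | inj₁ e = e
        ... | inj₂ r = ≤-absurd r q
        small : ∑ (λ y → 𝕋 (pull v φ) u y + cnt F y) < ∑ {n} (λ _ → 1ℤ)
        small = subst₂ _<_ (sym (∑-+ (𝕋 (pull v φ) u) (cnt F))) (sym (trans (∑-const n 1ℤ) (*-identityʳ nn)))
          (≤-<-trans (+-mono-≤ (∑𝕋-row (weight-permute W φ) (λ b → subst (_≤ e) (sym (∑-permute (N v (φ ⟨$⟩ʳ b)) φ)) (hN (φ ⟨$⟩ʳ b))) Δ≥0 u)
                               (≤-reflexive (∑cnt F))) room)

      repair-step : ∀ φ u b → 1ℤ ≤ A u b * N (pull v φ) u b → cnt F u ≡ 0ℤ →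
        ∃[ ψ ] AgreeOn F ψ φ × 𝔼 (N (pull v ψ)) < 𝔼 (N (pull v φ))
      repair-step φ u b bad fu = let y , T0 , fy = spot φ u in
        swap u y φ , swap-agree φ fu fy , 1+≤⇒< (≤-trans (+-monoʳ-≤ 1ℤ (EN-swap (weight-permute W φ) u y)) (arith T0 bad₂))
        where
        bad₂ : 1ℤ ≤ ∑ (λ b → A u b * N (pull v φ) u b)
        bad₂ = ≤-trans bad (term≤∑ (λ b → A≥0 u b ⊗ proj₁ (N-bd (weight-permute W φ) u b)) b)
        arith : ∀ {e t g} → t ≡ 0ℤ → 1ℤ ≤ g → 1ℤ + (e + (+ 2 * t - + 2 * g)) ≤ e
        arith {e} {g = g} refl h = ≤by (num 2 ⊗ diff h ⊕ num 1) (repair-step-identity e g)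

      repair : ∀ fuel φ → 𝔼 (N (pull v φ)) ≤ + fuel → FrozenGood φ → ∃[ ψ ] Good v ψ × AgreeOn F ψ φ
      repair fuel φ 𝔼≤ fg with zero-or-pos (EN≥0 (weight-permute W φ))
      ... | inj₁ g = φ , g , λ _ → refl
      ... | inj₂ pos with ∑∑<⇒∃< (λ _ _ → 0ℤ) (λ a b → A a b * N (pull v φ) a b)
                           (<-≤-trans (subst (_< 1ℤ) (sym (trans (∑-cong {g = λ _ → 0ℤ} (λ _ → ∑-zero n)) (∑-zero n))) (+<+ (ℕ.s≤s ℕ.z≤n))) pos)
      ...   | a , b , ab = finish fuel 𝔼≤ step
        where
        ab′ : 1ℤ ≤ A a b * N (pull v φ) a b
        ab′ = <⇒1+≤ ab
        step : ∃[ ψ ] AgreeOn F ψ φ × 𝔼 (N (pull v ψ)) < 𝔼 (N (pull v φ))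
        step with zero-or-pos (cnt≥0 F a) | zero-or-pos (cnt≥0 F b)
        ... | inj₁ fa | _       = repair-step φ a b ab′ fa
        ... | inj₂ _  | inj₁ fb = repair-step φ b a (subst (1ℤ ≤_) (cong₂ _*_ (A-symm a b) (N-sym (weight-permute W φ) a b)) ab′) fb
          where A-symm = Adjacency.symm H
        ... | inj₂ ia | inj₂ ib = ≤-absurd (fg (1≤cnt⇒∈ ia) (1≤cnt⇒∈ ib)) ab
        finish : ∀ fuel → 𝔼 (N (pull v φ)) ≤ + fuel → (∃[ ψ ] AgreeOn F ψ φ × 𝔼 (N (pull v ψ)) < 𝔼 (N (pull v φ))) → ∃[ ψ ] Good v ψ × AgreeOn F ψ φ
        finish ℕ.zero    h _ = ≤-absurd h (<-≤-trans (+<+ (ℕ.s≤s ℕ.z≤n)) pos)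
        finish (ℕ.suc k) h (ψ , ag , lt) =
          let θ , gθ , agθ = repair k ψ (pred-≤ (≤-trans (<⇒1+≤ lt) h))
                               (λ {x} {y} x∈ y∈ → subst₂ (λ p q → A x y * N v p q ≤ 0ℤ) (sym (ag x∈)) (sym (ag y∈)) (fg x∈ y∈))
          in θ , gθ , agree-trans {F = F} {θ} {ψ} {φ} agθ ag
          where
          pred-≤ : ∀ {x} → 1ℤ + x ≤ +[1+ k ] → x ≤ + k
          pred-≤ {x} h = ≤by (diff h) (pred-≤-identity x (+ k))

    ∑∑A≤ : (g : Fin n → ℤ) → (∀ u → 0ℤ ≤ g u) → ∑² (λ u b → A u b * g b) ≤ Δ * ∑ g
    ∑∑A≤ g p = ≤-trans (≤-reflexive (∑A-snd g)) (∑deg≤ g p)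

    near far : List (Fin n) → Fin n → ℤ
    near F u = ∑ (λ b → A u b * cnt F b)
    far  F u = cnt F u + near F u + ∑ (λ b → A u b * near F b)

    near≥0 : ∀ F u → 0ℤ ≤ near F u
    near≥0 F u = ∑-nonneg (λ b → A≥0 u b ⊗ cnt≥0 F b)

    far≥0 : ∀ F u → 0ℤ ≤ far F u
    far≥0 F u = cnt≥0 F u ⊕ near≥0 F u ⊕ ∑-nonneg (λ b → A≥0 u b ⊗ near≥0 F b)

    ∑far : 0ℤ ≤ Δ → ∀ F → ∑ (far F) ≤ (1ℤ + Δ + Δ * Δ) * + length F
    ∑far Δ≥0 F = ≤-trans (≤-reflexive (trans (∑-+ _ _) (cong (λ z → z + ∑ (λ u → ∑ (λ b → A u b * near F b))) (trans (∑-+ _ _) (cong (λ z → z + ∑ (near F)) (∑cnt F))))))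
      (arith (+ length F) (∑ (near F)) _ (subst (λ x → ∑ (near F) ≤ Δ * x) (∑cnt F) (∑∑A≤ (cnt F) (cnt≥0 F))) (∑∑A≤ (near F) (near≥0 F)))
      where
      arith : ∀ l p q → p ≤ Δ * l → q ≤ Δ * p → l + p + q ≤ (1ℤ + Δ + Δ * Δ) * l
      arith l p q h k = ≤by (diff h ⊕ diff k ⊕ Δ≥0 ⊗ diff h) (∑far-identity Δ l p q)

    record Far (F : List (Fin n)) (u : Fin n) : Set where
      field
        out  : u ∉ F
        out₁ : ∀ {b} → b ∈ F → A u b ≡ 0ℤ
        out₂ : ∀ {c b} → b ∈ F → A u c ≡ 1ℤ → A c b ≡ 0ℤ

    A≡0or1 : ∀ a b → A a b ≡ 0ℤ ⊎ A a b ≡ 1ℤ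
    A≡0or1 = Adjacency.val H

    ∈⇒1≤cnt : ∀ {F : List (Fin n)} {u} → u ∈ F → 1ℤ ≤ cnt F u
    ∈⇒1≤cnt {F} {u} u∈F with zero-or-pos (cnt≥0 F u)
    ... | inj₁ e = ⊥-elim (cnt≡0⇒∉ {F = F} e u∈F)
    ... | inj₂ p = p

    near≡0 : ∀ F u → near F u ≡ 0ℤ → ∀ {b} → b ∈ F → A u b ≡ 0ℤ
    near≡0 F u e {b} b∈F with A≡0or1 u b
    ... | inj₁ p = p
    ... | inj₂ p = ≤-absurd (subst (A u b * cnt F b ≤_) e (term≤∑ (λ b → A≥0 u b ⊗ cnt≥0 F b) b))
                     (subst (λ a → 0ℤ < a * cnt F b) (sym p) (subst (0ℤ <_) (sym (*-identityˡ _)) (1+≤⇒< (∈⇒1≤cnt b∈F))))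

    far⇒Far : ∀ F u → far F u ≡ 0ℤ → Far F u
    far⇒Far F u e = record
      { out  = cnt≡0⇒∉ {F = F} (sum≡0ˡ (cnt≥0 F u) (near≥0 F u) e₁)
      ; out₁ = near≡0 F u (sum≡0ʳ (cnt≥0 F u) (near≥0 F u) e₁)
      ; out₂ = λ {c} b∈F Auc → near≡0 F c (near-c c Auc) b∈F
      }
      where
      s≥0 = ∑-nonneg (λ b → A≥0 u b ⊗ near≥0 F b)
      e₁ = sum≡0ˡ (cnt≥0 F u ⊕ near≥0 F u) s≥0 e
      e₂ : ∑ (λ b → A u b * near F b) ≡ 0ℤ
      e₂ = sum≡0ʳ (cnt≥0 F u ⊕ near≥0 F u) s≥0 e
      near-c : ∀ c → A u c ≡ 1ℤ → near F c ≡ 0ℤ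
      near-c c p = ≤-antisym (≤-trans (≤-reflexive (sym (trans (cong (_* near F c) p) (*-identityˡ (near F c)))))
        (subst (A u c * near F c ≤_) e₂ (term≤∑ (λ b → A≥0 u b ⊗ near≥0 F b) c))) (near≥0 F c)

    nbrs : Fin n → List (Fin n)
    nbrs u = support (A u)

    length-nbrs : ∀ u → + length (nbrs u) ≤ Δ
    length-nbrs u = ≤-trans (length-support≤ (A u) (A≥0 u)) (Adjacency.deg≤ H u)

    ∈nbrs : ∀ {u b} → A u b ≡ 1ℤ → b ∈ nbrs u
    ∈nbrs {u} p = ∈-support⁺ (A u) (≤-reflexive (sym p))

    nbrs⇒A≡1 : ∀ {u b} → b ∈ nbrs u → A u b ≡ 1ℤ
    nbrs⇒A≡1 {u} {b} p with A≡0or1 u b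
    ... | inj₂ q = q
    ... | inj₁ q with subst (1ℤ ≤_) q (∈-support⁻ (A u) p)
    ...   | +≤+ ()

    Ok : Mat n → List (Fin n) → Permutation′ n → Set
    Ok v F φ = ∀ {a b} → a ∈ F → b ∈ F → A a b * N v (φ ⟨$⟩ʳ a) (φ ⟨$⟩ʳ b) ≤ 0ℤ

    record Ext (v : Mat n) (F : List (Fin n)) (φ : Permutation′ n) (us : List (Fin n)) (Q : Fin n → Set) : Set where
      field
        F′    : List (Fin n)
        φ′    : Permutation′ n
        old   : ∀ {x} → x ∈ F → x ∈ F′
        new   : ∀ {x} → x ∈ us → x ∈ F′
        agree : AgreeOn F φ′ φ
        ok    : Ok v F′ φ′
        src   : ∀ {x} → x ∈ F′ → x ∈ F ⊎ (x ∈ us × Q (φ′ ⟨$⟩ʳ x))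
        len   : length F′ ℕ.≤ length us ℕ.+ length F

    module _ {v : Mat n} (W : Weight v) where

      place : ∀ {F φ} → Ok v F φ → ∀ u z → u ∉ F → (∀ {x} → x ∈ F → φ ⟨$⟩ʳ x ≢ z) →
        (∀ {b} → b ∈ F → A u b * N v z (φ ⟨$⟩ʳ b) ≤ 0ℤ) → Ext v F φ (u ∷ []) (_≡ z)
      place {F} {φ} ok u z u∉F z∉ hz = record
        { F′ = u ∷ F ; φ′ = φ₁ ; old = there ; new = λ { (here refl) → here refl }
        ; agree = ag ; ok = ok₁ ; src = λ { (here refl) → inj₂ (here refl , at-u) ; (there p) → inj₁ p } ; len = ℕₚ.≤-refl }
        where
        y = φ ⟨$⟩ˡ z
        φ₁ = swap u y φ
        at-u : φ₁ ⟨$⟩ʳ u ≡ z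
        at-u = trans (cong (φ ⟨$⟩ʳ_) (tr-left u y)) (Perm.inverseʳ φ)
        ag : AgreeOn F φ₁ φ
        ag x∈F = cong (φ ⟨$⟩ʳ_) (tr-other (λ { refl → u∉F x∈F }) (λ { refl → z∉ x∈F (Perm.inverseʳ φ) }))
        ok₁ : Ok v (u ∷ F) φ₁
        ok₁ (here refl) (here refl) = ≤-reflexive (trans (cong (λ z → z * N v (φ₁ ⟨$⟩ʳ u) (φ₁ ⟨$⟩ʳ u)) (Adjacency.irr H u)) (*-zeroˡ (N v (φ₁ ⟨$⟩ʳ u) (φ₁ ⟨$⟩ʳ u))))
        ok₁ {_} {b} (here refl) (there b∈F) = subst₂ (λ p q → A u b * N v p q ≤ 0ℤ) (sym at-u) (sym (ag b∈F)) (hz b∈F)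
        ok₁ {a} (there a∈F) (here refl) = subst₂ (λ p q → p * q ≤ 0ℤ) (A-sym u a) (N-sym W _ _)
          (subst₂ (λ p q → A u a * N v p q ≤ 0ℤ) (sym at-u) (sym (ag a∈F)) (hz a∈F))
        ok₁ {a} {b} (there a∈F) (there b∈F) = subst₂ (λ p q → A a b * N v p q ≤ 0ℤ) (sym (ag a∈F)) (sym (ag b∈F)) (ok a∈F b∈F)

      module _ {e : ℤ} (hN : ∀ b → row (N v) b ≤ e) (bad : Fin n → ℤ) (bad≥0 : ∀ z → 0ℤ ≤ bad z) where

        spot-for : ∀ F (φ : Permutation′ n) u → ∑ bad + Δ * e + + length F < nn →
          ∃[ z ] bad z ≡ 0ℤ × (∀ {x} → x ∈ F → φ ⟨$⟩ʳ x ≢ z) × (∀ b → A u b * N v z (φ ⟨$⟩ʳ b) ≤ 0ℤ)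
        spot-for F φ u room = z , sum≡0ˡ (bad≥0 z) (adj≥0 z) e₁
            , (λ {x} x∈F eq → cnt≡0⇒∉ {F = map (φ ⟨$⟩ʳ_) F} (sum≡0ʳ (bad≥0 z ⊕ adj≥0 z) (cnt≥0 (map (φ ⟨$⟩ʳ_) F) z) e₀) (subst (_∈ map (φ ⟨$⟩ʳ_) F) eq (∈-map⁺ (φ ⟨$⟩ʳ_) x∈F)))
            , λ b → subst (A u b * N v z (φ ⟨$⟩ʳ b) ≤_) (sum≡0ʳ (bad≥0 z) (adj≥0 z) e₁) (term≤∑ (λ b → A≥0 u b ⊗ proj₁ (N-bd W z (φ ⟨$⟩ʳ b))) b)
          where
          adj : Fin n → ℤ
          adj z = ∑ (λ b → A u b * N v z (φ ⟨$⟩ʳ b))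
          adj≥0 : ∀ z → 0ℤ ≤ adj z
          adj≥0 z = ∑-nonneg (λ b → A≥0 u b ⊗ proj₁ (N-bd W z (φ ⟨$⟩ʳ b)))
          e≥0 : 0ℤ ≤ e
          e≥0 = ≤-trans (∑-nonneg (λ b → proj₁ (N-bd W u b))) (hN u)
          ∑adj : ∑ adj ≤ Δ * e
          ∑adj = ≤-trans (≤-reflexive (trans (∑-comm (λ z b → A u b * N v z (φ ⟨$⟩ʳ b))) (∑-cong (λ b → trans (∑-*ˡ (A u b) _)
                   (cong (A u b *_) (∑-cong (λ z → N-sym W z (φ ⟨$⟩ʳ b))))))))
                 (≤-trans (∑-mono (λ b → *-monoˡ (A≥0 u b) (hN (φ ⟨$⟩ʳ b))))
                 (≤-trans (≤-reflexive (∑-*ʳ e (A u))) (*-monoʳ-≤-nonNeg e {{nonNegative e≥0}} (Adjacency.deg≤ H u))))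
          total : ∑ (λ z → bad z + adj z + cnt (map (φ ⟨$⟩ʳ_) F) z) < nn
          total = ≤-<-trans (≤-trans (≤-reflexive (trans (∑-+ _ _) (cong₂ _+_ (∑-+ _ _) (trans (∑cnt (map (φ ⟨$⟩ʳ_) F)) (cong +_ (length-map (φ ⟨$⟩ʳ_) F))))))
            (+-monoˡ-≤ (+ length F) (+-monoʳ-≤ (∑ bad) ∑adj))) room
          found = ∑<n⇒∃0 (λ z → bad z + adj z + cnt (map (φ ⟨$⟩ʳ_) F) z) (λ z → bad≥0 z ⊕ adj≥0 z ⊕ cnt≥0 (map (φ ⟨$⟩ʳ_) F) z) total
          z = proj₁ found
          e₀ = proj₂ found
          e₁ = sum≡0ˡ (bad≥0 z ⊕ adj≥0 z) (cnt≥0 (map (φ ⟨$⟩ʳ_) F) z) e₀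

        placeAll : ∀ us {F φ} → Ok v F φ → ∑ bad + Δ * e + + (length us ℕ.+ length F) < nn → Ext v F φ us (λ z → bad z ≡ 0ℤ)
        placeAll [] {F} {φ} ok _ = record { F′ = F ; φ′ = φ ; old = λ p → p ; new = λ () ; agree = λ _ → refl ; ok = ok ; src = inj₁ ; len = ℕₚ.≤-refl }
        placeAll (u ∷ us) {F} {φ} ok room with zero-or-pos (cnt≥0 F u)
        ... | inj₂ p = record
          { F′ = X.F′ ; φ′ = X.φ′ ; old = X.old ; new = λ { (here refl) → X.old (1≤cnt⇒∈ p) ; (there q) → X.new q }
          ; agree = X.agree ; ok = X.ok ; src = λ q → shift (X.src q) ; len = ℕₚ.m≤n⇒m≤1+n X.len }
          where
          module X = Ext (placeAll us {F} {φ} ok (≤-<-trans (+-monoʳ-≤ (∑ bad + Δ * e) (+≤+ (ℕₚ.n≤1+n (length us ℕ.+ length F)))) room))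
          shift : ∀ {x} {Y : Set} → x ∈ F ⊎ (x ∈ us × Y) → x ∈ F ⊎ (x ∈ u ∷ us × Y)
          shift (inj₁ q) = inj₁ q
          shift (inj₂ (q , r)) = inj₂ (there q , r)
        ... | inj₁ fu = record
          { F′ = X.F′ ; φ′ = X.φ′ ; old = λ q → X.old (O.old q) ; new = λ { (here refl) → X.old (here refl) ; (there q) → X.new q }
          ; agree = λ q → trans (X.agree (there q)) (O.agree q) ; ok = X.ok ; src = λ q → shift (X.src q)
          ; len = subst (length X.F′ ℕ.≤_) (ℕₚ.+-suc (length us) (length F)) X.len }
          where
          sp = spot-for F φ u (≤-<-trans (+-monoʳ-≤ (∑ bad + Δ * e) (+≤+ (ℕₚ.m≤n+m (length F) (ℕ.suc (length us))))) room)
          z = proj₁ sp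
          module O = Ext (place {F} {φ} ok u z (cnt≡0⇒∉ {F = F} fu) (proj₁ (proj₂ (proj₂ sp))) (λ {b} _ → proj₂ (proj₂ (proj₂ sp)) b))
          module X = Ext (placeAll us {u ∷ F} {O.φ′} O.ok (subst (λ k → ∑ bad + Δ * e + + k < nn) (sym (ℕₚ.+-suc (length us) (length F))) room))
          at-u : bad (X.φ′ ⟨$⟩ʳ u) ≡ 0ℤ
          at-u = trans (cong bad (trans (X.agree (here refl)) (trans (cong (φ ⟨$⟩ʳ_) (tr-left u (φ ⟨$⟩ˡ z))) (Perm.inverseʳ φ {z})))) (proj₁ (proj₂ sp))
          shift : ∀ {x} → x ∈ u ∷ F ⊎ (x ∈ us × bad (X.φ′ ⟨$⟩ʳ x) ≡ 0ℤ) → x ∈ F ⊎ (x ∈ u ∷ us × bad (X.φ′ ⟨$⟩ʳ x) ≡ 0ℤ)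
          shift (inj₁ (here refl)) = inj₂ (here refl , at-u)
          shift (inj₁ (there q)) = inj₁ q
          shift (inj₂ (q , r)) = inj₂ (there q , r)

    A-irr : ∀ {a} {X : Set} → A a a ≡ 1ℤ → X
    A-irr {a} p with trans (sym p) (Adjacency.irr H a)
    ... | ()

    0≢1 : ∀ {x} {X : Set} → x ≡ 0ℤ → x ≡ 1ℤ → X
    0≢1 refl ()

    -- Exchanging u and u′ keeps φ an embedding and changes Σ A v by 2 g.
    record Gad (v : Mat n) (φ : Permutation′ n) (u u′ : Fin n) (g : ℤ) : Set where
      field
        apart : A u u′ ≡ 0ℤ
        adj   : ∀ {b} → A u b ≡ 1ℤ → N v (φ ⟨$⟩ʳ u′) (φ ⟨$⟩ʳ b) ≡ 0ℤ
        adj′  : ∀ {b} → A u′ b ≡ 1ℤ → N v (φ ⟨$⟩ʳ u) (φ ⟨$⟩ʳ b) ≡ 0ℤ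
        gain  : L (pull v φ) u u′ ≡ g

    module _ {v : Mat n} (W : Weight v) where

      gad-local : ∀ {φ ψ u u′ g} → φ ⟨$⟩ʳ u ≡ ψ ⟨$⟩ʳ u → φ ⟨$⟩ʳ u′ ≡ ψ ⟨$⟩ʳ u′ →
        (∀ {b} → A u b ≡ 1ℤ → φ ⟨$⟩ʳ b ≡ ψ ⟨$⟩ʳ b) → (∀ {b} → A u′ b ≡ 1ℤ → φ ⟨$⟩ʳ b ≡ ψ ⟨$⟩ʳ b) →
        Gad v φ u u′ g → Gad v ψ u u′ g
      gad-local {φ} {ψ} {u} {u′} {g} eu eu′ eb eb′ G = record
        { apart = G.apart
        ; adj   = λ p → subst₂ (λ x y → N v x y ≡ 0ℤ) eu′ (eb p) (G.adj p)
        ; adj′  = λ p → subst₂ (λ x y → N v x y ≡ 0ℤ) eu (eb′ p) (G.adj′ p)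
        ; gain  = trans (∑-cong (λ b → sym (term b (A≡0or1 u b) (A≡0or1 u′ b)))) G.gain
        }
        where
        module G = Gad G
        val : ∀ b → φ ⟨$⟩ʳ b ≡ ψ ⟨$⟩ʳ b → v (φ ⟨$⟩ʳ u′) (φ ⟨$⟩ʳ b) - v (φ ⟨$⟩ʳ u) (φ ⟨$⟩ʳ b) ≡ v (ψ ⟨$⟩ʳ u′) (ψ ⟨$⟩ʳ b) - v (ψ ⟨$⟩ʳ u) (ψ ⟨$⟩ʳ b)
        val b e = cong₂ _-_ (cong₂ v eu′ e) (cong₂ v eu e)
        term : ∀ b → A u b ≡ 0ℤ ⊎ A u b ≡ 1ℤ → A u′ b ≡ 0ℤ ⊎ A u′ b ≡ 1ℤ →
          (A u b - A u′ b) * (v (φ ⟨$⟩ʳ u′) (φ ⟨$⟩ʳ b) - v (φ ⟨$⟩ʳ u) (φ ⟨$⟩ʳ b)) ≡ (A u b - A u′ b) * (v (ψ ⟨$⟩ʳ u′) (ψ ⟨$⟩ʳ b) - v (ψ ⟨$⟩ʳ u) (ψ ⟨$⟩ʳ b))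
        term b (inj₂ p) _ = cong ((A u b - A u′ b) *_) (val b (eb p))
        term b (inj₁ p) (inj₂ q) = cong ((A u b - A u′ b) *_) (val b (eb′ q))
        term b (inj₁ p) (inj₁ q) = trans (cong (_* (v (φ ⟨$⟩ʳ u′) (φ ⟨$⟩ʳ b) - v (φ ⟨$⟩ʳ u) (φ ⟨$⟩ʳ b))) z)
          (trans (*-zeroˡ (v (φ ⟨$⟩ʳ u′) (φ ⟨$⟩ʳ b) - v (φ ⟨$⟩ʳ u) (φ ⟨$⟩ʳ b))) (sym (trans (cong (_* (v (ψ ⟨$⟩ʳ u′) (ψ ⟨$⟩ʳ b) - v (ψ ⟨$⟩ʳ u) (ψ ⟨$⟩ʳ b))) z) (*-zeroˡ (v (ψ ⟨$⟩ʳ u′) (ψ ⟨$⟩ʳ b) - v (ψ ⟨$⟩ʳ u) (ψ ⟨$⟩ʳ b))))))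
          where z : A u b - A u′ b ≡ 0ℤ
                z = cong₂ _-_ p q

      flip-good : ∀ {θ u u′ g} → Good v θ → Gad v θ u u′ g → Good v (swap u u′ θ)
      flip-good {θ} {u} {u′} good G = ≤-antisym (≤-trans (EN-swap Wθ u u′) (arith good T0 (∑-nonneg (λ b → A≥0 u b ⊗ proj₁ (N-bd Wθ u b)))))
                                           (EN≥0 (weight-permute W (swap u u′ θ)))
        where
        Wθ = weight-permute W θ
        module G = Gad G
        zero-mul : ∀ {a x} → a ≡ 0ℤ ⊎ a ≡ 1ℤ → (a ≡ 1ℤ → x ≡ 0ℤ) → a * x ≡ 0ℤ
        zero-mul {x = x} (inj₁ refl) _ = *-zeroˡ x
        zero-mul {a} (inj₂ p) h = trans (cong (a *_) (h p)) (*-zeroʳ a)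
        T0 : 𝕋 (pull v θ) u u′ ≡ 0ℤ
        T0 = trans (∑-cong (λ b → cong₂ _+_ (zero-mul (A≡0or1 u b) G.adj) (zero-mul (A≡0or1 u′ b) G.adj′))) (∑-zero n)
        arith : ∀ {e t g} → e ≡ 0ℤ → t ≡ 0ℤ → 0ℤ ≤ g → e + (+ 2 * t - + 2 * g) ≤ 0ℤ
        arith {g = g} refl refl p = ≤by (num 2 ⊗ p) (stays-good-identity g)

      flip-𝔼 : ∀ {θ u u′ g} → Gad v θ u u′ g → 𝔼 (pull v (swap u u′ θ)) ≡ 𝔼 (pull v θ) + + 2 * g
      flip-𝔼 {θ} {u} {u′} {g} G = trans (𝔼-swap (pull v θ) (Weight.symm (weight-permute W θ)) u u′)
        (trans (cong₂ (λ l a → 𝔼 (pull v θ) + (+ 2 * l - + 2 * (a * quad (pull v θ) u u′ u u′))) G.gain G.apart)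
               (flip-𝔼-identity (𝔼 (pull v θ)) g (quad (pull v θ) u u′ u u′)))
        where module G = Gad G

      Gd : Set
      Gd = Fin n × Fin n × ℤ

      Valid : Permutation′ n → Gd → Set
      Valid φ (u , u′ , g) = Gad v φ u u′ g

      End : Gd → Fin n → Set
      End (u , u′ , _) x = x ≡ u ⊎ x ≡ u′

      Closed : List (Fin n) → Gd → Set
      Closed F (u , u′ , _) = (u ∈ F × u′ ∈ F) × (∀ {b} → A u b ≡ 1ℤ → b ∈ F) × (∀ {b} → A u′ b ≡ 1ℤ → b ∈ F)

      Indep : Gd → Gd → Set
      Indep G G₂ = ∀ {p q} → End G p → End G₂ q → p ≢ q × A q p ≡ 0ℤ

      valid-agree : ∀ {F φ ψ} G → Closed F G → AgreeOn F φ ψ → Valid φ G → Valid ψ G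
      valid-agree {F} {φ} {ψ} (u , u′ , g) ((p , p′) , q , q′) ag = gad-local {φ} {ψ} (ag p) (ag p′) (λ e → ag (q e)) (λ e → ag (q′ e))

      valid-flip : ∀ {θ} G G₂ → Indep G G₂ → Valid θ G₂ → Valid (swap (proj₁ G) (proj₁ (proj₂ G)) θ) G₂
      valid-flip {θ} G@(u , u′ , _) (p , p′ , _) ind = gad-local {θ} {swap u u′ θ}
        (same (proj₁ (ind eu (inj₁ refl))) (proj₁ (ind eu′ (inj₁ refl)))) (same (proj₁ (ind eu (inj₂ refl))) (proj₁ (ind eu′ (inj₂ refl))))
        (λ e → same (λ { refl → 0≢1 (proj₂ (ind eu (inj₁ refl))) e }) (λ { refl → 0≢1 (proj₂ (ind eu′ (inj₁ refl))) e }))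
        (λ e → same (λ { refl → 0≢1 (proj₂ (ind eu (inj₂ refl))) e }) (λ { refl → 0≢1 (proj₂ (ind eu′ (inj₂ refl))) e }))
        where
        eu : End G u
        eu = inj₁ refl
        eu′ : End G u′
        eu′ = inj₂ refl
        same : ∀ {b} → u ≢ b → u′ ≢ b → θ ⟨$⟩ʳ b ≡ swap u u′ θ ⟨$⟩ʳ b
        same p q = cong (θ ⟨$⟩ʳ_) (sym (tr-other (λ e → p (sym e)) (λ e → q (sym e))))

      Small : Gd → Set
      Small (_ , _ , g) = g ≡ + 2 ⊎ g ≡ + 4

      flip : Gd → Permutation′ n → Permutation′ n
      flip (u , u′ , _) = swap u u′

      all-flip : ∀ {θ G gs} → All (Indep G) gs → All (Valid θ) gs → All (Valid (flip G θ)) gs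
      all-flip {θ} [] [] = []
      all-flip {θ} {G} (i ∷ is) (_∷_ {x = G₂} x xs) = valid-flip {θ} G G₂ i x ∷ all-flip {θ} {G} is xs

      -- Two gadgets always contain a subset of total gain 4.
      tune : ∀ r gs θ → 2 ℕ.* r ℕ.≤ length gs → AllPairs Indep gs → All (Valid θ) gs → All Small gs → Good v θ →
        ∃[ θ′ ] Good v θ′ × 𝔼 (pull v θ′) ≡ 𝔼 (pull v θ) + + 8 * + r
      tune ℕ.zero gs θ _ _ _ _ good = θ , good , sym (+-identityʳ _)
      tune (ℕ.suc r) gs θ le ind val sm good = go gs (subst (ℕ._≤ length gs) (ℕₚ.*-suc 2 r) le) ind val sm
        where
        Goal : Set
        Goal = ∃[ θ′ ] Good v θ′ × 𝔼 (pull v θ′) ≡ 𝔼 (pull v θ) + + 8 * +[1+ r ]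
        continue : ∀ {gs} θ₁ → 𝔼 (pull v θ₁) ≡ 𝔼 (pull v θ) + + 8 → 2 ℕ.* r ℕ.≤ length gs → AllPairs Indep gs → All (Valid θ₁) gs →
          All Small gs → Good v θ₁ → Goal
        continue {gs} θ₁ e le ind val sm good₁ =
          let θ₂ , good₂ , e₂ = tune r gs θ₁ le ind val sm good₁
          in θ₂ , good₂ , trans e₂ (trans (cong (_+ + 8 * + r) e) (continue-identity (𝔼 (pull v θ)) (+ r)))
        go : ∀ gs → 2 ℕ.+ 2 ℕ.* r ℕ.≤ length gs → AllPairs Indep gs → All (Valid θ) gs → All Small gs → Goal
        go (G₁@(u₁ , u₁′ , _) ∷ G₂@(u₂ , u₂′ , _) ∷ gs) (ℕ.s≤s (ℕ.s≤s le)) ((i₁₂ ∷ i₁) ∷ i₂ ∷ ind) (v₁ ∷ v₂ ∷ val) (inj₂ refl ∷ _ ∷ sm) =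
          continue (flip G₁ θ) (flip-𝔼 {θ} v₁) le ind (all-flip {θ} {G₁} i₁ val) sm (flip-good {θ} good v₁)
        go (G₁ ∷ G₂ ∷ gs) (ℕ.s≤s (ℕ.s≤s le)) ((i₁₂ ∷ i₁) ∷ i₂ ∷ ind) (v₁ ∷ v₂ ∷ val) (inj₁ refl ∷ inj₂ refl ∷ sm) =
          continue (flip G₂ θ) (flip-𝔼 {θ} v₂) le ind (all-flip {θ} {G₂} i₂ val) sm (flip-good {θ} good v₂)
        go (G₁ ∷ G₂ ∷ gs) (ℕ.s≤s (ℕ.s≤s le)) ((i₁₂ ∷ i₁) ∷ i₂ ∷ ind) (v₁ ∷ v₂ ∷ val) (inj₁ refl ∷ inj₁ refl ∷ sm) =
          continue (flip G₂ θ₁) (trans (flip-𝔼 {θ₁} v₂′) (trans (cong (λ x → x + + 4) (flip-𝔼 {θ} v₁)) (+-assoc (𝔼 (pull v θ)) (+ 4) (+ 4))))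
            le ind (all-flip {θ₁} {G₂} i₂ (all-flip {θ} {G₁} i₁ val)) sm (flip-good {θ₁} (flip-good {θ} good v₁) v₂′)
          where θ₁ = flip G₁ θ
                v₂′ = valid-flip {θ} G₁ G₂ i₁₂ v₂

      record Kit (F : List (Fin n)) (φ : Permutation′ n) (gs : List Gd) : Set where
        field
          ok     : Ok v F φ
          indep  : AllPairs Indep gs
          valid  : All (Valid φ) gs
          closed : All (Closed F) gs

      closed-mono : ∀ {F F′} → (∀ {x} → x ∈ F → x ∈ F′) → ∀ {gs} → All (Closed F) gs → All (Closed F′) gs
      closed-mono f [] = []
      closed-mono f (((p , q) , r , s) ∷ cs) = ((f p , f q) , (λ e → f (r e)) , (λ e → f (s e))) ∷ closed-mono f cs

      Away : List (Fin n) → Gd → Set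
      Away F G = ∀ {p} → End G p → p ∉ F × (∀ {b} → b ∈ F → A p b ≡ 0ℤ)

      away⇒indep : ∀ {F G} → Away F G → ∀ {gs} → All (Closed F) gs → All (Indep G) gs
      away⇒indep aw [] = []
      away⇒indep {F} {G} aw (_∷_ {x = G₂} c cs) = ind ∷ away⇒indep {F} {G} aw cs
        where
        end∈ : ∀ {q} → End G₂ q → q ∈ F
        end∈ (inj₁ refl) = proj₁ (proj₁ c)
        end∈ (inj₂ refl) = proj₂ (proj₁ c)
        ind : Indep G G₂
        ind p q = (λ { refl → proj₁ (aw p) (end∈ q) }) , trans (A-sym _ _) (proj₂ (aw p) (end∈ q))

      add : ∀ {F φ gs F′ φ′ G} → Kit F φ gs → (∀ {x} → x ∈ F → x ∈ F′) → AgreeOn F φ′ φ → Ok v F′ φ′ →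
        Valid φ′ G → Closed F′ G → Away F G → Kit F′ φ′ (G ∷ gs)
      add {F} {φ} {gs} {F′} {φ′} {G} K old ag ok va cl aw = record
        { ok = ok ; indep = away⇒indep {F} {G} aw K.closed ∷ K.indep
        ; valid = va ∷ transfer K.closed K.valid ; closed = cl ∷ closed-mono old K.closed }
        where
        module K = Kit K
        transfer : ∀ {gs} → All (Closed F) gs → All (Valid φ) gs → All (Valid φ′) gs
        transfer [] [] = []
        transfer (_∷_ {x = G₂} c cs) (x ∷ xs) = valid-agree {F} {φ} {φ′} G₂ c (λ e → sym (ag e)) x ∷ transfer cs xs

      record Half (F : List (Fin n)) (φ : Permutation′ n) (u x : Fin n) (pre : List (Fin n)) (y : Fin n) (bad : Fin n → ℤ) : Set where
        field
          F′     : List (Fin n)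
          φ′     : Permutation′ n
          old    : ∀ {a} → a ∈ F → a ∈ F′
          agree  : AgreeOn F φ′ φ
          ok     : Ok v F′ φ′
          cen    : φ′ ⟨$⟩ʳ u ≡ x
          cen∈   : u ∈ F′
          pre-at : ∀ {b} → b ∈ pre → φ′ ⟨$⟩ʳ b ≡ y
          nb     : ∀ {b} → A u b ≡ 1ℤ → b ∈ F′ × (b ∈ pre ⊎ bad (φ′ ⟨$⟩ʳ b) ≡ 0ℤ)
          img    : ∀ {a} → a ∈ F′ → a ∈ F ⊎ (φ′ ⟨$⟩ʳ a ≡ x ⊎ φ′ ⟨$⟩ʳ a ≡ y ⊎ bad (φ′ ⟨$⟩ʳ a) ≡ 0ℤ)
          within : ∀ {a} → a ∈ F′ → (a ∈ F ⊎ a ≡ u) ⊎ (a ∈ pre ⊎ A u a ≡ 1ℤ)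
          len    : length F′ ℕ.≤ length (nbrs u) ℕ.+ (length pre ℕ.+ ℕ.suc (length F))

      module _ {e : ℤ} (hN : ∀ b → row (N v) b ≤ e) where

        half : ∀ {F φ u x pre y} bad → (∀ z → 0ℤ ≤ bad z) → Ok v F φ → Far F u → (∀ {a} → a ∈ F → φ ⟨$⟩ʳ a ≢ x) →
          (∀ φ₁ → AgreeOn F φ₁ φ → φ₁ ⟨$⟩ʳ u ≡ x → Ok v (u ∷ F) φ₁ → Σ (Ext v (u ∷ F) φ₁ pre (_≡ y)) (λ X → ∀ {b} → b ∈ pre → Ext.φ′ X ⟨$⟩ʳ b ≡ y)) →
          ∑ bad + Δ * e + + (length (nbrs u) ℕ.+ (length pre ℕ.+ ℕ.suc (length F))) < nn → Half F φ u x pre y bad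
        half {F} {φ} {u} {x} {pre} {y} bad bad≥0 ok far x∉ ext room = record
          { F′ = Z.F′ ; φ′ = Z.φ′ ; old = λ p → Z.old (Y.old (there p)) ; agree = ag ; ok = Z.ok
          ; cen = trans (Z.agree (Y.old (here refl))) (trans (Y.agree (here refl)) at-u) ; cen∈ = Z.old (Y.old (here refl))
          ; pre-at = λ p → trans (Z.agree (Y.new p)) (pre-y p) ; nb = nb ; img = λ p → img₀ (Z.src p) ; within = λ p → in₀ (Z.src p)
          ; len = ℕₚ.≤-trans Z.len (ℕₚ.+-monoʳ-≤ (length (nbrs u)) Y.len) }
          where
          module far = Far far
          module O = Ext (place W {F} {φ} ok u x far.out x∉ (λ {b} p → ≤-reflexive (trans (cong (_* N v x (φ ⟨$⟩ʳ b)) (far.out₁ p)) (*-zeroˡ (N v x (φ ⟨$⟩ʳ b))))))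
          at-u : O.φ′ ⟨$⟩ʳ u ≡ x
          at-u = trans (cong (φ ⟨$⟩ʳ_) (tr-left u (φ ⟨$⟩ˡ x))) (Perm.inverseʳ φ {x})
          Yp = ext O.φ′ O.agree at-u O.ok
          module Y = Ext (proj₁ Yp)
          pre-y : ∀ {b} → b ∈ pre → Y.φ′ ⟨$⟩ʳ b ≡ y
          pre-y = proj₂ Yp
          module Z = Ext (placeAll W hN bad bad≥0 (nbrs u) {Y.F′} {Y.φ′} Y.ok
            (≤-<-trans (+-monoʳ-≤ (∑ bad + Δ * e) (+≤+ (ℕₚ.+-monoʳ-≤ (length (nbrs u)) Y.len))) room))
          ag : AgreeOn F Z.φ′ φ
          ag p = trans (Z.agree (Y.old (there p))) (trans (Y.agree (there p)) (O.agree p))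
          nb : ∀ {b} → A u b ≡ 1ℤ → b ∈ Z.F′ × (b ∈ pre ⊎ bad (Z.φ′ ⟨$⟩ʳ b) ≡ 0ℤ)
          nb {b} e = Z.new (∈nbrs e) , pick (Z.src (Z.new (∈nbrs e)))
            where
            pick₂ : b ∈ u ∷ F ⊎ (b ∈ pre × Y.φ′ ⟨$⟩ʳ b ≡ y) → b ∈ pre ⊎ bad (Z.φ′ ⟨$⟩ʳ b) ≡ 0ℤ
            pick₂ (inj₁ (here refl)) = A-irr e
            pick₂ (inj₁ (there p)) = 0≢1 (far.out₁ p) e
            pick₂ (inj₂ (p , _)) = inj₁ p
            pick : b ∈ Y.F′ ⊎ (b ∈ nbrs u × bad (Z.φ′ ⟨$⟩ʳ b) ≡ 0ℤ) → b ∈ pre ⊎ bad (Z.φ′ ⟨$⟩ʳ b) ≡ 0ℤ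
            pick (inj₁ p) = pick₂ (Y.src p)
            pick (inj₂ (_ , q)) = inj₂ q
          in₁ : ∀ {a} {X : Set} → a ∈ u ∷ F ⊎ (a ∈ pre × X) → (a ∈ F ⊎ a ≡ u) ⊎ (a ∈ pre ⊎ A u a ≡ 1ℤ)
          in₁ (inj₁ (here refl)) = inj₁ (inj₂ refl)
          in₁ (inj₁ (there q))   = inj₁ (inj₁ q)
          in₁ (inj₂ (q , _))     = inj₂ (inj₁ q)
          in₀ : ∀ {a} {X : Set} → a ∈ Y.F′ ⊎ (a ∈ nbrs u × X) → (a ∈ F ⊎ a ≡ u) ⊎ (a ∈ pre ⊎ A u a ≡ 1ℤ)
          in₀ (inj₁ p)       = in₁ (Y.src p)
          in₀ (inj₂ (q , _)) = inj₂ (inj₂ (nbrs⇒A≡1 q))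
          img₀ : ∀ {a} → a ∈ Y.F′ ⊎ (a ∈ nbrs u × bad (Z.φ′ ⟨$⟩ʳ a) ≡ 0ℤ) →
            a ∈ F ⊎ (Z.φ′ ⟨$⟩ʳ a ≡ x ⊎ Z.φ′ ⟨$⟩ʳ a ≡ y ⊎ bad (Z.φ′ ⟨$⟩ʳ a) ≡ 0ℤ)
          img₀ (inj₂ (_ , q)) = inj₂ (inj₂ (inj₂ q))
          img₀ {a} (inj₁ p) = lower (Y.src p)
            where
            lower : a ∈ u ∷ F ⊎ (a ∈ pre × Y.φ′ ⟨$⟩ʳ a ≡ y) → a ∈ F ⊎ (Z.φ′ ⟨$⟩ʳ a ≡ x ⊎ Z.φ′ ⟨$⟩ʳ a ≡ y ⊎ bad (Z.φ′ ⟨$⟩ʳ a) ≡ 0ℤ)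
            lower (inj₁ (here refl)) = inj₂ (inj₁ (trans (Z.agree p) (trans (Y.agree (here refl)) at-u)))
            lower (inj₁ (there q)) = inj₁ q
            lower (inj₂ (_ , q)) = inj₂ (inj₂ (inj₁ (trans (Z.agree p) q)))

    weighted-sum : (D : Fin n → ℤ) (u v₁ : Fin n) (r : ℤ) → A u v₁ ≡ 1ℤ → (∀ {b} → A u b ≡ 1ℤ → b ≡ v₁ ⊎ D b ≡ r) →
      ∑ (λ b → A u b * D b) ≡ deg u * r + (D v₁ - r)
    weighted-sum D u v₁ r e h = trans (∑-cong (λ b → term b (A≡0or1 u b)))
      (trans (∑-+ _ _) (cong₂ _+_ (∑-*ʳ r (A u)) (∑-δ v₁ (λ b → D b - r))))
      where
      term : ∀ b → A u b ≡ 0ℤ ⊎ A u b ≡ 1ℤ → A u b * D b ≡ A u b * r + δ v₁ b * (D b - r)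
      term b (inj₁ p) = lem (A u b) (D b) r (δ v₁ b) p (δ-≢ (λ { refl → 0≢1 p e }))
        where lem : ∀ a d r x → a ≡ 0ℤ → x ≡ 0ℤ → a * d ≡ a * r + x * (d - r)
              lem a d r x refl refl = weighted-sum-identity d r
      term b (inj₂ p) with h p
      ... | inj₁ refl = lem (A u b) (D b) r (δ b b) p (δ-refl b)
        where lem : ∀ a d r x → a ≡ 1ℤ → x ≡ 1ℤ → a * d ≡ a * r + x * (d - r)
              lem a d r x refl refl = weighted-sum-identity₂ d r
      ... | inj₂ q = trans (cong (A u b *_) q) (sym (trans (cong (λ z → A u b * r + δ v₁ b * (z - r)) q) (weighted-sum-identity₃ (A u b) r (δ v₁ b))))

    module _ {v : Mat n} (W : Weight v) where
      open Weight W using () renaming (val to v-val; irr to v-irr; symm to v-sym)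

      gad-from : ∀ {φ u u′ x x′ g} → φ ⟨$⟩ʳ u ≡ x → φ ⟨$⟩ʳ u′ ≡ x′ → A u u′ ≡ 0ℤ →
        (∀ {b} → A u b ≡ 1ℤ → N v x′ (φ ⟨$⟩ʳ b) ≡ 0ℤ) → (∀ {b} → A u′ b ≡ 1ℤ → N v x (φ ⟨$⟩ʳ b) ≡ 0ℤ) →
        ∑ (λ b → A u b * (v x′ (φ ⟨$⟩ʳ b) - v x (φ ⟨$⟩ʳ b))) - ∑ (λ b → A u′ b * (v x′ (φ ⟨$⟩ʳ b) - v x (φ ⟨$⟩ʳ b))) ≡ g →
        Gad v φ u u′ g
      gad-from {φ} {u} {u′} refl refl ap h h′ e = record { apart = ap ; adj = h ; adj′ = h′
        ; gain = trans (trans (∑-cong (λ b → ∑-δδ-identity (A u b) (A u′ b) (v (φ ⟨$⟩ʳ u′) (φ ⟨$⟩ʳ b) - v (φ ⟨$⟩ʳ u) (φ ⟨$⟩ʳ b)))) (∑-- _ _)) e }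

      -- A 4-cycle x y x′ y′ whose alternating sum g is positive.
      record Cycle (x x′ y y′ : Fin n) (g : ℤ) : Set where
        field
          xy   : N v x y ≡ 0ℤ
          x′y  : N v x′ y ≡ 0ℤ
          xy′  : N v x y′ ≡ 0ℤ
          x′y′ : N v x′ y′ ≡ 0ℤ
          val  : (v x′ y - v x y) - (v x′ y′ - v x y′) ≡ g
          1≤g  : 1ℤ ≤ g

        x≢x′ : x ≢ x′
        x≢x′ refl with subst (1ℤ ≤_) (trans (sym val) (x≢x′-identity (v x y) (v x y′))) 1≤g
        ... | +≤+ ()

        y≢y′ : y ≢ y′
        y≢y′ refl with subst (1ℤ ≤_) (trans (sym val) (x-x≡0 (v x′ y - v x y))) 1≤g
        ... | +≤+ ()

      N⇒≢ : ∀ {a b} → N v a b ≡ 0ℤ → a ≢ b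
      N⇒≢ {a} e refl = 0≢1 e (N-irr W a)

      Avoids : List (Fin n) → Permutation′ n → Fin n → Set
      Avoids F φ x = ∀ {a} → a ∈ F → φ ⟨$⟩ʳ a ≢ x

      record Grown (F : List (Fin n)) (φ : Permutation′ n) (gs : List (Gd W)) (Q : ℤ → Set) : Set where
        field
          F′    : List (Fin n)
          φ′    : Permutation′ n
          new   : Gd W
          gain  : Q (proj₂ (proj₂ new))
          kit   : Kit W F′ φ′ (new ∷ gs)
          len   : + length F′ ≤ + length F + (+ 2 * Δ + + 4)

      module _ {e : ℤ} (hN : ∀ b → row (N v) b ≤ e) (Δ≥0 : 0ℤ ≤ Δ) {R : ℤ} (room : (+ 8 + + 3 * Δ) * e + + 3 * R + + 5 < nn) where

        e≥0 : Fin n → 0ℤ ≤ e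
        e≥0 u = ≤-trans (∑-nonneg (λ b → proj₁ (N-bd W u b))) (hN u)

        class : ∀ x x′ → ∃[ r ] + 3 * ∑ (λ z → ne0 (v x′ z - v x z - r)) ≤ + 2 * nn + + 2 * e
        class x x′ = pick (least-of-three total)
          where
          cl : ℤ → ℤ
          cl r = ∑ (λ z → ne0 (v x′ z - v x z - r))
          total : cl -[1+ 1 ] + cl 0ℤ + cl (+ 2) ≤ + 2 * nn + + 2 * e
          total = ≤-trans (≤-reflexive (sym (trans (∑-+ _ _) (cong (_+ cl (+ 2)) (∑-+ _ _)))))
            (≤-trans (∑-mono (λ z → three-classes (v-val x z) (v-val x′ z)))
            (≤-trans (≤-reflexive (trans (∑-+ _ _) (cong₂ _+_ (trans (∑-+ _ _) (cong (_+ row (N v) x) (∑-const n (+ 2)))) refl)))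
              (≤by (diff (hN x) ⊕ diff (hN x′)) (total-identity nn e (row (N v) x) (row (N v) x′)))))
          pick : + 3 * cl -[1+ 1 ] ≤ + 2 * nn + + 2 * e ⊎ + 3 * cl 0ℤ ≤ + 2 * nn + + 2 * e ⊎ + 3 * cl (+ 2) ≤ + 2 * nn + + 2 * e →
            ∃[ r ] + 3 * cl r ≤ + 2 * nn + + 2 * e
          pick (inj₁ p) = -[1+ 1 ] , p
          pick (inj₂ (inj₁ p)) = 0ℤ , p
          pick (inj₂ (inj₂ p)) = + 2 , p

        some-nbr : ∀ {u} → 1ℤ ≤ deg u → ∃[ b ] A u b ≡ 1ℤ
        some-nbr {u} p with ∑<⇒∃< (λ _ → 0ℤ) (A u) (<-≤-trans (subst (_< 1ℤ) (sym (∑-zero n)) (+<+ (ℕ.s≤s ℕ.z≤n))) p)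
        ... | b , q with A≡0or1 u b
        ...   | inj₂ r = b , r
        ...   | inj₁ r = ≤-absurd (≤-reflexive r) q

        regular : ∀ {F φ gs d x x′ y y′ g} → Kit W F φ gs → 1ℤ ≤ d →
          (∀ F → + length F ≤ R → ∃[ u ] Far F u × deg u ≡ d) → Cycle x x′ y y′ g →
          Avoids F φ x → Avoids F φ x′ → Avoids F φ y → Avoids F φ y′ →
          + length F + (+ 2 * Δ + + 4) ≤ R → Grown F φ gs (_≡ g)
        regular {F} {φ} {gs} {d} {x} {x′} {y} {y′} {g} K 1≤d supply C ax ax′ ay ay′ lenF = record
          { F′ = H₂.F′ ; φ′ = H₂.φ′ ; new = u , u′ , g ; gain = refl ; len = ≤-trans len₂ (≤-reflexive (regular-identity (+ length F) Δ))
          ; kit = add W {F} {φ} {gs} {H₂.F′} {H₂.φ′} {u , u′ , g} K (λ p → H₂.old (H₁.old p)) (λ p → trans (H₂.agree (H₁.old p)) (H₁.agree p)) H₂.ok gad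
                    ((H₂.old H₁.cen∈ , H₂.cen∈) , (λ p → H₂.old (proj₁ (H₁.nb p))) , (λ p → proj₁ (H₂.nb p))) away }
          where
          module K = Kit K
          module C = Cycle C
          F≤R : + length F ≤ R
          F≤R = ≤-trans (≤by (num 2 ⊗ Δ≥0 ⊕ num 4) (F≤R-identity (+ length F) Δ)) lenF
          u = proj₁ (supply F F≤R)
          farU = proj₁ (proj₂ (supply F F≤R))
          deg-u : deg u ≡ d
          deg-u = proj₂ (proj₂ (supply F F≤R))
          nu = some-nbr {u} (subst (1ℤ ≤_) (sym deg-u) 1≤d)
          v₁ = proj₁ nu
          r = proj₁ (class x x′)
          bad : Fin n → ℤ
          bad z = ne0 (v x′ z - v x z - r) + N v x z + N v x′ z + δ y′ z
          b₁≥0 : ∀ z → 0ℤ ≤ ne0 (v x′ z - v x z - r)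
          b₁≥0 z = ne0≥0 (v x′ z - v x z - r)
          b₂≥0 : ∀ z → 0ℤ ≤ N v x z
          b₂≥0 z = proj₁ (N-bd W x z)
          b₃≥0 : ∀ z → 0ℤ ≤ N v x′ z
          b₃≥0 z = proj₁ (N-bd W x′ z)
          bad≥0 : ∀ z → 0ℤ ≤ bad z
          bad≥0 z = b₁≥0 z ⊕ b₂≥0 z ⊕ b₃≥0 z ⊕ δ≥0 y′ z
          bad-y′ : ∀ {z} → bad z ≡ 0ℤ → z ≢ y′
          bad-y′ {z} p q = δ≡0⇒≢ (sum≡0ʳ (b₁≥0 z ⊕ b₂≥0 z ⊕ b₃≥0 z) (δ≥0 y′ z) p) (sym q)
          bad-x′ : ∀ {z} → bad z ≡ 0ℤ → N v x′ z ≡ 0ℤ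
          bad-x′ {z} p = sum≡0ʳ (b₁≥0 z ⊕ b₂≥0 z) (b₃≥0 z) (sum≡0ˡ (b₁≥0 z ⊕ b₂≥0 z ⊕ b₃≥0 z) (δ≥0 y′ z) p)
          bad-12 : ∀ {z} → bad z ≡ 0ℤ → ne0 (v x′ z - v x z - r) + N v x z ≡ 0ℤ
          bad-12 {z} p = sum≡0ˡ (b₁≥0 z ⊕ b₂≥0 z) (b₃≥0 z) (sum≡0ˡ (b₁≥0 z ⊕ b₂≥0 z ⊕ b₃≥0 z) (δ≥0 y′ z) p)
          bad-x : ∀ {z} → bad z ≡ 0ℤ → N v x z ≡ 0ℤ
          bad-x {z} p = sum≡0ʳ (b₁≥0 z) (b₂≥0 z) (bad-12 p)
          bad-r : ∀ {z} → bad z ≡ 0ℤ → v x′ z - v x z ≡ r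
          bad-r {z} p = i-j≡0⇒i≡j (v x′ z - v x z) r (ne0≡0 (sum≡0ˡ (b₁≥0 z) (b₂≥0 z) (bad-12 p)))
          ∑bad : + 3 * ∑ bad ≤ + 2 * nn + + 8 * e + + 3
          ∑bad = ≤-trans (≤-reflexive (cong (+ 3 *_) (trans (∑-+ _ _) (cong₂ _+_ (trans (∑-+ _ _) (cong (_+ row (N v) x′) (∑-+ _ _))) (∑-δ₁ y′)))))
            (arith (∑ (λ z → ne0 (v x′ z - v x z - r))) (row (N v) x) (row (N v) x′) (proj₂ (class x x′)) (hN x) (hN x′))
            where
            arith : ∀ c p q → + 3 * c ≤ + 2 * nn + + 2 * e → p ≤ e → q ≤ e → + 3 * (c + p + q + 1ℤ) ≤ + 2 * nn + + 8 * e + + 3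
            arith c p q h i j = ≤by (diff h ⊕ num 3 ⊗ diff i ⊕ num 3 ⊗ diff j) (∑bad-identity nn e c p q)
          enough : ∀ {l} → l ≤ R → ∑ bad + Δ * e + l < nn
          enough {l} h = 1+≤⇒< (≤-cancel {c = + 3} (+<+ (ℕ.s≤s ℕ.z≤n)) (arith (∑ bad) ∑bad (<⇒1+≤ room)))
            where
            arith : ∀ s → + 3 * s ≤ + 2 * nn + + 8 * e + + 3 → 1ℤ + ((+ 8 + + 3 * Δ) * e + + 3 * R + + 5) ≤ nn → + 3 * (1ℤ + (s + Δ * e + l)) ≤ + 3 * nn
            arith s p q = ≤by (diff p ⊕ diff q ⊕ num 3 ⊗ diff h) (enough-identity nn e Δ R l s)
          size₁ : ∀ u (F : List (Fin n)) → + (length (nbrs u) ℕ.+ (1 ℕ.+ ℕ.suc (length F))) ≤ + length F + (Δ + + 2)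
          size₁ u F = ≤-trans (≤-reflexive (pos-+ (length (nbrs u)) (1 ℕ.+ ℕ.suc (length F)))) (≤by (diff (length-nbrs u)) (size₁-identity Δ (+ length (nbrs u)) (+ length F)))
          out : ∀ {F u b} → Far F u → A u b ≡ 1ℤ → b ∉ u ∷ F
          out far p (here refl) = A-irr p
          out far p (there q) = 0≢1 (Far.out₁ far q) p
          pre : ∀ {F φ u b x y} → Far F u → A u b ≡ 1ℤ → N v x y ≡ 0ℤ → Avoids F φ y → ∀ φ₁ → AgreeOn F φ₁ φ → φ₁ ⟨$⟩ʳ u ≡ x → Ok v (u ∷ F) φ₁ →
            Σ (Ext v (u ∷ F) φ₁ (b ∷ []) (_≡ y)) (λ X → ∀ {c} → c ∈ b ∷ [] → Ext.φ′ X ⟨$⟩ʳ c ≡ y)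
          pre {F} {φ} {u} {b} {x} {y} far p Nxy av φ₁ ag cen ok₁ =
            place W {u ∷ F} {φ₁} ok₁ b y (out far p) avoid adj , λ { (here refl) → trans (cong (φ₁ ⟨$⟩ʳ_) (tr-left b (φ₁ ⟨$⟩ˡ y))) (Perm.inverseʳ φ₁ {y}) }
            where
            avoid : ∀ {a} → a ∈ u ∷ F → φ₁ ⟨$⟩ʳ a ≢ y
            avoid (here refl) q = N⇒≢ Nxy (trans (sym cen) q)
            avoid (there a∈F) q = av a∈F (trans (sym (ag a∈F)) q)
            adj : ∀ {a} → a ∈ u ∷ F → A b a * N v y (φ₁ ⟨$⟩ʳ a) ≤ 0ℤ
            adj (here refl) = ≤-reflexive (trans (cong (A b u *_) (trans (cong (N v y) cen) (trans (N-sym W y x) Nxy))) (*-zeroʳ (A b u)))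
            adj {a} (there a∈F) = ≤-reflexive (trans (cong (_* N v y (φ₁ ⟨$⟩ʳ a)) (Far.out₂ far a∈F p)) (*-zeroˡ (N v y (φ₁ ⟨$⟩ʳ a))))
          half₁ : Half W F φ u x (v₁ ∷ []) y bad
          half₁ = half W hN bad bad≥0 K.ok farU ax (pre {F} {φ} farU (proj₂ nu) C.xy ay)
            (enough (≤-trans (size₁ u F) (≤-trans (≤by (Δ≥0 ⊕ num 2) (half₁-identity (+ length F) Δ)) lenF)))
          module H₁ = Half half₁
          len₁ : + length H₁.F′ ≤ + length F + (Δ + + 2)
          len₁ = ≤-trans (+≤+ H₁.len) (size₁ u F)
          F₁≤R : + length H₁.F′ + (Δ + + 2) ≤ R
          F₁≤R = ≤-trans (+-monoˡ-≤ (Δ + + 2) len₁) (≤-trans (≤-reflexive (regular-identity (+ length F) Δ)) lenF)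
          sup′ = supply H₁.F′ (≤-trans (≤by (Δ≥0 ⊕ num 2) (sup′-identity (+ length H₁.F′) Δ)) F₁≤R)
          u′ = proj₁ sup′
          farU′ = proj₁ (proj₂ sup′)
          deg-u′ : deg u′ ≡ d
          deg-u′ = proj₂ (proj₂ sup′)
          nu′ = some-nbr {u′} (subst (1ℤ ≤_) (sym deg-u′) 1≤d)
          v₁′ = proj₁ nu′
          avoids₁ : ∀ {z} → Avoids F φ z → x ≢ z → y ≢ z → (∀ {a} → bad a ≡ 0ℤ → a ≢ z) → Avoids H₁.F′ H₁.φ′ z
          avoids₁ {z} p q r s {a} a∈ eq = go (H₁.img a∈)
            where
            go : a ∈ F ⊎ (H₁.φ′ ⟨$⟩ʳ a ≡ x ⊎ H₁.φ′ ⟨$⟩ʳ a ≡ y ⊎ bad (H₁.φ′ ⟨$⟩ʳ a) ≡ 0ℤ) → ⊥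
            go (inj₁ a∈F) = p a∈F (trans (sym (H₁.agree a∈F)) eq)
            go (inj₂ (inj₁ e)) = q (trans (sym e) eq)
            go (inj₂ (inj₂ (inj₁ e))) = r (trans (sym e) eq)
            go (inj₂ (inj₂ (inj₂ e))) = s e eq
          half₂ : Half W H₁.F′ H₁.φ′ u′ x′ (v₁′ ∷ []) y′ bad
          half₂ = half W hN bad bad≥0 H₁.ok farU′ (avoids₁ ax′ C.x≢x′ (λ q → N⇒≢ C.x′y (sym q)) (λ e q → N⇒≢ (bad-x′ e) (sym q)))
            (pre {H₁.F′} {H₁.φ′} farU′ (proj₂ nu′) C.x′y′ (avoids₁ ay′ (N⇒≢ C.xy′) C.y≢y′ bad-y′))
            (enough (≤-trans (size₁ u′ H₁.F′) F₁≤R))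
          module H₂ = Half half₂
          len₂ : + length H₂.F′ ≤ + length F + (Δ + + 2) + (Δ + + 2)
          len₂ = ≤-trans (+≤+ H₂.len) (≤-trans (size₁ u′ H₁.F′) (+-monoˡ-≤ (Δ + + 2) len₁))
          module far = Far farU
          module far′ = Far farU′
          away : Away W F (u , u′ , g)
          away (inj₁ refl) = far.out , far.out₁
          away (inj₂ refl) = (λ p → far′.out (H₁.old p)) , (λ p → far′.out₁ (H₁.old p))
          jump : Fin n → ℤ
          jump b = v x′ (H₂.φ′ ⟨$⟩ʳ b) - v x (H₂.φ′ ⟨$⟩ʳ b)
          at : ∀ {b} → A u b ≡ 1ℤ → (b ≡ v₁ × H₂.φ′ ⟨$⟩ʳ b ≡ y) ⊎ bad (H₂.φ′ ⟨$⟩ʳ b) ≡ 0ℤ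
          at {b} p = go (proj₂ (H₁.nb p))
            where
            go : b ∈ v₁ ∷ [] ⊎ bad (H₁.φ′ ⟨$⟩ʳ b) ≡ 0ℤ → (b ≡ v₁ × H₂.φ′ ⟨$⟩ʳ b ≡ y) ⊎ bad (H₂.φ′ ⟨$⟩ʳ b) ≡ 0ℤ
            go (inj₁ (here refl)) = inj₁ (refl , trans (H₂.agree (proj₁ (H₁.nb p))) (H₁.pre-at (here refl)))
            go (inj₂ q) = inj₂ (trans (cong bad (H₂.agree (proj₁ (H₁.nb p)))) q)
          at′ : ∀ {b} → A u′ b ≡ 1ℤ → (b ≡ v₁′ × H₂.φ′ ⟨$⟩ʳ b ≡ y′) ⊎ bad (H₂.φ′ ⟨$⟩ʳ b) ≡ 0ℤ
          at′ {b} p = go (proj₂ (H₂.nb p))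
            where
            go : b ∈ v₁′ ∷ [] ⊎ bad (H₂.φ′ ⟨$⟩ʳ b) ≡ 0ℤ → (b ≡ v₁′ × H₂.φ′ ⟨$⟩ʳ b ≡ y′) ⊎ bad (H₂.φ′ ⟨$⟩ʳ b) ≡ 0ℤ
            go (inj₁ (here refl)) = inj₁ (refl , H₂.pre-at (here refl))
            go (inj₂ q) = inj₂ q
          v₁-at : H₂.φ′ ⟨$⟩ʳ v₁ ≡ y
          v₁-at = trans (H₂.agree (proj₁ (H₁.nb (proj₂ nu)))) (H₁.pre-at (here refl))
          v₁′-at : H₂.φ′ ⟨$⟩ʳ v₁′ ≡ y′
          v₁′-at = H₂.pre-at (here refl)
          nbr-x′ : ∀ {b} → (b ≡ v₁ × H₂.φ′ ⟨$⟩ʳ b ≡ y) ⊎ bad (H₂.φ′ ⟨$⟩ʳ b) ≡ 0ℤ → N v x′ (H₂.φ′ ⟨$⟩ʳ b) ≡ 0ℤ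
          nbr-x′ (inj₁ (_ , q)) = trans (cong (N v x′) q) C.x′y
          nbr-x′ (inj₂ q) = bad-x′ q
          nbr-x : ∀ {b} → (b ≡ v₁′ × H₂.φ′ ⟨$⟩ʳ b ≡ y′) ⊎ bad (H₂.φ′ ⟨$⟩ʳ b) ≡ 0ℤ → N v x (H₂.φ′ ⟨$⟩ʳ b) ≡ 0ℤ
          nbr-x (inj₁ (_ , q)) = trans (cong (N v x) q) C.xy′
          nbr-x (inj₂ q) = bad-x q
          split : ∀ {b w z} → (b ≡ w × H₂.φ′ ⟨$⟩ʳ b ≡ z) ⊎ bad (H₂.φ′ ⟨$⟩ʳ b) ≡ 0ℤ → b ≡ w ⊎ jump b ≡ r
          split (inj₁ (q , _)) = inj₁ q
          split (inj₂ q) = inj₂ (bad-r q)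
          gad : Gad v H₂.φ′ u u′ g
          gad = gad-from {H₂.φ′} (trans (H₂.agree H₁.cen∈) H₁.cen) H₂.cen (trans (A-sym u u′) (far′.out₁ H₁.cen∈))
            (λ p → nbr-x′ (at p)) (λ p → nbr-x (at′ p))
            (trans (cong₂ _-_ (weighted-sum jump u v₁ r (proj₂ nu) (λ p → split (at p))) (weighted-sum jump u′ v₁′ r (proj₂ nu′) (λ p → split (at′ p))))
              (trans (cong₂ (λ a b → a * r + (jump v₁ - r) - (b * r + (jump v₁′ - r))) deg-u deg-u′)
              (trans (regular-identity₂ d r (jump v₁) (jump v₁′)) (trans (cong₂ _-_ (cong (λ z → v x′ z - v x z) v₁-at) (cong (λ z → v x′ z - v x z) v₁′-at)) C.val))))

  ind≤1-identity : ∀ x → x ≡ 1ℤ - (1ℤ - x)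
  ind≤1-identity = solve-∀

  oriented-identity : ∀ a b c d → - ((a - b) - (c - d)) ≡ (b - a) - (d - c)
  oriented-identity = solve-∀

  edge-outside-identity : ∀ n G e R l → n * (n - (1ℤ + G * (+ 3 * e + + 2 * R))) + (n - 1ℤ) + n * ((G - 1ℤ) * (+ 3 * e + + 2 * R))
    + + 2 * (n * e) + + 2 * (n * (R - l)) ≡ n * n - (1ℤ + (n * e + n * l + n * l))
  edge-outside-identity = solve-∀

  square-identity : ∀ n e l s p q → n * e - s + n * (e - p) + n * (e - q) ≡ n * (+ 3 * e + + 2 * l) - (s + n * p + n * q + n * l + n * l)
  square-identity = solve-∀

  square-identity₂ : ∀ n e l s G R → G * (n * (+ 3 * e + + 2 * l) - s) + n * (n - (1ℤ + G * (+ 3 * e + + 2 * R))) + + 2 * (n * (G * (R - l))) + (n - 1ℤ)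
    ≡ n * n - (1ℤ + G * s)
  square-identity₂ = solve-∀

  nonzero-identity : ∀ a b c d → a - ((b - c) + d) ≡ - ((d - a) - (c - b))
  nonzero-identity = solve-∀

  enough-identity₂ : ∀ b l e R D → + 2 * e - b + (R - l) + (+ 6 + + 2 * D) * e + + 2 * R + + 5 ≡ (+ 8 + + 3 * D) * e + + 3 * R + + 5 - (b + D * e + l)
  enough-identity₂ = solve-∀

  size-identity : ∀ D k l → D - k + 1ℤ ≡ l + (D + + 2) - (k + (1ℤ + l))
  size-identity = solve-∀

  half₁-identity₂ : ∀ D → D + + 2 ≡ + 2 * D + + 4 - (0ℤ + (D + + 2))
  half₁-identity₂ = solve-∀

  len₁₂-identity : ∀ D l → D + + 2 - l ≡ + 2 * D + + 4 - (l + (D + + 2))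
  len₁₂-identity = solve-∀

  sum-of-identity : ∀ a i → a * (+ 2 - + 4 * i) ≡ + 2 * a - + 4 * (a * i)
  sum-of-identity = solve-∀

  zero-lem-identity : ∀ y i → 0ℤ * y ≡ + 2 * 0ℤ - + 4 * (0ℤ * i)
  zero-lem-identity = solve-∀

  mixed-identity : ∀ dp dt a b → + 2 * dp - + 4 * a - (+ 2 * dt - + 4 * b) ≡ + 2 * (dp - dt) - + 4 * a + + 4 * b
  mixed-identity = solve-∀

  mixed-identity₂ : ∀ a b j → + 2 * (1ℤ + + 2 * j) - + 4 * a + + 4 * b ≡ + 2 + + 4 * (j - a + b)
  mixed-identity₂ = solve-∀

  g-bd-identity : ∀ D p t → + 2 * (D - p) + + 2 * (D - t) ≡ + 4 * D - (p * + 2 + t * + 2)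
  g-bd-identity = solve-∀

  start-negative-identity : ∀ D → + 4 * (D - 1ℤ) + + 2 ≡ + 4 * D - + 2
  start-negative-identity = solve-∀

  Ls≤-identity : ∀ D a b → D - a + (D - b) + + 2 ≡ + 2 * D + + 4 - ((1ℤ + a) + (1ℤ + b))
  Ls≤-identity = solve-∀

  choose-identity : ∀ q t p → q - t ≡ (p - t) - (p - q)
  choose-identity = solve-∀

  choose-identity₂ : ∀ i j → + 2 * i - (1ℤ + + 2 * j) ≡ 1ℤ + + 2 * (i - j - 1ℤ)
  choose-identity₂ = solve-∀

  grow-identity : ∀ m s → (1ℤ + m) * s + s ≡ (1ℤ + (1ℤ + m)) * s
  grow-identity = solve-∀

  close-identity : ∀ t d x → x - (t - d) ≡ d - (t - x)
  close-identity = solve-∀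

  hit-4-identity : ∀ i → + 4 * (+ 2 * i) ≡ + 8 * i
  hit-4-identity = solve-∀

  hit-4-identity₂ : ∀ t x D → t - + 8 * D - x + + 8 * D ≡ t - x - 0ℤ
  hit-4-identity₂ = solve-∀

  hit-4-identity₃ : ∀ t x D → x - (t - + 8 * D - + 32 * D) + + 8 * D ≡ + 48 * D - (t - x)
  hit-4-identity₃ = solve-∀

  hit-4-identity₄ : ∀ t x g → t - (x + + 2 * g) ≡ (t - x) - + 2 * g
  hit-4-identity₄ = solve-∀

  hit-4-identity₅ : ∀ i o → + 4 * (1ℤ + + 2 * i) - + 2 * (+ 2 + + 4 * o) ≡ + 8 * (i - o)
  hit-4-identity₅ = solve-∀

  hit-4-identity₆ : ∀ t x D g → t - + 8 * D - x + + 2 * (+ 4 * D - g) ≡ t - (x + + 2 * g) - 0ℤ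
  hit-4-identity₆ = solve-∀

  hit-4-identity₇ : ∀ t x D g → x - (t - + 8 * D - + 32 * D) + + 2 * (g - - (+ 4 * D)) ≡ + 48 * D - (t - (x + + 2 * g))
  hit-4-identity₇ = solve-∀

  𝔼≡M-4j-identity : ∀ a i → a * (1ℤ - + 2 * i) ≡ a - + 2 * (a * i)
  𝔼≡M-4j-identity = solve-∀

  𝔼≡M-4j-identity₂ : ∀ m x → m - + 2 * (+ 2 * x) ≡ m + + 4 * - x
  𝔼≡M-4j-identity₂ = solve-∀

  edge-identity : ∀ a s x y → a * (s * ((1ℤ - + 2 * x) * (1ℤ - + 2 * y))) ≡ s * (a - + 2 * (a * x) - + 2 * (a * y) + + 4 * (a * (x * y)))
  edge-identity = solve-∀

  ∑dh-identity : ∀ p q x → (p + + 2 * q) * x ≡ p * x + + 2 * (q * x)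
  ∑dh-identity = solve-∀

  𝔼-mod8-identity : ∀ s m x y z → s * (m - + 2 * (x + + 2 * y) - + 2 * (x + + 2 * y) + + 4 * (+ 2 * z)) ≡ s * (m - + 4 * x) + + 8 * (s * (z - y))
  𝔼-mod8-identity = solve-∀

  total-identity₂ : ∀ e G R x y z → e - x + (e - y) + (e - z) + (G - 1ℤ) * (+ 3 * e + + 2 * R) + + 2 * R ≡ G * (+ 3 * e + + 2 * R) - (x + y + z)
  total-identity₂ = solve-∀

  cancel-identity : ∀ a b c → c * a * (b * b) ≡ b * a * (c * b)
  cancel-identity = solve-∀

  cancel-identity₂ : ∀ a r b → a * (r * (a * b)) ≡ a * a * (b * r)
  cancel-identity₂ = solve-∀

  module Spectra {n : ℕ} {A : Mat n} {k : ℕ} (H : Adjacency A (+ k)) where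
    open Embeddings H public

    Δ : ℤ
    Δ = + k

    module _ {e G R : ℤ} (rm : Room nn M Δ e G R) where
      open Room rm

      far-bound : ∀ F → + length F ≤ R → ∑ (far F) ≤ (1ℤ + Δ + Δ * Δ) * R
      far-bound F h = ≤-trans (∑far 0≤Δ F) (*-monoˡ (num 1 ⊕ 0≤Δ ⊕ 0≤Δ ⊗ 0≤Δ) h)

      -- Some degree d ≥ 1 is so frequent that vertices of degree d exist far from every small set.
      supply : ∃[ d ] 1ℤ ≤ d × (∀ F → + length F ≤ R → ∃[ u ] Far F u × deg u ≡ d)
      supply = + ℕ.suc (toℕ i) , +≤+ (ℕ.s≤s ℕ.z≤n) , λ F h → find F h
        where
        ind : Fin k → Fin n → ℤ
        ind i u = indicator (+ ℕ.suc (toℕ i)) (deg u)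
        ind≥0 : ∀ i u → 0ℤ ≤ ind i u
        ind≥0 i u = indicator≥0 (+ ℕ.suc (toℕ i)) (deg u)
        one≤ : ∀ u x → deg u ≡ x → 0ℤ ≤ x → x ≤ Δ → x ≤ Δ * ∑ (λ i → ind i u)
        one≤ u (+ ℕ.zero) _ _ _ = 0≤Δ ⊗ ∑-nonneg (λ i → ind≥0 i u)
        one≤ u +[1+ j ] e _ (+≤+ j<k) = ≤-trans (+≤+ j<k) (≤-trans (≤-reflexive (sym (*-identityʳ Δ))) (*-monoˡ 0≤Δ
          (≤-trans (≤-reflexive (sym one)) (term≤∑ (λ i → ind≥0 i u) (fromℕ< j<k)))))
          where one : ind (fromℕ< j<k) u ≡ 1ℤ
                one = trans (cong₂ (λ a b → indicator (+ ℕ.suc a) b) (toℕ-fromℕ< j<k) e) (indicator-refl +[1+ j ])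
        bound = (1ℤ + Δ + Δ * Δ) * R
        M≤ : M ≤ Δ * ∑² ind
        M≤ = ≤-trans (∑-mono (λ u → one≤ u (deg u) refl (deg≥0 u) (Adjacency.deg≤ H u)))
          (≤-reflexive (trans (∑-*ˡ Δ _) (cong (Δ *_) (sym (∑²-comm ind)))))
        freq : ∑ {k} (λ _ → bound) < ∑ (λ i → ∑ (ind i))
        freq = subst (_< ∑² ind) (sym (∑-const k bound)) (*-cancelˡ-<-nonNeg Δ {{nonNegative 0≤Δ}} (<-≤-trans many M≤))
        found = ∑<⇒∃< (λ _ → bound) (λ i → ∑ (ind i)) freq
        i = proj₁ found
        find : ∀ F → + length F ≤ R → ∃[ u ] Far F u × deg u ≡ + ℕ.suc (toℕ i)
        find F h = u , far⇒Far F u (below-1 (far≥0 F u) (<-≤-trans (proj₂ hit) ind≤1)) , indicator⇒≡ (≤-<-trans (far≥0 F u) (proj₂ hit))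
          where
          hit = ∑<⇒∃< (far F) (ind i) (≤-<-trans (far-bound F h) (proj₂ found))
          u = proj₁ hit
          ind≤1 : ind i u ≤ 1ℤ
          ind≤1 = ≤by (ne0≥0 (deg u - + ℕ.suc (toℕ i))) (ind≤1-identity (ne0 (deg u - + ℕ.suc (toℕ i))))

      module _ {v : Mat n} (W : Weight v) {d : ℤ} (sp : Spread v e d G) where
        open Weight W using () renaming (val to v-val; symm to v-sym)
        open Spread sp

        pm : ∀ {a b} → N v a b ≡ 0ℤ → PM (v a b)
        pm {a} {b} e = N≡0⇒PM (v-val a b) e

        record Square (L : List (Fin n)) : Set where
          field
            x x′ y y′ : Fin n
            g         : ℤ
            cycle     : Cycle W x x′ y y′ g
            x∉        : x ∉ L
            x′∉       : x′ ∉ L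
            y∉        : y ∉ L
            y′∉       : y′ ∉ L

        G≥0 : 0ℤ ≤ G
        G≥0 = ≤-trans 0≤1 1≤G

        oriented : ∀ {L x x′ y y′} → x ∉ L → x′ ∉ L → y ∉ L → y′ ∉ L → N v x y ≡ 0ℤ → N v x′ y ≡ 0ℤ → N v x y′ ≡ 0ℤ → N v x′ y′ ≡ 0ℤ →
          (v x′ y - v x y) - (v x′ y′ - v x y′) ≢ 0ℤ → Square L
        oriented {L} {x} {x′} {y} {y′} a b c d e f g h ne with 1ℤ ≤? (v x′ y - v x y) - (v x′ y′ - v x y′)
        ... | yes p = record { cycle = record { xy = e ; x′y = f ; xy′ = g ; x′y′ = h ; val = refl ; 1≤g = p } ; x∉ = a ; x′∉ = b ; y∉ = c ; y′∉ = d }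
        ... | no ¬p = record { cycle = record { xy = f ; x′y = e ; xy′ = h ; x′y′ = g ; val = refl ; 1≤g = pos′ } ; x∉ = b ; x′∉ = a ; y∉ = c ; y′∉ = d }
          where
          q = (v x′ y - v x y) - (v x′ y′ - v x y′)
          q<0 : q < 0ℤ
          q<0 with <-cmp q 0ℤ
          ... | tri< r _ _ = r
          ... | tri≈ _ r _ = ⊥-elim (ne r)
          ... | tri> _ _ r = ⊥-elim (¬p (<⇒1+≤ r))
          pos′ : 1ℤ ≤ (v x y - v x′ y) - (v x y′ - v x′ y′)
          pos′ = subst (1ℤ ≤_) (oriented-identity (v x′ y) (v x y) (v x′ y′) (v x y′)) (<⇒1+≤ (neg-mono-< q<0))

        NN≤ : ∑² (N v) ≤ nn * e
        NN≤ = ≤-trans (∑-mono row-N) (≤-reflexive (∑-const n e))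

        q≥0 : 0ℤ ≤ + 3 * e + + 2 * R
        q≥0 = num 3 ⊗ 0≤e ⊕ num 2 ⊗ 0≤R

        1≤nn : 1ℤ ≤ nn
        1≤nn = <⇒1+≤ (≤-<-trans (G≥0 ⊗ q≥0) cycles)

        cnt-sum₁ : ∀ L → ∑² {n} {n} (λ a _ → cnt L a) ≡ nn * + length L
        cnt-sum₁ L = trans (∑²-fst (cnt L)) (cong (nn *_) (∑cnt L))

        cnt-sum₂ : ∀ L → ∑² {n} {n} (λ _ b → cnt L b) ≡ nn * + length L
        cnt-sum₂ L = trans (∑²-snd (cnt L)) (cong (nn *_) (∑cnt L))

        edge-outside : ∀ L → + length L ≤ R → ∃[ a ] ∃[ b ] N v a b ≡ 0ℤ × a ∉ L × b ∉ L
        edge-outside L h = a , b , sum≡0ˡ (proj₁ (N-bd W a b)) (cnt≥0 L a) e₁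
            , cnt≡0⇒∉ {F = L} (sum≡0ʳ (proj₁ (N-bd W a b)) (cnt≥0 L a) e₁) , cnt≡0⇒∉ {F = L} (sum≡0ʳ (proj₁ (N-bd W a b) ⊕ cnt≥0 L a) (cnt≥0 L b) e₀)
          where
          arith : ∀ l → l ≤ R → 1ℤ + (nn * e + nn * l + nn * l) ≤ nn * nn
          arith l h = ≤by (num n ⊗ diff (<⇒1+≤ cycles) ⊕ diff 1≤nn ⊕ num n ⊗ (diff 1≤G ⊗ q≥0) ⊕ num 2 ⊗ (num n ⊗ 0≤e) ⊕ num 2 ⊗ (num n ⊗ diff h)) (edge-outside-identity nn G e R l)
          lt : ∑² (λ a b → N v a b + cnt L a + cnt L b) < ∑² {n} {n} (λ _ _ → 1ℤ)
          lt = subst₂ _<_ (sym (trans (∑²-+ _ _) (cong₂ _+_ (trans (∑²-+ _ _) (cong (λ z → ∑² (N v) + z) (cnt-sum₁ L))) (cnt-sum₂ L))))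
                 (sym (trans (∑²-fst (λ _ → 1ℤ)) (cong (nn *_) (trans (∑-const n 1ℤ) (*-identityʳ nn)))))
                 (≤-<-trans (+-monoˡ-≤ (nn * + length L) (+-monoˡ-≤ (nn * + length L) NN≤)) (1+≤⇒< (arith (+ length L) h)))
          hit = ∑∑<⇒∃< (λ a b → N v a b + cnt L a + cnt L b) (λ _ _ → 1ℤ) lt
          a = proj₁ hit
          b = proj₁ (proj₂ hit)
          e₀ = below-1 (proj₁ (N-bd W a b) ⊕ cnt≥0 L a ⊕ cnt≥0 L b) (proj₂ (proj₂ hit))
          e₁ = sum≡0ˡ (proj₁ (N-bd W a b) ⊕ cnt≥0 L a) (cnt≥0 L b) e₀

        square : ∀ L → + length L ≤ R → Square L
        square L h = oriented (cnt≡0⇒∉ {F = L} x0) x′∉ (cnt≡0⇒∉ {F = L} y0) y′∉ n₁ n₂ n₃ x′y′ nonzero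
          where
          l = + length L
          start = edge-outside L h
          x′ = proj₁ start
          y′ = proj₁ (proj₂ start)
          x′y′ = proj₁ (proj₂ (proj₂ start))
          x′∉ = proj₁ (proj₂ (proj₂ (proj₂ start)))
          y′∉ = proj₂ (proj₂ (proj₂ (proj₂ start)))
          f g : Mat n
          f x y = N v x y + N v x′ y + N v x y′ + cnt L x + cnt L y
          g x y = ne0 (v x y - ((v x y′ - v x′ y′) + v x′ y))
          f≤ : ∑² f ≤ nn * (+ 3 * e + + 2 * l)
          f≤ = ≤-trans (≤-reflexive (trans (∑²-+ _ _) (cong₂ _+_ (trans (∑²-+ _ _) (cong₂ _+_ (trans (∑²-+ _ _) (cong₂ _+_ (trans (∑²-+ _ _)
                 (cong (λ z → ∑² (N v) + z) (∑²-snd (N v x′)))) (∑²-fst (λ x → N v x y′)))) (cnt-sum₁ L))) (cnt-sum₂ L))))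
               (arith (∑² (N v)) (row (N v) x′) (∑ (λ x → N v x y′)) NN≤ (row-N x′) (≤-trans (≤-reflexive (∑-cong (λ x → N-sym W x y′))) (row-N y′)))
            where
            arith : ∀ s p q → s ≤ nn * e → p ≤ e → q ≤ e → s + nn * p + nn * q + nn * l + nn * l ≤ nn * (+ 3 * e + + 2 * l)
            arith s p q i j k = ≤by (diff i ⊕ num n ⊗ diff j ⊕ num n ⊗ diff k) (square-identity nn e l s p q)
          lt : ∑² f < ∑² g
          lt = *-cancelˡ-<-nonNeg G {{nonNegative G≥0}} (<-≤-trans (1+≤⇒< (arith (∑² f) f≤)) (rich (λ x → v x y′ - v x′ y′) (v x′)))
            where
            arith : ∀ s → s ≤ nn * (+ 3 * e + + 2 * l) → 1ℤ + G * s ≤ nn * nn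
            arith s i = ≤by (G≥0 ⊗ diff i ⊕ num n ⊗ diff (<⇒1+≤ cycles) ⊕ num 2 ⊗ (num n ⊗ (G≥0 ⊗ diff h)) ⊕ diff 1≤nn) (square-identity₂ nn e l s G R)
          hit = ∑∑<⇒∃< f g lt
          x = proj₁ hit
          y = proj₁ (proj₂ hit)
          k₁ = proj₁ (N-bd W x y)
          k₂ = proj₁ (N-bd W x′ y)
          k₃ = proj₁ (N-bd W x y′)
          k₄ = cnt≥0 L x
          k₅ = cnt≥0 L y
          gap = v x y - ((v x y′ - v x′ y′) + v x′ y)
          f0 : f x y ≡ 0ℤ
          f0 = below-1 (k₁ ⊕ k₂ ⊕ k₃ ⊕ k₄ ⊕ k₅) (<-≤-trans (proj₂ (proj₂ hit)) (ne0≤1 gap))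
          f1 = sum≡0ˡ (k₁ ⊕ k₂ ⊕ k₃ ⊕ k₄) k₅ f0
          y0 = sum≡0ʳ (k₁ ⊕ k₂ ⊕ k₃ ⊕ k₄) k₅ f0
          f2 = sum≡0ˡ (k₁ ⊕ k₂ ⊕ k₃) k₄ f1
          x0 = sum≡0ʳ (k₁ ⊕ k₂ ⊕ k₃) k₄ f1
          n₃ = sum≡0ʳ (k₁ ⊕ k₂) k₃ f2
          n₁ = sum≡0ˡ k₁ k₂ (sum≡0ˡ (k₁ ⊕ k₂) k₃ f2)
          n₂ = sum≡0ʳ k₁ k₂ (sum≡0ˡ (k₁ ⊕ k₂) k₃ f2)
          nonzero : (v x′ y - v x y) - (v x′ y′ - v x y′) ≢ 0ℤ
          nonzero z = <-irrefl refl (subst₂ _<_ f0 (cong ne0 (trans (nonzero-identity (v x y) (v x y′) (v x′ y′) (v x′ y)) (cong -_ z))) (proj₂ (proj₂ hit)))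

        NegativeSquare : Set
        NegativeSquare = ∃[ x ] ∃[ x′ ] ∃[ y ] ∃[ y′ ] (N v x y ≡ 0ℤ × N v x′ y ≡ 0ℤ) × (N v x y′ ≡ 0ℤ × N v x′ y′ ≡ 0ℤ)
                   × (v x′ y - v x y) - (v x′ y′ - v x y′) ≡ + 2

        negativeSquare? : Dec NegativeSquare
        negativeSquare? = any? (λ x → any? (λ x′ → any? (λ y → any? (λ y′ →
          ((N v x y ≟ 0ℤ) ×-dec (N v x′ y ≟ 0ℤ)) ×-dec (((N v x y′ ≟ 0ℤ) ×-dec (N v x′ y′ ≟ 0ℤ)) ×-dec ((v x′ y - v x y) - (v x′ y′ - v x y′) ≟ + 2))))))

        same-product : ¬ NegativeSquare → ∀ {x x′ y y′} → N v x y ≡ 0ℤ → N v x′ y ≡ 0ℤ → N v x y′ ≡ 0ℤ → N v x′ y′ ≡ 0ℤ →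
          v x′ y * v x y ≡ v x′ y′ * v x y′
        same-product ¬neg {x} {x′} {y} {y′} a b c d with parity-gap (pm b) (pm a) (pm d) (pm c)
        ... | inj₁ e = e
        ... | inj₂ (inj₁ e) = ⊥-elim (¬neg (x , x′ , y , y′ , (a , b) , (c , d) , e))
        ... | inj₂ (inj₂ e) = ⊥-elim (¬neg (x′ , x , y , y′ , (b , a) , (d , c) , e))

        opposites : ¬ NegativeSquare → ∃[ x ] ∃[ x′ ] x ≢ x′ × (∀ {z} → N v x z ≡ 0ℤ → N v x′ z ≡ 0ℤ → v x′ z - v x z ≡ + 2 ⊎ v x′ z - v x z ≡ - + 2)
        opposites ¬neg = x , x′ , Cycle.x≢x′ cycle , λ p q → opposite-gap (pm q) (pm p) (prod p q)
          where
          open Square (square [] 0≤R)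
          module C = Cycle cycle
          by-cases : v x′ y - v x y ≡ 0ℤ ⊎ v x′ y * v x y ≡ -1ℤ → v x′ y′ - v x y′ ≡ 0ℤ ⊎ v x′ y′ * v x y′ ≡ -1ℤ →
            ∃[ t ] N v x t ≡ 0ℤ × N v x′ t ≡ 0ℤ × v x′ t * v x t ≡ -1ℤ
          by-cases (inj₂ e) _ = y , C.xy , C.x′y , e
          by-cases _ (inj₂ e) = y′ , C.xy′ , C.x′y′ , e
          by-cases (inj₁ p) (inj₁ q) = ≤-absurd (subst (1ℤ ≤_) (trans (sym C.val) (cong₂ _-_ p q)) C.1≤g) (+<+ (ℕ.s≤s ℕ.z≤n))
          t = by-cases (equal-or-opposite (pm C.x′y) (pm C.xy)) (equal-or-opposite (pm C.x′y′) (pm C.xy′))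
          prod : ∀ {z} → N v x z ≡ 0ℤ → N v x′ z ≡ 0ℤ → v x′ z * v x z ≡ -1ℤ
          prod p q = trans (same-product ¬neg p q (proj₁ (proj₂ t)) (proj₁ (proj₂ (proj₂ t)))) (proj₂ (proj₂ (proj₂ t)))

    far-antitone : ∀ {F L u} → (∀ {a} → a ∈ F → a ∈ L) → Far L u → Far F u
    far-antitone h f = record { out = λ p → Far.out f (h p) ; out₁ = λ p → Far.out₁ f (h p) ; out₂ = λ p q → Far.out₂ f (h p) q }

    module Core {e G R : ℤ} (rm : Room nn M Δ e G R) {v : Mat n} (W : Weight v) {d : ℤ} (sp : Spread v e d G) where
      open Room rm
      open Spread sp
      open Weight W using () renaming (bd to v-bd)

      enough : ∀ {b l} → b ≤ + 2 * e → l ≤ R → b + Δ * e + l < nn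
      enough {b} {l} p q = ≤-<-trans (≤by (diff p ⊕ diff q ⊕ (num 6 ⊕ num 2 ⊗ 0≤Δ) ⊗ 0≤e ⊕ num 2 ⊗ 0≤R ⊕ num 5) (enough-identity₂ b l e R Δ)) build

      Odd : Gd W → Set
      Odd (_ , _ , g) = (∃[ j ] g ≡ + 2 + + 4 * j) × ∣ g ∣≤ (+ 4 * Δ)

      record Start : Set where
        field
          F      : List (Fin n)
          φ      : Permutation′ n
          G₀     : Gd W
          kit    : Kit W F φ (G₀ ∷ [])
          odd    : Odd G₀
          length≤ : + length F ≤ + 2 * Δ + + 4

      mixed : ∀ p t x x′ → + 2 * Δ + + 4 ≤ R → Far (p ∷ nbrs p) t → (∃[ j ] deg p - deg t ≡ 1ℤ + + 2 * j) → x ≢ x′ →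
        (∀ {z} → N v x z ≡ 0ℤ → N v x′ z ≡ 0ℤ → v x′ z - v x z ≡ + 2 ⊎ v x′ z - v x z ≡ - + 2) → Start
      mixed p t x x′ R≥ far (j , dj) x≢x′ opp = record
        { F = H₂.F′ ; φ = H₂.φ′ ; G₀ = p , t , g
        ; kit = record { ok = H₂.ok ; indep = [] ∷ [] ; valid = gad ∷ []
                       ; closed = ((H₂.old H₁.cen∈ , H₂.cen∈) , (λ e → H₂.old (proj₁ (H₁.nb e))) , (λ e → proj₁ (H₂.nb e))) ∷ [] }
        ; odd = (j - ∑ (λ b → A p b * isNeg (jump b)) + ∑ (λ b → A t b * isNeg (jump b)) , g≡) , g-bd
        ; length≤ = len₂ }
        where
        bad : Fin n → ℤ
        bad z = N v x z + N v x′ z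
        b₁≥0 : ∀ z → 0ℤ ≤ N v x z
        b₁≥0 z = proj₁ (N-bd W x z)
        b₂≥0 : ∀ z → 0ℤ ≤ N v x′ z
        b₂≥0 z = proj₁ (N-bd W x′ z)
        ∑bad : ∑ bad ≤ + 2 * e
        ∑bad = ≤-trans (≤-reflexive (∑-+ _ _)) (≤-trans (+-mono-≤ (row-N x) (row-N x′)) (≤-reflexive (x+x≡2x e)))
        none : ∀ {F φ u y} φ₁ → AgreeOn F φ₁ φ → φ₁ ⟨$⟩ʳ u ≡ y → Ok v (u ∷ F) φ₁ →
          Σ (Ext v (u ∷ F) φ₁ [] (_≡ x)) (λ X → ∀ {b} → b ∈ [] → Ext.φ′ X ⟨$⟩ʳ b ≡ x)
        none φ₁ _ _ ok = record { F′ = _ ; φ′ = φ₁ ; old = λ q → q ; new = λ () ; agree = λ _ → refl ; ok = ok ; src = inj₁ ; len = ℕₚ.≤-refl } , λ ()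
        size : ∀ u (F : List (Fin n)) → + (length (nbrs u) ℕ.+ (0 ℕ.+ ℕ.suc (length F))) ≤ + length F + (Δ + + 2)
        size u F = ≤-trans (≤-reflexive (pos-+ (length (nbrs u)) (ℕ.suc (length F)))) (≤by (diff (length-nbrs u) ⊕ num 1) (size-identity Δ (+ length (nbrs u)) (+ length F)))
        ok₀ : Ok v [] Perm.id
        ok₀ ()
        far₀ : Far [] p
        far₀ = record { out = λ () ; out₁ = λ () ; out₂ = λ () }
        half₁ : Half W [] Perm.id p x [] x bad
        half₁ = half W row-N bad (λ z → b₁≥0 z ⊕ b₂≥0 z) (λ {a} {b} → ok₀ {a} {b}) far₀ (λ ()) (none {[]} {Perm.id})
          (enough ∑bad (≤-trans (size p []) (≤-trans (≤by (0≤Δ ⊕ num 2) (half₁-identity₂ Δ)) R≥)))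
        module H₁ = Half half₁
        F₁⊆ : ∀ {a} → a ∈ H₁.F′ → a ∈ p ∷ nbrs p
        F₁⊆ {a} q = go (H₁.within q)
          where go : (a ∈ [] ⊎ a ≡ p) ⊎ (a ∈ [] ⊎ A p a ≡ 1ℤ) → a ∈ p ∷ nbrs p
                go (inj₁ (inj₂ refl)) = here refl
                go (inj₂ (inj₂ e)) = there (∈nbrs e)
        farT : Far H₁.F′ t
        farT = far-antitone F₁⊆ far
        len₁ : + length H₁.F′ ≤ Δ + + 2
        len₁ = ≤-trans (+≤+ H₁.len) (≤-trans (size p []) (≤-reflexive (+-identityˡ _)))
        avoid : Avoids W H₁.F′ H₁.φ′ x′
        avoid {a} q eq = go (H₁.img q)
          where go : a ∈ [] ⊎ (H₁.φ′ ⟨$⟩ʳ a ≡ x ⊎ H₁.φ′ ⟨$⟩ʳ a ≡ x ⊎ bad (H₁.φ′ ⟨$⟩ʳ a) ≡ 0ℤ) → ⊥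
                go (inj₂ (inj₁ e)) = x≢x′ (trans (sym e) eq)
                go (inj₂ (inj₂ (inj₁ e))) = x≢x′ (trans (sym e) eq)
                go (inj₂ (inj₂ (inj₂ e))) = N⇒≢ W (sum≡0ʳ (b₁≥0 _) (b₂≥0 _) e) (sym eq)
        len₁₂ : + length H₁.F′ + (Δ + + 2) ≤ + 2 * Δ + + 4
        len₁₂ = ≤by (diff len₁) (len₁₂-identity Δ (+ length H₁.F′))
        half₂ : Half W H₁.F′ H₁.φ′ t x′ [] x bad
        half₂ = half W row-N bad (λ z → b₁≥0 z ⊕ b₂≥0 z) H₁.ok farT avoid (none {H₁.F′} {H₁.φ′})
          (enough ∑bad (≤-trans (size t H₁.F′) (≤-trans len₁₂ R≥)))
        module H₂ = Half half₂
        len₂ : + length H₂.F′ ≤ + 2 * Δ + + 4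
        len₂ = ≤-trans (+≤+ H₂.len) (≤-trans (size t H₁.F′) len₁₂)
        jump : Fin n → ℤ
        jump b = v x′ (H₂.φ′ ⟨$⟩ʳ b) - v x (H₂.φ′ ⟨$⟩ʳ b)
        g : ℤ
        g = ∑ (λ b → A p b * jump b) - ∑ (λ b → A t b * jump b)
        drop : ∀ {φ₂ : Permutation′ n} {b} → b ∈ [] ⊎ bad (φ₂ ⟨$⟩ʳ b) ≡ 0ℤ → bad (φ₂ ⟨$⟩ʳ b) ≡ 0ℤ
        drop (inj₂ e) = e
        at : ∀ {b} → A p b ≡ 1ℤ → bad (H₂.φ′ ⟨$⟩ʳ b) ≡ 0ℤ
        at {b} e = trans (cong bad (H₂.agree (proj₁ (H₁.nb e)))) (drop {H₁.φ′} {b} (proj₂ (H₁.nb e)))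
        at′ : ∀ {b} → A t b ≡ 1ℤ → bad (H₂.φ′ ⟨$⟩ʳ b) ≡ 0ℤ
        at′ {b} e = drop {H₂.φ′} {b} (proj₂ (H₂.nb e))
        gad : Gad v H₂.φ′ p t g
        gad = gad-from W {H₂.φ′} (trans (H₂.agree H₁.cen∈) H₁.cen) H₂.cen (trans (A-sym p t) (Far.out₁ farT H₁.cen∈))
          (λ e → sum≡0ʳ (b₁≥0 _) (b₂≥0 _) (at e)) (λ e → sum≡0ˡ (b₁≥0 _) (b₂≥0 _) (at′ e)) refl
        sum-of : ∀ u → (∀ {b} → A u b ≡ 1ℤ → bad (H₂.φ′ ⟨$⟩ʳ b) ≡ 0ℤ) →
          ∑ (λ b → A u b * jump b) ≡ + 2 * deg u - + 4 * ∑ (λ b → A u b * isNeg (jump b))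
        sum-of u h = trans (∑-cong (λ b → term b (A≡0or1 u b))) (trans (∑-- _ _) (cong₂ _-_ (∑-*ˡ (+ 2) (A u)) (∑-*ˡ (+ 4) (λ b → A u b * isNeg (jump b)))))
          where
          value : ∀ {y} → y ≡ + 2 ⊎ y ≡ - + 2 → y ≡ + 2 - + 4 * isNeg y
          value (inj₁ refl) = refl
          value (inj₂ refl) = refl
          lem : ∀ a y i → y ≡ + 2 - + 4 * i → a * y ≡ + 2 * a - + 4 * (a * i)
          lem a y i refl = sum-of-identity a i
          zero-lem : ∀ a y i → a ≡ 0ℤ → a * y ≡ + 2 * a - + 4 * (a * i)
          zero-lem a y i refl = zero-lem-identity y i
          term : ∀ b → A u b ≡ 0ℤ ⊎ A u b ≡ 1ℤ → A u b * jump b ≡ + 2 * A u b - + 4 * (A u b * isNeg (jump b))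
          term b (inj₁ q) = zero-lem (A u b) (jump b) (isNeg (jump b)) q
          term b (inj₂ q) = lem (A u b) (jump b) (isNeg (jump b)) (value (opp (sum≡0ˡ (b₁≥0 _) (b₂≥0 _) (h q)) (sum≡0ʳ (b₁≥0 _) (b₂≥0 _) (h q))))
        g≡ : g ≡ + 2 + + 4 * (j - ∑ (λ b → A p b * isNeg (jump b)) + ∑ (λ b → A t b * isNeg (jump b)))
        g≡ = trans (cong₂ _-_ (sum-of p at) (sum-of t at′))
          (lem (deg p) (deg t) (∑ (λ b → A p b * isNeg (jump b))) (∑ (λ b → A t b * isNeg (jump b))) j dj)
          where lem : ∀ dp dt a b j → dp - dt ≡ 1ℤ + + 2 * j → + 2 * dp - + 4 * a - (+ 2 * dt - + 4 * b) ≡ + 2 + + 4 * (j - a + b)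
                lem dp dt a b j h = trans (mixed-identity dp dt a b) (trans (cong (λ z → + 2 * z - + 4 * a + + 4 * b) h) (mixed-identity₂ a b j))
        g-bd : ∣ g ∣≤ (+ 4 * Δ)
        g-bd = bd-weaken (bd-- (one p) (one t)) (≤by (num 2 ⊗ diff (Adjacency.deg≤ H p) ⊕ num 2 ⊗ diff (Adjacency.deg≤ H t)) (g-bd-identity Δ (deg p) (deg t)))
          where
          one : ∀ u → ∣ ∑ (λ b → A u b * jump b) ∣≤ (deg u * + 2)
          one u = subst (∣ ∑ (λ b → A u b * jump b) ∣≤_) (∑-*ʳ (+ 2) (A u)) (bd-∑ (λ b → bd-*ˡ (A≥0 u b) (bd-- (v-bd x′ (H₂.φ′ ⟨$⟩ʳ b)) (v-bd x (H₂.φ′ ⟨$⟩ʳ b)))))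

      avoids : ∀ {F φ x} → x ∉ map (φ ⟨$⟩ʳ_) F → Avoids W F φ x
      avoids {F} {φ} h a∈ eq = h (subst (_∈ map (φ ⟨$⟩ʳ_) F) eq (∈-map⁺ (φ ⟨$⟩ʳ_) a∈))

      length-image : ∀ F (φ : Permutation′ n) → + length F ≤ R → + length (map (φ ⟨$⟩ʳ_) F) ≤ R
      length-image F φ h = subst (λ l → + l ≤ R) (sym (length-map (φ ⟨$⟩ʳ_) F)) h

      start-negative : 1ℤ ≤ Δ → + 2 * Δ + + 4 ≤ R → NegativeSquare rm W sp → Start
      start-negative 1≤Δ R≥ (x , x′ , y , y′ , (a , b) , (c , d′) , g) =
        record { F = Gr.F′ ; φ = Gr.φ′ ; G₀ = Gr.new ; kit = Gr.kit
               ; odd = (0ℤ , Gr.gain) , subst (∣_∣≤ (+ 4 * Δ)) (sym Gr.gain) (nonneg-bd (num 2) (≤by (num 4 ⊗ diff 1≤Δ ⊕ num 2) (start-negative-identity Δ)))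
               ; length≤ = ≤-trans Gr.len (≤-reflexive (+-identityˡ _)) }
        where
        kit₀ : Kit W [] Perm.id []
        kit₀ = record { ok = λ () ; indep = [] ; valid = [] ; closed = [] }
        cycle : Cycle W x x′ y y′ (+ 2)
        cycle = record { xy = a ; x′y = b ; xy′ = c ; x′y′ = d′ ; val = g ; 1≤g = +≤+ (ℕ.s≤s ℕ.z≤n) }
        sup = supply rm
        module Gr = Grown (regular W row-N 0≤Δ build kit₀ (proj₁ (proj₂ sup)) (proj₂ (proj₂ sup))
          cycle
          (λ ()) (λ ()) (λ ()) (λ ()) (≤-trans (≤-reflexive (+-identityˡ _)) R≥))

      start-mixed : + 2 * Δ + + 4 ≤ R → ¬ NegativeSquare rm W sp → ∀ p q → (∃[ j ] deg p - deg q ≡ 1ℤ + + 2 * j) → Start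
      start-mixed R≥ ¬neg p q (j , e) = choose (even-or-odd (deg p - deg t))
        where
        Ls = (p ∷ nbrs p) ++ (q ∷ nbrs q)
        Ls≤ : + length Ls ≤ R
        Ls≤ = ≤-trans (≤-reflexive (trans (cong +_ (length-++ (p ∷ nbrs p))) (pos-+ (length (p ∷ nbrs p)) (length (q ∷ nbrs q)))))
               (≤-trans (≤by (diff (length-nbrs p) ⊕ diff (length-nbrs q) ⊕ num 2) (Ls≤-identity Δ (+ length (nbrs p)) (+ length (nbrs q)))) R≥)
        sup = supply rm
        t = proj₁ (proj₂ (proj₂ sup) Ls Ls≤)
        farT : Far Ls t
        farT = proj₁ (proj₂ (proj₂ (proj₂ sup) Ls Ls≤))
        o = opposites rm W sp ¬neg
        go : ∀ r → (∀ {a} → a ∈ r ∷ nbrs r → a ∈ Ls) → (∃[ i ] deg r - deg t ≡ 1ℤ + + 2 * i) → Start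
        go r h i = mixed r t (proj₁ o) (proj₁ (proj₂ o)) R≥ (far-antitone h farT) i (proj₁ (proj₂ (proj₂ o))) (proj₂ (proj₂ (proj₂ o)))
        choose : (∃[ i ] deg p - deg t ≡ + 2 * i) ⊎ (∃[ i ] deg p - deg t ≡ 1ℤ + + 2 * i) → Start
        choose (inj₂ i) = go p ∈-++⁺ˡ i
        choose (inj₁ (i , h)) = go q (∈-++⁺ʳ (p ∷ nbrs p)) (i - j - 1ℤ , trans (choose-identity (deg q) (deg t) (deg p)) (trans (cong₂ _-_ h e) (choose-identity₂ i j)))

      record Stock (base : List (Gd W)) (m : ℕ) : Set where
        field
          F      : List (Fin n)
          φ      : Permutation′ n
          news   : List (Gd W)
          count  : length news ≡ m
          small  : All (Small W) news
          kit    : Kit W F φ (news ++ base)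
          length≤ : + length F ≤ + (ℕ.suc m) * (+ 2 * Δ + + 4)

      grow : ∀ m {F φ base} → Kit W F φ base → + length F ≤ + 2 * Δ + + 4 → + (ℕ.suc m) * (+ 2 * Δ + + 4) ≤ R → Stock base m
      grow ℕ.zero {F} {φ} K h _ = record { F = F ; φ = φ ; news = [] ; count = refl ; small = [] ; kit = K
        ; length≤ = ≤-trans h (≤-reflexive (sym (*-identityˡ (+ 2 * Δ + + 4)))) }
      grow (ℕ.suc m) {F} {φ} {base} K h hR = record
        { F = Gr.F′ ; φ = Gr.φ′ ; news = Gr.new ∷ St.news ; count = cong ℕ.suc St.count ; small = sm ∷ St.small ; kit = Gr.kit
        ; length≤ = ≤-trans Gr.len (≤-trans (+-monoˡ-≤ s St.length≤) (≤-reflexive step)) }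
        where
        s = + 2 * Δ + + 4
        step : + (ℕ.suc m) * s + s ≡ + (ℕ.suc (ℕ.suc m)) * s
        step = grow-identity (+ m) s
        s≥0 : 0ℤ ≤ s
        s≥0 = num 2 ⊗ 0≤Δ ⊕ num 4
        hR′ : + (ℕ.suc m) * s ≤ R
        hR′ = ≤-trans (≤by s≥0 (y≡x+y-x (+ (ℕ.suc m) * s) s)) (≤-trans (≤-reflexive step) hR)
        module St = Stock (grow m K h hR′)
        sup = supply rm
        sq = square rm W sp (map (St.φ ⟨$⟩ʳ_) St.F) (length-image St.F St.φ (≤-trans St.length≤ hR′))
        module Sq = Square sq
        module C = Cycle Sq.cycle
        module Gr = Grown (regular W row-N 0≤Δ build St.kit (proj₁ (proj₂ sup)) (proj₂ (proj₂ sup)) Sq.cycle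
          (avoids {St.F} {St.φ} Sq.x∉) (avoids {St.F} {St.φ} Sq.x′∉) (avoids {St.F} {St.φ} Sq.y∉) (avoids {St.F} {St.φ} Sq.y′∉)
          (≤-trans (+-monoˡ-≤ s St.length≤) (≤-trans (≤-reflexive step) hR)))
        sm : Small W Gr.new
        sm = subst (λ g → g ≡ + 2 ⊎ g ≡ + 4) (trans C.val (sym Gr.gain))
          (small-gap (pm rm W sp C.x′y) (pm rm W sp C.xy) (pm rm W sp C.x′y′) (pm rm W sp C.xy′) (subst (1ℤ ≤_) (sym C.val) C.1≤g))

    module _ {e G R : ℤ} (rm : Room nn M Δ e G R) {v : Mat n} (W : Weight v) {d K : ℤ} (sp : Spread v e d G)
      (sz : Sizes nn M Δ e d R K G) where
      open Core rm W sp
      open Room rm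

      embed : ∀ {F φ} → Ok v F φ → + length F ≤ R → ∃[ ψ ] Good v ψ × AgreeOn F ψ φ
      embed {F} {φ} ok h = repair W (Spread.row-N sp) F 0≤Δ (≤-<-trans (+-monoʳ-≤ (+ 2 * (Δ * e)) h) fix) ∣ 𝔼 (N (pull v φ)) ∣ φ
        (≤-reflexive (sym (0≤i⇒+∣i∣≡i (EN≥0 (weight-permute W φ))))) ok

      Δ′ : ℤ
      Δ′ = + 32 * Δ

      tuned : ∀ {news} t m → length news ≡ 12 ℕ.* k → AllPairs (Indep W) news → All (Small W) news →
        2 ℕ.* m ℕ.≤ 12 ℕ.* k → ∀ θ j → Good v θ → All (Valid W θ) news → t - 𝔼 (pull v θ) ≡ + 8 * j → 0ℤ ≤ t - 𝔼 (pull v θ) →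
        t - 𝔼 (pull v θ) ≤ + 8 * + m → ∃[ θ′ ] Good v θ′ × 𝔼 (pull v θ′) ≡ t
      tuned {news} t m count ind sm 2m≤ θ j gθ val ej lo hi = go (multiple-small {j} (12 ℕ.* k) m (subst (0ℤ ≤_) ej lo) (≤-trans (≤-reflexive (sym ej)) hi) 2m≤)
        where
        go : ∃[ i ] j ≡ + i × 2 ℕ.* i ℕ.≤ 12 ℕ.* k → ∃[ θ′ ] Good v θ′ × 𝔼 (pull v θ′) ≡ t
        go (i , ei , le) = proj₁ tn , proj₁ (proj₂ tn) , trans (proj₂ (proj₂ tn))
            (trans (cong (λ z → 𝔼 (pull v θ) + + 8 * z) (sym ei)) (trans (cong (λ z → 𝔼 (pull v θ) + z) (sym ej)) (ascend-to-identity (𝔼 (pull v θ)) t)))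
          where tn = tune W i news θ (subst (2 ℕ.* i ℕ.≤_) (sym count) le) ind val sm gθ

      times : ∀ a → + (8 ℕ.* a) * + k ≡ + 8 * + (a ℕ.* k)
      times a = trans (cong (_* + k) (pos-* 8 a)) (trans (*-assoc (+ 8) (+ a) (+ k)) (cong (+ 8 *_) (sym (pos-* a k))))

      hit-8 : Stock [] (12 ℕ.* k) → + (ℕ.suc (12 ℕ.* k)) * (+ 2 * Δ + + 4) ≤ R →
        ∀ t → K * t ≤ M → K * (Δ′ - t) ≤ M → (∀ θ → Good v θ → ∃[ j ] t - 𝔼 (pull v θ) ≡ + 8 * j) →
        ∃[ θ ] Good v θ × 𝔼 (pull v θ) ≡ t
      hit-8 st hR t hi lo inv =
        tuned t (4 ℕ.* k) St.count (pairs-unbase St.news (Kit.indep St.kit)) St.small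
          (ℕₚ.≤-trans (ℕₚ.≤-reflexive (sym (ℕₚ.*-assoc 2 4 k))) (ℕₚ.*-monoˡ-≤ k (ℕₚ.m≤m+n 8 4)))
          θ (proj₁ (inv θ gθ)) gθ (transfer (Allₚ.++⁻ˡ St.news (Kit.closed St.kit)) (Allₚ.++⁻ˡ St.news (Kit.valid St.kit)))
          (proj₂ (inv θ gθ)) (diff upper) (≤-trans (close lower) (≤-reflexive (times 4)))
        where
        module St = Stock st
        F≤R : + length St.F ≤ R
        F≤R = ≤-trans St.length≤ hR
        em = embed {St.F} {St.φ} (Kit.ok St.kit) F≤R
        rc = reach sz St.F F≤R W sp t (proj₁ em) hi lo (proj₁ (proj₂ em))
        θ = proj₁ rc
        gθ : Good v θ
        gθ = proj₁ (proj₂ rc)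
        ag : AgreeOn St.F θ St.φ
        ag p = trans (proj₁ (proj₂ (proj₂ rc)) p) (proj₂ (proj₂ em) p)
        lower : t - Δ′ ≤ 𝔼 (pull v θ)
        lower = proj₁ (proj₂ (proj₂ (proj₂ rc)))
        upper : 𝔼 (pull v θ) ≤ t
        upper = proj₂ (proj₂ (proj₂ (proj₂ rc)))
        close : ∀ {x} → t - Δ′ ≤ x → t - x ≤ Δ′
        close {x} h = ≤by (diff h) (close-identity t Δ′ x)
        pairs-unbase : ∀ xs → AllPairs (Indep W) (xs ++ []) → AllPairs (Indep W) xs
        pairs-unbase []       _        = []
        pairs-unbase (x ∷ xs) (p ∷ ps) = Allₚ.++⁻ˡ xs p ∷ pairs-unbase xs ps
        transfer : ∀ {gs} → All (Closed W St.F) gs → All (Valid W St.φ) gs → All (Valid W θ) gs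
        transfer [] [] = []
        transfer (_∷_ {x = G₂} c cs) (x ∷ xs) = valid-agree W {St.F} {St.φ} {θ} G₂ c (λ e → sym (ag e)) x ∷ transfer cs xs

      hit-4 : (start : Start) → Stock (Start.G₀ start ∷ []) (12 ℕ.* k) → + (ℕ.suc (12 ℕ.* k)) * (+ 2 * Δ + + 4) ≤ R →
        ∀ t → K * (t - + 8 * Δ) ≤ M → K * (Δ′ - (t - + 8 * Δ)) ≤ M → (∀ θ → Good v θ → ∃[ j ] t - 𝔼 (pull v θ) ≡ + 4 * j) →
        ∃[ θ ] Good v θ × 𝔼 (pull v θ) ≡ t
      hit-4 start st hR t hi lo inv = finish (even-or-odd j)
        where
        module St = Stock st
        module S₀ = Start start
        G₀ = S₀.G₀
        F≤R : + length St.F ≤ R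
        F≤R = ≤-trans St.length≤ hR
        em = embed {St.F} {St.φ} (Kit.ok St.kit) F≤R
        ψ = proj₁ em
        rc = reach sz St.F F≤R W sp (t - + 8 * Δ) ψ hi lo (proj₁ (proj₂ em))
        θ = proj₁ rc
        gθ : Good v θ
        gθ = proj₁ (proj₂ rc)
        ag : AgreeOn St.F θ St.φ
        ag p = trans (proj₁ (proj₂ (proj₂ rc)) p) (proj₂ (proj₂ em) p)
        lower : t - + 8 * Δ - Δ′ ≤ 𝔼 (pull v θ)
        lower = proj₁ (proj₂ (proj₂ (proj₂ rc)))
        upper : 𝔼 (pull v θ) ≤ t - + 8 * Δ
        upper = proj₂ (proj₂ (proj₂ (proj₂ rc)))
        j = proj₁ (inv θ gθ)
        ej : t - 𝔼 (pull v θ) ≡ + 4 * j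
        ej = proj₂ (inv θ gθ)
        transfer : ∀ {gs} → All (Closed W St.F) gs → All (Valid W St.φ) gs → All (Valid W θ) gs
        transfer [] [] = []
        transfer (_∷_ {x = G₂} c cs) (x ∷ xs) = valid-agree W {St.F} {St.φ} {θ} G₂ c (λ e → sym (ag e)) x ∷ transfer cs xs
        valid : All (Valid W θ) (St.news ++ G₀ ∷ [])
        valid = transfer (Kit.closed St.kit) (Kit.valid St.kit)
        valid₀ : Valid W θ G₀
        valid₀ = All.head (Allₚ.++⁻ʳ St.news valid)
        split : ∀ xs → AllPairs (Indep W) (xs ++ G₀ ∷ []) → AllPairs (Indep W) xs × All (Indep W G₀) xs
        split []       _        = [] , []
        split (x ∷ xs) (p ∷ ps) = (Allₚ.++⁻ˡ xs p ∷ proj₁ (split xs ps)) , ind ∷ proj₂ (split xs ps)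
          where ind : Indep W G₀ x
                ind a b = let q , r = All.head (Allₚ.++⁻ʳ xs p) b a in (λ e → q (sym e)) , trans (A-sym _ _) r
        indep = split St.news (Kit.indep St.kit)
        tune-from : ∀ θ₁ j → Good v θ₁ → All (Valid W θ₁) St.news → t - 𝔼 (pull v θ₁) ≡ + 8 * j → 0ℤ ≤ t - 𝔼 (pull v θ₁) →
          t - 𝔼 (pull v θ₁) ≤ + 48 * Δ → ∃[ θ ] Good v θ × 𝔼 (pull v θ) ≡ t
        tune-from θ₁ j g₁ v₁ e₁ lo₁ hi₁ = tuned t (6 ℕ.* k) St.count (proj₁ indep) St.small (ℕₚ.≤-reflexive (sym (ℕₚ.*-assoc 2 6 k)))
          θ₁ j g₁ v₁ e₁ lo₁ (≤-trans hi₁ (≤-reflexive (times 6)))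
        finish : (∃[ i ] j ≡ + 2 * i) ⊎ (∃[ i ] j ≡ 1ℤ + + 2 * i) → ∃[ θ ] Good v θ × 𝔼 (pull v θ) ≡ t
        finish (inj₁ (i , ei)) = tune-from θ i gθ (Allₚ.++⁻ˡ St.news valid) (trans ej (trans (cong (+ 4 *_) ei) (hit-4-identity i)))
            (≤by (diff upper ⊕ num 8 ⊗ 0≤Δ) (hit-4-identity₂ t (𝔼 (pull v θ)) Δ)) (≤by (diff lower ⊕ num 8 ⊗ 0≤Δ) (hit-4-identity₃ t (𝔼 (pull v θ)) Δ))
        finish (inj₂ (i , ei)) = tune-from (flip W G₀ θ) (i - o) (flip-good W {θ} gθ valid₀) (all-flip W {θ} {G₀} (proj₂ indep) (Allₚ.++⁻ˡ St.news valid))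
            (trans (cong (λ z → t - z) flipE) (trans (hit-4-identity₄ t (𝔼 (pull v θ)) g) (trans (cong₂ (λ a b → a - + 2 * b) (trans ej (cong (+ 4 *_) ei)) eo) (hit-4-identity₅ i o))))
            (≤-trans (≤by (diff upper ⊕ num 2 ⊗ diff (proj₂ g-bd)) (hit-4-identity₆ t (𝔼 (pull v θ)) Δ g)) (≤-reflexive (cong (λ z → t - z) (sym flipE))))
            (≤-trans (≤-reflexive (cong (λ z → t - z) flipE)) (≤by (diff lower ⊕ num 2 ⊗ diff (proj₁ g-bd)) (hit-4-identity₇ t (𝔼 (pull v θ)) Δ g)))
          where
          g = proj₂ (proj₂ G₀)
          o = proj₁ (proj₁ S₀.odd)
          eo : g ≡ + 2 + + 4 * o
          eo = proj₂ (proj₁ S₀.odd)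
          g-bd : ∣ g ∣≤ (+ 4 * Δ)
          g-bd = proj₂ S₀.odd
          flipE : 𝔼 (pull v (flip W G₀ θ)) ≡ 𝔼 (pull v θ) + + 2 * g
          flipE = flip-𝔼 W {θ} valid₀

    good-edge : ∀ {v} (W : Weight v) {θ} → Good v θ → ∀ {a b} → A a b ≡ 1ℤ → N (pull v θ) a b ≡ 0ℤ
    good-edge {v} W {θ} g {a} {b} e = ≤-antisym (≤-trans (≤-reflexive (sym (trans (cong (_* N (pull v θ) a b) e) (*-identityˡ (N (pull v θ) a b)))))
      (subst (A a b * N (pull v θ) a b ≤_) g (term≤∑² (λ a b → A≥0 a b ⊗ proj₁ (N-bd (weight-permute W θ) a b)) a b)))
      (proj₁ (N-bd (weight-permute W θ) a b))

    by-edge : ∀ {a b} x y → (A a b ≡ 1ℤ → x ≡ y) → A a b * x ≡ A a b * y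
    by-edge {a} {b} x y h = go (A≡0or1 a b)
      where go : A a b ≡ 0ℤ ⊎ A a b ≡ 1ℤ → A a b * x ≡ A a b * y
            go (inj₁ e) = trans (cong (_* x) e) (trans (*-zeroˡ x) (sym (trans (cong (_* y) e) (*-zeroˡ y))))
            go (inj₂ e) = cong (A a b *_) (h e)

    A-diag : ∀ {a} x → A a a * x ≡ 0ℤ
    A-diag {a} x = trans (cong (_* x) (Adjacency.irr H a)) (*-zeroˡ x)

    𝔼≡M-4j : ∀ {v} (W : Weight v) θ → Good v θ → ∃[ j ] 𝔼 (pull v θ) ≡ M + + 4 * j
    𝔼≡M-4j {v} W θ g = - ∑² (up f) , (begin
      𝔼 (pull v θ)
        ≡⟨ ∑²-cong (λ a b → trans (by-edge (v (θ ⟨$⟩ʳ a) (θ ⟨$⟩ʳ b)) (1ℤ - + 2 * isNeg (v (θ ⟨$⟩ʳ a) (θ ⟨$⟩ʳ b)))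
             (λ e → PM-isNeg (N≡0⇒PM (Weight.val W _ _) (good-edge W {θ} g e)))) (𝔼≡M-4j-identity (A a b) (isNeg (v (θ ⟨$⟩ʳ a) (θ ⟨$⟩ʳ b))))) ⟩
      ∑² (λ a b → A a b - + 2 * f a b)
        ≡⟨ trans (∑²-- A (λ a b → + 2 * f a b)) (cong (λ z → M - z) (∑²-*ˡ (+ 2) f)) ⟩
      M - + 2 * ∑² f
        ≡⟨ cong (λ z → M - + 2 * z) (symmetric-sum f (λ a b → cong₂ (λ x y → x * isNeg y) (A-sym a b) (Weight.symm W _ _)) (λ a → A-diag (isNeg (v (θ ⟨$⟩ʳ a) (θ ⟨$⟩ʳ a))))) ⟩
      M - + 2 * (+ 2 * ∑² (up f)) ≡⟨ 𝔼≡M-4j-identity₂ M (∑² (up f)) ⟩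
      M + + 4 * - ∑² (up f) ∎)
      where
      open ≡-Reasoning
      f : Mat n
      f a b = A a b * isNeg (v (θ ⟨$⟩ʳ a) (θ ⟨$⟩ʳ b))

    𝔼-mod8 : ∀ {v} (W : Weight v) → TwoSided v → (p : ℤ) (q : Fin n → ℤ) → (∀ u → deg u ≡ p + + 2 * q u) →
      ∃[ κ ] ∀ θ → Good v θ → ∃[ j ] 𝔼 (pull v θ) ≡ κ + + 8 * j
    𝔼-mod8 {v} W 𝕋 p q deg≡ = s * (M - + 4 * (p * ∑ h)) , λ θ g → proof θ g
      where
      open TwoSided 𝕋
      open ≡-Reasoning
      h : Fin n → ℤ
      h x = isNeg (σ x)
      module _ (θ : Permutation′ n) (g : Good v θ) where
        hθ : Fin n → ℤ
        hθ a = h (θ ⟨$⟩ʳ a)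
        f : Mat n
        f a b = A a b * (hθ a * hθ b)
        j : ℤ
        j = s * (∑² (up f) - ∑ (λ a → q a * hθ a))
        edge : ∀ a b → A a b * v (θ ⟨$⟩ʳ a) (θ ⟨$⟩ʳ b) ≡ s * (A a b - + 2 * (A a b * hθ a) - + 2 * (A a b * hθ b) + + 4 * f a b)
        edge a b = trans (by-edge (v (θ ⟨$⟩ʳ a) (θ ⟨$⟩ʳ b)) (s * ((1ℤ - + 2 * hθ a) * (1ℤ - + 2 * hθ b)))
            (λ e → trans (form (good-edge W {θ} g e)) (cong (s *_) (cong₂ _*_ (PM-isNeg (σ-pm (θ ⟨$⟩ʳ a))) (PM-isNeg (σ-pm (θ ⟨$⟩ʳ b)))))))
          (edge-identity (A a b) s (hθ a) (hθ b))
        ∑dh : ∑ (λ a → deg a * hθ a) ≡ p * ∑ h + + 2 * ∑ (λ a → q a * hθ a)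
        ∑dh = trans (∑-cong (λ a → trans (cong (_* hθ a) (deg≡ a)) (∑dh-identity p (q a) (hθ a))))
          (trans (∑-+ _ _) (cong₂ _+_ (trans (∑-*ˡ p hθ) (cong (p *_) (∑-permute h θ))) (∑-*ˡ (+ 2) (λ a → q a * hθ a))))
        proof : ∃[ j ] 𝔼 (pull v θ) ≡ s * (M - + 4 * (p * ∑ h)) + + 8 * j
        proof = j , (begin
          𝔼 (pull v θ) ≡⟨ trans (∑²-cong edge) (∑²-*ˡ s (λ a b → A a b - + 2 * (A a b * hθ a) - + 2 * (A a b * hθ b) + + 4 * f a b)) ⟩
          s * ∑² (λ a b → A a b - + 2 * (A a b * hθ a) - + 2 * (A a b * hθ b) + + 4 * f a b)
            ≡⟨ cong (s *_) (trans (∑²-+ (λ a b → A a b - + 2 * (A a b * hθ a) - + 2 * (A a b * hθ b)) (λ a b → + 4 * f a b)) (cong₂ _+_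
                 (trans (∑²-- (λ a b → A a b - + 2 * (A a b * hθ a)) (λ a b → + 2 * (A a b * hθ b))) (cong₂ _-_
                   (trans (∑²-- A (λ a b → + 2 * (A a b * hθ a))) (cong (λ z → M - z) (trans (∑²-*ˡ (+ 2) (λ a b → A a b * hθ a)) (cong (+ 2 *_) (∑A-fst hθ)))))
                   (trans (∑²-*ˡ (+ 2) (λ a b → A a b * hθ b)) (cong (+ 2 *_) (∑A-snd hθ)))))
                 (trans (∑²-*ˡ (+ 4) f) (cong (+ 4 *_) (symmetric-sum f
                   (λ a b → cong₂ _*_ (A-sym a b) (*-comm (hθ a) (hθ b))) (λ a → A-diag (hθ a * hθ a))))))) ⟩
          s * (M - + 2 * ∑ (λ a → deg a * hθ a) - + 2 * ∑ (λ a → deg a * hθ a) + + 4 * (+ 2 * ∑² (up f)))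
            ≡⟨ cong (λ z → s * (M - + 2 * z - + 2 * z + + 4 * (+ 2 * ∑² (up f)))) ∑dh ⟩
          s * (M - + 2 * (p * ∑ h + + 2 * ∑ (λ a → q a * hθ a)) - + 2 * (p * ∑ h + + 2 * ∑ (λ a → q a * hθ a)) + + 4 * (+ 2 * ∑² (up f)))
            ≡⟨ 𝔼-mod8-identity s M (p * ∑ h) (∑ (λ a → q a * hθ a)) (∑² (up f)) ⟩
          s * (M - + 4 * (p * ∑ h)) + + 8 * j ∎)

    module Sided {e G R : ℤ} (rm : Room nn M Δ e G R) {v : Mat n} (W : Weight v) {d : ℤ} (sp : Spread v e d G) (¬neg : ¬ NegativeSquare rm W sp) where
      open Room rm
      open Spread sp
      open Weight W using () renaming (symm to v-sym)

      common : ∀ a b c → ∃[ z ] N v a z ≡ 0ℤ × N v b z ≡ 0ℤ × N v c z ≡ 0ℤ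
      common a b c = z , sum≡0ˡ ka kb e₁ , sum≡0ʳ ka kb e₁ , sum≡0ʳ (ka ⊕ kb) kc e₀
        where
        total : ∑ (λ z → N v a z + N v b z + N v c z) < nn
        total = ≤-<-trans (≤-trans (≤-reflexive (trans (∑-+ _ _) (cong (_+ row (N v) c) (∑-+ _ _))))
          (arith (row (N v) a) (row (N v) b) (row (N v) c) (row-N a) (row-N b) (row-N c))) cycles
          where
          arith : ∀ x y z → x ≤ e → y ≤ e → z ≤ e → x + y + z ≤ G * (+ 3 * e + + 2 * R)
          arith x y z p q r = ≤by (diff p ⊕ diff q ⊕ diff r ⊕ diff 1≤G ⊗ (num 3 ⊗ 0≤e ⊕ num 2 ⊗ 0≤R) ⊕ num 2 ⊗ 0≤R) (total-identity₂ e G R x y z)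
        hit = ∑<n⇒∃0 (λ z → N v a z + N v b z + N v c z) (λ z → proj₁ (N-bd W a z) ⊕ proj₁ (N-bd W b z) ⊕ proj₁ (N-bd W c z)) total
        z = proj₁ hit
        e₀ = proj₂ hit
        ka = proj₁ (N-bd W a z)
        kb = proj₁ (N-bd W b z)
        kc = proj₁ (N-bd W c z)
        e₁ = sum≡0ˡ (ka ⊕ kb) kc e₀

      opaque
        mid : Fin n → Fin n → Fin n → Fin n
        mid a b c = proj₁ (common a b c)

        mid₁ : ∀ a b c → N v a (mid a b c) ≡ 0ℤ
        mid₁ a b c = proj₁ (proj₂ (common a b c))

        mid₂ : ∀ a b c → N v b (mid a b c) ≡ 0ℤ
        mid₂ a b c = proj₁ (proj₂ (proj₂ (common a b c)))

        mid₃ : ∀ a b c → N v c (mid a b c) ≡ 0ℤ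
        mid₃ a b c = proj₂ (proj₂ (proj₂ (common a b c)))

      ρ : Fin n → Fin n → ℤ
      ρ x x′ = v x′ (mid x x′ x′) * v x (mid x x′ x′)

      v-pm : ∀ {a b} → N v a b ≡ 0ℤ → PM (v a b)
      v-pm = pm rm W sp

      ρ-at : ∀ {x x′ z} → N v x z ≡ 0ℤ → N v x′ z ≡ 0ℤ → ρ x x′ ≡ v x′ z * v x z
      ρ-at {x} {x′} p q = same-product rm W sp ¬neg (mid₁ x x′ x′) (mid₂ x x′ x′) p q

      ρ-pm : ∀ x x′ → PM (ρ x x′)
      ρ-pm x x′ = PM-* (v-pm (mid₂ x x′ x′)) (v-pm (mid₁ x x′ x′))

      ρ-sym : ∀ x x′ → ρ x x′ ≡ ρ x′ x
      ρ-sym x x′ = trans (*-comm (v x′ (mid x x′ x′)) (v x (mid x x′ x′))) (sym (ρ-at (mid₂ x x′ x′) (mid₁ x x′ x′)))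

      ρ-trans : ∀ x y z → ρ x z ≡ ρ x y * ρ y z
      ρ-trans x y z = trans (ρ-at a c) (trans (cancel (v x t) (v y t) (v z t) (PM-sq (v-pm b))) (sym (cong₂ _*_ (ρ-at a b) (ρ-at b c))))
        where
        t = mid x y z
        a = mid₁ x y z
        b = mid₂ x y z
        c = mid₃ x y z
        cancel : ∀ a b c → b * b ≡ 1ℤ → c * a ≡ b * a * (c * b)
        cancel a b c h = trans (sym (*-identityʳ (c * a))) (trans (cong (c * a *_) (sym h)) (cancel-identity a b c))

      type : Fin n → Fin n → ℤ
      type u w = v u w * ρ u w

      type-sym : ∀ u w → type u w ≡ type w u
      type-sym u w = cong₂ _*_ (v-sym u w) (ρ-sym u w)

      type-star : ∀ {u w w′} → N v u w ≡ 0ℤ → N v u w′ ≡ 0ℤ → type u w ≡ type u w′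
      type-star {u} {w} {w′} p q = trans (cong (v u w *_) (trans (ρ-trans u w′ w) (cong (ρ u w′ *_)
          (trans (ρ-at {w′} {w} {u} (trans (N-sym W w′ u) q) (trans (N-sym W w u) p)) (cong₂ _*_ (v-sym w u) (v-sym w′ u))))))
        (cancel (v u w) (ρ u w′) (v u w′) (PM-sq (v-pm p)))
        where
        cancel : ∀ a r b → a * a ≡ 1ℤ → a * (r * (a * b)) ≡ b * r
        cancel a r b h = trans (cancel-identity₂ a r b) (trans (cong (_* (b * r)) h) (*-identityˡ (b * r)))

      type-const : ∀ {u w u′ w′} → N v u w ≡ 0ℤ → N v u′ w′ ≡ 0ℤ → type u w ≡ type u′ w′
      type-const {u} {w} {u′} {w′} p q =
        trans (type-star p a) (trans (type-sym u z) (trans (type-star (trans (N-sym W z u) a) (trans (N-sym W z u′) b))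
          (trans (type-sym z u′) (type-star b q))))
        where
        z = mid u u′ u′
        a = mid₁ u u′ u′
        b = mid₂ u u′ u′

      two-sided : TwoSided v
      two-sided = record { s = type a₀ b₀ ; σ = ρ a₀ ; s-pm = PM-* (v-pm e₀) (ρ-pm a₀ b₀) ; σ-pm = ρ-pm a₀
        ; form = λ {u} {w} p → trans (solve-v (v u w) (ρ u w) (PM-sq (ρ-pm u w)))
            (trans (cong₂ _*_ (type-const p e₀) (ρ-trans u a₀ w)) (cong (λ z → type a₀ b₀ * (z * ρ a₀ w)) (ρ-sym u a₀))) }
        where
        start = edge-outside rm W sp [] 0≤R
        a₀ = proj₁ start
        b₀ = proj₁ (proj₂ start)
        e₀ = proj₁ (proj₂ (proj₂ start))
        solve-v : ∀ a r → r * r ≡ 1ℤ → a ≡ a * r * r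
        solve-v a r h = trans (sym (*-identityʳ a)) (trans (cong (a *_) (sym h)) (sym (*-assoc a r r)))

  open import Defs

  b2z : Bool → ℤ
  b2z true  = 1ℤ
  b2z false = 0ℤ

  b2z-T : ∀ {b} → T b → b2z b ≡ 1ℤ
  b2z-T {true} _ = refl

  b2z-¬T : ∀ {b} → ¬ T b → b2z b ≡ 0ℤ
  b2z-¬T {true}  h = ⊥-elim (h tt)
  b2z-¬T {false} _ = refl

  list-sum : List ℤ → ℤ
  list-sum = foldr _+_ 0ℤ

  opaque
    unfolding ∑

    list-sum-tabulate : ∀ {n} {X : Set} (g : X → ℤ) (h : Fin n → X) → list-sum (map g (tabulate h)) ≡ ∑ (λ i → g (h i))
    list-sum-tabulate {ℕ.zero}  g h = refl
    list-sum-tabulate {ℕ.suc n} g h = cong (λ z → g (h zero) + z) (list-sum-tabulate g (λ i → h (suc i)))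

    ∣tabulate∣ : ∀ {n} (f : Fin n → Bool) → + ∣ Vec.tabulate f ∣ˢ ≡ ∑ (λ i → b2z (f i))
    ∣tabulate∣ {ℕ.zero}  f = refl
    ∣tabulate∣ {ℕ.suc n} f with f zero
    ... | true  = cong (λ z → 1ℤ + z) (∣tabulate∣ (λ i → f (suc i)))
    ... | false = trans (∣tabulate∣ (λ i → f (suc i))) (sym (+-identityˡ _))

  list-sum-++ : ∀ xs ys → list-sum (xs ++ ys) ≡ list-sum xs + list-sum ys
  list-sum-++ []       ys = sym (+-identityˡ _)
  list-sum-++ (x ∷ xs) ys = trans (cong (λ z → x + z) (list-sum-++ xs ys)) (sym (+-assoc x (list-sum xs) (list-sum ys)))

  list-sum-product : ∀ {X Y : Set} (g : X × Y → ℤ) xs ys →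
    list-sum (map g (cartesianProduct xs ys)) ≡ list-sum (map (λ x → list-sum (map (λ y → g (x , y)) ys)) xs)
  list-sum-product g []       ys = refl
  list-sum-product g (x ∷ xs) ys = trans (cong list-sum (map-++ g (map (x ,_) ys) (cartesianProduct xs ys)))
    (trans (list-sum-++ (map g (map (x ,_) ys)) (map g (cartesianProduct xs ys)))
      (cong₂ _+_ (cong list-sum (sym (map-∘ ys))) (list-sum-product g xs ys)))

  list-sum-pairs : ∀ {n} (g : Fin n × Fin n → ℤ) → list-sum (map g (cartesianProduct (allFin n) (allFin n))) ≡ ∑² (λ u v → g (u , v))
  list-sum-pairs {n} g = trans (list-sum-product g (allFin n) (allFin n))
    (trans (list-sum-tabulate (λ x → list-sum (map (λ y → g (x , y)) (allFin n))) (λ i → i)) (∑-cong (λ u → list-sum-tabulate (λ y → g (u , y)) (λ i → i))))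

  from-maybe : ∀ {X : Set} → (X → ℤ) → Maybe X → ℤ
  from-maybe g (just x) = g x
  from-maybe g nothing  = 0ℤ

  list-sum-mapMaybe : ∀ {X Y : Set} (g : Y → ℤ) (f : X → Maybe Y) xs → list-sum (map g (mapMaybe f xs)) ≡ list-sum (map (λ x → from-maybe g (f x)) xs)
  list-sum-mapMaybe g f []       = refl
  list-sum-mapMaybe g f (x ∷ xs) with f x
  ... | just y  = cong (λ z → g y + z) (list-sum-mapMaybe g f xs)
  ... | nothing = trans (list-sum-mapMaybe g f xs) (sym (+-identityˡ _))

  list-sum-ones : ∀ {X : Set} (xs : List X) → + length xs ≡ list-sum (map (λ _ → 1ℤ) xs)
  list-sum-ones []       = refl
  list-sum-ones (x ∷ xs) = cong (λ z → 1ℤ + z) (list-sum-ones xs)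

  sign-eq : Sign → Sign → ℤ
  sign-eq s t with s ≟ˢ t
  ... | yes _ = 1ℤ
  ... | no  _ = 0ℤ

  list-sum-filter : ∀ {X : Set} (c : X → Sign) s xs → + length (filter (λ x → c x ≟ˢ s) xs) ≡ list-sum (map (λ x → sign-eq (c x) s) xs)
  list-sum-filter c s []       = refl
  list-sum-filter c s (x ∷ xs) with c x ≟ˢ s
  ... | yes _ = cong (λ z → 1ℤ + z) (list-sum-filter c s xs)
  ... | no  _ = trans (list-sum-filter c s xs) (sym (+-identityˡ _))

  module _ {n : ℕ} (adj : Fin n → Fin n → Bool) where

    edge-finder : Σ (Fin n × Fin n → Maybe (Edge adj)) (λ f → edges adj ≡ mapMaybe f (cartesianProduct (allFin n) (allFin n)))
    edge-finder = _ , refl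

    EdgeSpec : Fin n → Fin n → Maybe (Edge adj) → Set
    EdgeSpec u v m = (m ≡ nothing × ¬ (u <ᶠ v × T (adj u v))) ⊎ (Σ (u <ᶠ v) λ p → Σ (T (adj u v)) λ q → m ≡ just (edge u v p q))

    edge-spec : ∀ u v → EdgeSpec u v (proj₁ edge-finder (u , v))
    edge-spec u v with u <ᶠ? v | T? (adj u v)
    ... | yes p | yes q = inj₂ (p , q , refl)
    ... | yes p | no ¬q = inj₁ (refl , λ r → ¬q (proj₂ r))
    ... | no ¬p | yes _ = inj₁ (refl , λ r → ¬p (proj₁ r))
    ... | no ¬p | no  _ = inj₁ (refl , λ r → ¬p (proj₁ r))

    up-yes : ∀ (f : Mat n) {u v} → u <ᶠ v → up f u v ≡ f u v
    up-yes f {u} {v} p with u <ᶠ? v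
    ... | yes _ = refl
    ... | no ¬p = ⊥-elim (¬p p)

    edge-sum : (g : Edge adj → ℤ) (f : Mat n) → (∀ u v p q → g (edge u v p q) ≡ f u v) →
      list-sum (map g (edges adj)) ≡ ∑² (up (λ u v → b2z (adj u v) * f u v))
    edge-sum g f h = trans (cong (λ es → list-sum (map g es)) (proj₂ edge-finder))
      (trans (list-sum-mapMaybe g (proj₁ edge-finder) (cartesianProduct (allFin n) (allFin n)))
      (trans (list-sum-pairs (λ x → from-maybe g (proj₁ edge-finder x))) (∑²-cong (λ u v → term u v (edge-spec u v)))))
      where
      term : ∀ u v {m} → EdgeSpec u v m → from-maybe g m ≡ up (λ u v → b2z (adj u v) * f u v) u v
      term u v (inj₂ (p , q , refl)) = trans (h u v p q) (sym (trans (up-yes (λ u v → b2z (adj u v) * f u v) p)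
        (trans (cong (_* f u v) (b2z-T q)) (*-identityˡ (f u v)))))
      term u v (inj₁ (refl , no-edge)) with u <ᶠ? v
      ... | no _  = refl
      ... | yes p = sym (trans (cong (_* f u v) (b2z-¬T (λ q → no-edge (p , q)))) (*-zeroˡ (f u v)))

    edge-sum₂ : (∀ u v → adj u v ≡ adj v u) → (∀ u → adj u u ≡ false) → (g : Edge adj → ℤ) (f : Mat n) → (∀ u v → f u v ≡ f v u) →
      (∀ u v p q → g (edge u v p q) ≡ f u v) → + 2 * list-sum (map g (edges adj)) ≡ ∑² (λ u v → b2z (adj u v) * f u v)
    edge-sum₂ adj-sym adj-irr g f f-sym h = trans (cong (+ 2 *_) (edge-sum g f h))
      (sym (symmetric-sum (λ u v → b2z (adj u v) * f u v) (λ u v → cong₂ (λ a b → b2z a * b) (adj-sym u v) (f-sym u v))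
        (λ u → trans (cong (λ a → b2z a * f u u) (adj-irr u)) (*-zeroˡ (f u u)))))

  adjacency : ∀ {n} → Graph n → Mat n
  adjacency H u v = b2z (Graph.adj H u v)

  size-sum : ∀ {n} (H : Graph n) → + 2 * + size H ≡ ∑² (adjacency H)
  size-sum H = trans (cong (+ 2 *_) (list-sum-ones (edges (Graph.adj H))))
    (trans (edge-sum₂ (Graph.adj H) (Graph.sym H) (Graph.irrefl H) (λ _ → 1ℤ) (λ _ _ → 1ℤ) (λ _ _ → refl) (λ _ _ _ _ → refl))
      (∑²-cong (λ u v → *-identityʳ (adjacency H u v))))

  degree-sum : ∀ {n} (H : Graph n) u → + degree H u ≡ ∑ (adjacency H u)
  degree-sum H u = ∣tabulate∣ (Graph.adj H u)

  degree≤max : ∀ {n} (H : Graph n) u → degree H u ℕ.≤ maxDegree H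
  degree≤max H u = All.lookup (xs≤max 0 (degrees H)) (∈-map⁺ (degree H) (∈-allFin u))

  min≤degree : ∀ {n} (H : Graph n) u → minDegree H ℕ.≤ degree H u
  min≤degree {n} H u = All.lookup (min≤xs n (degrees H)) (∈-map⁺ (degree H) (∈-allFin u))

  adjacency-props : ∀ {n} (H : Graph n) → Adjacency (adjacency H) (+ maxDegree H)
  adjacency-props H = record
    { symm = λ a b → cong b2z (Graph.sym H a b)
    ; irr  = λ a → cong b2z (Graph.irrefl H a)
    ; val  = λ a b → v (Graph.adj H a b)
    ; deg≤ = λ a → subst (_≤ + maxDegree H) (degree-sum H a) (+≤+ (degree≤max H a))
    }
    where v : ∀ b → b2z b ≡ 0ℤ ⊎ b2z b ≡ 1ℤ
          v true  = inj₂ refl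
          v false = inj₁ refl

  ◃1-PM : ∀ s → PM (s ◃ 1)
  ◃1-PM Sign.+ = inj₁ refl
  ◃1-PM Sign.- = inj₂ refl

  parity-spec-identity : ∀ j → + 2 + + 2 * j ≡ + 2 * (1ℤ + j)
  parity-spec-identity = solve-∀

  parity-spec-identity₂ : ∀ j → + 2 + (1ℤ + + 2 * j) ≡ 1ℤ + + 2 * (1ℤ + j)
  parity-spec-identity₂ = solve-∀

  parity-≢-identity : ∀ i j → 1ℤ + + 2 * i - + 2 * j ≡ 1ℤ + + 2 * (i - j)
  parity-≢-identity = solve-∀

  module Colours {n : ℕ} (G : Graph n) (c : Colouring G) where
    open Graph G using (adj; irrefl)

    opaque
      half-weight : Mat n
      half-weight x y with x <ᶠ? y | T? (adj x y)
      ... | yes p | yes q = c (edge x y p q) ◃ 1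
      ... | yes _ | no  _ = 0ℤ
      ... | no  _ | _     = 0ℤ

      half-edge : ∀ {x y} (p : x <ᶠ y) (q : T (adj x y)) → half-weight x y ≡ c (edge x y p q) ◃ 1
      half-edge {x} {y} p q with x <ᶠ? y | T? (adj x y)
      ... | yes p′ | yes q′ = cong₂ (λ p q → c (edge x y p q) ◃ 1) (<ᶠ-irrelevant p′ p) (T-irrelevant q′ q)
      ... | yes _  | no ¬q  = ⊥-elim (¬q q)
      ... | no ¬p  | _      = ⊥-elim (¬p p)

      half-≮ : ∀ {x y} → ¬ (x <ᶠ y) → half-weight x y ≡ 0ℤ
      half-≮ {x} {y} ¬p with x <ᶠ? y | T? (adj x y)
      ... | yes p | _ = ⊥-elim (¬p p)
      ... | no _  | _ = refl

      half-¬adj : ∀ {x y} → ¬ T (adj x y) → half-weight x y ≡ 0ℤ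
      half-¬adj {x} {y} ¬q with x <ᶠ? y | T? (adj x y)
      ... | yes _ | yes q = ⊥-elim (¬q q)
      ... | yes _ | no _  = refl
      ... | no _  | _     = refl

    weight : Mat n
    weight x y = half-weight x y + half-weight y x

    weight-sym : ∀ x y → weight x y ≡ weight y x
    weight-sym x y = +-comm (half-weight x y) (half-weight y x)

    weight-edge : ∀ {x y} (p : x <ᶠ y) (q : T (adj x y)) → weight x y ≡ c (edge x y p q) ◃ 1
    weight-edge p q = trans (cong₂ _+_ (half-edge p q) (half-≮ (<ᶠ-asym p))) (+-identityʳ _)

    weight-¬adj : ∀ {x y} → ¬ T (adj x y) → weight x y ≡ 0ℤ
    weight-¬adj {x} {y} ¬q = cong₂ _+_ (half-¬adj ¬q) (half-¬adj (λ q → ¬q (subst T (Graph.sym G y x) q)))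

    weight-adj : ∀ {x y} → T (adj x y) → PM (weight x y)
    weight-adj {x} {y} q with <ᶠ-cmp x y
    ... | tri< p _ _    = subst PM (sym (weight-edge p q)) (◃1-PM _)
    ... | tri≈ _ refl _ = ⊥-elim (subst T (irrefl x) q)
    ... | tri> _ _ p    = subst PM (sym (trans (weight-sym x y) (weight-edge p (subst T (Graph.sym G x y) q)))) (◃1-PM _)

    weight-N : ∀ x y → N weight x y ≡ 1ℤ - b2z (adj x y)
    weight-N x y with T? (adj x y)
    ... | yes q = trans (cong (λ z → 1ℤ - z) (PM-sq (weight-adj q))) (cong (λ z → 1ℤ - z) (sym (b2z-T q)))
    ... | no ¬q = trans (cong (λ z → 1ℤ - z * z) (weight-¬adj ¬q)) (cong (λ z → 1ℤ - z) (sym (b2z-¬T ¬q)))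

    weight-props : Weight weight
    weight-props = record
      { symm = weight-sym
      ; irr  = λ a → weight-¬adj (subst T (irrefl a))
      ; val  = v
      }
      where
      v : ∀ x y → weight x y ≡ 0ℤ ⊎ weight x y ≡ 1ℤ ⊎ weight x y ≡ -1ℤ
      v x y with T? (adj x y)
      ... | yes q = inj₂ (weight-adj q)
      ... | no ¬q = inj₁ (weight-¬adj ¬q)

    N≡0⇒adj : ∀ {x y} → N weight x y ≡ 0ℤ → T (adj x y)
    N≡0⇒adj {x} {y} e with T? (adj x y)
    ... | yes q = q
    ... | no ¬q = 0≢1′ (trans (sym e) (trans (weight-N x y) (cong (λ z → 1ℤ - z) (b2z-¬T ¬q))))
      where 0≢1′ : 0ℤ ≡ 1ℤ → T (adj x y)
            0≢1′ ()

    adj⇒N≡0 : ∀ {x y} → T (adj x y) → N weight x y ≡ 0ℤ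
    adj⇒N≡0 {x} {y} q = trans (weight-N x y) (cong (λ z → 1ℤ - z) (b2z-T q))

    total-sum : (H′ : Subgraph G) → + 2 * total G c H′ ≡ ∑² (λ x y → b2z (Subgraph.adj H′ x y) * weight x y)
    total-sum H′ = edge-sum₂ (Subgraph.adj H′) (Subgraph.sym H′) irr′ (λ e → c (inclusion H′ e) ◃ 1) weight weight-sym
        (λ u v p q → sym (weight-edge p (Subgraph.adj⊆ H′ u v q)))
      where
      irr′ : ∀ u → Subgraph.adj H′ u u ≡ false
      irr′ u with Subgraph.adj H′ u u | Subgraph.adj⊆ H′ u u
      ... | false | _ = refl
      ... | true  | h = ⊥-elim (subst T (irrefl u) (h tt))

  injective⇒onto : ∀ {m} (f : Fin m → Fin m) → (∀ {x y} → f x ≡ f y → x ≡ y) → ∀ y → ∃[ x ] f x ≡ y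
  injective⇒onto {ℕ.suc m} f inj y with any? (λ x → f x ≟ᶠ y)
  ... | yes p = p
  ... | no ¬p = ⊥-elim (ℕₚ.<-irrefl refl (injective⇒≤ {f = λ x → punchOut (λ e → ¬p (x , sym e))} (λ {x} {x′} e → inj (punchOut-injective (λ e → ¬p (x , sym e)) (λ e → ¬p (x′ , sym e)) e))))

  sign-of : ∀ {x} → PM x → ∃[ s ] s ◃ 1 ≡ x
  sign-of (inj₁ refl) = Sign.+ , refl
  sign-of (inj₂ refl) = Sign.- , refl

  ◃1-injective : ∀ {s t} → s ◃ 1 ≡ t ◃ 1 → s ≡ t
  ◃1-injective {Sign.+} {Sign.+} _ = refl
  ◃1-injective {Sign.-} {Sign.-} _ = refl
  ◃1-injective {Sign.+} {Sign.-} ()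
  ◃1-injective {Sign.-} {Sign.+} ()

  ◃1-≢ : ∀ {s t} → s ≢ t → s ◃ 1 ≡ (t ◃ 1) * -1ℤ
  ◃1-≢ {Sign.+} {Sign.+} h = ⊥-elim (h refl)
  ◃1-≢ {Sign.-} {Sign.-} h = ⊥-elim (h refl)
  ◃1-≢ {Sign.+} {Sign.-} _ = refl
  ◃1-≢ {Sign.-} {Sign.+} _ = refl

  side : Bool → ℤ
  side true  = 1ℤ
  side false = -1ℤ

  same-side : ∀ {g a b} → T g → T ((g ∧ (a ∧ b)) ∨ (g ∧ (not a ∧ not b))) → side a * side b ≡ 1ℤ
  same-side {true} {true}  {true}  _ _ = refl
  same-side {true} {false} {false} _ _ = refl

  other-side : ∀ {g a b} → T g → ¬ T ((g ∧ (a ∧ b)) ∨ (g ∧ (not a ∧ not b))) → side a * side b ≡ -1ℤ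
  other-side {true} {true}  {true}  _ h = ⊥-elim (h tt)
  other-side {true} {true}  {false} _ _ = refl
  other-side {true} {false} {true}  _ _ = refl
  other-side {true} {false} {false} _ h = ⊥-elim (h tt)

  parity-spec : ∀ m → (ℕ.parity m ≡ 0ℙ × ∃[ j ] + m ≡ + 2 * j) ⊎ (ℕ.parity m ≡ 1ℙ × ∃[ j ] + m ≡ 1ℤ + + 2 * j)
  parity-spec 0 = inj₁ (refl , 0ℤ , refl)
  parity-spec 1 = inj₂ (refl , 0ℤ , refl)
  parity-spec (ℕ.suc (ℕ.suc m)) with parity-spec m
  ... | inj₁ (p , j , e) = inj₁ (p , 1ℤ + j , trans (cong (λ z → + 2 + z) e) (parity-spec-identity j))
  ... | inj₂ (p , j , e) = inj₂ (p , 1ℤ + j , trans (cong (λ z → + 2 + z) e) (parity-spec-identity₂ j))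

  parity-bit : Parity → ℤ
  parity-bit 0ℙ = 0ℤ
  parity-bit 1ℙ = 1ℤ

  parity-form : ∀ m → ∃[ j ] + m ≡ parity-bit (ℕ.parity m) + + 2 * j
  parity-form m with parity-spec m
  ... | inj₁ (p , j , e) = j , trans e (trans (sym (+-identityˡ _)) (cong (λ b → parity-bit b + + 2 * j) (sym p)))
  ... | inj₂ (p , j , e) = j , trans e (cong (λ b → parity-bit b + + 2 * j) (sym p))

  parity-≢ : ∀ {m m′} → ℕ.parity m ≢ ℕ.parity m′ → ∃[ j ] + m - + m′ ≡ 1ℤ + + 2 * j
  parity-≢ {m} {m′} h with parity-spec m | parity-spec m′
  ... | inj₁ (p , _) | inj₁ (q , _) = ⊥-elim (h (trans p (sym q)))
  ... | inj₂ (p , _) | inj₂ (q , _) = ⊥-elim (h (trans p (sym q)))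
  ... | inj₂ (_ , i , e) | inj₁ (_ , j , f) = i - j , trans (cong₂ _-_ e f) (parity-≢-identity i j)
  ... | inj₁ (_ , i , e) | inj₂ (_ , j , f) = i - j - 1ℤ , trans (cong₂ _-_ e f) (choose-identity₂ i j)

  -- The rational constants ε, ν and α are all 1/q; clearing denominators gives integer inequalities.
  1≤K-identity : ∀ D → + 16 + + 3 * D ≡ + 17 + + 3 * D - 1ℤ
  1≤K-identity = solve-∀

  room-identity : ∀ n G K e R → + 3 * G * (n - K * e) + + 2 * G * (n - K * R) + (K - (1ℤ + + 5 * G)) * n + (n - 1ℤ) ≡ K * n - (1ℤ + K * (G * (+ 3 * e + + 2 * R)))
  room-identity = solve-∀

  room-identity₂ : ∀ n Δ K e R → (+ 8 + + 3 * Δ) * (n - K * e) + + 3 * (n - K * R) + + 5 * (n - K) + (K - (+ 17 + + 3 * Δ)) * n + (n - 1ℤ)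
    ≡ K * n - (1ℤ + K * ((+ 8 + + 3 * Δ) * e + + 3 * R + + 5))
  room-identity₂ = solve-∀

  room-identity₃ : ∀ M Δ K R → (Δ * (Δ * (1ℤ + Δ + Δ * Δ))) * (M - K * R) + (K - (1ℤ + Δ * (Δ * (1ℤ + Δ + Δ * Δ)))) * M + (M - 1ℤ)
    ≡ K * M - (1ℤ + K * (Δ * (Δ * ((1ℤ + Δ + Δ * Δ) * R))))
  room-identity₃ = solve-∀

  room-identity₄ : ∀ n Δ K e R → + 2 * Δ * (n - K * e) + (n - K * R) + (K - (+ 2 + + 2 * Δ)) * n + (n - 1ℤ) ≡ K * n - (1ℤ + K * (+ 2 * (Δ * e) + R))
  room-identity₄ = solve-∀

  module Reciprocal (d : ℕ) where
    q : ℤ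
    q = +[1+ d ]

    Q r : ℚ
    Q = fromℤ q
    r = ℚ.1/ Q

    r>0 : 0ℚ ℚ.< r
    r>0 = ℚₚ.positive⁻¹ r

    fromℤ-≤ : ∀ {a b} → fromℤ a ℚ.≤ fromℤ b → a ≤ b
    fromℤ-≤ {a} {b} p = subst₂ _≤_ (*-identityʳ a) (*-identityʳ b) (ℚₚ.drop-*≤* p)

    fromℤ-* : ∀ a b → fromℤ a ℚ.* fromℤ b ≡ fromℤ (a * b)
    fromℤ-* a b = ℚₚ.toℚᵘ-injective (ℚₚ.toℚᵘ-homo-* (fromℤ a) (fromℤ b))

    fromℤ-+ : ∀ a b → fromℤ a ℚ.+ fromℤ b ≡ fromℤ (a + b)
    fromℤ-+ a b = ℚₚ.toℚᵘ-injective (ℚᵘₚ.≃-trans (ℚₚ.toℚᵘ-homo-+ (fromℤ a) (fromℤ b))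
      (ℚᵘ.*≡* (cong (_* 1ℤ) (cong₂ _+_ (*-identityʳ a) (*-identityʳ b)))))

    fromℤ-neg : ∀ a → ℚ.- fromℤ a ≡ fromℤ (- a)
    fromℤ-neg a = ℚₚ.toℚᵘ-injective (ℚₚ.toℚᵘ-homo‿- (fromℤ a))

    scale : ∀ {x y} → x ℚ.≤ y → Q ℚ.* x ℚ.≤ Q ℚ.* y
    scale p = ℚₚ.*-monoˡ-≤-nonNeg Q p

    module _ where
      open import Data.Rational.Solver
      open +-*-Solver hiding (_:^_) renaming (solve to solveℚ)

      expand : ∀ c s → Q ℚ.* ((c ℚ.+ r) ℚ.* s) ≡ Q ℚ.* c ℚ.* s ℚ.+ s
      expand c s = trans (solveℚ 4 (λ Q c r s → Q :* ((c :+ r) :* s) := Q :* c :* s :+ (Q :* r) :* s) refl Q c r s)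
        (cong (λ z → Q ℚ.* c ℚ.* s ℚ.+ z) (trans (cong (ℚ._* s) (ℚₚ.*-inverseʳ Q)) (ℚₚ.*-identityˡ s)))

      expand⁻ : ∀ c s → Q ℚ.* ((c ℚ.- r) ℚ.* s) ≡ Q ℚ.* c ℚ.* s ℚ.- s
      expand⁻ c s = trans (solveℚ 4 (λ Q c r s → Q :* ((c :- r) :* s) := Q :* c :* s :- (Q :* r) :* s) refl Q c r s)
        (cong (λ z → Q ℚ.* c ℚ.* s ℚ.- z) (trans (cong (ℚ._* s) (ℚₚ.*-inverseʳ Q)) (ℚₚ.*-identityˡ s)))

      cancel-r : ∀ s → Q ℚ.* (r ℚ.* s) ≡ s
      cancel-r s = trans (sym (ℚₚ.*-assoc Q r s)) (trans (cong (ℚ._* s) (ℚₚ.*-inverseʳ Q)) (ℚₚ.*-identityˡ s))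

      double-half : ∀ x s → fromℤ (+ 2) ℚ.* (Q ℚ.* ½ ℚ.* s ℚ.+ x) ≡ Q ℚ.* s ℚ.+ fromℤ (+ 2) ℚ.* x
      double-half x s = trans (solveℚ 5 (λ t h Q s x → t :* (Q :* h :* s :+ x) := (t :* h) :* (Q :* s) :+ t :* x) refl (fromℤ (+ 2)) ½ Q s x)
        (cong (λ z → z ℚ.+ fromℤ (+ 2) ℚ.* x) (ℚₚ.*-identityˡ (Q ℚ.* s)))

    twice : ∀ {x y} → x ℚ.≤ y → fromℤ (+ 2) ℚ.* x ℚ.≤ fromℤ (+ 2) ℚ.* y
    twice p = ℚₚ.*-monoˡ-≤-nonNeg (fromℤ (+ 2)) p

    minus : ∀ a b → fromℤ a ℚ.- fromℤ b ≡ fromℤ (a - b)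
    minus a b = trans (cong (λ z → fromℤ a ℚ.+ z) (fromℤ-neg b)) (fromℤ-+ a (- b))

    clear-ε : ∀ a b → (1ℚ ℚ.- r) ℚ.* fromℤ a ℚ.≤ fromℤ b → q * a - a ≤ q * b
    clear-ε a b h = fromℤ-≤ (subst₂ ℚ._≤_
      (trans (expand⁻ 1ℚ (fromℤ a)) (trans (cong (λ z → z ℚ.* fromℤ a ℚ.- fromℤ a) (ℚₚ.*-identityʳ Q))
        (trans (cong (λ z → z ℚ.- fromℤ a) (fromℤ-* q a)) (minus (q * a) a))))
      (fromℤ-* q b) (scale h))

    clear-ν⁻ : ∀ a b → (½ ℚ.- r) ℚ.* fromℤ a ℚ.≤ fromℤ b → q * a + + 2 * (- a) ≤ + 2 * (q * b)
    clear-ν⁻ a b h = fromℤ-≤ (subst₂ ℚ._≤_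
      (trans (cong (fromℤ (+ 2) ℚ.*_) (expand⁻ ½ (fromℤ a))) (trans (double-half (ℚ.- fromℤ a) (fromℤ a))
        (trans (cong₂ (λ x y → x ℚ.+ fromℤ (+ 2) ℚ.* y) (fromℤ-* q a) (fromℤ-neg a)) (trans (cong (λ z → fromℤ (q * a) ℚ.+ z) (fromℤ-* (+ 2) (- a))) (fromℤ-+ (q * a) (+ 2 * - a))))))
      (trans (cong (fromℤ (+ 2) ℚ.*_) (fromℤ-* q b)) (fromℤ-* (+ 2) (q * b))) (twice (scale h)))

    clear-ν⁺ : ∀ a b → fromℤ b ℚ.≤ (½ ℚ.+ r) ℚ.* fromℤ a → + 2 * (q * b) ≤ q * a + + 2 * a
    clear-ν⁺ a b h = fromℤ-≤ (subst₂ ℚ._≤_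
      (trans (cong (fromℤ (+ 2) ℚ.*_) (fromℤ-* q b)) (fromℤ-* (+ 2) (q * b)))
      (trans (cong (fromℤ (+ 2) ℚ.*_) (expand ½ (fromℤ a))) (trans (double-half (fromℤ a) (fromℤ a))
        (trans (cong₂ ℚ._+_ (fromℤ-* q a) (fromℤ-* (+ 2) a)) (fromℤ-+ (q * a) (+ 2 * a)))))
      (twice (scale h)))

    clear-α⁺ : ∀ a b → fromℤ b ℚ.≤ r ℚ.* fromℤ a → q * b ≤ a
    clear-α⁺ a b h = fromℤ-≤ (subst₂ ℚ._≤_ (fromℤ-* q b) (cancel-r (fromℤ a)) (scale h))

    clear-α⁻ : ∀ a b → ℚ.- (r ℚ.* fromℤ a) ℚ.≤ fromℤ b → - a ≤ q * b
    clear-α⁻ a b h = fromℤ-≤ (subst₂ ℚ._≤_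
      (trans (sym (ℚₚ.neg-distribʳ-* Q (r ℚ.* fromℤ a))) (trans (cong ℚ.-_ (cancel-r (fromℤ a))) (fromℤ-neg a))) (fromℤ-* q b) (scale h))

  record Thresholds (Δ K G R B : ℤ) : Set where
    field
      1≤Δ  : 1ℤ ≤ Δ
      1≤G  : 1ℤ ≤ G
      K≥₀  : + 40 * ((+ 8 * G) * (+ 8 * G) * (Δ * Δ)) ≤ K
      K≥₁  : 1ℤ + + 5 * G ≤ K
      K≥₂  : + 17 + + 3 * Δ ≤ K
      K≥₃  : 1ℤ + Δ * (Δ * (1ℤ + Δ + Δ * Δ)) ≤ K
      K≥₄  : + 2 + + 2 * Δ ≤ K
      0≤R  : 0ℤ ≤ R
      KR≤B : K * R ≤ B
      K≤B  : K ≤ B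
      40KΔ≤B : + 40 * (K * Δ) ≤ B

    0≤Δ : 0ℤ ≤ Δ
    0≤Δ = ≤-trans 0≤1 1≤Δ

    1≤K : 1ℤ ≤ K
    1≤K = ≤-trans (≤by (num 16 ⊕ num 3 ⊗ 0≤Δ) (1≤K-identity Δ)) K≥₂

    0≤K : 0ℤ ≤ K
    0≤K = ≤-trans 0≤1 1≤K

    module _ {n M e d : ℤ} (B≤n : B ≤ n) (B≤M : B ≤ M) (M≤Δn : M ≤ Δ * n) (0≤e : 0ℤ ≤ e) (Ke≤n : K * e ≤ n) (Kd≤ : K * d ≤ n * n) where

      sizes : Sizes n M Δ e d R K G
      sizes = record { 1≤Δ = 1≤Δ ; 1≤G = 1≤G ; 1≤K = 1≤K ; K≤n = ≤-trans K≤B B≤n ; K≤M = ≤-trans K≤B B≤M ; M≤Δn = M≤Δn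
        ; e≥0 = 0≤e ; f≥0 = 0≤R ; Ke≤n = Ke≤n ; Kd≤ = Kd≤ ; Kf≤n = ≤-trans KR≤B B≤n ; Kf≤M = ≤-trans KR≤B B≤M ; K≥ = K≥₀ }

      private
        KR≤n : K * R ≤ n
        KR≤n = ≤-trans KR≤B B≤n
        KR≤M : K * R ≤ M
        KR≤M = ≤-trans KR≤B B≤M
        0≤n : 0ℤ ≤ n
        0≤n = ≤-trans (0≤K ⊗ 0≤R) KR≤n
        1≤n : 1ℤ ≤ n
        1≤n = ≤-trans 1≤K (≤-trans K≤B B≤n)
        1≤M : 1ℤ ≤ M
        1≤M = ≤-trans 1≤K (≤-trans K≤B B≤M)
        0≤M : 0ℤ ≤ M
        0≤M = ≤-trans 0≤1 1≤M
        0≤G : 0ℤ ≤ G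
        0≤G = ≤-trans 0≤1 1≤G
        below : ∀ {x y} → 1ℤ + K * x ≤ K * y → x < y
        below {x} {y} h = *-cancelˡ-<-nonNeg K {{nonNegative 0≤K}} (1+≤⇒< h)

      room : Room n M Δ e G R
      room = record
        { 0≤Δ = 0≤Δ ; 0≤e = 0≤e ; 0≤R = 0≤R ; 1≤G = 1≤G
        ; cycles = below (≤by (num 3 ⊗ 0≤G ⊗ diff Ke≤n ⊕ num 2 ⊗ 0≤G ⊗ diff KR≤n ⊕ diff K≥₁ ⊗ 0≤n ⊕ diff 1≤n) (room-identity n G K e R))
        ; build  = below (≤by ((num 8 ⊕ num 3 ⊗ 0≤Δ) ⊗ diff Ke≤n ⊕ num 3 ⊗ diff KR≤n ⊕ num 5 ⊗ diff (≤-trans K≤B B≤n) ⊕ diff K≥₂ ⊗ 0≤n ⊕ diff 1≤n) (room-identity₂ n Δ K e R))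
        ; many   = below (≤by ((0≤Δ ⊗ (0≤Δ ⊗ (num 1 ⊕ 0≤Δ ⊕ 0≤Δ ⊗ 0≤Δ))) ⊗ diff KR≤M ⊕ diff K≥₃ ⊗ 0≤M ⊕ diff 1≤M) (room-identity₃ M Δ K R))
        ; fix    = below (≤by (num 2 ⊗ 0≤Δ ⊗ diff Ke≤n ⊕ diff KR≤n ⊕ diff K≥₄ ⊗ 0≤n ⊕ diff 1≤n) (room-identity₄ n Δ K e R))
        }

  Ke≤n-identity : ∀ K n μ → + 2 * K * μ - (+ 2 * K * n - n) + n ≡ + 2 * n - + 2 * (K * (n - μ))
  Ke≤n-identity = solve-∀

  KD≤-identity : ∀ K s x y → + 2 * K * s + + 2 * s - + 2 * (+ 2 * K * x) + (+ 2 * (+ 2 * K * y) - (+ 2 * K * s + + 2 * (- s)))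
    ≡ + 2 * (+ 2 * s) - + 2 * (K * (+ 2 * x - + 2 * y))
  KD≤-identity = solve-∀

  discrepancy-identity : ∀ a b → - (+ 2 * a - + 2 * b) ≡ + 2 * b - + 2 * a
  discrepancy-identity = solve-∀

  frequent-identity : ∀ q s c n μ → + 4 * q * (+ 2 * (q * c) - (q * s + + 2 * (- s))) + + 2 * (q - + 2) * q * (+ 2 * s - n * μ)
    + + 2 * (q - + 2) * n * (q * μ - (q * n - n)) + n * n * (q * (q - + 6) + + 4) ≡ q * q * (+ 4 * (+ 2 * c)) - q * q * (n * n)
  frequent-identity = solve-∀

  module Balance {n : ℕ} (G : Graph n) (c : Colouring G) where
    open Colours G c

    nn s μ e : ℤ
    nn = + n
    s  = + size G
    μ  = + minDegree G
    e  = nn - μ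

    count : Sign → ℤ
    count t = + colourCount G c t

    plus minus D : ℤ
    plus  = ∑² (λ x y → isPos (weight x y))
    minus = ∑² (λ x y → isNeg (weight x y))
    D     = ∑² weight

    ∑²adj≡ : + 2 * s ≡ ∑² (adjacency G)
    ∑²adj≡ = size-sum G

    nμ≤2s : nn * μ ≤ + 2 * s
    nμ≤2s = ≤-trans (≤-reflexive (sym (∑-const n μ))) (≤-trans (∑-mono (λ u → ≤-trans (+≤+ (min≤degree G u)) (≤-reflexive (degree-sum G u)))) (≤-reflexive (sym ∑²adj≡)))

    2s≤n² : + 2 * s ≤ nn * nn
    2s≤n² = ≤-trans (≤-reflexive ∑²adj≡) (≤-trans (∑²-mono {g = λ _ _ → 1ℤ} (λ u v → b2z≤1 (Graph.adj G u v)))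
        (≤-reflexive (trans (∑²-fst (λ _ → 1ℤ)) (cong (nn *_) (trans (∑-const n 1ℤ) (*-identityʳ nn))))))
      where b2z≤1 : ∀ b → b2z b ≤ 1ℤ
            b2z≤1 true  = ≤-refl
            b2z≤1 false = num 1

    on-edges : (f : ℤ → ℤ) → f 0ℤ ≡ 0ℤ → ∑² (λ x y → b2z (Graph.adj G x y) * f (weight x y)) ≡ ∑² (λ x y → f (weight x y))
    on-edges f f0 = ∑²-cong (λ x y → term x y (T? (Graph.adj G x y)))
      where
      term : ∀ x y → Dec (T (Graph.adj G x y)) → b2z (Graph.adj G x y) * f (weight x y) ≡ f (weight x y)
      term x y (yes q) = trans (cong (_* f (weight x y)) (b2z-T q)) (*-identityˡ (f (weight x y)))
      term x y (no ¬q) = trans (cong (_* f (weight x y)) (b2z-¬T ¬q)) (trans (*-zeroˡ (f (weight x y))) (sym (trans (cong f (weight-¬adj ¬q)) f0)))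

    counting : (f : ℤ → ℤ) → f 0ℤ ≡ 0ℤ → ∀ t → (∀ s → sign-eq s t ≡ f (s ◃ 1)) → + 2 * count t ≡ ∑² (λ x y → f (weight x y))
    counting f f0 t h = trans (cong (+ 2 *_) (list-sum-filter c t (edges (Graph.adj G))))
      (trans (edge-sum₂ (Graph.adj G) (Graph.sym G) (Graph.irrefl G) (λ e → sign-eq (c e) t) (λ x y → f (weight x y)) (λ x y → cong f (weight-sym x y))
        (λ u v p q → trans (h (c (edge u v p q))) (cong f (sym (weight-edge p q))))) (on-edges f f0))

    plus≡ : + 2 * count Sign.+ ≡ plus
    plus≡ = counting isPos refl Sign.+ (λ { Sign.+ → refl ; Sign.- → refl })

    minus≡ : + 2 * count Sign.- ≡ minus
    minus≡ = counting isNeg refl Sign.- (λ { Sign.+ → refl ; Sign.- → refl })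

    D≡ : D ≡ + 2 * count Sign.+ - + 2 * count Sign.-
    D≡ = trans (trans (∑²-cong (λ x y → split (Weight.val weight-props x y))) (∑²-- _ _)) (sym (cong₂ _-_ plus≡ minus≡))
      where split : ∀ {x} → x ≡ 0ℤ ⊎ x ≡ 1ℤ ⊎ x ≡ -1ℤ → x ≡ isPos x - isNeg x
            split (inj₁ refl) = refl
            split (inj₂ (inj₁ refl)) = refl
            split (inj₂ (inj₂ refl)) = refl

    row-N : ∀ b → ∑ (N weight b) ≤ e
    row-N b = ≤-trans (≤-reflexive (trans (∑-cong (weight-N b)) (trans (∑-- _ _) (cong₂ _-_ (trans (∑-const n 1ℤ) (*-identityʳ nn)) (sym (degree-sum G b))))))
      (+-monoʳ-≤ nn (neg-mono-≤ (+≤+ (min≤degree G b))))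

    0≤e : 1ℤ ≤ nn → 0ℤ ≤ e
    0≤e (+≤+ (ℕ.s≤s _)) = ≤-trans (∑-nonneg (λ x → proj₁ (N-bd weight-props zero x))) (row-N zero)

    module _ {K q : ℤ} (q≡ : q ≡ + 2 * K) (6≤q : + 6 ≤ q) (hε : q * nn - nn ≤ q * μ)
      (hν⁻ : ∀ t → q * s + + 2 * (- s) ≤ + 2 * (q * count t)) (hν⁺ : ∀ t → + 2 * (q * count t) ≤ q * s + + 2 * s) where

      0≤q : 0ℤ ≤ q
      0≤q = ≤-trans (num 6) 6≤q

      Ke≤n : 0ℤ ≤ e → K * e ≤ nn
      Ke≤n e≥0 = ≤-cancel {c = + 2} (+<+ (ℕ.s≤s ℕ.z≤n)) (≤by (diff hε ⊕ num n) (trans (cong (λ q → q * μ - (q * nn - nn) + nn) q≡) (Ke≤n-identity K nn μ)))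

      KD≤ : ∀ x y → + 2 * (q * x) ≤ q * s + + 2 * s → q * s + + 2 * (- s) ≤ + 2 * (q * y) → K * (+ 2 * x - + 2 * y) ≤ nn * nn
      KD≤ x y h i = ≤-trans (≤-cancel {c = + 2} (+<+ (ℕ.s≤s ℕ.z≤n)) (≤by (diff h ⊕ diff i)
          (trans (cong (λ q → q * s + + 2 * s - + 2 * (q * x) + (+ 2 * (q * y) - (q * s + + 2 * (- s)))) q≡) (KD≤-identity K s x y)))) 2s≤n²

      discrepancy : ∃[ d ] ∣ D ∣≤ d × K * d ≤ nn * nn
      discrepancy with 0ℤ ≤? D
      ... | yes p = D , (≤-trans (neg-mono-≤ p) p , ≤-refl) , subst (λ z → K * z ≤ nn * nn) (sym D≡) (KD≤ _ _ (hν⁺ Sign.+) (hν⁻ Sign.-))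
      ... | no ¬p = - D , (≤-reflexive (neg-involutive D) , ≤-trans (<⇒≤ (≰⇒> ¬p)) (neg-mono-≤ (<⇒≤ (≰⇒> ¬p))))
                  , subst (λ z → K * z ≤ nn * nn) (sym (trans (cong -_ D≡) (discrepancy-identity (count Sign.+) (count Sign.-)))) (KD≤ _ _ (hν⁺ Sign.-) (hν⁻ Sign.+))

      frequent : ∀ t {x} → + 2 * count t ≡ x → nn * nn ≤ + 4 * x
      frequent t refl = ≤-cancel {c = q * q} (1+≤⇒< (1≤* 1≤q 1≤q)) (≤by
          (num 4 ⊗ 0≤q ⊗ diff (hν⁻ t) ⊕ num 2 ⊗ q-2≥0 ⊗ 0≤q ⊗ diff nμ≤2s ⊕ num 2 ⊗ q-2≥0 ⊗ num n ⊗ diff hε ⊕ (num n ⊗ num n) ⊗ (0≤q ⊗ diff 6≤q ⊕ num 4))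
          (frequent-identity q s (count t) nn μ))
        where
        1≤q : 1ℤ ≤ q
        1≤q = ≤-trans (+≤+ (ℕ.s≤s ℕ.z≤n)) 6≤q
        q-2≥0 : 0ℤ ≤ q - + 2
        q-2≥0 = diff (≤-trans (+≤+ (ℕ.s≤s (ℕ.s≤s ℕ.z≤n))) 6≤q)

  only-if-identity : ∀ t t₀ b → t - b ≡ (t - t₀) + (t₀ - b)
  only-if-identity = solve-∀

  only-if-identity₂ : ∀ a j i x → a * (j - i) + x * a ≡ (j - i + x) * a
  only-if-identity₂ = solve-∀

  gap-identity : ∀ x y → + 2 * (x - y) ≡ + 2 * x - + 2 * y
  gap-identity = solve-∀

  gap-identity₂ : ∀ κ a j i → κ + + 2 * a * j - (κ + + 2 * a * i) ≡ + 2 * (a * (j - i))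
  gap-identity₂ = solve-∀

  residue-identity : ∀ a x y t₀ κ j → + 2 * (x * a - y * a + t₀) - (κ + + 2 * a * j) ≡ + 2 * (x * a - y * a) + (+ 2 * t₀ - (κ + + 2 * a * j))
  residue-identity = solve-∀

  residue-identity₂ : ∀ a x y κ i j → + 2 * (x * a - y * a) + (κ + + 2 * a * i - (κ + + 2 * a * j)) ≡ + 2 * a * (x - y + (i - j))
  residue-identity₂ = solve-∀

  residue-identity₃ : ∀ t b t₀ → t ≡ (t - b) - (t₀ - b) + t₀
  residue-identity₃ = solve-∀

  x≡2x-x : ∀ x → x ≡ + 2 * x - x
  x≡2x-x = solve-∀

  spectrum-identity : ∀ g e K → g * (+ 2 * e) + + 2 * (g * e) + (K - (1ℤ + + 5 * g)) * e + e ≡ K * e - g * e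
  spectrum-identity = solve-∀

  s≤R-identity : ∀ m s → m * s ≡ (1ℤ + m) * s - s
  s≤R-identity = solve-∀

  up-bound-identity : ∀ K t x m → m - + 2 * K * t + K * x ≡ m - K * (+ 2 * t - x)
  up-bound-identity = solve-∀

  low-bound-identity : ∀ K t x m D → + 2 * K * t - - m + (m - + 40 * (K * D)) + K * (+ 40 * D - x) ≡ + 2 * m - K * (x - + 2 * t)
  low-bound-identity = solve-∀

  hit-identity : ∀ D t → + 40 * D - + 2 * t ≡ + 32 * D - (+ 2 * t - + 8 * D)
  hit-identity = solve-∀

  module Assembly {n : ℕ} (H G : Graph n) (c : Colouring G) where

    open Colours G c
    open Spectra (adjacency-props H)

    module _ (φ : Permutation′ n) (good : Good weight φ) where

      image-edge : ∀ {a b} → T (Graph.adj H a b) → T (Graph.adj G (φ ⟨$⟩ʳ a) (φ ⟨$⟩ʳ b))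
      image-edge q = N≡0⇒adj (good-edge weight-props {φ} good (b2z-T q))

      copy : Subgraph G
      copy = record
        { vertices = ⊤
        ; adj      = λ x y → Graph.adj H (φ ⟨$⟩ˡ x) (φ ⟨$⟩ˡ y)
        ; sym      = λ x y → Graph.sym H _ _
        ; ends     = λ _ _ _ → ∈⊤
        ; adj⊆     = λ x y q → subst₂ (λ a b → T (Graph.adj G a b)) (Perm.inverseʳ φ) (Perm.inverseʳ φ) (image-edge q)
        }

      copy-is-copy : IsCopyOf H copy
      copy-is-copy = record
        { bijection = mk↔ₛ′ (λ a → φ ⟨$⟩ʳ a , ∈⊤) (λ x → φ ⟨$⟩ˡ proj₁ x)
            (λ { (x , p) → pair≡ (Perm.inverseʳ φ) }) (λ a → Perm.inverseˡ φ)
        ; adj-iso   = λ a b → sym (cong₂ (Graph.adj H) (Perm.inverseˡ φ) (Perm.inverseˡ φ))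
        }
        where
        pair≡ : ∀ {x y : Fin n} {p : x Data.Fin.Subset.∈ ⊤} {q : y Data.Fin.Subset.∈ ⊤} → x ≡ y → (x , p) ≡ (y , q)
        pair≡ {p = p} {q} refl = cong (_ ,_) ([]=-irrelevant p q)

      copy-total : + 2 * total G c copy ≡ 𝔼 (pull weight φ)
      copy-total = trans (total-sum copy) (trans (sym (∑²-permute (λ x y → b2z (Subgraph.adj copy x y) * weight x y) φ))
        (∑²-cong (λ a b → cong (λ h → b2z h * pull weight φ a b) (cong₂ (Graph.adj H) (Perm.inverseˡ φ) (Perm.inverseˡ φ)))))

    module _ {H′ : Subgraph G} (I : IsCopyOf H H′) where
      open IsCopyOf I

      image-injective : ∀ {x y} → image x ≡ image y → x ≡ y
      image-injective {x} {y} e = trans (sym (Inverse.strictlyInverseʳ bijection x)) (trans (cong (Inverse.from bijection) (pair≡ e)) (Inverse.strictlyInverseʳ bijection y))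
        where
        pair≡ : ∀ {p q : ∃[ v ] (v Data.Fin.Subset.∈ Subgraph.vertices H′)} → proj₁ p ≡ proj₁ q → p ≡ q
        pair≡ {x , p} {_ , q} refl = cong (x ,_) ([]=-irrelevant p q)

      onto : ∀ y → ∃[ x ] image x ≡ y
      onto = injective⇒onto image image-injective

      embedding : Permutation′ n
      embedding = mk↔ₛ′ image (λ y → proj₁ (onto y)) (λ y → proj₂ (onto y)) (λ x → image-injective (proj₂ (onto (image x))))

      embedding-good : Good weight embedding
      embedding-good = trans (∑²-cong (λ a b → term a b (T? (Graph.adj H a b)))) (trans (∑-cong (λ _ → ∑-zero n)) (∑-zero n))
        where
        term : ∀ a b → Dec (T (Graph.adj H a b)) → adjacency H a b * N (pull weight embedding) a b ≡ 0ℤ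
        term a b (yes q) = trans (cong (adjacency H a b *_) (adj⇒N≡0 (Subgraph.adj⊆ H′ (image a) (image b) (subst T (adj-iso a b) q)))) (*-zeroʳ (adjacency H a b))
        term a b (no ¬q) = trans (cong (_* N (pull weight embedding) a b) (b2z-¬T ¬q)) (*-zeroˡ (N (pull weight embedding) a b))

      embedding-total : + 2 * total G c H′ ≡ 𝔼 (pull weight embedding)
      embedding-total = trans (total-sum H′) (trans (sym (∑²-permute (λ x y → b2z (Subgraph.adj H′ x y) * weight x y) embedding))
        (∑²-cong (λ a b → cong (λ h → b2z h * pull weight embedding a b) (sym (adj-iso a b)))))

    private
      union : Subset n → Subgraph G
      union V₁ = induced G V₁ ∪ induced G (∁ V₁)

      union-adj : ∀ (V₁ : Subset n) u v → Subgraph.adj (union V₁) u v ≡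
        (Graph.adj G u v ∧ (Vec.lookup V₁ u ∧ Vec.lookup V₁ v)) ∨ (Graph.adj G u v ∧ (not (Vec.lookup V₁ u) ∧ not (Vec.lookup V₁ v)))
      union-adj V₁ u v = cong₂ (λ a b → (Graph.adj G u v ∧ (Vec.lookup V₁ u ∧ Vec.lookup V₁ v)) ∨ (Graph.adj G u v ∧ (a ∧ b)))
        (lookup-map u not V₁) (lookup-map v not V₁)

    bipartite⇒two-sided : Bipartite G c → TwoSided weight
    bipartite⇒two-sided (V₁ , s , h) = record { s = s ◃ 1 ; σ = σ ; s-pm = ◃1-PM s ; σ-pm = λ u → side-pm (Vec.lookup V₁ u) ; form = λ e → form (N≡0⇒adj e) }
      where
      σ : Fin n → ℤ
      σ u = side (Vec.lookup V₁ u)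
      side-pm : ∀ b → PM (side b)
      side-pm true  = inj₁ refl
      side-pm false = inj₂ refl
      ordered : ∀ {u w} (p : u <ᶠ w) (q : T (Graph.adj G u w)) → weight u w ≡ (s ◃ 1) * (σ u * σ w)
      ordered {u} {w} p q = trans (weight-edge p q) (go (c (edge u w p q) ≟ˢ s))
        where
        go : Dec (c (edge u w p q) ≡ s) → c (edge u w p q) ◃ 1 ≡ (s ◃ 1) * (σ u * σ w)
        go (yes e) = trans (cong (_◃ 1) e) (sym (trans (cong ((s ◃ 1) *_) (same-side {Graph.adj G u w} {Vec.lookup V₁ u} {Vec.lookup V₁ w} q
          (subst T (union-adj V₁ u w) (Equivalence.to (h (edge u w p q)) e)))) (*-identityʳ (s ◃ 1))))
        go (no ¬e) = trans (◃1-≢ ¬e) (cong ((s ◃ 1) *_) (sym (other-side {Graph.adj G u w} {Vec.lookup V₁ u} {Vec.lookup V₁ w} q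
          (λ t → ¬e (Equivalence.from (h (edge u w p q)) (subst T (sym (union-adj V₁ u w)) t))))))
      form : ∀ {u w} → T (Graph.adj G u w) → weight u w ≡ (s ◃ 1) * (σ u * σ w)
      form {u} {w} q with <ᶠ-cmp u w
      ... | tri< p _ _    = ordered p q
      ... | tri≈ _ refl _ = ⊥-elim (subst T (Graph.irrefl G u) q)
      ... | tri> _ _ p    = trans (weight-sym u w) (trans (ordered p (subst T (Graph.sym G u w) q)) (cong ((s ◃ 1) *_) (*-comm (σ w) (σ u))))

    two-sided⇒bipartite : TwoSided weight → Bipartite G c
    two-sided⇒bipartite TS = V₁ , s₀ , λ { (edge u w p q) → mk⇔ (to u w p q) (from u w p q) }
      where
      open TwoSided TS
      which : ∀ {x} → PM x → Bool
      which (inj₁ _) = true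
      which (inj₂ _) = false
      side-which : ∀ {x} (p : PM x) → side (which p) ≡ x
      side-which (inj₁ refl) = refl
      side-which (inj₂ refl) = refl
      V₁ : Subset n
      V₁ = Vec.tabulate (λ u → which (σ-pm u))
      σ≡ : ∀ u → side (Vec.lookup V₁ u) ≡ σ u
      σ≡ u = trans (cong side (lookup∘tabulate (λ u → which (σ-pm u)) u)) (side-which (σ-pm u))
      s₀ : Sign
      s₀ = proj₁ (sign-of s-pm)
      s≡ : s₀ ◃ 1 ≡ s
      s≡ = proj₂ (sign-of s-pm)
      colour : ∀ u w p q → c (edge u w p q) ◃ 1 ≡ (s₀ ◃ 1) * (side (Vec.lookup V₁ u) * side (Vec.lookup V₁ w))
      colour u w p q = trans (sym (weight-edge p q)) (trans (form (adj⇒N≡0 q)) (cong₂ _*_ (sym s≡) (cong₂ _*_ (sym (σ≡ u)) (sym (σ≡ w)))))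
      flipped : ∀ s → s ◃ 1 ≢ (s ◃ 1) * -1ℤ
      flipped Sign.+ ()
      flipped Sign.- ()
      to : ∀ u w p q → c (edge u w p q) ≡ s₀ → T (Subgraph.adj (union V₁) u w)
      to u w p q e = subst T (sym (union-adj V₁ u w)) (go (T? _))
        where
        X = (Graph.adj G u w ∧ (Vec.lookup V₁ u ∧ Vec.lookup V₁ w)) ∨ (Graph.adj G u w ∧ (not (Vec.lookup V₁ u) ∧ not (Vec.lookup V₁ w)))
        go : Dec (T X) → T X
        go (yes t) = t
        go (no ¬t) = ⊥-elim (flipped s₀ (trans (cong (_◃ 1) (sym e)) (trans (colour u w p q)
          (cong ((s₀ ◃ 1) *_) (other-side {Graph.adj G u w} {Vec.lookup V₁ u} {Vec.lookup V₁ w} q ¬t)))))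
      from : ∀ u w p q → T (Subgraph.adj (union V₁) u w) → c (edge u w p q) ≡ s₀
      from u w p q t = ◃1-injective (trans (colour u w p q) (trans (cong ((s₀ ◃ 1) *_)
        (same-side {Graph.adj G u w} {Vec.lookup V₁ u} {Vec.lookup V₁ w} q (subst T (union-adj V₁ u w) t))) (*-identityʳ (s₀ ◃ 1))))

    k : ℕ
    k = maxDegree H

    M≡2m : M ≡ + 2 * + size H
    M≡2m = sym (size-sum H)

    Invariant : ℤ → Set
    Invariant step = ∃[ κ ] ∀ θ → Good weight θ → ∃[ j ] 𝔼 (pull weight θ) ≡ κ + step * j

    Within : ℤ → ℤ → Set
    Within q t = (- + size H ≤ q * t) × (q * t ≤ + size H)

    -- Embeddings whose energies realise every admissible value in one residue class give the theorem.
    spectrum : ∀ {q} a u → + 4 ≡ u * + a → Invariant (+ 2 * + a) → (ψ : Permutation′ n) → Good weight ψ →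
      (∀ t → Within q t → (∀ θ → Good weight θ → ∃[ j ] + 2 * t - 𝔼 (pull weight θ) ≡ + 2 * + a * j) → ∃[ θ ] Good weight θ × 𝔼 (pull weight θ) ≡ + 2 * t) →
      Σ[ b ∈ Fin 4 ] ∀ t → - + size H ≤ q * t → q * t ≤ + size H → (Σ[ H′ ∈ Subgraph G ] (IsCopyOf H H′ × total G c H′ ≡ t)) ⇔ (t ≡ + toℕ b [mod a ])
    spectrum {q} a u 4≡ (κ , inv) ψ gψ hit = b , λ t lo hi → mk⇔ (only-if t) (if t (lo , hi))
      where
      t₀ : ℤ
      t₀ = total G c (copy ψ gψ)
      b : Fin 4
      b = fromℕ< (n%ℕd<d t₀ 4)
      b≡ : t₀ - + toℕ b ≡ (t₀ /ℕ 4) * u * + a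
      b≡ = trans (cong (λ r → t₀ - + r) (toℕ-fromℕ< (n%ℕd<d t₀ 4))) (trans (cong (_- + (t₀ %ℕ 4)) (a≡a%ℕn+[a/ℕn]*n t₀ 4))
        (trans (x+y-x≡y (+ (t₀ %ℕ 4)) ((t₀ /ℕ 4) * + 4)) (trans (cong ((t₀ /ℕ 4) *_) 4≡) (sym (*-assoc (t₀ /ℕ 4) u (+ a))))))
      halve : ∀ {x y} → + 2 * x ≡ + 2 * y → x ≡ y
      halve {x} {y} = *-cancelˡ-≡ (+ 2) x y
      j₀ = proj₁ (inv ψ gψ)
      energy₀ : + 2 * t₀ ≡ κ + + 2 * + a * j₀
      energy₀ = trans (copy-total ψ gψ) (proj₂ (inv ψ gψ))
      only-if : ∀ t → Σ[ H′ ∈ Subgraph G ] (IsCopyOf H H′ × total G c H′ ≡ t) → t ≡ + toℕ b [mod a ]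
      only-if t (H′ , I , e) = Signed.∣⇒∣ᵤ (Signed.divides (j - j₀ + (t₀ /ℕ 4) * u) (trans (only-if-identity t t₀ (+ toℕ b)) (trans (cong₂ _+_ gap b≡) (only-if-identity₂ (+ a) j j₀ (t₀ /ℕ 4 * u)))))
        where
        φ = embedding I
        j = proj₁ (inv φ (embedding-good I))
        energy : + 2 * t ≡ κ + + 2 * + a * j
        energy = trans (cong (+ 2 *_) (sym e)) (trans (embedding-total I) (proj₂ (inv φ (embedding-good I))))
        gap : t - t₀ ≡ + a * (j - j₀)
        gap = halve (trans (gap-identity t t₀) (trans (cong₂ _-_ energy energy₀) (gap-identity₂ κ (+ a) j j₀)))
      if : ∀ t → Within q t → t ≡ + toℕ b [mod a ] → Σ[ H′ ∈ Subgraph G ] (IsCopyOf H H′ × total G c H′ ≡ t)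
      if t w cong-t = copy θ gθ , copy-is-copy θ gθ , halve (trans (copy-total θ gθ) (proj₂ (proj₂ found)))
        where
        dvd : + a Signed.∣ (t - + toℕ b)
        dvd = Signed.∣ᵤ⇒∣ cong-t
        x : ℤ
        x = Signed._∣_.quotient dvd
        ex : t - + toℕ b ≡ x * + a
        ex = Signed._∣_.equality dvd
        residue : ∀ θ → Good weight θ → ∃[ j ] + 2 * t - 𝔼 (pull weight θ) ≡ + 2 * + a * j
        residue θ g = x - (t₀ /ℕ 4) * u + (j₀ - j) , trans (cong₂ (λ p r → + 2 * p - r) t≡ (proj₂ (inv θ g)))
            (trans (residue-identity (+ a) x (t₀ /ℕ 4 * u) t₀ κ j) (trans (cong (λ z → + 2 * (x * + a - t₀ /ℕ 4 * u * + a) + (z - (κ + + 2 * + a * j))) energy₀) (residue-identity₂ (+ a) x (t₀ /ℕ 4 * u) κ j₀ j)))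
          where
          j = proj₁ (inv θ g)
          t≡ : t ≡ x * + a - (t₀ /ℕ 4) * u * + a + t₀
          t≡ = trans (residue-identity₃ t (+ toℕ b) t₀) (cong₂ (λ p r → p - r + t₀) ex b≡)
        found = hit t w residue
        θ = proj₁ found
        gθ = proj₁ (proj₂ found)

    open Balance G c using (row-N; 0≤e; plus≡; minus≡; frequent; discrepancy; Ke≤n)

    module _ {K q R B h : ℤ} (th : Thresholds (+ k) K (+ 120 * (h * h)) R B) (16≤h : + 16 ≤ h) (q≡ : q ≡ + 2 * K) (6≤q : + 6 ≤ q)
      (R≥ : + (ℕ.suc (12 ℕ.* k)) * (+ 2 * + k + + 4) ≤ R) (B≤n : B ≤ + n) (B≤m : B ≤ + size H)
      (hε : q * + n - + n ≤ q * + minDegree G)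
      (hν⁻ : ∀ t → q * + size G + + 2 * (- + size G) ≤ + 2 * (q * + colourCount G c t))
      (hν⁺ : ∀ t → + 2 * (q * + colourCount G c t) ≤ q * + size G + + 2 * + size G) where

      open Thresholds th

      γ e : ℤ
      γ = + 120 * (h * h)
      e = + n - + minDegree G

      1≤n : 1ℤ ≤ + n
      1≤n = ≤-trans 1≤K (≤-trans K≤B B≤n)

      nonneg-e : 0ℤ ≤ e
      nonneg-e = 0≤e 1≤n

      Ke : K * e ≤ + n
      Ke = Ke≤n q≡ 6≤q hε hν⁻ hν⁺ nonneg-e

      dis = discrepancy q≡ 6≤q hε hν⁻ hν⁺
      d = proj₁ dis

      m≤M : + size H ≤ M
      m≤M = ≤-trans (≤by (num (size H)) (x≡2x-x (+ size H))) (≤-reflexive (sym M≡2m))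

      M≤Δn : M ≤ + k * + n
      M≤Δn = ≤-trans (∑-mono (Adjacency.deg≤ (adjacency-props H))) (≤-reflexive (trans (∑-const n (+ k)) (*-comm (+ n) (+ k))))

      sz : Sizes nn M (+ k) e d R K γ
      sz = sizes B≤n (≤-trans B≤m m≤M) M≤Δn nonneg-e Ke (proj₂ (proj₂ dis))

      rm : Room nn M (+ k) e γ R
      rm = room B≤n (≤-trans B≤m m≤M) M≤Δn nonneg-e Ke (proj₂ (proj₂ dis))

      sp : Spread weight e d γ
      sp = record
        { row-N = row-N ; tot = proj₁ (proj₂ dis)
        ; rich  = λ a b → Rich.rich weight-props a b 16≤h (frequent q≡ 6≤q hε hν⁻ hν⁺ Sign.+ plus≡) (frequent q≡ 6≤q hε hν⁻ hν⁺ Sign.- minus≡) row-N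
            (≤-trans (≤by (≤-trans 0≤1 1≤G ⊗ (num 2 ⊗ nonneg-e) ⊕ num 2 ⊗ (≤-trans 0≤1 1≤G ⊗ nonneg-e) ⊕ diff K≥₁ ⊗ nonneg-e ⊕ nonneg-e) (spectrum-identity γ e K)) Ke)
            (1+≤⇒< 1≤n) }

      open Core rm weight-props sp

      s : ℤ
      s = + 2 * + k + + 4
      s≥0 : 0ℤ ≤ s
      s≥0 = num 2 ⊗ num k ⊕ num 4

      s≤R : s ≤ R
      s≤R = ≤-trans (≤by ((num (12 ℕ.* k)) ⊗ s≥0) (s≤R-identity (+ (12 ℕ.* k)) s)) R≥

      kit₀ : Kit weight-props [] Perm.id []
      kit₀ = record { ok = λ () ; indep = [] ; valid = [] ; closed = [] }

      stock₀ : Stock [] (12 ℕ.* k)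
      stock₀ = grow (12 ℕ.* k) kit₀ s≥0 R≥

      first : ∃[ ψ ] Good weight ψ × AgreeOn (Stock.F stock₀) ψ (Stock.φ stock₀)
      first = embed rm weight-props sp sz {Stock.F stock₀} {Stock.φ stock₀} (Kit.ok (Stock.kit stock₀)) (≤-trans (Stock.length≤ stock₀) R≥)

      40KΔ≤m : + 40 * (K * + k) ≤ + size H
      40KΔ≤m = ≤-trans 40KΔ≤B B≤m

      up-bound : ∀ t → q * t ≤ + size H → ∀ x → 0ℤ ≤ x → K * (+ 2 * t - x) ≤ M
      up-bound t h x x≥0 = ≤-trans (≤by (diff h ⊕ 0≤K ⊗ x≥0) (trans (cong (λ q → + size H - q * t + K * x) q≡) (up-bound-identity K t x (+ size H)))) m≤M

      low-bound : ∀ t → - + size H ≤ q * t → ∀ x → x ≤ + 40 * + k → K * (x - + 2 * t) ≤ M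
      low-bound t h x x≤ = ≤-trans (≤by (diff h ⊕ diff 40KΔ≤m ⊕ 0≤K ⊗ diff x≤)
          (trans (cong (λ q → q * t - - + size H + (+ size H - + 40 * (K * + k)) + K * (+ 40 * + k - x)) q≡) (low-bound-identity K t x (+ size H) (+ k)))) (≤-reflexive (sym M≡2m))

      inert-case : TwoSided weight → (∀ u v → ℕ.parity (degree H u) ≡ ℕ.parity (degree H v)) →
        Σ[ b ∈ Fin 4 ] ∀ t → - + size H ≤ q * t → q * t ≤ + size H → (Σ[ H′ ∈ Subgraph G ] (IsCopyOf H H′ × total G c H′ ≡ t)) ⇔ (t ≡ + toℕ b [mod 4 ])
      inert-case TS par = spectrum {q} 4 1ℤ refl inv (proj₁ first) (proj₁ (proj₂ first)) hit
        where
        v₀ : Fin n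
        v₀ = vertex 1≤n
          where vertex : ∀ {n} → 1ℤ ≤ + n → Fin n
                vertex (+≤+ (ℕ.s≤s _)) = zero
        p : ℤ
        p = parity-bit (ℕ.parity (degree H v₀))
        deg≡ : ∀ u → deg u ≡ p + + 2 * proj₁ (parity-form (degree H u))
        deg≡ u = trans (sym (degree-sum H u)) (trans (proj₂ (parity-form (degree H u)))
          (cong (λ z → parity-bit z + + 2 * proj₁ (parity-form (degree H u))) (par u v₀)))
        inv : Invariant (+ 2 * + 4)
        inv = 𝔼-mod8 weight-props TS p (λ u → proj₁ (parity-form (degree H u))) deg≡
        hit : ∀ t → Within q t → (∀ θ → Good weight θ → ∃[ j ] + 2 * t - 𝔼 (pull weight θ) ≡ + 8 * j) → ∃[ θ ] Good weight θ × 𝔼 (pull weight θ) ≡ + 2 * t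
        hit t (lo , hi) = hit-8 rm weight-props sp sz stock₀ R≥ (+ 2 * t)
          (subst (λ z → K * z ≤ M) (+-identityʳ (+ 2 * t)) (up-bound t hi 0ℤ ≤-refl))
          (low-bound t lo (+ 32 * + k) (*-monoʳ-≤-nonNeg (+ k) (+≤+ (ℕₚ.m≤m+n 32 8))))

      mixed-case : Start → Σ[ b ∈ Fin 4 ] ∀ t → - + size H ≤ q * t → q * t ≤ + size H →
        (Σ[ H′ ∈ Subgraph G ] (IsCopyOf H H′ × total G c H′ ≡ t)) ⇔ (t ≡ + toℕ b [mod 2 ])
      mixed-case start = spectrum {q} 2 (+ 2) refl (M , 𝔼≡M-4j weight-props) (proj₁ first) (proj₁ (proj₂ first)) hit
        where
        hit : ∀ t → Within q t → (∀ θ → Good weight θ → ∃[ j ] + 2 * t - 𝔼 (pull weight θ) ≡ + 4 * j) → ∃[ θ ] Good weight θ × 𝔼 (pull weight θ) ≡ + 2 * t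
        hit t (lo , hi) = hit-4 rm weight-props sp sz start (grow (12 ℕ.* k) (Start.kit start) (Start.length≤ start) R≥) R≥ (+ 2 * t)
          (up-bound t hi (+ 8 * + k) (num 8 ⊗ num k))
          (subst (λ z → K * z ≤ M) (hit-identity (+ k) t) (low-bound t lo (+ 40 * + k) ≤-refl))

      find-start : ¬ Inert H G c → Start
      find-start ¬inert = by-square (negativeSquare? rm weight-props sp)
        where
        DifferentParity : Set
        DifferentParity = ∃[ u ] ∃[ v ] ¬ (ℕ.parity (degree H u) ≡ ℕ.parity (degree H v))
        different? : Dec DifferentParity
        different? = any? (λ u → any? (λ v → ¬? (ℕ.parity (degree H u) ≟ₚ ℕ.parity (degree H v))))
        by-parity : ¬ NegativeSquare rm weight-props sp → Dec DifferentParity → Start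
        by-parity ¬neg (yes (u , v , ne)) = start-mixed s≤R ¬neg u v
          (subst₂ (λ a b → ∃[ j ] a - b ≡ 1ℤ + + 2 * j) (degree-sum H u) (degree-sum H v) (parity-≢ {degree H u} {degree H v} ne))
        by-parity ¬neg (no ¬ne) = ⊥-elim (¬inert (same , two-sided⇒bipartite (Sided.two-sided rm weight-props sp ¬neg)))
          where
          same : ∀ u v → ℕ.parity (degree H u) ≡ ℕ.parity (degree H v)
          same u v = decidable-stable (ℕ.parity (degree H u) ≟ₚ ℕ.parity (degree H v)) (λ ne → ¬ne (u , v , ne))
        by-square : Dec (NegativeSquare rm weight-props sp) → Start
        by-square (yes neg) = start-negative 1≤Δ s≤R neg
        by-square (no ¬neg) = by-parity ¬neg different?

      both-cases : ∀ a → (Inert H G c × a ≡ 4) ⊎ (¬ Inert H G c × a ≡ 2) → Σ[ b ∈ Fin 4 ] ∀ t → - + size H ≤ q * t → q * t ≤ + size H →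
        (Σ[ H′ ∈ Subgraph G ] (IsCopyOf H H′ × total G c H′ ≡ t)) ⇔ (t ≡ + toℕ b [mod a ])
      both-cases _ (inj₁ ((par , bip) , refl)) = inert-case (bipartite⇒two-sided bip) par
      both-cases _ (inj₂ (¬inert , refl))      = mixed-case (find-start ¬inert)

  opaque
    h₀ : ℤ
    h₀ = + 16

    16≤h₀ : + 16 ≤ h₀
    16≤h₀ = ≤-refl

  module Constants (Δ : ℕ) (1≤Δ : 1 ℕ.≤ Δ) where
    γ K R B : ℤ
    γ = + 120 * (h₀ * h₀)
    K = + 40 * ((+ 8 * γ) * (+ 8 * γ) * (+ Δ * + Δ)) + (1ℤ + + 5 * γ) + (+ 17 + + 3 * + Δ) + (1ℤ + + Δ * (+ Δ * (1ℤ + + Δ + + Δ * + Δ))) + (+ 2 + + 2 * + Δ)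
    R = + (ℕ.suc (12 ℕ.* Δ)) * (+ 2 * + Δ + + 4)
    B = K * R + K + + 40 * (K * + Δ)

    private
      0≤D : 0ℤ ≤ + Δ
      0≤D = num Δ
      1≤γ : 1ℤ ≤ γ
      1≤γ = 1≤* {+ 120} (+≤+ (ℕ.s≤s ℕ.z≤n)) (1≤* (≤-trans (+≤+ (ℕ.s≤s ℕ.z≤n)) 16≤h₀) (≤-trans (+≤+ (ℕ.s≤s ℕ.z≤n)) 16≤h₀))
      0≤γ : 0ℤ ≤ γ
      0≤γ = ≤-trans 0≤1 1≤γ
      k₀ = num 40 ⊗ ((num 8 ⊗ 0≤γ) ⊗ (num 8 ⊗ 0≤γ) ⊗ (0≤D ⊗ 0≤D))
      k₁ = num 1 ⊕ num 5 ⊗ 0≤γ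
      k₂ = num 17 ⊕ num 3 ⊗ 0≤D
      k₃ = num 1 ⊕ 0≤D ⊗ (0≤D ⊗ (num 1 ⊕ 0≤D ⊕ 0≤D ⊗ 0≤D))
      k₄ = num 2 ⊕ num 2 ⊗ 0≤D
      left : ∀ {x y} → 0ℤ ≤ y → x ≤ x + y
      left {x} {y} p = ≤by p (y≡x+y-x x y)
      right : ∀ {x y} → 0ℤ ≤ x → y ≤ x + y
      right {x} {y} p = ≤by p (x≡x+y-y x y)
      0≤K : 0ℤ ≤ K
      0≤K = k₀ ⊕ k₁ ⊕ k₂ ⊕ k₃ ⊕ k₄
      0≤R : 0ℤ ≤ R
      0≤R = num (ℕ.suc (12 ℕ.* Δ)) ⊗ (num 2 ⊗ 0≤D ⊕ num 4)

    17≤K : + 17 ≤ K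
    17≤K = ≤-trans (left (num 3 ⊗ 0≤D)) (≤-trans (right (k₀ ⊕ k₁)) (≤-trans (left k₃) (left k₄)))

    0≤B : 0ℤ ≤ B
    0≤B = 0≤K ⊗ 0≤R ⊕ 0≤K ⊕ num 40 ⊗ (0≤K ⊗ 0≤D)

    thresholds : Thresholds (+ Δ) K γ R B
    thresholds = record
      { 1≤Δ = +≤+ 1≤Δ ; 1≤G = 1≤γ
      ; K≥₀ = ≤-trans (left k₁) (≤-trans (left k₂) (≤-trans (left k₃) (left k₄)))
      ; K≥₁ = ≤-trans (right k₀) (≤-trans (left k₂) (≤-trans (left k₃) (left k₄)))
      ; K≥₂ = ≤-trans (right (k₀ ⊕ k₁)) (≤-trans (left k₃) (left k₄))
      ; K≥₃ = ≤-trans (right (k₀ ⊕ k₁ ⊕ k₂)) (left k₄)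
      ; K≥₄ = right (k₀ ⊕ k₁ ⊕ k₂ ⊕ k₃)
      ; 0≤R = 0≤R
      ; KR≤B = ≤-trans (left 0≤K) (left (num 40 ⊗ (0≤K ⊗ 0≤D)))
      ; K≤B = ≤-trans (right (0≤K ⊗ 0≤R)) (left (num 40 ⊗ (0≤K ⊗ 0≤D)))
      ; 40KΔ≤B = right (0≤K ⊗ 0≤R ⊕ 0≤K) }

    predecessor : ∀ {x} → 1ℤ ≤ x → ∃[ d ] +[1+ d ] ≡ x
    predecessor {+[1+ d ]} _ = d , refl
    predecessor {+ ℕ.zero} (+≤+ ())

    6≤2K : + 6 ≤ + 2 * K
    6≤2K = ≤-trans (+≤+ (ℕₚ.m≤m+n 6 28)) (*-monoˡ (num 2) 17≤K)

    d : ℕ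
    d = proj₁ (predecessor (≤-trans (+≤+ (ℕ.s≤s ℕ.z≤n)) 6≤2K))

    q≡ : +[1+ d ] ≡ + 2 * K
    q≡ = proj₂ (predecessor (≤-trans (+≤+ (ℕ.s≤s ℕ.z≤n)) 6≤2K))

    open Reciprocal d public

    N₀ : ℕ
    N₀ = ∣ B ∣

    N₀≡B : + N₀ ≡ B
    N₀≡B = 0≤i⇒+∣i∣≡i 0≤B

    conclusion : ∀ n m → N₀ ℕ.≤ n → N₀ ℕ.≤ m → (H : Graph n) → size H ≡ m → maxDegree H ≡ Δ →
      (G : Graph n) → (1ℚ ℚ.- r) ℚ.* fromℤ (+ n) ℚ.≤ fromℤ (+ minDegree G) →
      (c : Colouring G) → Balanced G c r → ∀ a → (Inert H G c × a ≡ 4) ⊎ (¬ Inert H G c × a ≡ 2) →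
      Σ[ b ∈ Fin 4 ] ∀ (k : ℤ) → ℚ.- (r ℚ.* fromℤ (+ m)) ℚ.≤ fromℤ k → fromℤ k ℚ.≤ r ℚ.* fromℤ (+ m) →
        (Σ[ H′ ∈ Subgraph G ] (IsCopyOf H H′ × total G c H′ ≡ k)) ⇔ (k ≡ + toℕ b [mod a ])
    conclusion n m N≤n N≤m H size≡ max≡ G hε c bal a cases = proj₁ result , λ k lo hi →
        proj₂ result k (subst (λ s → - + s ≤ q * k) (sym size≡) (clear-α⁻ (+ m) k lo)) (subst (λ s → q * k ≤ + s) (sym size≡) (clear-α⁺ (+ m) k hi))
      where
      result = Assembly.both-cases H G c
        (subst (λ x → Thresholds (+ x) K γ R B) (sym max≡) thresholds) 16≤h₀ q≡ (≤-trans 6≤2K (≤-reflexive (sym q≡)))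
        (≤-reflexive (cong (λ x → + (ℕ.suc (12 ℕ.* x)) * (+ 2 * + x + + 4)) max≡))
        (subst (_≤ + n) N₀≡B (+≤+ N≤n)) (subst₂ (λ b s → b ≤ + s) N₀≡B (sym size≡) (+≤+ N≤m))
        (clear-ε (+ n) (+ minDegree G) hε)
        (λ t → clear-ν⁻ (+ size G) (+ colourCount G c t) (proj₁ (bal t)))
        (λ t → clear-ν⁺ (+ size G) (+ colourCount G c t) (proj₂ (bal t)))
        a cases

open import Defs
open import Data.Fin.Base using (Fin; toℕ)
open import Data.Integer.Base using (ℤ; +_)
open import Data.Nat.Base using (ℕ; _≤_)
open import Data.Product.Base using (_×_; _,_; Σ-syntax; ∃-syntax)
open import Data.Rational.Base as ℚ using (ℚ; 0ℚ; 1ℚ)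
open import Data.Rational.Literals using (fromℤ)
open import Data.Sum.Base using (_⊎_)
open import Function.Bundles using (_⇔_)
open import Relation.Binary.PropositionalEquality using (_≡_)
open import Relation.Nullary.Negation.Core using (¬_)

theorem1p15 : ∀ (Δ : ℕ) → 1 ≤ Δ →
    ∃[ ε ] ∃[ ν ] ∃[ α ] (0ℚ ℚ.< ε × 0ℚ ℚ.< ν × 0ℚ ℚ.< α ×
    (∃[ N ] ∀ (n m : ℕ) → N ≤ n → N ≤ m →
    ∀ (H : Graph n) → size H ≡ m → maxDegree H ≡ Δ →
    ∀ (G : Graph n) → (1ℚ ℚ.- ε) ℚ.* fromℤ (+ n) ℚ.≤ fromℤ (+ minDegree G) →
    ∀ (c : Colouring G) → Balanced G c ν →
    ∀ (a : ℕ) → (Inert H G c × a ≡ 4) ⊎ (¬ Inert H G c × a ≡ 2) →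
    Σ[ b ∈ Fin 4 ] ∀ (k : ℤ) →
    ℚ.- (α ℚ.* fromℤ (+ m)) ℚ.≤ fromℤ k → fromℤ k ℚ.≤ α ℚ.* fromℤ (+ m) →
    (Σ[ H′ ∈ Subgraph G ] (IsCopyOf H H′ × total G c H′ ≡ k)) ⇔ (k ≡ + toℕ b [mod a ])))
theorem1p15 Δ 1≤Δ = r , r , r , r>0 , r>0 , r>0 , N₀ , conclusion
  where open EmbeddingSpectrum.Constants Δ 1≤Δ
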